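{- Let $k\in\mathbb{N}$ with $k\geq 2$. Then: (i) Almost all $T_{k+1}$-free oriented graphs are $k$-partite, i.e. the proportion of labelled $T_{k+1}$-free oriented graphs on vertex set $[n]$ that are $k$-partite tends to $1$ as $n\to\infty$. (ii) Almost all $T_{k+1}$-free digraphs are $k$-partite, i.e. the proportion of labelled $T_{k+1}$-free digraphs on vertex set $[n]$ that are $k$-partite tends to $1$ as $n\to\infty$.
   Context: A digraph is a pair $(V,E)$ with $E$ a set of ordered pairs of distinct vertices (no loops, no two edges in the same direction between the same pair, but both directions are allowed). An oriented graph is a digraph with at most one edge between any two vertices. $T_{k+1}$ denotes the transitive tournament on $k+1$ vertices. A (di)graph is $H$-free if it contains no (not necessarily induced) subgraph isomorphic to $H$. A digraph is $k$-partite if its vertex set can be partitioned into $k$ classes with no edge having both endpoints in the same class. All graphs are labelled. -}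

module Defs where

open import Data.Nat using (ℕ; suc; _∸_; _*_; _≤_; _≥_)
open import Data.Fin using (Fin; _<_)
open import Data.Bool using (Bool; true; false)
open import Data.Vec using (Vec; lookup)
open import Data.List using (List; length)
open import Data.List.Relation.Unary.Unique.Propositional using (Unique)
open import Data.List.Membership.Propositional using (_∈_)
open import Data.Product using (Σ; ∃; _×_)
open import Relation.Binary.PropositionalEquality using (_≡_; _≢_)
open import Relation.Nullary using (¬_)
open import Function.Bundles using (_⇔_)
open import Function.Definitions using (Injective)

-- A labelled (di)graph on vertex set [n] = Fin n, given by its adjacency
-- matrix: adj g i j ≡ true  means there is a directed edge i → j.
Graph : ℕ → Set
Graph n = Vec (Vec Bool n) n

adj : ∀ {n} → Graph n → Fin n → Fin n → Bool
adj g i j = lookup (lookup g i) j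

IsDigraph : ∀ {n} → Graph n → Set
IsDigraph {n} g = (i : Fin n) → adj g i i ≡ false

IsOriented : ∀ {n} → Graph n → Set
IsOriented {n} g = IsDigraph g × ((i j : Fin n) → adj g i j ≡ true → adj g j i ≡ false)

-- g contains T_{k+1} (transitive tournament on vertices 0..k, edges i → j for i < j)
-- as a (not necessarily induced) subgraph: an injective vertex map preserving edges.
ContainsTT : ℕ → ∀ {n} → Graph n → Set
ContainsTT k {n} g =
  Σ (Fin (suc k) → Fin n) λ f →
    Injective _≡_ _≡_ f × ((i j : Fin (suc k)) → i < j → adj g (f i) (f j) ≡ true)

TTFree : ℕ → ∀ {n} → Graph n → Set
TTFree k g = ¬ ContainsTT k g

Partite : ℕ → ∀ {n} → Graph n → Set
Partite k {n} g =
  Σ (Fin n → Fin k) λ c → (i j : Fin n) → adj g i j ≡ true → c i ≢ c j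

HasCount : ∀ {n} → (Graph n → Set) → ℕ → Set
HasCount {n} P c =
  Σ (List (Graph n)) λ xs →
    Unique xs × ((g : Graph n) → (g ∈ xs) ⇔ P g) × length xs ≡ c

-- "Almost all graphs satisfying Class are k-partite": the proportion of
-- T_{k+1}-free graphs in Class on [n] that are k-partite tends to 1, i.e.
-- for every m ≥ 1 there is N such that for all n ≥ N, with
-- a = #{T_{k+1}-free}, p = #{T_{k+1}-free and k-partite}, we have
-- m * (a - p) ≤ a  (i.e. 1 - p/a ≤ 1/m).
AlmostAllPartite : (k : ℕ) → (Class : ∀ {n} → Graph n → Set) → Set
AlmostAllPartite k Class =
  (m : ℕ) → m ≥ 1 → ∃ λ N → (n : ℕ) → n ≥ N →
    Σ ℕ λ a → Σ ℕ λ p →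
      HasCount {n} (λ g → Class g × TTFree k g) a ×
      HasCount {n} (λ g → (Class g × TTFree k g) × Partite k g) p ×
      m * (a ∸ p) ≤ a

{-# OPTIONS --safe #-}
-- Write q = 3 (oriented graphs) or q = 4 (digraphs) for the number of states of a pair of vertices, f(n) for the number of
-- T_{k+1}-free graphs and p(n) for the number of k-partite ones. Adding a vertex to a smallest class shows
-- p(n+1) ≥ p(n) q^((1-1/k)n), so it suffices to split the T_{k+1}-free graphs that are not k-partite into classes in which a
-- set S of boundedly many vertices attaches to the rest in fewer than q^((1-1/k-ε)|S|n) ways; then f ≤ C p follows by induction
-- on n, and with it the negligibility of every class.
--
-- (1) A block is a family of large disjoint parts, modelled on a pattern whose pairs are empty, single (all arcs one way) or
-- double (no large empty rectangle in either direction). If the outside vertices attach to a block in many ways, a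
-- Sauer-Shelah argument adds a part to it, with a high weight towards the old ones. After boundedly many steps a weighted
-- Turán theorem, proved with random orderings, yields k pairwise double parts.
-- (2) Relative to such parts every vertex has few neighbours in one part (its colour), and two adjacent vertices have few
-- common out-neighbours in a part of another colour. So a large matching inside the colour classes is rare, and the graph
-- is k-partite up to o(n) vertices.
-- (3) Unbalanced classes, or pairs of large subsets of two classes with few arcs, are rare.
-- (4) Otherwise the colouring is nearly determined by the graph without two adjacent vertices u and v of the same colour, and
-- u and v have few common out-neighbours in another class, which is rare again.
--
-- The goals are inequalities between natural numbers, hence stable, so classical reasoning under ¬¬ is available throughout.

module Submission where

open import Defs
open import Data.Nat
open import Data.Nat.Properties
open import Data.Nat.DivMod using (_/_; _%_; m/n*n≤m; /-monoˡ-≤; m*n/n≡m; m/n≤m; m≡m%n+[m/n]*n; m%n<n)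
open import Data.Nat.Induction using (<-rec)
open import Data.Nat.Tactic.RingSolver using (solve-∀)
open import Data.Bool using (Bool; true; false; if_then_else_; not; _∧_; _∨_)
open import Data.Bool.Properties using (∧-comm) renaming (_≟_ to _≟ᵇ_)
open import Data.Fin as Fin using (Fin; zero; suc)
import Data.Fin.Properties as Finₚ
open import Data.Vec as Vec using (Vec; []; _∷_; lookup)
import Data.Vec.Properties as Vecₚ
open import Data.List as List using (List; []; _∷_; length; map; filter; take; _++_)
import Data.List.Properties as Listₚ
open import Data.List.Relation.Unary.All as All using (All; []; _∷_)
import Data.List.Relation.Unary.All.Properties as Allₚ
open import Data.List.Relation.Unary.Any using (here; there; any?; Any; index)
open import Data.List.Relation.Unary.Any.Properties using (lookup-index)
open import Data.List.Relation.Unary.AllPairs as AllPairs using (AllPairs; []; _∷_)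
import Data.List.Relation.Unary.AllPairs.Properties as AllPairsₚ
open import Data.List.Relation.Unary.Unique.Propositional using (Unique)
import Data.List.Relation.Unary.Unique.Propositional.Properties as Uniqueₚ
open import Data.List.Relation.Binary.Pointwise as Pw using (Pointwise; []; _∷_)
open import Data.List.Membership.Propositional using (_∈_; _∉_; find; lose)
open import Data.List.Membership.Propositional.Properties
open import Data.List.Membership.DecPropositional using (_∈?_)
open import Data.Product using (Σ; ∃; _×_; _,_; proj₁; proj₂)
import Data.Product.Properties as Productₚ
open import Data.Sum using (_⊎_; inj₁; inj₂; [_,_]′)
open import Data.Empty using (⊥; ⊥-elim)
open import Data.Unit using (⊤; tt)
open import Function using (_∘_; id; case_of_; mk⇔)
open import Relation.Nullary
open import Relation.Nullary.Decidable using (¬¬-excluded-middle; decidable-stable; ¬?; dec-true; dec-false; map′; _×-dec_; _→-dec_)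
open import Relation.Binary.Definitions using (DecidableEquality; tri<; tri≈; tri>)
open import Relation.Binary.PropositionalEquality hiding (J)

-- A class is described by data, such as a colouring of all vertices, whose choice costs a factor
-- exponential in n. A fixed saving per vertex of S beats this only if S has many vertices; the last
-- class deletes just two, which is why the colouring must be nearly determined there.
--
-- Single pairs are the obstacle to a plain use of Turán's theorem. A family of neighbourhoods on s
-- vertices that shatters no d-set can still have about 2^s members, so a single pair carries log 2
-- / log q of the information of a double one, and a weighted extremal problem has to be solved
-- whose optimum is still the Turán value.
--
-- The Sauer-Shelah error is d log s bits for each part of size s. It is o(s) because the next size
-- d is the square root of s, while the density of double pairs is measured at a scale μ that is
-- fixed from the start.
--
-- Exponents such as (1-1/k)n are fractions. Inequalities between counts are raised to a power that
-- clears the denominators, and stray factors are absorbed into powers of q.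
--
-- The induction behind f ≤ C p is sound because the n from which a class is negligible does not
-- depend on C.

module Cardinality where
  private variable
    A B : Set
    P Q R : A → Set
    m n M N : ℕ

  -- Classical reasoning under double negation, and counting

  infixl 1 _>>=_
  _>>=_ : ¬ ¬ A → (A → ¬ ¬ B) → ¬ ¬ B
  (m >>= f) k = m (λ a → f a k)

  return : A → ¬ ¬ A
  return a k = k a

  lem : ¬ ¬ Dec A
  lem = ¬¬-excluded-middle

  stable-≤ : ¬ ¬ (m ≤ n) → m ≤ n
  stable-≤ {m} {n} = decidable-stable (m ≤? n)

  bool-stable : ∀ {b : Bool} → ¬ ¬ (b ≡ true) → b ≡ true
  bool-stable {true} _ = refl
  bool-stable {false} n = ⊥-elim (n λ ())

  ¬¬-All : ∀ {xs : List A} → (∀ x → P x → ¬ ¬ Q x) → All P xs → ¬ ¬ All Q xs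
  ¬¬-All f [] = return []
  ¬¬-All f (p ∷ ps) = f _ p >>= λ q → ¬¬-All f ps >>= λ qs → return (q ∷ qs)

  ¬¬-Fin : ∀ {n} {P : Fin n → Set} → (∀ i → ¬ ¬ P i) → ¬ ¬ (∀ i → P i)
  ¬¬-Fin {zero} f = return λ ()
  ¬¬-Fin {suc n} f = f zero >>= λ p → ¬¬-Fin (f ∘ suc) >>= λ ps → return λ { zero → p ; (suc i) → ps i }

  ¬¬-choice : ∀ {n} {P : Fin n → A → Set} → (∀ i → ¬ ¬ ∃ (P i)) → ¬ ¬ Σ (Vec A n) λ v → ∀ i → P i (lookup v i)
  ¬¬-choice {P = P} f = ¬¬-Fin f >>= λ g →
    return (Vec.tabulate (proj₁ ∘ g) , λ i → subst (P i) (sym (Vecₚ.lookup∘tabulate (proj₁ ∘ g) i)) (proj₂ (g i)))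

  -- Upper bounds on cardinalities

  -- Lists without repetition replace finite sets because the predicates to be counted are
  -- undecidable. In this form a bound is a family of inequalities between numbers, so it may be
  -- proved under double negation.
  Card≤ : (A → Set) → ℕ → Set
  Card≤ P M = ∀ xs → Unique xs → All P xs → length xs ≤ M

  card-mono : M ≤ N → Card≤ P M → Card≤ P N
  card-mono le c xs u a = ≤-trans (c xs u a) le

  card-stable : ¬ ¬ Card≤ P M → Card≤ P M
  card-stable c xs u a = stable-≤ (c >>= λ c′ → return (c′ xs u a))

  card-⊆ : (∀ x → P x → ¬ ¬ Q x) → Card≤ Q M → Card≤ P M
  card-⊆ f c xs u a = stable-≤ (¬¬-All f a >>= λ a′ → return (c xs u a′))

  -- An empty class satisfies any bound, so a member may be assumed. It supplies the facts about
  -- fixed parameters that every member carries, for instance that the vertices of a block are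
  -- distinct.
  card-rep : (∀ x → P x → Card≤ P M) → Card≤ P M
  card-rep f [] u a = z≤n
  card-rep f (x ∷ xs) u (p ∷ a) = f x p (x ∷ xs) u (p ∷ a)

  card-∅ : (∀ x → ¬ P x) → Card≤ P M
  card-∅ f = card-rep λ x p → ⊥-elim (f x p)

  card-1 : (∀ x y → P x → P y → x ≡ y) → Card≤ P 1
  card-1 f [] _ _ = z≤n
  card-1 f (x ∷ []) _ _ = s≤s z≤n
  card-1 f (x ∷ y ∷ xs) ((x≢y ∷ _) ∷ _) (p ∷ q ∷ _) = ⊥-elim (x≢y (f x y p q))

  card-remove : ∀ a → P a → Card≤ P (suc M) → Card≤ (λ x → P x × x ≢ a) M
  card-remove a p c xs u ps = s≤s⁻¹ (c (a ∷ xs) (All.map (λ q e → proj₂ q (sym e)) ps ∷ u) (p ∷ All.map proj₁ ps))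

  length-partition : (P? : ∀ x → Dec (P x)) (xs : List A) →
    length (filter P? xs) + length (filter (¬? ∘ P?) xs) ≡ length xs
  length-partition P? [] = refl
  length-partition P? (x ∷ xs) with P? x
  ... | yes p = cong suc (length-partition P? xs)
  ... | no p = trans (+-suc _ _) (cong suc (length-partition P? xs))

  partition-⊎ : ∀ {xs : List A} → All (λ x → P x ⊎ Q x) xs → Unique xs →
    Σ (List A) λ ys → Σ (List A) λ zs → Unique ys × Unique zs × All P ys × All Q zs ×
      length xs ≡ length ys + length zs × (∀ x → x ∈ ys ⊎ x ∈ zs → x ∈ xs)
  partition-⊎ [] [] = [] , [] , [] , [] , [] , [] , refl , λ { x (inj₁ ()) ; x (inj₂ ()) }
  partition-⊎ {xs = x ∷ xs} (p ∷ ps) (x∉ ∷ u) with partition-⊎ ps u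
  ... | ys , zs , uy , uz , py , qz , eq , sub with p
  ...   | inj₁ px = x ∷ ys , zs , All.tabulate (λ {y} y∈ e → All.lookup x∉ (sub y (inj₁ y∈)) e) ∷ uy , uz ,
          px ∷ py , qz , cong suc eq ,
          λ { y (inj₁ (here e)) → here e ; y (inj₁ (there y∈)) → there (sub y (inj₁ y∈)) ; y (inj₂ y∈) → there (sub y (inj₂ y∈)) }
  ...   | inj₂ qx = ys , x ∷ zs , uy , All.tabulate (λ {y} y∈ e → All.lookup x∉ (sub y (inj₂ y∈)) e) ∷ uz ,
          py , qx ∷ qz , trans (cong suc eq) (sym (+-suc _ _)) ,
          λ { y (inj₂ (here e)) → here e ; y (inj₁ y∈) → there (sub y (inj₁ y∈)) ; y (inj₂ (there y∈)) → there (sub y (inj₂ y∈)) }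

  card-⊎ : Card≤ P M → Card≤ Q N → Card≤ (λ x → P x ⊎ Q x) (M + N)
  card-⊎ c d xs u a with partition-⊎ a u
  ... | ys , zs , uy , uz , py , qz , eq , _ = subst (_≤ _) (sym eq) (+-mono-≤ (c ys uy py) (d zs uz qz))

  card-inj : (h : A → B) → (∀ x y → P x → P y → h x ≡ h y → x ≡ y) → (∀ x → P x → Q (h x)) → Card≤ Q M → Card≤ P M
  card-inj {P = P} h inj f c xs u a =
    subst (_≤ _) (Listₚ.length-map h xs) (c (map h xs) (uniq xs u a) (Allₚ.map⁺ (All.map (λ {x} → f x) a)))
    where
    uniq : ∀ xs → Unique xs → All P xs → Unique (map h xs)
    uniq [] _ _ = []
    uniq (x ∷ xs) (x∉ ∷ u) (p ∷ a) =
      Allₚ.map⁺ (All.zipWith (λ { {y} (x≢y , q) e → x≢y (inj x y p q e) }) (x∉ , a)) ∷ uniq xs u a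

  -- Union bound over a parameter `a`. The parameter need not be unique, and it has to exist only
  -- classically.
  card-bind : {R : A → B → Set} → Card≤ Q M → (∀ a → Q a → Card≤ (R a) N) →
    (∀ x → P x → ¬ ¬ ∃ λ a → Q a × R a x) → Card≤ P (M * N)
  card-bind {A = A} {B = B} {M = M} {N = N} {R = R} cQ cR f = card-⊆ f (go M cQ cR)
    where
    go : ∀ M {Q : A → Set} → Card≤ Q M → (∀ a → Q a → Card≤ (R a) N) → Card≤ (λ x → ∃ λ a → Q a × R a x) (M * N)
    go zero cQ cR = card-∅ λ { x (a , q , _) → case cQ (a ∷ []) ([] ∷ []) (q ∷ []) of λ () }
    go (suc M) cQ cR = card-rep λ { _ (a , q , _) →
      card-⊆ (λ { x (b , q′ , r) → lem {b ≡ a} >>= λ { (yes refl) → return (inj₁ r) ; (no b≢a) → return (inj₂ (b , (q′ , b≢a) , r)) } })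
        (card-⊎ (cR a q) (go M (card-remove a q cQ) (λ b q′ → cR b (proj₁ q′)))) }

  -- Only fibres through an actual member `x₀` have to be bounded; that member then serves as the
  -- reference object against which the others are compared.
  card-fiber : (h : A → B) → Card≤ Q M → (∀ x → P x → Q (h x)) →
    (∀ x₀ → P x₀ → Card≤ (λ x → P x × h x ≡ h x₀) N) → Card≤ P (M * N)
  card-fiber {A = A} {P = P} h c f g =
    card-bind {R = λ b x → P x × h x ≡ b} c
      (λ b q → card-rep λ { x₀ (p₀ , refl) → g x₀ p₀ })
      (λ x p → return (h x , f x p , p , refl))

  many : ¬ Card≤ P m → ¬ ¬ Σ (List A) λ xs → Unique xs × All P xs × length xs ≡ suc m
  many {m = m} nc k = nc λ xs u a → ≮⇒≥ λ m<l → k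
    (take (suc m) xs , Uniqueₚ.take⁺ (suc m) u , Allₚ.take⁺ (suc m) a ,
     trans (Listₚ.length-take (suc m) xs) (m≤n⇒m⊓n≡m m<l))

  enumerate : ∀ g → Card≤ P g → ¬ ¬ Σ (List A) λ l → length l ≤ g × All P l × (∀ x → P x → ¬ ¬ (x ∈ l))
  enumerate {P = P} zero c = return ([] , z≤n , [] , λ x p → λ _ → case c (x ∷ []) ([] ∷ []) (p ∷ []) of λ ())
  enumerate {P = P} (suc g) c = lem {∃ P} >>= λ
    { (no np) → return ([] , z≤n , [] , λ x p → ⊥-elim (np (x , p)))
    ; (yes (a , p)) → enumerate g (card-remove a p c) >>= λ { (l , le , al , cov) →
        return (a ∷ l , s≤s le , p ∷ All.map proj₁ al , λ x q → lem {x ≡ a} >>= λ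
          { (yes e) → return (here e)
          ; (no ne) → cov x (q , ne) >>= λ x∈ → return (there x∈) }) } }

  card-fin : Card≤ {A = Fin n} (λ _ → ⊤) n
  card-fin {n = zero} = card-∅ λ ()
  card-fin {n = suc n} = card-⊆ {Q = λ i → i ≡ zero ⊎ (∃ λ j → i ≡ suc j)}
    (λ { zero _ → return (inj₁ refl) ; (suc i) _ → return (inj₂ (i , refl)) })
    (card-mono (≤-reflexive (cong suc (*-identityʳ n)))
      (card-⊎ {M = 1} (card-1 λ { _ _ refl refl → refl })
        (card-bind {R = λ j i → i ≡ suc j} (card-fin {n}) (λ _ _ → card-1 λ { _ _ refl refl → refl })
          (λ { _ (j , e) → return (j , tt , e) }))))

  -- Sums, products and counts over Fin n

  sumF : (Fin n → ℕ) → ℕ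
  sumF {zero} f = 0
  sumF {suc n} f = f zero + sumF (f ∘ suc)

  prodF : (Fin n → ℕ) → ℕ
  prodF {zero} f = 1
  prodF {suc n} f = f zero * prodF (f ∘ suc)

  𝟙 : Bool → ℕ
  𝟙 b = if b then 1 else 0

  #_ : (Fin n → Bool) → ℕ
  # b = sumF (𝟙 ∘ b)

  sumF-mono : ∀ {f g : Fin n → ℕ} → (∀ i → f i ≤ g i) → sumF f ≤ sumF g
  sumF-mono {zero} le = z≤n
  sumF-mono {suc n} le = +-mono-≤ (le zero) (sumF-mono (le ∘ suc))

  sumF-cong : ∀ {f g : Fin n → ℕ} → (∀ i → f i ≡ g i) → sumF f ≡ sumF g
  sumF-cong {zero} eq = refl
  sumF-cong {suc n} eq = cong₂ _+_ (eq zero) (sumF-cong (eq ∘ suc))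

  sumF-+ : ∀ (f g : Fin n → ℕ) → sumF (λ i → f i + g i) ≡ sumF f + sumF g
  sumF-+ {zero} f g = refl
  sumF-+ {suc n} f g = trans (cong (f zero + g zero +_) (sumF-+ (f ∘ suc) (g ∘ suc))) (swap (f zero) (g zero) _ _)
    where
    swap : ∀ a b c d → a + b + (c + d) ≡ a + c + (b + d)
    swap = solve-∀

  sumF-* : ∀ c (f : Fin n → ℕ) → sumF (λ i → c * f i) ≡ c * sumF f
  sumF-* {zero} c f = sym (*-zeroʳ c)
  sumF-* {suc n} c f = trans (cong (c * f zero +_) (sumF-* c (f ∘ suc))) (sym (*-distribˡ-+ c _ _))

  term≤sumF : ∀ (f : Fin n → ℕ) i → f i ≤ sumF f
  term≤sumF f zero = m≤m+n _ _
  term≤sumF f (suc i) = ≤-trans (term≤sumF (f ∘ suc) i) (m≤n+m _ _)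

  sumF-const : ∀ n c → sumF {n} (λ _ → c) ≡ n * c
  sumF-const zero c = refl
  sumF-const (suc n) c = cong (c +_) (sumF-const n c)

  sumF-swap : ∀ {n m} (f : Fin n → Fin m → ℕ) → sumF (λ i → sumF (f i)) ≡ sumF (λ j → sumF (λ i → f i j))
  sumF-swap {zero} {m} f = sym (trans (sumF-const m 0) (*-zeroʳ m))
  sumF-swap {suc n} {m} f = trans (cong (sumF (f zero) +_) (sumF-swap (f ∘ suc))) (sym (sumF-+ (f zero) _))

  prodF-mono : ∀ {f g : Fin n → ℕ} → (∀ i → f i ≤ g i) → prodF f ≤ prodF g
  prodF-mono {zero} le = ≤-refl
  prodF-mono {suc n} le = *-mono-≤ (le zero) (prodF-mono (le ∘ suc))

  *-swap : ∀ a b c d → a * b * (c * d) ≡ a * c * (b * d)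
  *-swap = solve-∀

  prodF-* : ∀ (f g : Fin n → ℕ) → prodF (λ i → f i * g i) ≡ prodF f * prodF g
  prodF-* {zero} f g = refl
  prodF-* {suc n} f g = trans (cong (f zero * g zero *_) (prodF-* (f ∘ suc) (g ∘ suc))) (*-swap (f zero) (g zero) _ _)

  prodF-const : ∀ n c → prodF {n} (λ _ → c) ≡ c ^ n
  prodF-const zero c = refl
  prodF-const (suc n) c = cong (c *_) (prodF-const n c)

  prodF-exp : ∀ q (f : Fin n → ℕ) → prodF (λ i → q ^ f i) ≡ q ^ sumF f
  prodF-exp {zero} q f = refl
  prodF-exp {suc n} q f = trans (cong (q ^ f zero *_) (prodF-exp q (f ∘ suc))) (sym (^-distribˡ-+-* q (f zero) _))

  ^-distribʳ : ∀ e a b → (a * b) ^ e ≡ a ^ e * b ^ e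
  ^-distribʳ zero a b = refl
  ^-distribʳ (suc e) a b = trans (cong (a * b *_) (^-distribʳ e a b)) (*-swap a b _ _)

  ^-^-comm : ∀ a b c → (a ^ b) ^ c ≡ (a ^ c) ^ b
  ^-^-comm a b c = trans (^-*-assoc a b c) (trans (cong (a ^_) (*-comm b c)) (sym (^-*-assoc a c b)))

  prodF-^ : ∀ e (f : Fin n → ℕ) → prodF f ^ e ≡ prodF (λ i → f i ^ e)
  prodF-^ {zero} e f = ^-zeroˡ e
  prodF-^ {suc n} e f = trans (^-distribʳ e (f zero) _) (cong (f zero ^ e *_) (prodF-^ e (f ∘ suc)))

  onlyAt : Fin n → ℕ → Fin n → ℕ
  onlyAt zero a zero = a
  onlyAt zero a (suc j) = 1
  onlyAt (suc i) a zero = 1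
  onlyAt (suc i) a (suc j) = onlyAt i a j

  prodF-onlyAt : ∀ (i : Fin n) a → prodF (onlyAt i a) ≡ a
  prodF-onlyAt {suc n} zero a = trans (cong (a *_) (trans (prodF-const n 1) (^-zeroˡ n))) (*-identityʳ a)
  prodF-onlyAt (suc i) a = trans (+-identityʳ _) (prodF-onlyAt i a)

  onlyAt-same : ∀ (i : Fin n) a → onlyAt i a i ≡ a
  onlyAt-same zero a = refl
  onlyAt-same (suc i) a = onlyAt-same i a

  onlyAt-other : ∀ {i j : Fin n} a → i ≢ j → onlyAt i a j ≡ 1
  onlyAt-other {i = zero} {zero} a ne = ⊥-elim (ne refl)
  onlyAt-other {i = zero} {suc j} a ne = refl
  onlyAt-other {i = suc i} {zero} a ne = refl
  onlyAt-other {i = suc i} {suc j} a ne = onlyAt-other a (ne ∘ cong suc)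

  card-# : (b : Fin n → Bool) → Card≤ (λ i → b i ≡ true) (# b)
  card-# {zero} b = card-∅ λ ()
  card-# {suc n} b = card-⊆ {Q = λ i → (i ≡ zero × b zero ≡ true) ⊎ (∃ λ j → b (suc j) ≡ true × i ≡ suc j)}
    (λ { zero e → return (inj₁ (refl , e)) ; (suc i) e → return (inj₂ (i , e , refl)) })
    (card-mono (≤-reflexive (cong (𝟙 (b zero) +_) (*-identityʳ _)))
      (card-⊎ (at0 (b zero) refl)
        (card-bind {R = λ j i → i ≡ suc j} (card-# (b ∘ suc)) (λ _ _ → card-1 λ { _ _ refl refl → refl })
          (λ { _ (j , e , eq) → return (j , e , eq) }))))
    where
    at0 : ∀ c → b zero ≡ c → Card≤ (λ (i : Fin (suc n)) → i ≡ zero × b zero ≡ true) (𝟙 c)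
    at0 true _ = card-1 λ { _ _ (refl , _) (refl , _) → refl }
    at0 false e = card-∅ λ { _ (_ , e′) → case trans (sym e) e′ of λ () }

  positions : (b : Fin n → Bool) → Σ (List (Fin n)) λ xs → Unique xs × All (λ i → b i ≡ true) xs × length xs ≡ # b
  positions {zero} b = [] , [] , [] , refl
  positions {suc n} b with positions (b ∘ suc)
  ... | xs , u , a , eq with b zero in e
  ...   | true = zero ∷ map suc xs , Allₚ.map⁺ (All.universal (λ _ ()) xs) ∷ Uniqueₚ.map⁺ Finₚ.suc-injective u ,
                 e ∷ Allₚ.map⁺ a , cong suc (trans (Listₚ.length-map suc xs) eq)
  ...   | false = map suc xs , Uniqueₚ.map⁺ Finₚ.suc-injective u , Allₚ.map⁺ a , trans (Listₚ.length-map suc xs) eq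

  #-≤ : {b : Fin n → Bool} → Card≤ (λ i → b i ≡ true) M → # b ≤ M
  #-≤ {b = b} c with positions b
  ... | xs , u , a , eq = subst (_≤ _) eq (c xs u a)

  length-≤-# : {b : Fin n → Bool} {xs : List (Fin n)} → Unique xs → All (λ i → b i ≡ true) xs → length xs ≤ # b
  length-≤-# {b = b} {xs} u a = card-# b xs u a

  #-not : (b : Fin n → Bool) → # (not ∘ b) + # b ≡ n
  #-not {zero} b = refl
  #-not {suc n} b with b zero
  ... | true = trans (+-suc _ _) (cong suc (#-not (b ∘ suc)))
  ... | false = cong suc (#-not (b ∘ suc))

  -- Vectors with a bounded number of exceptional coordinates

  card-∷ : {Q : A → Set} {R : Vec A n → Set} → Card≤ Q M → Card≤ R N →
    Card≤ (λ (v : Vec A (suc n)) → Q (Vec.head v) × R (Vec.tail v)) (M * N)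
  card-∷ {R = R} c d = card-bind {R = λ a v → Vec.head v ≡ a × R (Vec.tail v)} c
    (λ a _ → card-inj {Q = R} Vec.tail (λ { (x ∷ v) (y ∷ w) (refl , _) (refl , _) refl → refl }) (λ v → proj₂) d)
    (λ v (q , r) → return (Vec.head v , q , refl , r))

  -- `j` is a budget of exceptions, available only at the coordinates marked by `bb`. A value may be
  -- both good and allowed, so the decomposition need not be unique; for an upper bound this is
  -- harmless.
  Few : ∀ {n} → (Fin n → A → Set) → (A → Set) → (Fin n → Bool) → ℕ → Vec A n → Set
  Few {n = zero} Gd Al bb j [] = ⊤
  Few {n = suc n} Gd Al bb j (a ∷ v) =
    (Gd zero a × Few (Gd ∘ suc) Al (bb ∘ suc) j v) ⊎
    (bb zero ≡ true × Al a × Σ ℕ λ j′ → j ≡ suc j′ × Few (Gd ∘ suc) Al (bb ∘ suc) j′ v)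

  countFew : ∀ {n} → (Fin n → ℕ) → ℕ → (Fin n → Bool) → ℕ → ℕ
  countFew {zero} g h bb j = 1
  countFew {suc n} g h bb zero = g zero * countFew (g ∘ suc) h (bb ∘ suc) zero
  countFew {suc n} g h bb (suc j) =
    g zero * countFew (g ∘ suc) h (bb ∘ suc) (suc j) + (if bb zero then h else 0) * countFew (g ∘ suc) h (bb ∘ suc) j

  card-few : ∀ {n} {Gd : Fin n → A → Set} {Al : A → Set} {g h} (bb : Fin n → Bool) j →
    (∀ i → Card≤ (Gd i) (g i)) → Card≤ Al h → Card≤ (Few Gd Al bb j) (countFew g h bb j)
  card-few {n = zero} bb j cg ch = card-1 λ { [] [] _ _ → refl }
  card-few {n = suc n} {Gd} {Al} bb zero cg ch =
    card-⊆ (λ { (a ∷ v) (inj₁ x) → return x ; (a ∷ v) (inj₂ (_ , _ , _ , () , _)) })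
      (card-∷ (cg zero) (card-few (bb ∘ suc) zero (cg ∘ suc) ch))
  card-few {n = suc n} {Gd} {Al} {g} {h} bb (suc j) cg ch =
    card-⊆ (λ { (a ∷ v) (inj₁ x) → return (inj₁ x) ; (a ∷ v) (inj₂ (b , al , _ , refl , f)) → return (inj₂ ((b , al) , f)) })
      (card-⊎ (card-∷ (cg zero) (card-few (bb ∘ suc) (suc j) (cg ∘ suc) ch))
              (card-∷ (bad (bb zero)) (card-few (bb ∘ suc) j (cg ∘ suc) ch)))
    where
    bad : ∀ b → Card≤ (λ a → b ≡ true × Al a) (if b then h else 0)
    bad true = card-⊆ (λ _ p → return (proj₂ p)) ch
    bad false = card-∅ λ { _ (() , _) }

  few-intro : ∀ {n} {Gd : Fin n → A → Set} {Al : A → Set} {bb : Fin n → Bool} (sp : Fin n → A → Bool) (v : Vec A n) j →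
    (∀ i → sp i (lookup v i) ≡ false → Gd i (lookup v i)) →
    (∀ i → sp i (lookup v i) ≡ true → bb i ≡ true × Al (lookup v i)) →
    # (λ i → sp i (lookup v i)) ≤ j → Few Gd Al bb j v
  few-intro {n = zero} sp [] j gd bd le = tt
  few-intro {n = suc n} sp (a ∷ v) j gd bd le with sp zero a in e
  ... | false = inj₁ (gd zero e , few-intro (sp ∘ suc) v j (gd ∘ suc) (bd ∘ suc) le)
  few-intro {n = suc n} sp (a ∷ v) (suc j) gd bd (s≤s le) | true =
    inj₂ (proj₁ (bd zero e) , proj₂ (bd zero e) , j , refl , few-intro (sp ∘ suc) v j (gd ∘ suc) (bd ∘ suc) le)

  card-Π : ∀ {n} {Q : Fin n → A → Set} {g : Fin n → ℕ} → (∀ i → Card≤ (Q i) (g i)) →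
    Card≤ (λ (v : Vec A n) → ∀ i → Q i (lookup v i)) (prodF g)
  card-Π {n = zero} c = card-1 λ { [] [] _ _ → refl }
  card-Π {n = suc n} {Q} c = card-⊆ (λ { (a ∷ v) f → return (f zero , f ∘ suc) }) (card-∷ (c zero) (card-Π (c ∘ suc)))

  card-Vec : ∀ n {Q : A → Set} → Card≤ Q M → Card≤ (λ (v : Vec A n) → ∀ i → Q (lookup v i)) (M ^ n)
  card-Vec {M = M} n c = card-mono (≤-reflexive (prodF-const n M)) (card-Π (λ _ → c))

  card-List : ∀ g {Q : A → Set} → Card≤ Q M → Card≤ (λ (l : List A) → length l ≤ g × All Q l) ((1 + M) ^ g)
  card-List zero c = card-1 λ { [] [] _ _ → refl ; (_ ∷ _) _ (() , _) _ ; [] (_ ∷ _) _ (() , _) }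
  card-List {A = A} {M = M} (suc g) {Q} c = card-⊆ {Q = λ l → l ≡ [] ⊎ Rest l}
    (λ { [] _ → return (inj₁ refl) ; (x ∷ l) (s≤s le , q ∷ a) → return (inj₂ (x , q , l , refl , le , a)) })
    (card-mono (+-monoˡ-≤ (M * (1 + M) ^ g) (>-nonZero⁻¹ ((1 + M) ^ g) ⦃ m^n≢0 (1 + M) g ⦄))
      (card-⊎ {M = 1} (card-1 λ { _ _ refl refl → refl })
      (card-bind {R = λ x l → Σ (List A) λ l′ → l ≡ x ∷ l′ × length l′ ≤ g × All Q l′} c
        (λ x _ → card-inj {Q = λ l → length l ≤ g × All Q l} (List.drop 1)
          (λ { _ _ (_ , refl , _) (_ , refl , _) refl → refl }) (λ { _ (_ , refl , p) → p }) (card-List g c))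
        λ { l (x , q , r) → return (x , q , r) })))
    where
    Rest : List A → Set
    Rest l = Σ A λ x → Q x × Σ (List A) λ l′ → l ≡ x ∷ l′ × length l′ ≤ g × All Q l′

  -- Give every exception the weight `1 / a`. A vector with at most `j` exceptions has weight at
  -- least `1 / a ^ j`, and the total weight is at most `(1 + h / a) ^ # bb * prodF g`; here
  -- `1 ≤ g i` turns `g i + h / a` into a multiple of `g i`.
  countFew-chernoff : ∀ {n} (g : Fin n → ℕ) h (bb : Fin n → Bool) j a .⦃ _ : NonZero a ⦄ → (∀ i → 1 ≤ g i) →
    countFew g h bb j * a ^ # bb ≤ a ^ j * (a + h) ^ # bb * prodF g
  countFew-chernoff {zero} g h bb j a pos =
    ≤-trans (>-nonZero⁻¹ (a ^ j) ⦃ m^n≢0 a j ⦄) (≤-reflexive (sym (trans (*-identityʳ _) (*-identityʳ _))))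
  countFew-chernoff {suc n} g h bb zero a pos with bb zero | countFew-chernoff (g ∘ suc) h (bb ∘ suc) zero a (pos ∘ suc)
  ... | true | ih = begin
    g zero * N₀ * (a * A′)       ≡⟨ r₁ (g zero) N₀ a A′ ⟩
    g zero * a * (N₀ * A′)       ≤⟨ *-mono-≤ (*-monoʳ-≤ (g zero) (m≤m+n a h)) ih ⟩
    g zero * (a + h) * (1 * H * Π) ≡⟨ r₂ (g zero) (a + h) H Π ⟩
    1 * ((a + h) * H) * (g zero * Π) ∎
    where
    open ≤-Reasoning
    N₀ = countFew (g ∘ suc) h (bb ∘ suc) zero
    A′ = a ^ # (bb ∘ suc)
    H = (a + h) ^ # (bb ∘ suc)
    Π = prodF (g ∘ suc)
    r₁ : ∀ g N a A → g * N * (a * A) ≡ g * a * (N * A)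
    r₁ = solve-∀
    r₂ : ∀ g c H P → g * c * (1 * H * P) ≡ 1 * (c * H) * (g * P)
    r₂ = solve-∀
  ... | false | ih = ≤-trans (≤-reflexive (*-assoc (g zero) _ _))
      (≤-trans (*-monoʳ-≤ (g zero) ih) (≤-reflexive (r (g zero) ((a + h) ^ # (bb ∘ suc)) (prodF (g ∘ suc)))))
    where
    r : ∀ g H P → g * (1 * H * P) ≡ 1 * H * (g * P)
    r = solve-∀
  countFew-chernoff {suc n} g h bb (suc j) a pos
    with bb zero | countFew-chernoff (g ∘ suc) h (bb ∘ suc) (suc j) a (pos ∘ suc) | countFew-chernoff (g ∘ suc) h (bb ∘ suc) j a (pos ∘ suc)
  ... | true | ih₁ | ih₀ = begin
    (g zero * N₁ + h * N₀) * (a * A′)                 ≡⟨ r₁ (g zero) N₁ N₀ h a A′ ⟩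
    g zero * a * (N₁ * A′) + h * a * (N₀ * A′)        ≤⟨ +-mono-≤ (*-monoʳ-≤ (g zero * a) ih₁) (*-mono-≤ (*-monoˡ-≤ a (m≤n*m h (g zero) ⦃ >-nonZero (pos zero) ⦄)) ih₀) ⟩
    g zero * a * (a * J * H * Π) + g zero * h * a * (J * H * Π) ≡⟨ r₂ (g zero) a h J H Π ⟩
    a * J * ((a + h) * H) * (g zero * Π) ∎
    where
    open ≤-Reasoning
    N₁ = countFew (g ∘ suc) h (bb ∘ suc) (suc j)
    N₀ = countFew (g ∘ suc) h (bb ∘ suc) j
    J = a ^ j
    A′ = a ^ # (bb ∘ suc)
    H = (a + h) ^ # (bb ∘ suc)
    Π = prodF (g ∘ suc)
    r₁ : ∀ g N M h a A → (g * N + h * M) * (a * A) ≡ g * a * (N * A) + h * a * (M * A)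
    r₁ = solve-∀
    r₂ : ∀ g a h J H P → g * a * (a * J * H * P) + g * h * a * (J * H * P) ≡ a * J * ((a + h) * H) * (g * P)
    r₂ = solve-∀
  ... | false | ih₁ | ih₀ = ≤-trans (≤-reflexive (r₁ (g zero) _ _))
      (≤-trans (*-monoʳ-≤ (g zero) ih₁) (≤-reflexive (r₂ (g zero) (a ^ suc j) _ (prodF (g ∘ suc)))))
    where
    r₁ : ∀ g N A → (g * N + 0) * A ≡ g * (N * A)
    r₁ = solve-∀
    r₂ : ∀ g J H P → g * (J * H * P) ≡ J * H * (g * P)
    r₂ = solve-∀

  countFew-poly : ∀ {n} (g : Fin n → ℕ) h (bb : Fin n → Bool) j → (∀ i → 1 ≤ g i) →
    countFew g h bb j ≤ prodF g * (1 + h * n) ^ j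
  countFew-poly {zero} g h bb j pos = ≤-trans (>-nonZero⁻¹ ((1 + h * 0) ^ j) ⦃ m^n≢0 (1 + h * 0) j ⦄) (≤-reflexive (sym (*-identityˡ _)))
  countFew-poly {suc n} g h bb zero pos =
    ≤-trans (*-monoʳ-≤ (g zero) (countFew-poly (g ∘ suc) h (bb ∘ suc) zero (pos ∘ suc))) (≤-reflexive (sym (*-assoc (g zero) _ 1)))
  countFew-poly {suc n} g h bb (suc j) pos = begin
    g zero * N₁ + b * N₀        ≤⟨ +-mono-≤ (*-monoʳ-≤ (g zero) ih₁) (*-mono-≤ (≤-trans b≤h (m≤n*m h (g zero) ⦃ >-nonZero (pos zero) ⦄)) ih₀) ⟩
    g zero * (Π * (c * c ^ j)) + g zero * h * (Π * c ^ j)  ≡⟨ r (g zero) Π h n (c ^ j) ⟩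
    g zero * Π * ((1 + h * suc n) * c ^ j) ≤⟨ *-monoʳ-≤ (g zero * Π) (*-monoʳ-≤ (1 + h * suc n) (^-monoˡ-≤ j (+-monoʳ-≤ 1 (*-monoʳ-≤ h (n≤1+n n))))) ⟩
    g zero * Π * (1 + h * suc n) ^ suc j ∎
    where
    open ≤-Reasoning
    N₁ = countFew (g ∘ suc) h (bb ∘ suc) (suc j)
    N₀ = countFew (g ∘ suc) h (bb ∘ suc) j
    b = if bb zero then h else 0
    Π = prodF (g ∘ suc)
    c = 1 + h * n
    ih₁ = countFew-poly (g ∘ suc) h (bb ∘ suc) (suc j) (pos ∘ suc)
    ih₀ = countFew-poly (g ∘ suc) h (bb ∘ suc) j (pos ∘ suc)
    b≤h : b ≤ h
    b≤h with bb zero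
    ... | true = ≤-refl
    ... | false = z≤n
    r : ∀ g P h n C → g * (P * ((1 + h * n) * C)) + g * h * (P * C) ≡ g * P * ((1 + h * suc n) * C)
    r = solve-∀

  ^-cancelˡ-≤ : ∀ e .⦃ _ : NonZero e ⦄ → m ^ e ≤ n ^ e → m ≤ n
  ^-cancelˡ-≤ e le = ≮⇒≥ λ n<m → <⇒≱ (^-monoˡ-< e n<m) le

  n<2^n : ∀ n → n < 2 ^ n
  n<2^n zero = s≤s z≤n
  n<2^n (suc n) = begin-strict
    suc n         ≤⟨ n<2^n n ⟩
    2 ^ n         <⟨ m<n+m (2 ^ n) (>-nonZero⁻¹ (2 ^ n) ⦃ m^n≢0 2 n ⦄) ⟩
    2 ^ n + 2 ^ n ≡⟨ cong (2 ^ n +_) (sym (+-identityʳ _)) ⟩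
    2 ^ suc n     ∎
    where open ≤-Reasoning

  n≤2^n : ∀ n → n ≤ 2 ^ n
  n≤2^n n = <⇒≤ (n<2^n n)

  -- `(1 + 1/2m)^i ≤ 1 / (1 - i/2m)` holds by induction on `i`. In `go` the denominators are cleared
  -- and `d` is `m - i`; at `i = m` the right-hand side is 2.
  bernoulli : ∀ m .⦃ _ : NonZero m ⦄ → (2 * m + 1) ^ m ≤ 2 * (2 * m) ^ m
  bernoulli m = *-cancelˡ-≤ m (begin
    m * (2 * m + 1) ^ m         ≡⟨ cong (_* (2 * m + 1) ^ m) (sym (+-identityʳ m)) ⟩
    (m + 0) * (2 * m + 1) ^ m   ≤⟨ go m 0 (+-identityʳ m) ⟩
    2 * m * (2 * m) ^ m         ≡⟨ r m ((2 * m) ^ m) ⟩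
    m * (2 * (2 * m) ^ m)       ∎)
    where
    open ≤-Reasoning
    r : ∀ m X → 2 * m * X ≡ m * (2 * X)
    r = solve-∀
    go : ∀ i d → i + d ≡ m → (m + d) * (2 * m + 1) ^ i ≤ 2 * m * (2 * m) ^ i
    go zero d refl = ≤-reflexive (cong (λ z → (d + z) * 1) (sym (+-identityʳ d)))
    go (suc i) d eq = begin
      (m + d) * ((2 * m + 1) * (2 * m + 1) ^ i) ≡⟨ sym (*-assoc (m + d) _ _) ⟩
      (m + d) * (2 * m + 1) * (2 * m + 1) ^ i   ≤⟨ *-monoˡ-≤ ((2 * m + 1) ^ i) step ⟩
      2 * m * (m + suc d) * (2 * m + 1) ^ i             ≡⟨ *-assoc (2 * m) _ _ ⟩
      2 * m * ((m + suc d) * (2 * m + 1) ^ i)           ≤⟨ *-monoʳ-≤ (2 * m) (go i (suc d) (trans (+-suc i d) eq)) ⟩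
      2 * m * (2 * m * (2 * m) ^ i) ∎
      where
      r₁ : ∀ m d → (m + d) * (2 * m + 1) ≡ 2 * m * m + 2 * m * d + m + d
      r₁ = solve-∀
      r₂ : ∀ m d → 2 * m * (m + suc d) ≡ 2 * m * m + 2 * m * d + m + m
      r₂ = solve-∀
      step : (m + d) * (2 * m + 1) ≤ 2 * m * (m + suc d)
      step = subst₂ _≤_ (sym (r₁ m d)) (sym (r₂ m d)) (+-monoʳ-≤ (2 * m * m + 2 * m * d + m) (subst (d ≤_) eq (m≤n+m d (suc i))))

  -- Entropy bound: if the exceptional coordinates are a small enough proportion, they cost at most 2^(1/e) per coordinate.
  countFew-bound : ∀ e h .⦃ _ : NonZero e ⦄ .⦃ _ : NonZero h ⦄ → Σ ℕ λ D → ∀ {n} (g : Fin n → ℕ) (bb : Fin n → Bool) j → (∀ i → 1 ≤ g i) →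
    D * j ≤ # bb → countFew g h bb j ^ e ≤ 2 ^ # bb * prodF g ^ e
  countFew-bound e h = D , bound
    where
    -- Two factors have to stay below `2 ^ (# bb / (2 * e))` each: `(1 + h / a) ^ # bb`, by the
    -- choice of `a` and Bernoulli's inequality, and `a ^ j`, by the choice of `D`.
    m₀ = e * 2
    a = 2 * m₀ * h
    D = a * m₀
    instance
      nz-m : NonZero m₀
      nz-m = m*n≢0 e 2
      nz-2m : NonZero (2 * m₀)
      nz-2m = m*n≢0 2 m₀
      nz-a : NonZero a
      nz-a = m*n≢0 (2 * m₀) h
    a+h : (a + h) ^ m₀ ≤ 2 * a ^ m₀
    a+h = begin
      (a + h) ^ m₀               ≡⟨ cong (_^ m₀) (r (2 * m₀) h) ⟩
      ((2 * m₀ + 1) * h) ^ m₀    ≡⟨ ^-distribʳ m₀ (2 * m₀ + 1) h ⟩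
      (2 * m₀ + 1) ^ m₀ * h ^ m₀ ≤⟨ *-monoˡ-≤ (h ^ m₀) (bernoulli m₀) ⟩
      2 * (2 * m₀) ^ m₀ * h ^ m₀ ≡⟨ *-assoc 2 ((2 * m₀) ^ m₀) (h ^ m₀) ⟩
      2 * ((2 * m₀) ^ m₀ * h ^ m₀) ≡⟨ cong (2 *_) (sym (^-distribʳ m₀ (2 * m₀) h)) ⟩
      2 * a ^ m₀ ∎
      where
      open ≤-Reasoning
      r : ∀ x h → x * h + h ≡ (x + 1) * h
      r = solve-∀
    bound : ∀ {n} (g : Fin n → ℕ) (bb : Fin n → Bool) j → (∀ i → 1 ≤ g i) →
      D * j ≤ # bb → countFew g h bb j ^ e ≤ 2 ^ # bb * prodF g ^ e
    bound g bb j pos le = ^-cancelˡ-≤ 2 (begin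
      (X ^ e) ^ 2              ≡⟨ ^-*-assoc X e 2 ⟩
      X ^ m₀                   ≤⟨ *-cancelʳ-≤ (X ^ m₀) (2 ^ Y * 2 ^ Y * G ^ m₀) ((a ^ m₀) ^ Y) ⦃ m^n≢0 (a ^ m₀) Y ⦃ m^n≢0 a m₀ ⦄ ⦄ main ⟩
      2 ^ Y * 2 ^ Y * G ^ m₀   ≡⟨ cong₂ _*_ (r (2 ^ Y)) (sym (^-*-assoc G e 2)) ⟩
      (2 ^ Y) ^ 2 * (G ^ e) ^ 2 ≡⟨ sym (^-distribʳ 2 (2 ^ Y) (G ^ e)) ⟩
      (2 ^ Y * G ^ e) ^ 2 ∎)
      where
      open ≤-Reasoning
      X = countFew g h bb j
      Y = # bb
      G = prodF g
      r : ∀ x → x * x ≡ x * (x * 1)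
      r = solve-∀
      aj : (a ^ j) ^ m₀ ≤ 2 ^ Y
      aj = begin
        (a ^ j) ^ m₀ ≤⟨ ^-monoˡ-≤ m₀ (^-monoˡ-≤ j (n≤2^n a)) ⟩
        ((2 ^ a) ^ j) ^ m₀ ≡⟨ ^-^-comm (2 ^ a) j m₀ ⟩
        ((2 ^ a) ^ m₀) ^ j ≡⟨ cong (_^ j) (^-*-assoc 2 a m₀) ⟩
        (2 ^ D) ^ j ≡⟨ ^-*-assoc 2 D j ⟩
        2 ^ (D * j) ≤⟨ ^-monoʳ-≤ 2 le ⟩
        2 ^ Y ∎
      main : X ^ m₀ * (a ^ m₀) ^ Y ≤ 2 ^ Y * 2 ^ Y * G ^ m₀ * (a ^ m₀) ^ Y
      main = begin
        X ^ m₀ * (a ^ m₀) ^ Y ≡⟨ cong (X ^ m₀ *_) (^-^-comm a m₀ Y) ⟩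
        X ^ m₀ * (a ^ Y) ^ m₀ ≡⟨ sym (^-distribʳ m₀ X (a ^ Y)) ⟩
        (X * a ^ Y) ^ m₀ ≤⟨ ^-monoˡ-≤ m₀ (countFew-chernoff g h bb j a pos) ⟩
        (a ^ j * (a + h) ^ Y * G) ^ m₀ ≡⟨ trans (^-distribʳ m₀ (a ^ j * (a + h) ^ Y) G) (cong (_* G ^ m₀) (^-distribʳ m₀ (a ^ j) _)) ⟩
        (a ^ j) ^ m₀ * ((a + h) ^ Y) ^ m₀ * G ^ m₀ ≡⟨ cong (λ z → (a ^ j) ^ m₀ * z * G ^ m₀) (^-^-comm (a + h) Y m₀) ⟩
        (a ^ j) ^ m₀ * ((a + h) ^ m₀) ^ Y * G ^ m₀ ≤⟨ *-monoˡ-≤ (G ^ m₀) (*-mono-≤ aj (^-monoˡ-≤ Y a+h)) ⟩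
        2 ^ Y * (2 * a ^ m₀) ^ Y * G ^ m₀ ≡⟨ cong (λ z → 2 ^ Y * z * G ^ m₀) (^-distribʳ Y 2 (a ^ m₀)) ⟩
        2 ^ Y * (2 ^ Y * (a ^ m₀) ^ Y) * G ^ m₀ ≡⟨ r₂ (2 ^ Y) ((a ^ m₀) ^ Y) (G ^ m₀) ⟩
        2 ^ Y * 2 ^ Y * G ^ m₀ * (a ^ m₀) ^ Y ∎
        where
        r₂ : ∀ x y z → x * (x * y) * z ≡ x * x * z * y
        r₂ = solve-∀

open Cardinality

-- Random orderings

-- `n !` times the expectation of `g` over a uniformly random ordering, drawn without replacement.
sumOrders : ∀ {A : Set} {n} → Vec A n → (List A → ℕ) → ℕ
sumOrders {n = zero} xs g = g []
sumOrders {n = suc n} xs g = sumF λ i → sumOrders (Vec.removeAt xs i) (λ l → g (lookup xs i ∷ l))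

sumOrders-mono : ∀ {A : Set} {n} (xs : Vec A n) {g h} → (∀ l → g l ≤ h l) → sumOrders xs g ≤ sumOrders xs h
sumOrders-mono {n = zero} xs le = le []
sumOrders-mono {n = suc n} xs le = sumF-mono λ i → sumOrders-mono (Vec.removeAt xs i) λ l → le (lookup xs i ∷ l)

sumOrders-const : ∀ {A : Set} {n} (xs : Vec A n) c → sumOrders xs (λ _ → c) ≡ c * n !
sumOrders-const {n = zero} xs c = sym (*-identityʳ c)
sumOrders-const {n = suc n} xs c = trans (sumF-cong λ i → sumOrders-const (Vec.removeAt xs i) c)
  (trans (sumF-const (suc n) (c * n !)) (r (suc n) c (n !)))
  where
  r : ∀ a b c → a * (b * c) ≡ b * (a * c)
  r = solve-∀

sumOrders-+ : ∀ {A : Set} {n} (xs : Vec A n) g h → sumOrders xs (λ l → g l + h l) ≡ sumOrders xs g + sumOrders xs h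
sumOrders-+ {n = zero} xs g h = refl
sumOrders-+ {n = suc n} xs g h = trans (sumF-cong λ i → sumOrders-+ (Vec.removeAt xs i) (λ l → g (lookup xs i ∷ l)) (λ l → h (lookup xs i ∷ l)))
  (sumF-+ {suc n} (λ i → sumOrders (Vec.removeAt xs i) (λ l → g (lookup xs i ∷ l))) (λ i → sumOrders (Vec.removeAt xs i) (λ l → h (lookup xs i ∷ l))))

sumOrders-sumF : ∀ {A : Set} {n m} (xs : Vec A n) (g : Fin m → List A → ℕ) →
  sumOrders xs (λ l → sumF (λ v → g v l)) ≡ sumF (λ v → sumOrders xs (g v))
sumOrders-sumF {m = zero} xs g = sumOrders-const xs 0
sumOrders-sumF {m = suc m} xs g = trans (sumOrders-+ xs (g zero) _) (cong (sumOrders xs (g zero) +_) (sumOrders-sumF xs (g ∘ suc)))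

-- The role an element plays for a fixed v: v itself, an element v has to precede, or neither.
data Role : Set where
  self rival other : Role

isSelf isRival : Role → ℕ
isSelf self = 1
isSelf _ = 0
isRival rival = 1
isRival _ = 0

before : ∀ {A : Set} → (A → Role) → List A → ℕ
before ρ [] = 0
before ρ (u ∷ l) with ρ u
... | self = 1
... | rival = 0
... | other = before ρ l

sumV : ∀ {A : Set} {n} → (A → ℕ) → Vec A n → ℕ
sumV f xs = sumF (f ∘ lookup xs)

sumV-removeAt : ∀ {A : Set} {n} (f : A → ℕ) (xs : Vec A (suc n)) i → f (lookup xs i) + sumV f (Vec.removeAt xs i) ≡ sumV f xs
sumV-removeAt f (x ∷ xs) zero = refl
sumV-removeAt f (x ∷ y ∷ xs) (suc i) = trans (r (f (lookup (y ∷ xs) i)) (f x) _) (cong (f x +_) (sumV-removeAt f (y ∷ xs) i))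
  where
  r : ∀ a b c → a + (b + c) ≡ b + (a + c)
  r = solve-∀

-- Among an element and its rivals each is equally likely to come first, so the probability is
-- `1 / (1 + rivals)`. The proof conditions on the first element of the ordering: `wt` is `1 + a`
-- times the conditional probability, and it adds up to `suc n`.
sumOrders-before : ∀ {A : Set} {n} (ρ : A → Role) (xs : Vec A n) →
  sumV (isSelf ∘ ρ) xs ≡ 1 → sumOrders xs (before ρ) * (1 + sumV (isRival ∘ ρ) xs) ≡ n !
sumOrders-before {n = zero} ρ [] ()
sumOrders-before {n = suc n} ρ xs one = begin
  sumF term * (1 + a)                    ≡⟨ *-comm (sumF term) (1 + a) ⟩
  (1 + a) * sumF term                    ≡⟨ sym (sumF-* (1 + a) term) ⟩
  sumF (λ i → (1 + a) * term i)          ≡⟨ sumF-cong step ⟩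
  sumF (λ i → n ! * wt (ρ (lookup xs i))) ≡⟨ sumF-* (n !) (wt ∘ ρ ∘ lookup xs) ⟩
  n ! * sumV (wt ∘ ρ) xs                 ≡⟨ cong (n ! *_) total ⟩
  n ! * suc n                            ≡⟨ *-comm (n !) (suc n) ⟩
  suc n * n ! ∎
  where
  open ≡-Reasoning
  a = sumV (isRival ∘ ρ) xs
  term : Fin (suc n) → ℕ
  term i = sumOrders (Vec.removeAt xs i) (λ l → before ρ (lookup xs i ∷ l))
  wt : Role → ℕ
  wt self = 1 + a
  wt rival = 0
  wt other = 1
  step : ∀ i → (1 + a) * term i ≡ n ! * wt (ρ (lookup xs i))
  step i with ρ (lookup xs i) in e
  ... | self = trans (cong ((1 + a) *_) (trans (sumOrders-const (Vec.removeAt xs i) 1) (*-identityˡ (n !)))) (*-comm (1 + a) (n !))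
  ... | rival = trans (cong ((1 + a) *_) (sumOrders-const (Vec.removeAt xs i) 0)) (trans (*-zeroʳ (1 + a)) (sym (*-zeroʳ (n !))))
  ... | other = trans (*-comm (1 + a) _) (trans (cong (λ z → sumOrders (Vec.removeAt xs i) (before ρ) * (1 + z)) (sym (rv isRival refl)))
                 (trans (sumOrders-before ρ (Vec.removeAt xs i) (trans (rv isSelf refl) one)) (sym (*-identityʳ (n !)))))
    where
    rv : ∀ (f : Role → ℕ) → f other ≡ 0 → sumV (f ∘ ρ) (Vec.removeAt xs i) ≡ sumV (f ∘ ρ) xs
    rv f z = trans (cong (_+ sumV (f ∘ ρ) (Vec.removeAt xs i)) (sym (trans (cong f e) z))) (sumV-removeAt (f ∘ ρ) xs i)
  total : sumV (wt ∘ ρ) xs ≡ suc n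
  total = +-cancelʳ-≡ a _ _ (begin
    sumV (wt ∘ ρ) xs + a      ≡⟨ sym (sumF-+ (wt ∘ ρ ∘ lookup xs) (isRival ∘ ρ ∘ lookup xs)) ⟩
    sumF (λ i → wt (ρ (lookup xs i)) + isRival (ρ (lookup xs i))) ≡⟨ sumF-cong (λ i → w (ρ (lookup xs i))) ⟩
    sumF (λ i → 1 + a * isSelf (ρ (lookup xs i))) ≡⟨ sumF-+ {suc n} (λ _ → 1) (λ i → a * isSelf (ρ (lookup xs i))) ⟩
    sumF {suc n} (λ _ → 1) + sumF (λ i → a * isSelf (ρ (lookup xs i))) ≡⟨ cong₂ _+_ (trans (sumF-const (suc n) 1) (*-identityʳ (suc n))) (trans (sumF-* a (isSelf ∘ ρ ∘ lookup xs)) (trans (cong (a *_) one) (*-identityʳ a))) ⟩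
    suc n + a ∎)
    where
    w : ∀ r → wt r + isRival r ≡ 1 + a * isSelf r
    w self = cong suc (trans (+-identityʳ a) (sym (*-identityʳ a)))
    w rival = cong suc (sym (*-zeroʳ a))
    w other = cong suc (sym (*-zeroʳ a))

allOther : ∀ {A : Set} → (A → Role) → List A → Bool
allOther ρ [] = true
allOther ρ (u ∷ l) with ρ u
... | other = allOther ρ l
... | _ = false

-- The success that is still to come once `pre` has been read. It drops to zero after a rival, and
-- also after the element itself, so each element is counted exactly when it is read.
pick : ∀ {A : Set} → (A → Role) → List A → List A → ℕ
pick ρ pre l = if allOther ρ pre then before ρ l else 0

pick-step : ∀ {A : Set} (ρ : A → Role) pre u l → ρ u ≢ self → pick ρ pre (u ∷ l) ≡ pick ρ (u ∷ pre) l
pick-step ρ pre u l ns with ρ u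
... | self = ⊥-elim (ns refl)
... | other = refl
... | rival with allOther ρ pre
...   | true = refl
...   | false = refl

pick-self : ∀ {A : Set} (ρ : A → Role) pre u l → ρ u ≡ self → pick ρ pre (u ∷ l) ≡ 𝟙 (allOther ρ pre) × pick ρ (u ∷ pre) l ≡ 0
pick-self ρ pre u l e rewrite e with allOther ρ pre
... | true = refl , refl
... | false = refl , refl

allOther-All : ∀ {A : Set} (ρ : A → Role) pre → allOther ρ pre ≡ true → All (λ u → ρ u ≡ other) pre
allOther-All ρ [] e = []
allOther-All ρ (u ∷ pre) e with ρ u in eq
... | other = eq ∷ allOther-All ρ pre e

sumF-except : ∀ {n} (f g : Fin n → ℕ) u → (∀ v → v ≢ u → f v ≡ g v) → g u ≡ 0 → sumF f ≡ f u + sumF g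
sumF-except {suc n} f g zero eq z = cong (f zero +_) (trans (sumF-cong (λ i → eq (suc i) λ ())) (sym (cong (_+ sumF (g ∘ suc)) z)))
sumF-except {suc n} f g (suc u) eq z =
  trans (cong₂ _+_ (eq zero λ ()) (sumF-except (f ∘ suc) (g ∘ suc) u (λ v ne → eq (suc v) (ne ∘ Finₚ.suc-injective)) z))
    (r (g zero) (f (suc u)) (sumF (g ∘ suc)))
  where
  r : ∀ a b c → a + (b + c) ≡ b + (a + c)
  r = solve-∀

-- The Caro-Wei argument with two ways of joining the chain: an element that precedes all its rivals
-- for `ρ₁` goes to the end, one that precedes all its rivals for `ρ₂` goes to the front. Both use
-- the same chain, so the union of the two events is bounded by `K`.
module Orders {N K : ℕ} (ρ₁ ρ₂ : Fin N → Fin N → Role) (Rel : Fin N → Fin N → Set)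
  (self₁ : ∀ v u → ρ₁ v u ≡ self → v ≡ u) (refl₁ : ∀ v → ρ₁ v v ≡ self)
  (self₂ : ∀ v u → ρ₂ v u ≡ self → v ≡ u) (refl₂ : ∀ v → ρ₂ v v ≡ self)
  (rel₁ : ∀ v u → ρ₁ v u ≡ other → Rel u v) (rel₂ : ∀ v u → ρ₂ v u ≡ other → Rel v u)
  (bounded : ∀ L → AllPairs Rel L → length L ≤ K) where

  -- The picked vertices can be arranged into a chain: each of them goes to one end of the chain of its predecessors.
  picks : ∀ l pre L → AllPairs Rel L → All (_∈ pre) L →
    sumF (λ v → pick (ρ₁ v) pre l ⊔ pick (ρ₂ v) pre l) + length L ≤ K
  picks [] pre L ap sub = subst (λ z → z + length L ≤ K) (sym (trans (sumF-cong z) (trans (sumF-const N 0) (*-zeroʳ N)))) (bounded L ap)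
    where
    z : ∀ v → pick (ρ₁ v) pre [] ⊔ pick (ρ₂ v) pre [] ≡ 0
    z v with allOther (ρ₁ v) pre | allOther (ρ₂ v) pre
    ... | true | true = refl
    ... | true | false = refl
    ... | false | true = refl
    ... | false | false = refl
  picks (u ∷ l) pre L ap sub = subst (λ z → z + length L ≤ K)
    (sym (sumF-except (λ v → pick (ρ₁ v) pre (u ∷ l) ⊔ pick (ρ₂ v) pre (u ∷ l)) (λ v → pick (ρ₁ v) (u ∷ pre) l ⊔ pick (ρ₂ v) (u ∷ pre) l) u
      (λ v ne → cong₂ _⊔_ (pick-step (ρ₁ v) pre u l (ne ∘ self₁ v u)) (pick-step (ρ₂ v) pre u l (ne ∘ self₂ v u)))
      (cong₂ _⊔_ (proj₂ (pick-self (ρ₁ u) pre u l (refl₁ u))) (proj₂ (pick-self (ρ₂ u) pre u l (refl₂ u))))))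
    (subst (λ z → z + S + length L ≤ K) (sym (cong₂ _⊔_ (proj₁ (pick-self (ρ₁ u) pre u l (refl₁ u))) (proj₁ (pick-self (ρ₂ u) pre u l (refl₂ u))))) extend)
    where
    S = sumF (λ v → pick (ρ₁ v) (u ∷ pre) l ⊔ pick (ρ₂ v) (u ∷ pre) l)
    r : ∀ a b → a + suc b ≡ 1 + a + b
    r = solve-∀
    extend : 𝟙 (allOther (ρ₁ u) pre) ⊔ 𝟙 (allOther (ρ₂ u) pre) + S + length L ≤ K
    extend with allOther (ρ₁ u) pre in e₁ | allOther (ρ₂ u) pre in e₂
    ... | false | false = picks l (u ∷ pre) L ap (All.map there sub)
    ... | false | true = subst (_≤ K) (r S (length L)) (picks l (u ∷ pre) (u ∷ L)
            (All.map (λ w∈ → rel₂ u _ (All.lookup (allOther-All (ρ₂ u) pre e₂) w∈)) sub ∷ ap) (here refl ∷ All.map there sub))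
    ... | true | b₂ = subst (_≤ K) (trans (cong (S +_) (trans (Listₚ.length-++ L) (+-comm (length L) 1))) (trans (r S (length L)) (cong (λ z → z + S + length L) (one b₂))))
            (picks l (u ∷ pre) (L ++ u ∷ [])
              (AllPairsₚ.++⁺ ap ([] ∷ []) (All.map (λ w∈ → rel₁ u _ (All.lookup (allOther-All (ρ₁ u) pre e₁) w∈) ∷ []) sub))
              (Allₚ.++⁺ (All.map there sub) (here refl ∷ [])))
      where
      one : ∀ b → 1 ≡ 1 ⊔ 𝟙 b
      one true = refl
      one false = refl

  picks-avg : sumF (λ v → sumOrders (Vec.allFin N) (λ l → before (ρ₁ v) l ⊔ before (ρ₂ v) l)) ≤ K * N !
  picks-avg = subst₂ _≤_ (sumOrders-sumF (Vec.allFin N) (λ v l → before (ρ₁ v) l ⊔ before (ρ₂ v) l)) (sumOrders-const (Vec.allFin N) K)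
    (sumOrders-mono (Vec.allFin N) λ l → subst (_≤ K) (+-identityʳ _) (picks l [] [] [] []))

-- Kinds of pairs and their weights

data Kind : Set where
  non dbl : Kind
  sg : Bool → Kind

flip : Kind → Kind
flip non = non
flip dbl = dbl
flip (sg b) = sg (not b)

-- `true` is the direction from the first vertex of the pair to the second, here and in `sg`.
has : Bool → Kind → Bool
has b non = false
has b dbl = true
has true (sg b) = b
has false (sg b) = not b

-- 2^11 ≤ 3^7 ≤ 4^7: a single arc carries at most 7/11 of the information of a double one.
weight : Kind → ℕ
weight non = 0
weight dbl = 11
weight (sg _) = 7

-- Turán's bound; x, p, m count the non-neighbours, single out- and single in-neighbours of a vertex

-- `1/α + 1/β - 1/γ ≥ 3/w` without denominators, with equality for `p = m = 0`. Written with
-- `m = p + d`, the difference of the two sides is a polynomial with nonnegative coefficients.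
key-wlog : ∀ x p d → let m = p + d; α = x + p; β = x + m; γ = x + p + m; w = 3 * x + p + m in
  3 * (α * β * γ) + w * (α * β) ≤ w * γ * (α + β)
key-wlog x p d = subst (3 * ((x + p) * (x + (p + d)) * (x + p + (p + d))) + (3 * x + p + (p + d)) * ((x + p) * (x + (p + d))) ≤_)
  (sym (r x p d)) (m≤m+n _ (x * x * (2 * p + d) + x * (2 * p * p + 2 * p * d + 2 * d * d) + (2 * p + d) * d * d))
  where
  r : ∀ x p d → (3 * x + p + (p + d)) * (x + p + (p + d)) * (x + p + (x + (p + d))) ≡
    3 * ((x + p) * (x + (p + d)) * (x + p + (p + d))) + (3 * x + p + (p + d)) * ((x + p) * (x + (p + d))) +
    (x * x * (2 * p + d) + x * (2 * p * p + 2 * p * d + 2 * d * d) + (2 * p + d) * d * d)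
  r = solve-∀

key : ∀ x p m → let α = x + p; β = x + m; γ = x + p + m; w = 3 * x + p + m in
  3 * (α * β * γ) + w * (α * β) ≤ w * γ * (α + β)
key x p m with ≤-total p m
... | inj₁ p≤m = subst (λ m → 3 * ((x + p) * (x + m) * (x + p + m)) + (3 * x + p + m) * ((x + p) * (x + m)) ≤ (3 * x + p + m) * (x + p + m) * (x + p + (x + m)))
                   (m+[n∸m]≡n p≤m) (key-wlog x p (m ∸ p))
... | inj₂ m≤p = subst₂ _≤_ (r₁ x p m) (r₂ x p m) (subst (λ p → 3 * ((x + m) * (x + p) * (x + m + p)) + (3 * x + m + p) * ((x + m) * (x + p)) ≤ (3 * x + m + p) * (x + m + p) * (x + m + (x + p)))
                   (m+[n∸m]≡n m≤p) (key-wlog x m (p ∸ m)))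
  where
  r₁ : ∀ x p m → 3 * ((x + m) * (x + p) * (x + m + p)) + (3 * x + m + p) * ((x + m) * (x + p)) ≡ 3 * ((x + p) * (x + m) * (x + p + m)) + (3 * x + p + m) * ((x + p) * (x + m))
  r₁ = solve-∀
  r₂ : ∀ x p m → (3 * x + m + p) * (x + m + p) * (x + m + (x + p)) ≡ (3 * x + p + m) * (x + p + m) * (x + p + (x + m))
  r₂ = solve-∀

2ab≤a²+b² : ∀ a b → 2 * (a * b) ≤ a * a + b * b
2ab≤a²+b² a b with ≤-total a b
... | inj₁ a≤b = subst (λ b → 2 * (a * b) ≤ a * a + b * b) (m+[n∸m]≡n a≤b) (subst (2 * (a * (a + (b ∸ a))) ≤_) (sym (r a (b ∸ a))) (m≤m+n _ _))
  where
  r : ∀ a d → a * a + (a + d) * (a + d) ≡ 2 * (a * (a + d)) + d * d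
  r = solve-∀
... | inj₂ b≤a = subst (λ a → 2 * (a * b) ≤ a * a + b * b) (m+[n∸m]≡n b≤a) (subst (2 * ((b + (a ∸ b)) * b) ≤_) (sym (r b (a ∸ b))) (m≤m+n _ _))
  where
  r : ∀ a d → (a + d) * (a + d) + a * a ≡ 2 * ((a + d) * a) + d * d
  r = solve-∀

-- `key` gives `a + b - c ≥ 3T/w`, and `9M²/w + w ≥ 6M` is the tangent line at `w = 3M`, the value
-- of `w` in a complete multipartite graph with parts of size `M`.
vertex₁ : ∀ x p m a b c T M → 1 ≤ x → a * (x + p) ≡ T → b * (x + m) ≡ T → c * (x + p + m) ≡ T →
  6 * T * M + 3 * c * (M * M) ≤ 3 * (a + b) * (M * M) + T * (3 * x + p + m)
vertex₁ (suc x′) p m a b c T M _ ea eb ec = *-cancelʳ-≤ _ _ w (begin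
  (6 * T * M + 3 * c * (M * M)) * w          ≡⟨ r₁ T M c w ⟩
  T * (2 * (3 * M * w)) + 3 * (M * M) * (c * w) ≤⟨ +-monoˡ-≤ _ (*-monoʳ-≤ T (2ab≤a²+b² (3 * M) w)) ⟩
  T * (3 * M * (3 * M) + w * w) + 3 * (M * M) * (c * w) ≡⟨ r₂ T M c w ⟩
  3 * (M * M) * (3 * T + c * w) + T * w * w  ≤⟨ +-monoˡ-≤ (T * w * w) (*-monoʳ-≤ (3 * (M * M)) harmonic) ⟩
  3 * (M * M) * ((a + b) * w) + T * w * w    ≡⟨ r₃ T M a b w ⟩
  (3 * (a + b) * (M * M) + T * w) * w ∎)
  where
  open ≤-Reasoning
  x = suc x′
  w = 3 * x + p + m
  α = x + p
  β = x + m
  γ = x + p + m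
  r₁ : ∀ T M c w → (6 * T * M + 3 * c * (M * M)) * w ≡ T * (2 * (3 * M * w)) + 3 * (M * M) * (c * w)
  r₁ = solve-∀
  r₂ : ∀ T M c w → T * (3 * M * (3 * M) + w * w) + 3 * (M * M) * (c * w) ≡ 3 * (M * M) * (3 * T + c * w) + T * w * w
  r₂ = solve-∀
  r₃ : ∀ T M a b w → 3 * (M * M) * ((a + b) * w) + T * w * w ≡ (3 * (a + b) * (M * M) + T * w) * w
  r₃ = solve-∀
  s₁ : ∀ T c w α β γ → (3 * T + c * w) * (α * β * γ) ≡ T * (3 * (α * β * γ)) + c * γ * (w * (α * β))
  s₁ = solve-∀
  s₂ : ∀ T w α β γ → T * (w * γ * (α + β)) ≡ w * γ * (T * β + T * α)
  s₂ = solve-∀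
  s₃ : ∀ a b w α β γ → w * γ * (a * α * β + b * β * α) ≡ (a + b) * w * (α * β * γ)
  s₃ = solve-∀
  harmonic : 3 * T + c * w ≤ (a + b) * w
  harmonic = *-cancelʳ-≤ _ _ (α * β * γ) (begin
    (3 * T + c * w) * (α * β * γ)                  ≡⟨ s₁ T c w α β γ ⟩
    T * (3 * (α * β * γ)) + c * γ * (w * (α * β))  ≡⟨ cong (λ z → T * (3 * (α * β * γ)) + z * (w * (α * β))) ec ⟩
    T * (3 * (α * β * γ)) + T * (w * (α * β))      ≡⟨ sym (*-distribˡ-+ T _ _) ⟩
    T * (3 * (α * β * γ) + w * (α * β))            ≤⟨ *-monoʳ-≤ T (key x p m) ⟩
    T * (w * γ * (α + β))                          ≡⟨ s₂ T w α β γ ⟩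
    w * γ * (T * β + T * α)                        ≡⟨ cong₂ (λ y z → w * γ * (y * β + z * α)) (sym ea) (sym eb) ⟩
    w * γ * (a * α * β + b * β * α)                ≡⟨ s₃ a b w α β γ ⟩
    (a + b) * w * (α * β * γ) ∎)

-- The tangent line of `t²/γ` at `γ = t`.
vertex₂ : ∀ γ c T t .⦃ _ : NonZero γ ⦄ → c * γ ≡ T → 2 * T * t ≤ c * (t * t) + T * γ
vertex₂ γ c T t ec = *-cancelʳ-≤ _ _ γ (begin
  2 * T * t * γ           ≡⟨ r₁ T t γ ⟩
  T * (2 * (t * γ))       ≤⟨ *-monoʳ-≤ T (2ab≤a²+b² t γ) ⟩
  T * (t * t + γ * γ)     ≡⟨ *-distribˡ-+ T (t * t) (γ * γ) ⟩
  T * (t * t) + T * (γ * γ) ≡⟨ cong (λ z → z * (t * t) + T * (γ * γ)) (sym ec) ⟩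
  c * γ * (t * t) + T * (γ * γ) ≡⟨ r₂ c γ t T ⟩
  (c * (t * t) + T * γ) * γ ∎)
  where
  open ≤-Reasoning
  r₁ : ∀ T t γ → 2 * T * t * γ ≡ T * (2 * (t * γ))
  r₁ = solve-∀
  r₂ : ∀ c γ t T → c * γ * (t * t) + T * (γ * γ) ≡ (c * (t * t) + T * γ) * γ
  r₂ = solve-∀

isNon isDbl : Kind → Bool
isNon non = true
isNon _ = false
isDbl dbl = true
isDbl _ = false

isSg : Bool → Kind → Bool
isSg b non = false
isSg b dbl = false
isSg true (sg c) = c
isSg false (sg c) = not c

-- Two extremal conditions are imposed at once: at most `suc k′` vertices in a transitive tournament
-- of the pattern, and at most `k′` in a clique of double pairs. `M` and `t` are the part sizes of
-- the balanced multipartite graphs with `suc k′` and `k′` parts.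
module Turan {N : ℕ} (κ : Fin N → Fin N → Kind) (κ-irrefl : ∀ v → κ v v ≡ non) (κ-flip : ∀ u v → κ v u ≡ flip (κ u v))
  (k′ : ℕ) (M t : ℕ) (N≡kM : N ≡ suc k′ * M) (N≡k′t : N ≡ k′ * t)
  (noTT : ∀ L → AllPairs (λ u v → has true (κ u v) ≡ true) L → length L ≤ suc k′)
  (noDK : ∀ L → AllPairs (λ u v → κ u v ≡ dbl) L → length L ≤ k′) where

  x p m : Fin N → ℕ
  x v = sumF (λ u → 𝟙 (isNon (κ v u)))
  p v = sumF (λ u → 𝟙 (isSg true (κ v u)))
  m v = sumF (λ u → 𝟙 (isSg false (κ v u)))

  role : (Kind → Bool) → Fin N → Fin N → Role
  role b v u with v Fin.≟ u
  ... | yes _ = self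
  ... | no _ = if b (κ v u) then rival else other

  role-self : ∀ b v u → role b v u ≡ self → v ≡ u
  role-self b v u e with v Fin.≟ u
  ... | yes eq = eq
  ... | no _ with b (κ v u)
  role-self b v u () | no _ | true
  role-self b v u () | no _ | false

  role-refl : ∀ b v → role b v v ≡ self
  role-refl b v with v Fin.≟ v
  ... | yes _ = refl
  ... | no ne = ⊥-elim (ne refl)

  role-other : ∀ b v u → role b v u ≡ other → b (κ v u) ≡ false
  role-other b v u e with v Fin.≟ u
  role-other b v u () | yes _
  ... | no _ with b (κ v u)
  ... | false = refl

  b₊ b₋ b₂ : Kind → Bool
  b₊ κ = isNon κ ∨ isSg true κ
  b₋ κ = isNon κ ∨ isSg false κ
  b₂ κ = not (isDbl κ)

  V = Vec.allFin N
  T = N !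

  before-count : ∀ b → b non ≡ true → ∀ v → sumOrders V (before (role b v)) * sumF (λ u → 𝟙 (b (κ v u))) ≡ T
  before-count b bnon v = trans (cong (sumOrders V (before (role b v)) *_) count)
      (sumOrders-before (role b v) V (trans (all isSelf) selfs))
    where
    all : ∀ (f : Role → ℕ) → sumV (f ∘ role b v) V ≡ sumF (f ∘ role b v)
    all f = sumF-cong λ i → cong (f ∘ role b v) (Vecₚ.lookup-allFin i)
    selfs : sumF (isSelf ∘ role b v) ≡ 1
    selfs = trans (sumF-except (isSelf ∘ role b v) (λ _ → 0) v (λ u ne → ns u ne) refl)
      (trans (cong₂ _+_ (cong isSelf (role-refl b v)) (trans (sumF-const N 0) (*-zeroʳ N))) refl)
      where
      ns : ∀ u → u ≢ v → isSelf (role b v u) ≡ 0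
      ns u ne with role b v u in e
      ... | self = ⊥-elim (ne (sym (role-self b v u e)))
      ... | rival = refl
      ... | other = refl
    count : sumF (λ u → 𝟙 (b (κ v u))) ≡ 1 + sumV (isRival ∘ role b v) V
    count = trans (sumF-cong pt) (trans (sumF-+ (isSelf ∘ role b v) (isRival ∘ role b v)) (cong₂ _+_ selfs (sym (all isRival))))
      where
      pt : ∀ u → 𝟙 (b (κ v u)) ≡ isSelf (role b v u) + isRival (role b v u)
      pt u with v Fin.≟ u
      ... | yes refl = cong 𝟙 (trans (cong b (κ-irrefl v)) bnon)
      ... | no _ with b (κ v u)
      ...   | true = refl
      ...   | false = refl

  a b c : Fin N → ℕ
  a v = sumOrders V (before (role b₊ v))
  b v = sumOrders V (before (role b₋ v))
  c v = sumOrders V (before (role b₂ v))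

  split : ∀ (f g : Kind → Bool) (h : Kind → ℕ) → (∀ κ → h κ ≡ 𝟙 (f κ) + 𝟙 (g κ)) → ∀ v →
    sumF (λ u → h (κ v u)) ≡ sumF (λ u → 𝟙 (f (κ v u))) + sumF (λ u → 𝟙 (g (κ v u)))
  split f g h eq v = trans (sumF-cong (λ u → eq (κ v u))) (sumF-+ (λ u → 𝟙 (f (κ v u))) (λ u → 𝟙 (g (κ v u))))

  a-count : ∀ v → a v * (x v + p v) ≡ T
  a-count v = trans (cong (a v *_) (sym (split isNon (isSg true) (𝟙 ∘ b₊) (λ { non → refl ; dbl → refl ; (sg true) → refl ; (sg false) → refl }) v))) (before-count b₊ refl v)

  b-count : ∀ v → b v * (x v + m v) ≡ T
  b-count v = trans (cong (b v *_) (sym (split isNon (isSg false) (𝟙 ∘ b₋) (λ { non → refl ; dbl → refl ; (sg true) → refl ; (sg false) → refl }) v))) (before-count b₋ refl v)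

  c-count : ∀ v → c v * (x v + p v + m v) ≡ T
  c-count v = trans (cong (c v *_) (sym (trans (split b₊ (isSg false) (𝟙 ∘ b₂) (λ { non → refl ; dbl → refl ; (sg true) → refl ; (sg false) → refl }) v)
      (cong (_+ m v) (split isNon (isSg true) (𝟙 ∘ b₊) (λ { non → refl ; dbl → refl ; (sg true) → refl ; (sg false) → refl }) v))))) (before-count b₂ refl v)

  -- Inclusion-exclusion: `v` precedes both sets of rivals exactly when it precedes their union,
  -- which is the set of rivals for `b₂`.
  before-meet : ∀ v l → before (role b₊ v) l + before (role b₋ v) l ≤ before (role b₊ v) l ⊔ before (role b₋ v) l + before (role b₂ v) l
  before-meet v [] = z≤n
  before-meet v (u ∷ l) with v Fin.≟ u
  ... | yes _ = ≤-refl
  ... | no _ with κ v u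
  ...   | non = z≤n
  ...   | dbl = before-meet v l
  ...   | sg true = ≤-reflexive (sym (+-identityʳ _))
  ...   | sg false = ≤-reflexive (cong (_+ 0) (sym (⊔-identityʳ _)))

  sum-ab : sumF (λ v → a v + b v) ≤ suc k′ * T + sumF c
  sum-ab = begin
    sumF (λ v → a v + b v) ≡⟨ sumF-cong (λ v → sym (sumOrders-+ V (before (role b₊ v)) (before (role b₋ v)))) ⟩
    sumF (λ v → sumOrders V (λ l → before (role b₊ v) l + before (role b₋ v) l)) ≤⟨ sumF-mono (λ v → sumOrders-mono V (before-meet v)) ⟩
    sumF (λ v → sumOrders V (λ l → before (role b₊ v) l ⊔ before (role b₋ v) l + before (role b₂ v) l)) ≡⟨ sumF-cong (λ v → sumOrders-+ V (λ l → before (role b₊ v) l ⊔ before (role b₋ v) l) (before (role b₂ v))) ⟩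
    sumF (λ v → sumOrders V (λ l → before (role b₊ v) l ⊔ before (role b₋ v) l) + c v) ≡⟨ sumF-+ (λ v → sumOrders V (λ l → before (role b₊ v) l ⊔ before (role b₋ v) l)) c ⟩
    sumF (λ v → sumOrders V (λ l → before (role b₊ v) l ⊔ before (role b₋ v) l)) + sumF c ≤⟨ +-monoˡ-≤ (sumF c) O.picks-avg ⟩
    suc k′ * T + sumF c ∎
    where
    open ≤-Reasoning
    rel₁ : ∀ v u → role b₊ v u ≡ other → has true (κ u v) ≡ true
    rel₁ v u e = trans (cong (has true) (κ-flip v u)) (lemma (κ v u) (role-other b₊ v u e))
      where
      lemma : ∀ κ → b₊ κ ≡ false → has true (flip κ) ≡ true
      lemma dbl _ = refl
      lemma (sg false) _ = refl
    rel₂ : ∀ v u → role b₋ v u ≡ other → has true (κ v u) ≡ true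
    rel₂ v u e = lemma (κ v u) (role-other b₋ v u e)
      where
      lemma : ∀ κ → b₋ κ ≡ false → has true κ ≡ true
      lemma dbl _ = refl
      lemma (sg true) _ = refl
    module O = Orders (role b₊) (role b₋) (λ u v → has true (κ u v) ≡ true) (role-self b₊) (role-refl b₊) (role-self b₋) (role-refl b₋) rel₁ rel₂ noTT

  sum-c : sumF c ≤ k′ * T
  sum-c = ≤-trans (sumF-mono {f = c} λ v → sumOrders-mono V λ l → m≤m⊔n (before (role b₂ v) l) (before (role b₂ v) l)) O.picks-avg
    where
    rel₁ : ∀ v u → role b₂ v u ≡ other → κ v u ≡ dbl
    rel₁ v u e = lemma (κ v u) (role-other b₂ v u e)
      where
      lemma : ∀ κ → b₂ κ ≡ false → κ ≡ dbl
      lemma dbl _ = refl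
    module O = Orders (role b₂) (role b₂) (λ u v → κ u v ≡ dbl) (role-self b₂) (role-refl b₂) (role-self b₂) (role-refl b₂)
      (λ v u e → trans (κ-flip v u) (cong flip (rel₁ v u e))) rel₁ noDK

  w γ : Fin N → ℕ
  w v = 3 * x v + p v + m v
  γ v = x v + p v + m v

  x-pos : ∀ v → 1 ≤ x v
  x-pos v = subst (_≤ x v) (cong (𝟙 ∘ isNon) (κ-irrefl v)) (term≤sumF (λ u → 𝟙 (isNon (κ v u))) v)

  instance
    T≢0 : NonZero T
    T≢0 = N !≢0

  sum-w : 3 * (suc k′ * (M * M)) ≤ sumF w
  sum-w = *-cancelˡ-≤ T (+-cancelˡ-≤ (3 * (M * M) * (suc k′ * T + sumF c)) _ _ (begin
    3 * (M * M) * (suc k′ * T + sumF c) + T * (3 * (suc k′ * (M * M))) ≡⟨ r₁ M (suc k′) T (sumF c) ⟩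
    suc k′ * M * (6 * T * M) + 3 * (M * M) * sumF c ≡⟨ cong (λ z → z * (6 * T * M) + 3 * (M * M) * sumF c) (sym N≡kM) ⟩
    N * (6 * T * M) + 3 * (M * M) * sumF c ≡⟨ cong₂ _+_ (sym (sumF-const N (6 * T * M))) (sym (sumF-* (3 * (M * M)) c)) ⟩
    sumF {N} (λ _ → 6 * T * M) + sumF (λ v → 3 * (M * M) * c v) ≡⟨ sym (sumF-+ {N} (λ _ → 6 * T * M) (λ v → 3 * (M * M) * c v)) ⟩
    sumF (λ v → 6 * T * M + 3 * (M * M) * c v) ≤⟨ sumF-mono (λ v → subst₂ _≤_ (cong (6 * T * M +_) (r₂ (c v) M)) (cong (_+ T * w v) (r₂ (a v + b v) M))
                                                    (vertex₁ (x v) (p v) (m v) (a v) (b v) (c v) T M (x-pos v) (a-count v) (b-count v) (c-count v))) ⟩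
    sumF (λ v → 3 * (M * M) * (a v + b v) + T * w v) ≡⟨ sumF-+ (λ v → 3 * (M * M) * (a v + b v)) (λ v → T * w v) ⟩
    sumF (λ v → 3 * (M * M) * (a v + b v)) + sumF (λ v → T * w v) ≡⟨ cong₂ _+_ (sumF-* (3 * (M * M)) (λ v → a v + b v)) (sumF-* T w) ⟩
    3 * (M * M) * sumF (λ v → a v + b v) + T * sumF w ≤⟨ +-monoˡ-≤ (T * sumF w) (*-monoʳ-≤ (3 * (M * M)) sum-ab) ⟩
    3 * (M * M) * (suc k′ * T + sumF c) + T * sumF w ∎))
    where
    open ≤-Reasoning
    r₁ : ∀ M k T c → 3 * (M * M) * (k * T + c) + T * (3 * (k * (M * M))) ≡ k * M * (6 * T * M) + 3 * (M * M) * c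
    r₁ = solve-∀
    r₂ : ∀ c M → 3 * c * (M * M) ≡ 3 * (M * M) * c
    r₂ = solve-∀

  sum-γ : k′ * (t * t) ≤ sumF γ
  sum-γ = *-cancelˡ-≤ T (+-cancelˡ-≤ (t * t * (k′ * T)) _ _ (begin
    t * t * (k′ * T) + T * (k′ * (t * t)) ≡⟨ r₁ t k′ T ⟩
    k′ * t * (2 * T * t) ≡⟨ cong (_* (2 * T * t)) (sym N≡k′t) ⟩
    N * (2 * T * t) ≡⟨ sym (sumF-const N (2 * T * t)) ⟩
    sumF {N} (λ _ → 2 * T * t) ≤⟨ sumF-mono (λ v → subst (λ z → 2 * T * t ≤ z + T * γ v) (*-comm (c v) (t * t))
                                     (vertex₂ (γ v) (c v) T t ⦃ >-nonZero (≤-trans (x-pos v) (≤-trans (m≤m+n (x v) (p v)) (m≤m+n _ (m v)))) ⦄ (c-count v))) ⟩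
    sumF (λ v → t * t * c v + T * γ v) ≡⟨ trans (sumF-+ (λ v → t * t * c v) (λ v → T * γ v)) (cong₂ _+_ (sumF-* (t * t) c) (sumF-* T γ)) ⟩
    t * t * sumF c + T * sumF γ ≤⟨ +-monoˡ-≤ (T * sumF γ) (*-monoʳ-≤ (t * t) sum-c) ⟩
    t * t * (k′ * T) + T * sumF γ ∎))
    where
    open ≤-Reasoning
    r₁ : ∀ t k T → t * t * (k * T) + T * (k * (t * t)) ≡ k * t * (2 * T * t)
    r₁ = solve-∀

  totalWeight : ℕ
  totalWeight = sumF λ v → sumF λ u → weight (κ v u)

  -- `22 - 2 * weight` takes the values 22, 8 and 0 on `non`, `sg` and `dbl`, and so does
  -- `7 * 3 + 1`, `7 * 1 + 1`, `0`, the contribution of a pair to `7 * w + γ`. The missing weight is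
  -- thus a combination of the two quantities that were bounded from below.
  turan : 2 * totalWeight + (21 * (suc k′ * (M * M)) + k′ * (t * t)) ≤ 22 * (N * N)
  turan = begin
    2 * totalWeight + (21 * (suc k′ * (M * M)) + k′ * (t * t)) ≤⟨ +-monoʳ-≤ (2 * totalWeight) (+-mono-≤ (≤-trans (≤-reflexive (r (suc k′ * (M * M)))) (*-monoʳ-≤ 7 sum-w)) sum-γ) ⟩
    2 * totalWeight + (7 * sumF w + sumF γ) ≡⟨ cong₂ _+_ (sym (sumF-* 2 W)) (trans (cong (_+ sumF γ) (sym (sumF-* 7 w))) (sym (sumF-+ (λ v → 7 * w v) γ))) ⟩
    sumF (λ v → 2 * W v) + sumF (λ v → 7 * w v + γ v) ≡⟨ sym (sumF-+ (λ v → 2 * W v) (λ v → 7 * w v + γ v)) ⟩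
    sumF (λ v → 2 * W v + (7 * w v + γ v)) ≡⟨ sumF-cong row ⟩
    sumF {N} (λ v → 22 * N) ≡⟨ trans (sumF-const N (22 * N)) (r′ N) ⟩
    22 * (N * N) ∎
    where
    open ≤-Reasoning
    W : Fin N → ℕ
    W v = sumF λ u → weight (κ v u)
    r : ∀ X → 21 * X ≡ 7 * (3 * X)
    r = solve-∀
    r′ : ∀ N → N * (22 * N) ≡ 22 * (N * N)
    r′ = solve-∀
    s : ∀ W x p m → 2 * W + (7 * (3 * x + p + m) + (x + p + m)) ≡ 2 * (W + (11 * x + (4 * p + 4 * m)))
    s = solve-∀
    r″ : ∀ N → 2 * (N * 11) ≡ 22 * N
    r″ = solve-∀
    row : ∀ v → 2 * W v + (7 * w v + γ v) ≡ 22 * N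
    row v = trans (s (W v) (x v) (p v) (m v)) (trans (cong (2 *_) (begin-equality
      W v + (11 * x v + (4 * p v + 4 * m v)) ≡⟨ cong (W v +_) (sym (cong₂ _+_ (sumF-* 11 (λ u → 𝟙 (isNon (κ v u)))) (cong₂ _+_ (sumF-* 4 (λ u → 𝟙 (isSg true (κ v u)))) (sumF-* 4 (λ u → 𝟙 (isSg false (κ v u))))))) ⟩
      W v + (sumF X + (sumF P + sumF Q)) ≡⟨ cong (λ z → W v + (sumF X + z)) (sym (sumF-+ P Q)) ⟩
      W v + (sumF X + sumF (λ u → P u + Q u)) ≡⟨ cong (W v +_) (sym (sumF-+ X (λ u → P u + Q u))) ⟩
      W v + sumF (λ u → X u + (P u + Q u)) ≡⟨ sym (sumF-+ (λ u → weight (κ v u)) (λ u → X u + (P u + Q u))) ⟩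
      sumF (λ u → weight (κ v u) + (X u + (P u + Q u))) ≡⟨ sumF-cong (λ u → q (κ v u)) ⟩
      sumF {N} (λ _ → 11) ≡⟨ sumF-const N 11 ⟩
      N * 11 ∎)) (r″ N))
      where
      X P Q : Fin N → ℕ
      X u = 11 * 𝟙 (isNon (κ v u))
      P u = 4 * 𝟙 (isSg true (κ v u))
      Q u = 4 * 𝟙 (isSg false (κ v u))
      q : ∀ κ → weight κ + (11 * 𝟙 (isNon κ) + (4 * 𝟙 (isSg true κ) + 4 * 𝟙 (isSg false κ))) ≡ 11
      q non = refl
      q dbl = refl
      q (sg true) = refl
      q (sg false) = refl

-- Patterns, built by adding one vertex at a time; the newest vertex has index zero

Pat : ℕ → Set
Pat zero = ⊤
Pat (suc r) = Vec Kind r × Pat r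

kind : ∀ {r} → Pat r → Fin r → Fin r → Kind
kind (w , D) zero zero = non
kind (w , D) zero (suc j) = lookup w j
kind (w , D) (suc i) zero = flip (lookup w i)
kind (w , D) (suc i) (suc j) = kind D i j

kind-irrefl : ∀ {r} (D : Pat r) v → kind D v v ≡ non
kind-irrefl (w , D) zero = refl
kind-irrefl (w , D) (suc v) = kind-irrefl D v

flip-flip : ∀ κ → κ ≡ flip (flip κ)
flip-flip non = refl
flip-flip dbl = refl
flip-flip (sg true) = refl
flip-flip (sg false) = refl

kind-flip : ∀ {r} (D : Pat r) u v → kind D v u ≡ flip (kind D u v)
kind-flip (w , D) zero zero = refl
kind-flip (w , D) zero (suc v) = refl
kind-flip (w , D) (suc u) zero = flip-flip (lookup w u)
kind-flip (w , D) (suc u) (suc v) = kind-flip D u v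

weightOf : ∀ {r} → Vec Kind r → ℕ
weightOf w = sumF (weight ∘ lookup w)

weight-flip : ∀ κ → weight (flip κ) ≡ weight κ
weight-flip non = refl
weight-flip dbl = refl
weight-flip (sg _) = refl

-- Heavy means density at least 1 - 1/k - 1/(44 k²), slightly below that of the Turán graph.
Heavy : ℕ → ∀ {r} → Vec Kind r → Set
Heavy k′ {r} w = r * (44 * (suc k′ * k′)) ≤ 4 * (suc k′ * suc k′) * weightOf w + r

HeavyPat : ℕ → ∀ {r} → Pat r → Set
HeavyPat k′ {zero} D = ⊤
HeavyPat k′ {suc r} (w , D) = Heavy k′ w × HeavyPat k′ D

patWeight : ∀ {r} → Pat r → ℕ
patWeight D = sumF λ v → sumF λ u → weight (kind D v u)

patWeight-suc : ∀ {r} (w : Vec Kind r) (D : Pat r) → patWeight (w , D) ≡ 2 * weightOf w + patWeight D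
patWeight-suc w D = trans (cong (weightOf w +_) (trans (sumF-+ (λ v → weight (flip (lookup w v))) (λ v → sumF λ u → weight (kind D v u)))
    (cong (_+ patWeight D) (sumF-cong λ v → weight-flip (lookup w v))))) (r (weightOf w) (patWeight D))
  where
  r : ∀ a b → a + (a + b) ≡ 2 * a + b
  r = solve-∀

-- Summing the heaviness of every vertex towards the older ones gives `4k² * patWeight D ≥ (c - 1) *
-- r * (r - 1)`, stated without subtraction.
heavy-weight : ∀ k′ r (D : Pat r) → HeavyPat k′ D → let c = 44 * (suc k′ * k′) in
  c * (r * r) + r ≤ 4 * (suc k′ * suc k′) * patWeight D + r * r + c * r
heavy-weight k′ zero D h = ≤-trans (≤-reflexive (trans (+-identityʳ _) (*-zeroʳ (44 * (suc k′ * k′))))) z≤n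
heavy-weight k′ (suc r) (w , D) (h , hs) = begin
  c * (suc r * suc r) + suc r                                  ≡⟨ e₁ c r ⟩
  (c * (r * r) + r) + 2 * (r * c) + (c + 1)                    ≤⟨ +-monoˡ-≤ (c + 1) (+-mono-≤ (heavy-weight k′ r D hs) (*-monoʳ-≤ 2 h)) ⟩
  (d * P + r * r + c * r) + 2 * (d * W + r) + (c + 1)          ≡⟨ e₂ d P r c W ⟩
  d * (2 * W + P) + suc r * suc r + c * suc r                  ≡⟨ cong (λ z → d * z + suc r * suc r + c * suc r) (sym (patWeight-suc w D)) ⟩
  d * patWeight (w , D) + suc r * suc r + c * suc r ∎
  where
  open ≤-Reasoning
  c = 44 * (suc k′ * k′)
  d = 4 * (suc k′ * suc k′)
  P = patWeight D
  W = weightOf w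
  e₁ : ∀ c r → c * ((1 + r) * (1 + r)) + (1 + r) ≡ (c * (r * r) + r) + 2 * (r * c) + (c + 1)
  e₁ = solve-∀
  e₂ : ∀ d P r c W → (d * P + r * r + c * r) + 2 * (d * W + r) + (c + 1) ≡ d * (2 * W + P) + (1 + r) * (1 + r) + c * (1 + r)
  e₂ = solve-∀

-- `N` is a multiple of `k` and `k′`, so `M` and `t` are integers, and it equals the constant `c` of
-- `heavy-weight`. Heaviness gives `4k²W ≥ N³ - 2N² + N`, whereas Turán's bound gives
-- `4k²W ≤ N³ - 2(k/k′)N²`, which is smaller because `k > k′`.
heavy-clique : ∀ k″ → let k′ = suc k″; N = 44 * (suc k′ * k′) in (D : Pat N) → HeavyPat k′ D →
  (∀ L → AllPairs (λ u v → has true (kind D u v) ≡ true) L → length L ≤ suc k′) →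
  (∀ L → AllPairs (λ u v → kind D u v ≡ dbl) L → length L ≤ k′) → ⊥
heavy-clique k″ D h noTT noDK = <-irrefl refl (begin-strict
  N * (N * N) + B                          <⟨ m<m+n (N * (N * N) + B) {N} (s≤s z≤n) ⟩
  N * (N * N) + B + N                      ≡⟨ q₃ (N * (N * N)) B N ⟩
  N * (N * N) + N + B                      ≤⟨ +-monoˡ-≤ B (heavy-weight k′ N D h) ⟩
  4 * (k * k) * W + N * N + N * N + B      ≡⟨ q₁ k W (N * N) (21 * (k * (44 * k′ * (44 * k′))) + k′ * (44 * k * (44 * k))) ⟩
  2 * (k * k) * (2 * W + (21 * (k * (44 * k′ * (44 * k′))) + k′ * (44 * k * (44 * k)))) + 2 * (N * N)
                                           ≤⟨ +-monoˡ-≤ (2 * (N * N)) (*-monoʳ-≤ (2 * (k * k)) turan) ⟩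
  2 * (k * k) * (22 * (N * N)) + 2 * (N * N) ≤⟨ m≤m+n _ _ ⟩
  2 * (k * k) * (22 * (N * N)) + 2 * (N * N) + 2 * 44 * (44 * (k * k * k′)) ≡⟨ q₂ k″ ⟩
  N * (N * N) + B ∎)
  where
  open ≤-Reasoning
  k′ = suc k″
  k = suc k′
  N = 44 * (k * k′)
  W = patWeight D
  B = 2 * (k * k) * (21 * (k * (44 * k′ * (44 * k′))) + k′ * (44 * k * (44 * k)))
  e : ∀ k k′ → 44 * (k * k′) ≡ k * (44 * k′)
  e = solve-∀
  e′ : ∀ k k′ → 44 * (k * k′) ≡ k′ * (44 * k)
  e′ = solve-∀
  open Turan (kind D) (kind-irrefl D) (kind-flip D) k′ (44 * k′) (44 * k) (e k k′) (e′ k k′) noTT noDK using (turan)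
  q₁ : ∀ k W X Y → 4 * (k * k) * W + X + X + 2 * (k * k) * Y ≡ 2 * (k * k) * (2 * W + Y) + 2 * X
  q₁ = solve-∀
  q₂ : ∀ j → 2 * ((2 + j) * (2 + j)) * (22 * (44 * ((2 + j) * (1 + j)) * (44 * ((2 + j) * (1 + j))))) + 2 * (44 * ((2 + j) * (1 + j)) * (44 * ((2 + j) * (1 + j)))) + 2 * 44 * (44 * ((2 + j) * (2 + j) * (1 + j))) ≡
    44 * ((2 + j) * (1 + j)) * (44 * ((2 + j) * (1 + j)) * (44 * ((2 + j) * (1 + j)))) + 2 * ((2 + j) * (2 + j)) * (21 * ((2 + j) * (44 * (1 + j) * (44 * (1 + j)))) + (1 + j) * (44 * (2 + j) * (44 * (2 + j))))
  q₂ = solve-∀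
  q₃ : ∀ a b c → a + b + c ≡ a + c + b
  q₃ = solve-∀

-- Shattering and a Sauer-Shelah lemma for rows of states

State : Set
State = Bool × Bool

-- The first component is the arc leaving the observing vertex, the second the arc entering it.
sees : Bool → State → Bool
sees true (o , i) = o
sees false (o , i) = i

ok : Bool → State → Bool
ok both (o , i) = both ∨ not (o ∧ i)

arity : Bool → ℕ
arity both = if both then 4 else 3

arity≢0 : ∀ both → NonZero (arity both)
arity≢0 true = _
arity≢0 false = _

Ok : Bool → State → Set
Ok both s = ok both s ≡ true

card-Ok : ∀ both → Card≤ (Ok both) (arity both)
card-Ok true = card-⊆ {Q = λ s → s ≡ (false , false) ⊎ s ≡ (false , true) ⊎ s ≡ (true , false) ⊎ s ≡ (true , true)}
  (λ { (false , false) _ → return (inj₁ refl) ; (false , true) _ → return (inj₂ (inj₁ refl))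
     ; (true , false) _ → return (inj₂ (inj₂ (inj₁ refl))) ; (true , true) _ → return (inj₂ (inj₂ (inj₂ refl))) })
  (card-⊎ {M = 1} only (card-⊎ {M = 1} only (card-⊎ {M = 1} {N = 1} only only)))
  where
  only : ∀ {a : State} → Card≤ (_≡ a) 1
  only = card-1 λ { _ _ refl refl → refl }
card-Ok false = card-⊆ {Q = λ s → s ≡ (false , false) ⊎ s ≡ (false , true) ⊎ s ≡ (true , false)}
  (λ { (false , false) _ → return (inj₁ refl) ; (false , true) _ → return (inj₂ (inj₁ refl))
     ; (true , false) _ → return (inj₂ (inj₂ refl)) ; (true , true) () })
  (card-⊎ {M = 1} only (card-⊎ {M = 1} {N = 1} only only))
  where
  only : ∀ {a : State} → Card≤ (_≡ a) 1
  only = card-1 λ { _ _ refl refl → refl }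

Inj : ∀ {s d} → Vec (Fin s) d → Set
Inj B = ∀ a b → lookup B a ≡ lookup B b → a ≡ b

inj-∷ : ∀ {s d} (B : Vec (Fin s) d) → Inj B → Inj (zero ∷ Vec.map suc B)
inj-∷ B inj zero zero e = refl
inj-∷ B inj zero (suc b) e rewrite Vecₚ.lookup-map b Fin.suc B = case e of λ ()
inj-∷ B inj (suc a) zero e rewrite Vecₚ.lookup-map a Fin.suc B = case e of λ ()
inj-∷ B inj (suc a) (suc b) e rewrite Vecₚ.lookup-map a Fin.suc B | Vecₚ.lookup-map b Fin.suc B = cong suc (inj a b (Finₚ.suc-injective e))

inj-map-suc : ∀ {s d} (B : Vec (Fin s) d) → Inj B → Inj (Vec.map Fin.suc B)
inj-map-suc B inj a b e rewrite Vecₚ.lookup-map a Fin.suc B | Vecₚ.lookup-map b Fin.suc B = inj a b (Finₚ.suc-injective e)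

choose : ∀ {n} d (b : Fin n → Bool) → d ≤ # b → Σ (Vec (Fin n) d) λ B → Inj B × ∀ a → b (lookup B a) ≡ true
choose zero b le = [] , (λ ()) , λ ()
choose {suc n} (suc d) b le with b zero in e
... | true with choose d (b ∘ suc) (s≤s⁻¹ le)
...   | B , inj , t = zero ∷ Vec.map suc B , inj-∷ B inj , λ { zero → e ; (suc a) → trans (cong b (Vecₚ.lookup-map a suc B)) (t a) }
choose {suc n} (suc d) b le | false with choose (suc d) (b ∘ suc) le
...   | B , inj , t = Vec.map suc B , inj-map-suc B inj , λ a → trans (cong b (Vecₚ.lookup-map a suc B)) (t a)

-- A sign asks for one arc and leaves the opposite one free, so a state with both arcs matches
-- either sign. This is what makes one definition serve oriented graphs and digraphs.
Matches : ∀ {s d} → Vec (Fin s) d → Vec Bool d → Vec State s → Set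
Matches B σ x = ∀ a → sees (lookup σ a) (lookup x (lookup B a)) ≡ true

Shatters : ∀ {s d} → (Vec State s → Set) → Vec (Fin s) d → Set
Shatters F B = Inj B × ∀ σ → ¬ ¬ ∃ λ x → F x × Matches B σ x

-- Over a fixed tail, the empty state and the first nonzero state that occurs are counted by
-- induction with the same `d`. If a further nonzero state occurs, the nonzero states over this tail
-- show both signs at the new coordinate, so such tails shatter no set of size `d - 1`; at most two
-- further states are possible.
sauer : ∀ s d (F : Vec State s → Set) → (∀ (B : Vec (Fin s) d) → ¬ Shatters F B) → Card≤ F (2 ^ s * (s + 1) ^ d)
sauer s zero F ns = card-∅ λ x f → ns [] ((λ ()) , λ _ → return (x , f , λ ()))
sauer zero (suc d) F ns = card-mono (≤-reflexive (sym (trans (+-identityʳ _) (^-zeroˡ (suc d))))) (card-1 λ { [] [] _ _ → refl })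
sauer (suc s) (suc d) F ns = card-mono numeric (card-⊆ cover
    (card-⊎ (sec (false , false) F₀ (sauer s (suc d) F₀ ns₀))
    (card-⊎ (card-inj {Q = A₁} Vec.tail first-inj (λ { (x ∷ y) (f , nz , _) k → k (_ , nz , f) }) (sauer s (suc d) A₁ nsA))
    (card-⊎ (sec (false , true) I (sauer s d I nsI)) (sec (true , true) I (sauer s d I nsI))))))
  where
  F₀ A₁ I : Vec State s → Set
  F₀ y = F ((false , false) ∷ y)
  A₁ y = ¬ ¬ ∃ λ x → x ≢ (false , false) × F (x ∷ y)
  U : Bool → Vec State s → Set
  U b y = ¬ ¬ ∃ λ x → sees b x ≡ true × F (x ∷ y)
  I y = U true y × U false y
  First : Vec State (suc s) → Set
  First (x ∷ y) = F (x ∷ y) × x ≢ (false , false) ×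
    ((x ≡ (true , false)) ⊎ (x ≡ (false , true) × ¬ F ((true , false) ∷ y)) ⊎
     (x ≡ (true , true) × ¬ F ((true , false) ∷ y) × ¬ F ((false , true) ∷ y)))
  sec : ∀ a G {M} → Card≤ G M → Card≤ (λ (v : Vec State (suc s)) → Vec.head v ≡ a × G (Vec.tail v)) M
  sec a G c = card-inj {Q = G} Vec.tail (λ { (_ ∷ _) (_ ∷ _) (refl , _) (refl , _) refl → refl }) (λ _ → proj₂) c
  first-inj : ∀ x y → First x → First y → Vec.tail x ≡ Vec.tail y → x ≡ y
  first-inj (x ∷ v) (y ∷ .v) (fx , _ , cx) (fy , _ , cy) refl = cong (_∷ v) (uniq cx cy fx fy)
    where
    uniq : ∀ {x y} →
      ((x ≡ (true , false)) ⊎ (x ≡ (false , true) × ¬ F ((true , false) ∷ v)) ⊎ (x ≡ (true , true) × ¬ F ((true , false) ∷ v) × ¬ F ((false , true) ∷ v))) →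
      ((y ≡ (true , false)) ⊎ (y ≡ (false , true) × ¬ F ((true , false) ∷ v)) ⊎ (y ≡ (true , true) × ¬ F ((true , false) ∷ v) × ¬ F ((false , true) ∷ v))) →
      F (x ∷ v) → F (y ∷ v) → x ≡ y
    uniq (inj₁ refl) (inj₁ refl) _ _ = refl
    uniq (inj₁ refl) (inj₂ (inj₁ (_ , n))) fx _ = ⊥-elim (n fx)
    uniq (inj₁ refl) (inj₂ (inj₂ (_ , n , _))) fx _ = ⊥-elim (n fx)
    uniq (inj₂ (inj₁ (refl , n))) (inj₁ refl) _ fy = ⊥-elim (n fy)
    uniq (inj₂ (inj₁ (refl , _))) (inj₂ (inj₁ (refl , _))) _ _ = refl
    uniq (inj₂ (inj₁ (refl , _))) (inj₂ (inj₂ (_ , _ , n))) fx _ = ⊥-elim (n fx)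
    uniq (inj₂ (inj₂ (refl , n , _))) (inj₁ refl) _ fy = ⊥-elim (n fy)
    uniq (inj₂ (inj₂ (refl , _ , n))) (inj₂ (inj₁ (refl , _))) _ fy = ⊥-elim (n fy)
    uniq (inj₂ (inj₂ (refl , _))) (inj₂ (inj₂ (refl , _))) _ _ = refl
  cover : ∀ v → F v → ¬ ¬ ((Vec.head v ≡ (false , false) × F₀ (Vec.tail v)) ⊎ First v ⊎
    (Vec.head v ≡ (false , true) × I (Vec.tail v)) ⊎ (Vec.head v ≡ (true , true) × I (Vec.tail v)))
  cover ((false , false) ∷ y) f = return (inj₁ (refl , f))
  cover ((true , false) ∷ y) f = return (inj₂ (inj₁ (f , (λ ()) , inj₁ refl)))
  cover ((false , true) ∷ y) f = lem {F ((true , false) ∷ y)} >>= λ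
    { (yes g) → return (inj₂ (inj₂ (inj₁ (refl , (return (_ , refl , g)) , (return (_ , refl , f))))))
    ; (no n) → return (inj₂ (inj₁ (f , (λ ()) , inj₂ (inj₁ (refl , n))))) }
  cover ((true , true) ∷ y) f = lem {F ((true , false) ∷ y)} >>= λ
    { (yes g) → return (inj₂ (inj₂ (inj₂ (refl , (return (_ , refl , f)) , (return (_ , refl , f))))))
    ; (no n) → lem {F ((false , true) ∷ y)} >>= λ
      { (yes g) → return (inj₂ (inj₂ (inj₂ (refl , (return (_ , refl , f)) , (return (_ , refl , f))))))
      ; (no n′) → return (inj₂ (inj₁ (f , (λ ()) , inj₂ (inj₂ (refl , n , n′))))) } }
  lift : ∀ {e} (B : Vec (Fin s) e) σ x y → Matches B σ y → Matches (Vec.map suc B) σ (x ∷ y)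
  lift B σ x y mt a rewrite Vecₚ.lookup-map a Fin.suc B = mt a
  ns₀ : ∀ B → ¬ Shatters F₀ B
  ns₀ B (inj , sh) = ns (Vec.map suc B) (inj-map-suc B inj , λ σ → sh σ >>= λ { (y , f , mt) → return (_ , f , lift B σ _ y mt) })
  nsA : ∀ B → ¬ Shatters A₁ B
  nsA B (inj , sh) = ns (Vec.map suc B) (inj-map-suc B inj , λ σ → sh σ >>= λ { (y , a , mt) → a >>= λ { (x , _ , f) → return (_ , f , lift B σ x y mt) } })
  nsI : ∀ (B : Vec (Fin s) d) → ¬ Shatters I B
  nsI B (inj , sh) = ns (zero ∷ Vec.map suc B) (inj-∷ B inj ,
    λ { (b ∷ σ) → sh σ >>= λ { (y , i , mt) → u b i >>= λ { (x , e , f) → return (_ , f , λ { zero → e ; (suc a) → lift B σ x y mt a }) } } })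
    where
    u : ∀ b {y} → I y → U b y
    u true = proj₁
    u false = proj₂
  numeric : let X = 2 ^ s * (s + 1) ^ suc d; Y = 2 ^ s * (s + 1) ^ d in X + (X + (Y + Y)) ≤ 2 ^ suc s * (suc s + 1) ^ suc d
  numeric = begin
    2 ^ s * ((s + 1) * Z) + (2 ^ s * ((s + 1) * Z) + (2 ^ s * Z + 2 ^ s * Z)) ≡⟨ r (2 ^ s) s Z ⟩
    2 * 2 ^ s * ((suc s + 1) * Z) ≤⟨ *-monoʳ-≤ (2 * 2 ^ s) (*-monoʳ-≤ (suc s + 1) (^-monoˡ-≤ d (n≤1+n (s + 1)))) ⟩
    2 ^ suc s * (suc s + 1) ^ suc d ∎
    where
    open ≤-Reasoning
    Z = (s + 1) ^ d
    r : ∀ P s Z → P * ((s + 1) * Z) + (P * ((s + 1) * Z) + (P * Z + P * Z)) ≡ 2 * P * ((1 + s + 1) * Z)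
    r = solve-∀

card-Kind : Card≤ {A = Kind} (λ _ → ⊤) 4
card-Kind = card-⊆ {Q = λ κ → κ ≡ non ⊎ κ ≡ dbl ⊎ κ ≡ sg true ⊎ κ ≡ sg false}
  (λ { non _ → return (inj₁ refl) ; dbl _ → return (inj₂ (inj₁ refl))
     ; (sg true) _ → return (inj₂ (inj₂ (inj₁ refl))) ; (sg false) _ → return (inj₂ (inj₂ (inj₂ refl))) })
  (card-⊎ {M = 1} only (card-⊎ {M = 1} only (card-⊎ {M = 1} {N = 1} only only)))
  where
  only : ∀ {a : Kind} → Card≤ (_≡ a) 1
  only = card-1 λ { _ _ refl refl → refl }

card-All : ∀ {A : Set} {n M} → Card≤ {A = A} (λ _ → ⊤) M → Card≤ {A = Vec A n} (λ _ → ⊤) (M ^ n)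
card-All {n = n} c = card-⊆ (λ _ _ → return λ _ → tt) (card-Vec n c)

nonzero : State → Bool
nonzero (o , i) = o ∨ i

Sparse : ∀ {s} → ℕ → Vec State s → Set
Sparse j = Few (λ _ x → x ≡ (false , false)) (Ok true) (λ _ → true) j

card-Sparse : ∀ {s} j → Card≤ (Sparse {s} j) ((1 + 4 * s) ^ j)
card-Sparse {s} j = card-mono (≤-trans (countFew-poly {s} (λ _ → 1) 4 (λ _ → true) j λ _ → ≤-refl)
    (≤-reflexive (trans (cong (_* (1 + 4 * s) ^ j) (trans (prodF-const s 1) (^-zeroˡ s))) (*-identityˡ _))))
  (card-few (λ _ → true) j (λ _ → card-1 λ { _ _ refl refl → refl }) (card-Ok true))

#-nonzero : ∀ {s} (x : Vec State s) → # (nonzero ∘ lookup x) ≤ # (sees true ∘ lookup x) + # (sees false ∘ lookup x)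
#-nonzero x = ≤-trans (sumF-mono λ i → pt (lookup x i)) (≤-reflexive (sumF-+ (𝟙 ∘ sees true ∘ lookup x) (𝟙 ∘ sees false ∘ lookup x)))
  where
  pt : ∀ s → 𝟙 (nonzero s) ≤ 𝟙 (sees true s) + 𝟙 (sees false s)
  pt (false , i) = ≤-refl
  pt (true , i) = s≤s z≤n

sparse-intro : ∀ {s} (x : Vec State s) j → # (nonzero ∘ lookup x) ≤ j → Sparse j x
sparse-intro x j le = few-intro (λ _ → nonzero) x j (λ i → z (lookup x i)) (λ i _ → refl , refl) le
  where
  z : ∀ s → nonzero s ≡ false → s ≡ (false , false)
  z (false , false) _ = refl

module MultiSauer (both : Bool) (s d : ℕ) (d≤s : d ≤ s) where

  q = arity both

  q≢0 : NonZero q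
  q≢0 = arity≢0 both

  Row : ℕ → Set
  Row r = Vec (Vec State s) r

  -- The rows that remain once one part is dealt with. In the double case the whole fibre over `y`
  -- has to shatter `B`, so that any signs on `B` can still be prescribed after `y` is chosen.
  Tail : Kind → Vec (Fin s) d → ∀ {r} → (Row (suc r) → Set) → Row r → Set
  Tail dbl B F y = ∀ σ → ¬ ¬ ∃ λ x → F (x ∷ y) × Matches B σ x
  Tail (sg b) B F y = ¬ ¬ ∃ λ x → F (x ∷ y) × Matches B (Vec.replicate d b) x
  Tail non B F y = ¬ ¬ ∃ λ x → F (x ∷ y)

  Realises : ∀ {r} → (Row r → Set) → Vec Kind r → Vec (Vec (Fin s) d) r → Set
  Realises F [] [] = ¬ ¬ F []
  Realises F (κ ∷ w) (B ∷ Bs) = Inj B × Realises (Tail κ B F) w Bs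

  cost : Kind → ℕ
  cost non = 1
  cost (sg _) = 2 ^ s
  cost dbl = q ^ s

  cost≢0 : ∀ κ → NonZero (cost κ)
  cost≢0 non = _
  cost≢0 (sg _) = m^n≢0 2 s
  cost≢0 dbl = m^n≢0 q s ⦃ q≢0 ⦄

  costOf : ∀ {r} → Vec Kind r → ℕ
  costOf [] = 1
  costOf (κ ∷ w) = cost κ * costOf w

  fud K : ℕ
  fud = (1 + 4 * s) ^ (2 * d)
  K = 4 * (s ^ d * fud)

  1≤fud : 1 ≤ fud
  1≤fud = >-nonZero⁻¹ fud ⦃ m^n≢0 (1 + 4 * s) (2 * d) ⦄

  B₀ : Vec (Fin s) d
  B₀ = Vec.tabulate (λ i → Fin.inject≤ i d≤s)

  inj-B₀ : Inj B₀
  inj-B₀ a b e = Finₚ.inject≤-injective d≤s d≤s a b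
    (trans (sym (Vecₚ.lookup∘tabulate (λ i → Fin.inject≤ i d≤s) a)) (trans e (Vecₚ.lookup∘tabulate (λ i → Fin.inject≤ i d≤s) b)))

  Entry : Kind → Vec (Fin s) d → ∀ {r} → (Row (suc r) → Set) → Row (suc r) → Set
  Entry dbl B F (x ∷ y) = F (x ∷ y) × Tail dbl B F y
  Entry (sg b) B F (x ∷ y) = F (x ∷ y) × (∀ (B′ : Vec (Fin s) d) → ¬ Shatters (λ x → F (x ∷ y)) B′) × Matches B (Vec.replicate d b) x
  Entry non B F (x ∷ y) = F (x ∷ y) × Sparse (2 * d) x

  entry-tail : ∀ κ B {r} (F : Row (suc r) → Set) x y → Entry κ B F (x ∷ y) → Tail κ B F y
  entry-tail dbl B F x y (f , t) = t
  entry-tail (sg b) B F x y (f , _ , mt) = return (x , f , mt)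
  entry-tail non B F x y (f , _) = return (x , f)

  matches-rep : ∀ b (B : Vec (Fin s) d) x → (∀ a → sees b (lookup x (lookup B a)) ≡ true) → Matches B (Vec.replicate d b) x
  matches-rep b B x h a rewrite Vecₚ.lookup-replicate a b = h a

  classify : ∀ {r} (F : Row (suc r) → Set) ρ → F ρ → ¬ ¬ ∃ λ κ → ∃ λ B → Inj B × Entry κ B F ρ
  classify F (x ∷ y) f = lem {∃ λ (B : Vec (Fin s) d) → Shatters (λ x → F (x ∷ y)) B} >>= λ
    { (yes (B , inj , sh)) → return (dbl , B , inj , f , sh)
    ; (no ns) → return (signs ns) }
    where
    signs : ¬ (∃ λ (B : Vec (Fin s) d) → Shatters (λ x → F (x ∷ y)) B) → ∃ λ κ → ∃ λ B → Inj B × Entry κ B F (x ∷ y)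
    signs ns with d ≤? # (sees true ∘ lookup x) | d ≤? # (sees false ∘ lookup x)
    ... | yes le | _ = let B , inj , h = choose d (sees true ∘ lookup x) le in sg true , B , inj , f , (λ B′ sh → ns (B′ , sh)) , matches-rep true B x h
    ... | no _ | yes le = let B , inj , h = choose d (sees false ∘ lookup x) le in sg false , B , inj , f , (λ B′ sh → ns (B′ , sh)) , matches-rep false B x h
    ... | no n₁ | no n₂ = non , B₀ , inj-B₀ , f , sparse-intro x (2 * d) (≤-trans (#-nonzero x)
          (≤-trans (+-mono-≤ (≰⇒≥ n₁) (≰⇒≥ n₂)) (≤-reflexive (cong (d +_) (sym (+-identityʳ d))))))

  AllOk : ∀ {r} → Row r → Set
  AllOk ρ = ∀ i a → Ok both (lookup (lookup ρ i) a)

  card-entry : ∀ κ B {r} (F : Row (suc r) → Set) → (∀ ρ → F ρ → AllOk ρ) → ∀ y → Card≤ (λ x → Entry κ B F (x ∷ y)) (fud * cost κ)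
  card-entry dbl B F F-ok y = card-mono (m≤n*m (q ^ s) fud ⦃ >-nonZero 1≤fud ⦄) (card-⊆ (λ x e → return λ a → F-ok (x ∷ y) (proj₁ e) zero a) (card-Vec s (card-Ok both)))
  card-entry (sg b) B F F-ok y = card-rep λ { _ (_ , ns , _) →
    card-mono (≤-trans (≤-reflexive (*-comm (2 ^ s) _)) (*-monoˡ-≤ (2 ^ s)
       (≤-trans (^-monoˡ-≤ d (≤-trans (≤-reflexive (+-comm s 1)) (+-monoʳ-≤ 1 (m≤n*m s 4)))) (^-monoʳ-≤ (1 + 4 * s) (m≤n*m d 2)))))
      (card-⊆ (λ x e → return (proj₁ e)) (sauer s d (λ x → F (x ∷ y)) ns)) }
  card-entry non B F F-ok y = card-mono (≤-reflexive (sym (*-identityʳ fud))) (card-⊆ (λ x e → return (proj₂ e)) (card-Sparse (2 * d)))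

  -- Rows are sorted by the kind and the set `B` found at the first part. Over a fixed tail at most
  -- `fud * cost κ` entries are possible, by `sauer` in the single case, and the tails satisfy the
  -- hypothesis with the budget `M / cost κ`. The four kinds, the `s ^ d` sets and `fud` make up the
  -- factor `K` for each part.
  multi-sauer : ∀ r (F : Row r → Set) M → (∀ ρ → F ρ → AllOk ρ) → (∀ w Bs → Realises F w Bs → costOf w ≤ M) → Card≤ F (K ^ r * M)
  multi-sauer zero F M F-ok h = card-rep λ { [] f → card-mono (≤-trans (h [] [] (return f)) (≤-reflexive (sym (*-identityˡ M)))) (card-1 λ { [] [] _ _ → refl }) }
  multi-sauer (suc r) F M F-ok h = card-mono (≤-reflexive (e (s ^ d) fud (K ^ r) M))
    (card-bind {R = λ κ ρ → ∃ λ B → Inj B × Entry κ B F ρ} card-Kind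
      (λ κ _ → card-bind {R = λ B ρ → Inj B × Entry κ B F ρ} (card-All (card-fin {s}))
        (λ B _ → card-mono (bound κ) (card-rep λ { ρ (inj , _) →
            card-bind {R = λ y ρ → Vec.tail ρ ≡ y × Entry κ B F ρ} (multi-sauer r (Tail κ B F) (_/_ M (cost κ) ⦃ cost≢0 κ ⦄) (tail-ok κ B)
                (λ w Bs re → /-mono κ (h (κ ∷ w) (B ∷ Bs) (inj , re))))
              (λ y _ → card-inj {Q = λ x → Entry κ B F (x ∷ y)} Vec.head (λ { (_ ∷ _) (_ ∷ _) (refl , _) (refl , _) refl → refl })
                 (λ { (_ ∷ _) (refl , e) → e }) (card-entry κ B F F-ok y))
              (λ { (x ∷ y) (_ , e) → return (y , entry-tail κ B F x y e , refl , e) }) }))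
        (λ ρ (B , i , e) → return (B , tt , i , e)))
      (λ ρ f → classify F ρ f >>= λ { (κ , r) → return (κ , tt , r) }))
    where
    e : ∀ a b c M → 4 * (a * (b * (c * M))) ≡ 4 * (a * b) * c * M
    e = solve-∀
    bound : ∀ κ → K ^ r * (_/_ M (cost κ) ⦃ cost≢0 κ ⦄) * (fud * cost κ) ≤ fud * (K ^ r * M)
    bound κ = ≤-trans (≤-reflexive (e′ (K ^ r) (_/_ M (cost κ) ⦃ cost≢0 κ ⦄) fud (cost κ))) (*-monoʳ-≤ fud (*-monoʳ-≤ (K ^ r) (m/n*n≤m M (cost κ) ⦃ cost≢0 κ ⦄)))
      where
      e′ : ∀ a b c d → a * b * (c * d) ≡ c * (a * (b * d))
      e′ = solve-∀
    /-mono : ∀ κ {x} → cost κ * x ≤ M → x ≤ _/_ M (cost κ) ⦃ cost≢0 κ ⦄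
    /-mono κ {x} le = subst (_≤ _/_ M (cost κ) ⦃ cost≢0 κ ⦄) (m*n/n≡m x (cost κ) ⦃ cost≢0 κ ⦄)
      (/-monoˡ-≤ (cost κ) ⦃ cost≢0 κ ⦄ (≤-trans (≤-reflexive (*-comm x (cost κ))) le))
    tail-ok : ∀ κ B y → Tail κ B F y → AllOk y
    tail-ok κ B y t i a = bool-stable (ex κ t >>= λ { (x , f) → return (F-ok (x ∷ y) f (suc i) a) })
      where
      ex : ∀ κ → Tail κ B F y → ¬ ¬ ∃ λ x → F (x ∷ y)
      ex dbl t = t (Vec.replicate d true) >>= λ { (x , f , _) → return (x , f) }
      ex (sg _) t = t >>= λ { (x , f , _) → return (x , f) }
      ex non t = t

  Meets : Kind → Vec (Fin s) d → Vec Bool d → Vec State s → Set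
  Meets non B σ x = ⊤
  Meets (sg b) B σ x = Matches B (Vec.replicate d b) x
  Meets dbl B σ x = Matches B σ x

  -- The entries are chosen from the last part back to the first, since membership in `Tail` is what
  -- guarantees the next choice. Hence the signs at different double parts can be prescribed
  -- independently and realised by one row.
  realises-use : ∀ {r} (F : Row r → Set) w Bs → Realises F w Bs → ∀ (σ : Fin r → Vec Bool d) →
    ¬ ¬ ∃ λ ρ → F ρ × ∀ i → Meets (lookup w i) (lookup Bs i) (σ i) (lookup ρ i)
  realises-use F [] [] re σ = re >>= λ f → return ([] , f , λ ())
  realises-use F (κ ∷ w) (B ∷ Bs) (_ , re) σ = realises-use (Tail κ B F) w Bs re (σ ∘ suc) >>= λ { (y , t , mt) →
      ex κ t >>= λ { (x , f , mt₀) → return (x ∷ y , f , λ { zero → mt₀ ; (suc i) → mt i }) } }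
    where
    ex : ∀ κ {y} → Tail κ B F y → ¬ ¬ ∃ λ x → F (x ∷ y) × Meets κ B (σ zero) x
    ex dbl t = t (σ zero)
    ex (sg _) t = t
    ex non t = t >>= λ { (x , f) → return (x , f , tt) }

  realises-inj : ∀ {r} (F : Row r → Set) w Bs → Realises F w Bs → ∀ i → Inj (lookup Bs i)
  realises-inj F (κ ∷ w) (B ∷ Bs) (inj , _) zero = inj
  realises-inj F (κ ∷ w) (B ∷ Bs) (_ , re) (suc i) = realises-inj _ w Bs re i

-- Chains (lists that induce a transitive tournament) and their embedding into rich parts

st : ∀ {n} → Graph n → Fin n → Fin n → State
st G x y = adj G x y , adj G y x

IsClass : Bool → ∀ {n} → Graph n → Set
IsClass both G = IsDigraph G × (∀ i j → Ok both (st G i j))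

Free : Bool → ℕ → ∀ {n} → Graph n → Set
Free both k G = IsClass both G × TTFree k G

Arc : ∀ {n} → Graph n → Fin n → Fin n → Set
Arc G x y = adj G x y ≡ true

AllPairs-lookup : ∀ {A : Set} {R : A → A → Set} {xs} → AllPairs R xs → ∀ i j → i Fin.< j → R (List.lookup xs i) (List.lookup xs j)
AllPairs-lookup (r ∷ _) zero (suc j) _ = All.lookup r (∈-lookup′ j)
  where
  ∈-lookup′ : ∀ {A : Set} {xs : List A} i → List.lookup xs i ∈ xs
  ∈-lookup′ {xs = x ∷ xs} zero = here refl
  ∈-lookup′ {xs = x ∷ xs} (suc i) = there (∈-lookup′ i)
AllPairs-lookup (_ ∷ ap) (suc i) (suc j) (s≤s lt) = AllPairs-lookup ap i j lt

noChain : ∀ both {k n} (G : Graph n) → Free both k G → ∀ {xs} → AllPairs (Arc G) xs → length xs ≤ k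
noChain both {k} {n} G ((loopless , _) , free) {xs} ch = ≮⇒≥ λ lt → free (subst CT (trans (Listₚ.length-take (suc k) xs) (m≤n⇒m⊓n≡m lt)) (ct (AllPairsₚ.take⁺ (suc k) ch)))
  where
  CT : ℕ → Set
  CT m = Σ (Fin m → Fin n) λ f → (∀ {x y} → f x ≡ f y → x ≡ y) × (∀ i j → i Fin.< j → adj G (f i) (f j) ≡ true)
  ct : ∀ {xs} → AllPairs (Arc G) xs → CT (length xs)
  ct {xs} ap = List.lookup xs , inj , AllPairs-lookup ap
    where
    loop : ∀ {x y} → x ≡ y → Arc G x y → ⊥
    loop {x} refl e = case trans (sym e) (loopless x) of λ ()
    inj : ∀ {x y} → List.lookup xs x ≡ List.lookup xs y → x ≡ y
    inj {x} {y} e with Finₚ.<-cmp x y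
    ... | tri< lt _ _ = ⊥-elim (loop e (AllPairs-lookup ap x y lt))
    ... | tri≈ _ eq _ = eq
    ... | tri> _ _ gt = ⊥-elim (loop (sym e) (AllPairs-lookup ap y x gt))

outs : ∀ {n} → Graph n → Fin n → List (Fin n) → List (Fin n)
outs G x Y = filter (λ y → adj G x y ≟ᵇ true) Y

-- A weak form of density for sets of size at least `t`: one vertex of `X` with out-neighbours in a
-- `1 / C` proportion of `Y` is all that a greedy embedding asks for.
Rich : ∀ {n} → Graph n → ℕ → ℕ → (Fin n → Set) → (Fin n → Set) → Set
Rich G t C P Q = ∀ X Y → Unique X → Unique Y → All P X → All Q Y → t ≤ length X → t ≤ length Y →
  ¬ ¬ ∃ λ x → x ∈ X × length Y ≤ C * length (outs G x Y)

module Embedding {n : ℕ} (G : Graph n) {I : Set} (Pt : I → Fin n → Set) (t C : ℕ) .⦃ _ : NonZero t ⦄ .⦃ _ : NonZero C ⦄ where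

  -- For each `j` at most `t` vertices of `X` have too few out-neighbours in `A j`, as richness
  -- would otherwise apply to them. A set of size `suc (length L) * t` survives the removal of all
  -- of these.
  goodVertex : ∀ i (A : I → List (Fin n)) L → All (λ j → Rich G t C (Pt i) (Pt j)) L →
    All (λ j → Unique (A j) × All (Pt j) (A j) × t ≤ length (A j)) L →
    ∀ X → Unique X → All (Pt i) X → suc (length L) * t ≤ length X →
    ¬ ¬ ∃ λ x → x ∈ X × All (λ j → length (A j) ≤ C * length (outs G x (A j))) L
  goodVertex i A [] _ _ [] u p le = ⊥-elim (≢-nonZero⁻¹ t (m+n≡0⇒m≡0 t (n≤0⇒n≡0 le)))
  goodVertex i A [] _ _ (x ∷ X) u p le = return (x , here refl , [])
  goodVertex i A (j ∷ L) (rich ∷ riches) ((uA , pA , tA) ∷ as) X u p le =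
    goodVertex i A L riches as X₁ (Uniqueₚ.filter⁺ good? u) (Allₚ.filter⁺ good? p) enough >>= λ { (x , x∈ , gs) →
      let x∈X , g = ∈-filter⁻ good? x∈ in return (x , x∈X , g ∷ gs) }
    where
    good? : ∀ x → Dec (length (A j) ≤ C * length (outs G x (A j)))
    good? x = length (A j) ≤? C * length (outs G x (A j))
    X₁ = filter good? X
    X₂ = filter (¬? ∘ good?) X
    few : length X₂ ≤ t
    few = ≮⇒≥ λ lt → rich X₂ (A j) (Uniqueₚ.filter⁺ (¬? ∘ good?) u) uA (Allₚ.filter⁺ (¬? ∘ good?) p) pA (<⇒≤ lt) tA
      λ { (x , x∈ , g) → proj₂ (∈-filter⁻ (¬? ∘ good?) {xs = X} x∈) g }
    enough : suc (length L) * t ≤ length X₁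
    enough = +-cancelʳ-≤ t _ _ (≤-trans (≤-trans (≤-reflexive (+-comm _ t)) le)
      (≤-trans (≤-reflexive (sym (length-partition good? X))) (+-monoʳ-≤ (length X₁) few)))

  -- `l * t` vertices are needed to make a choice, and each of the at most `l` earlier choices may
  -- shrink a list by the factor `C`.
  threshold : ℕ → ℕ
  threshold l = l * t * C ^ l

  embed : ∀ L → AllPairs (λ i j → Rich G t C (Pt i) (Pt j)) L → (A : I → List (Fin n)) →
    All (λ i → Unique (A i) × All (Pt i) (A i) × threshold (length L) ≤ length (A i)) L →
    ¬ ¬ ∃ λ xs → Pointwise (λ i x → x ∈ A i) L xs × AllPairs (Arc G) xs
  embed [] _ A _ = return ([] , [] , [])
  embed (i ∷ L) (rich ∷ riches) A ((uA , pA , tA) ∷ as) =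
    goodVertex i A L rich (All.map (λ (u , p , le) → u , p , ≤-trans t≤ le) as) (A i) uA pA (≤-trans st≤ tA) >>= λ { (x , x∈ , gs) →
    embed L riches (λ j → outs G x (A j)) (All.zipWith (λ { {j} ((u , p , le) , g) →
        Uniqueₚ.filter⁺ _ u , Allₚ.filter⁺ _ p , shrink (≤-trans le g) }) (as , gs)) >>= λ { (xs , pw , ch) →
    return (x ∷ xs , x∈ ∷ Pw.map (λ {j} m → proj₁ (∈-filter⁻ (λ y → adj G x y ≟ᵇ true) {xs = A j} m)) pw , arcs pw ∷ ch) } }
    where
    l = length L
    st≤ : suc l * t ≤ threshold (suc l)
    st≤ = m≤m*n (suc l * t) (C ^ suc l) ⦃ m^n≢0 C (suc l) ⦄
    t≤ : t ≤ threshold (suc l)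
    t≤ = ≤-trans (m≤m+n t (l * t)) st≤
    shrink : ∀ {y} → threshold (suc l) ≤ C * y → threshold l ≤ y
    shrink {y} le = *-cancelˡ-≤ C (≤-trans (≤-trans (≤-reflexive (e C l t (C ^ l))) (*-monoˡ-≤ (C ^ suc l) (*-monoˡ-≤ t (n≤1+n l)))) le)
      where
      e : ∀ C l t X → C * (l * t * X) ≡ l * t * (C * X)
      e = solve-∀
    arcs : ∀ {x L xs} → Pointwise (λ i y → y ∈ outs G x (A i)) L xs → All (Arc G x) xs
    arcs [] = []
    arcs {x} {i ∷ _} (m ∷ pw) = proj₂ (∈-filter⁻ (λ y → adj G x y ≟ᵇ true) {xs = A i} m) ∷ arcs pw

  threshold-mono : ∀ {l l′} → l ≤ l′ → threshold l ≤ threshold l′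
  threshold-mono le = *-mono-≤ (*-monoˡ-≤ t le) (^-monoʳ-≤ C le)

AllPairs-insert : ∀ {A : Set} {R : A → A → Set} xs {ys v} → AllPairs R (xs ++ ys) → All (λ x → R x v) xs → All (R v) ys → AllPairs R (xs ++ v ∷ ys)
AllPairs-insert [] ap _ b = b ∷ ap
AllPairs-insert (x ∷ xs) (r ∷ ap) (a ∷ as) b =
  Allₚ.++⁺ (Allₚ.++⁻ˡ xs r) (a ∷ Allₚ.++⁻ʳ xs r) ∷ AllPairs-insert xs ap as b

Pointwise-split : ∀ {A B : Set} {R : A → B → Set} L₁ {L₂ xs} → Pointwise R (L₁ ++ L₂) xs →
  Σ (List B) λ xs₁ → Σ (List B) λ xs₂ → xs ≡ xs₁ ++ xs₂ × Pointwise R L₁ xs₁ × Pointwise R L₂ xs₂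
Pointwise-split [] pw = [] , _ , refl , [] , pw
Pointwise-split (i ∷ L₁) (r ∷ pw) with Pointwise-split L₁ pw
... | xs₁ , xs₂ , refl , pw₁ , pw₂ = _ ∷ xs₁ , xs₂ , refl , r ∷ pw₁ , pw₂

Pointwise-All : ∀ {A B : Set} {R : A → B → Set} {P : A → Set} {Q : B → Set} {L xs} →
  (∀ {i x} → P i → R i x → Q x) → All P L → Pointwise R L xs → All Q xs
Pointwise-All f [] [] = []
Pointwise-All f (p ∷ ps) (r ∷ pw) = f p r ∷ Pointwise-All f ps pw

module Parts {both : Bool} {k′ n : ℕ} (G : Graph n) (free : Free both (suc k′) G) (Pt : Fin (suc k′) → Fin n → Set) (t C : ℕ)
  .⦃ _ : NonZero t ⦄ .⦃ _ : NonZero C ⦄ (rich : ∀ i j → i ≢ j → Rich G t C (Pt i) (Pt j)) where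

  open Embedding G Pt t C

  k = suc k′

  θ : ℕ
  θ = threshold (suc k)

  Fits : (Fin k → List (Fin n)) → Set
  Fits Y = ∀ i → Unique (Y i) × All (Pt i) (Y i)

  -- Otherwise every part has a long list on at least one side. A chain with one vertex from each
  -- part can be embedded with the parts using in-neighbours ahead of those using out-neighbours,
  -- and inserting `v` between the two groups gives `k + 1` vertices.
  few-in-some-part : ∀ v (Y⁺ Y⁻ : Fin k → List (Fin n)) → Fits Y⁺ → Fits Y⁻ →
    (∀ i → All (Arc G v) (Y⁺ i)) → (∀ i → All (λ y → Arc G y v) (Y⁻ i)) →
    ¬ ¬ ∃ λ i → length (Y⁺ i) < θ × length (Y⁻ i) < θ
  few-in-some-part v Y⁺ Y⁻ fit⁺ fit⁻ arc⁺ arc⁻ none = emb λ { (xs , pw , ch) → contra xs pw ch }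
    where
    sgn : ∀ i → Dec (θ ≤ length (Y⁺ i))
    sgn i = θ ≤? length (Y⁺ i)
    A : Fin k → List (Fin n)
    A i with sgn i
    ... | yes _ = Y⁺ i
    ... | no _ = Y⁻ i
    L⁻ = filter (¬? ∘ sgn) (List.allFin k)
    L⁺ = filter sgn (List.allFin k)
    lenL : length (L⁻ ++ L⁺) ≡ k
    lenL = trans (Listₚ.length-++ L⁻) (trans (+-comm (length L⁻) _) (trans (length-partition sgn (List.allFin k)) (Listₚ.length-tabulate id)))
    fitA : ∀ i → Unique (A i) × All (Pt i) (A i) × θ ≤ length (A i)
    fitA i with sgn i
    ... | yes le = proj₁ (fit⁺ i) , proj₂ (fit⁺ i) , le
    ... | no nle = proj₁ (fit⁻ i) , proj₂ (fit⁻ i) , ≮⇒≥ λ lt → none (i , ≰⇒> nle , lt)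
    uall = Uniqueₚ.allFin⁺ k
    distinct : Unique (L⁻ ++ L⁺)
    distinct = Uniqueₚ.++⁺ (Uniqueₚ.filter⁺ (¬? ∘ sgn) uall) (Uniqueₚ.filter⁺ sgn uall)
      λ { (a , b) → proj₂ (∈-filter⁻ (¬? ∘ sgn) {xs = List.allFin k} a) (proj₂ (∈-filter⁻ sgn {xs = List.allFin k} b)) }
    emb = embed (L⁻ ++ L⁺) (AllPairs.map (λ {i} {j} → rich i j) distinct) A
      (All.tabulate λ {i} _ → let u , p , le = fitA i in u , p , ≤-trans (threshold-mono (≤-trans (≤-reflexive lenL) (n≤1+n k))) le)
    contra : ∀ xs → Pointwise (λ i x → x ∈ A i) (L⁻ ++ L⁺) xs → AllPairs (Arc G) xs → ⊥
    contra xs pw ch with Pointwise-split L⁻ pw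
    ... | xs₁ , xs₂ , refl , pw₁ , pw₂ = <-irrefl refl (≤-trans (≤-reflexive len) (noChain both G free
        (AllPairs-insert xs₁ ch (Pointwise-All in⁻ (Allₚ.all-filter (¬? ∘ sgn) (List.allFin k)) pw₁) (Pointwise-All in⁺ (Allₚ.all-filter sgn (List.allFin k)) pw₂))))
      where
      in⁻ : ∀ {i x} → ¬ (θ ≤ length (Y⁺ i)) → x ∈ A i → Arc G x v
      in⁻ {i} n x∈ with sgn i
      ... | yes le = ⊥-elim (n le)
      ... | no _ = All.lookup (arc⁻ i) x∈
      in⁺ : ∀ {i x} → θ ≤ length (Y⁺ i) → x ∈ A i → Arc G v x
      in⁺ {i} le x∈ with sgn i
      ... | yes _ = All.lookup (arc⁺ i) x∈
      ... | no n = ⊥-elim (n le)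
      len : suc k ≡ length (xs₁ ++ v ∷ xs₂)
      len = sym (trans (Listₚ.length-++ xs₁) (trans (+-suc (length xs₁) _) (cong suc (trans (sym (Listₚ.length-++ xs₁)) (trans (sym (Pw.Pointwise-length pw)) lenL)))))

  -- Otherwise a chain through the common out-neighbours in the `k - 1` parts other than `i` exists,
  -- and `u`, `v` in front of it make `k + 1` vertices.
  few-common-outs : ∀ u v → Arc G u v → ∀ i (Y : Fin k → List (Fin n)) → Fits Y →
    (∀ j → All (λ y → Arc G u y × Arc G v y) (Y j)) → ¬ ¬ ∃ λ j → j ≢ i × length (Y j) < θ
  few-common-outs u v uv i Y fit arcs none = emb λ { (xs , pw , ch) → <-irrefl refl (≤-trans (≤-reflexive (len pw)) (noChain both G free
      ((uv ∷ Pointwise-All (λ {j} _ m → proj₁ (All.lookup (arcs j) m)) (trivial L) pw) ∷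
       Pointwise-All (λ {j} _ m → proj₂ (All.lookup (arcs j) m)) (trivial L) pw ∷ ch))) }
    where
    L = map (Fin.punchIn i) (List.allFin k′)
    trivial : ∀ (L : List (Fin k)) → All (λ _ → ⊤) L
    trivial L = All.universal (λ _ → tt) L
    lenL : length L ≡ k′
    lenL = trans (Listₚ.length-map _ (List.allFin k′)) (Listₚ.length-tabulate id)
    distinct : Unique L
    distinct = Uniqueₚ.map⁺ (λ {x} {y} → Finₚ.punchIn-injective i x y) (Uniqueₚ.allFin⁺ k′)
    len : ∀ {xs} → Pointwise (λ j x → x ∈ Y j) L xs → suc k ≡ 2 + length xs
    len pw = cong (2 +_) (trans (sym lenL) (Pw.Pointwise-length pw))
    emb = embed L (AllPairs.map (λ {a} {b} → rich a b) distinct) Y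
      (Allₚ.map⁺ (All.tabulate λ {a} _ → proj₁ (fit (Fin.punchIn i a)) , proj₂ (fit (Fin.punchIn i a)) ,
        ≤-trans (threshold-mono (≤-trans (≤-reflexive lenL) (≤-trans (n≤1+n k′) (n≤1+n k)))) (≮⇒≥ λ lt → none (Fin.punchIn i a , Finₚ.punchInᵢ≢i i a , lt))))

∈-take⁻ : ∀ {A : Set} m (X : List A) {x} → x ∈ take m X → x ∈ X
∈-take⁻ (suc m) (y ∷ X) (here e) = here e
∈-take⁻ (suc m) (y ∷ X) (there x∈) = there (∈-take⁻ m X x∈)

Disp : ∀ {n} → Graph n → ℕ → (Fin n → Set) → (Fin n → Set) → Set
Disp G μ P Q = ∀ X Y → Unique X → Unique Y → All P X → All Q Y → μ ≤ length X → μ ≤ length Y →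
  ¬ ¬ ∃ λ x → ∃ λ y → x ∈ X × y ∈ Y × Arc G x y

-- If all vertices of `X` had fewer than `length Y / (2 * μ)` out-neighbours in `Y`, then `μ` of
-- them would reach less than half of `Y`. The other half has at least `μ` vertices and receives no
-- arc from them, against `Disp`.
disp⇒rich : ∀ {n} (G : Graph n) μ .⦃ _ : NonZero μ ⦄ P Q → Disp G μ P Q → Rich G (2 * μ) (2 * μ) P Q
disp⇒rich {n} G μ P Q disp X Y uX uY pX qY tX tY none =
  disp X′ (miss X′) (Uniqueₚ.take⁺ μ uX) (miss-U X′) (Allₚ.take⁺ μ pX) (miss-All X′) (≤-reflexive (sym lenX′)) enough
    λ { (x , y , x∈ , y∈ , a) → miss-none X′ y∈ x∈ a }
  where
  X′ = take μ X
  lenX′ : length X′ ≡ μ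
  lenX′ = trans (Listₚ.length-take μ X) (m≤n⇒m⊓n≡m (≤-trans (m≤n*m μ 2) tX))
  arc? : ∀ x y → Dec (adj G x y ≡ true)
  arc? x y = adj G x y ≟ᵇ true
  miss : List (Fin n) → List (Fin n)
  miss [] = Y
  miss (x ∷ Z) = filter (¬? ∘ arc? x) (miss Z)
  miss-U : ∀ Z → Unique (miss Z)
  miss-U [] = uY
  miss-U (x ∷ Z) = Uniqueₚ.filter⁺ _ (miss-U Z)
  miss-All : ∀ Z → All Q (miss Z)
  miss-All [] = qY
  miss-All (x ∷ Z) = Allₚ.filter⁺ _ (miss-All Z)
  miss-none : ∀ Z {x y} → y ∈ miss Z → x ∈ Z → Arc G x y → ⊥
  miss-none (z ∷ Z) y∈ (here refl) a = proj₂ (∈-filter⁻ (¬? ∘ arc? z) {xs = miss Z} y∈) a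
  miss-none (z ∷ Z) y∈ (there x∈) a = miss-none Z (proj₁ (∈-filter⁻ (¬? ∘ arc? z) {xs = miss Z} y∈)) x∈ a
  few : ∀ x → x ∈ X → 2 * μ * length (outs G x Y) ≤ length Y
  few x x∈ = ≮⇒≥ λ lt → none (x , x∈ , <⇒≤ lt)
  sublen : ∀ Z x → length (filter (arc? x) (miss Z)) ≤ length (outs G x Y)
  sublen [] x = ≤-refl
  sublen (z ∷ Z) x = ≤-trans (shorter (miss Z)) (sublen Z x)
    where
    shorter : ∀ W → length (filter (arc? x) (filter (¬? ∘ arc? z) W)) ≤ length (filter (arc? x) W)
    shorter [] = z≤n
    shorter (w ∷ W) with arc? z w
    ... | yes _ with arc? x w
    ...   | yes _ = ≤-trans (shorter W) (n≤1+n _)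
    ...   | no _ = shorter W
    shorter (w ∷ W) | no _ with arc? x w
    ...   | yes _ = s≤s (shorter W)
    ...   | no _ = shorter W
  loss : ∀ Z → All (_∈ X) Z → 2 * μ * length Y ≤ 2 * μ * length (miss Z) + length Z * length Y
  loss [] _ = ≤-reflexive (sym (+-identityʳ _))
  loss (z ∷ Z) (z∈ ∷ Z⊆) = begin
    2 * μ * length Y                                             ≤⟨ loss Z Z⊆ ⟩
    2 * μ * length (miss Z) + length Z * length Y                ≡⟨ cong (λ w → 2 * μ * w + length Z * length Y) (sym (length-partition (arc? z) (miss Z))) ⟩
    2 * μ * (o + length (miss (z ∷ Z))) + length Z * length Y    ≡⟨ r (2 * μ) o (length (miss (z ∷ Z))) (length Z * length Y) ⟩
    2 * μ * length (miss (z ∷ Z)) + (2 * μ * o + length Z * length Y) ≤⟨ +-monoʳ-≤ (2 * μ * length (miss (z ∷ Z))) (+-monoˡ-≤ (length Z * length Y) (≤-trans (*-monoʳ-≤ (2 * μ) (sublen Z z)) (few z z∈))) ⟩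
    2 * μ * length (miss (z ∷ Z)) + length (z ∷ Z) * length Y ∎
    where
    open ≤-Reasoning
    o = length (filter (arc? z) (miss Z))
    r : ∀ a b c d → a * (b + c) + d ≡ a * c + (a * b + d)
    r = solve-∀
  enough : μ ≤ length (miss X′)
  enough = *-cancelˡ-≤ (2 * μ) ⦃ m*n≢0 2 μ ⦄ (+-cancelʳ-≤ (μ * length Y) _ _ (begin
    2 * μ * μ + μ * length Y              ≤⟨ +-monoˡ-≤ (μ * length Y) (≤-trans (≤-reflexive (*-comm (2 * μ) μ)) (*-monoʳ-≤ μ tY)) ⟩
    μ * length Y + μ * length Y           ≡⟨ r μ (length Y) ⟩
    2 * μ * length Y                      ≤⟨ loss X′ (All.tabulate λ x∈ → ∈-take⁻ μ X x∈) ⟩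
    2 * μ * length (miss X′) + length X′ * length Y ≡⟨ cong (λ z → 2 * μ * length (miss X′) + z * length Y) lenX′ ⟩
    2 * μ * length (miss X′) + μ * length Y ∎))
    where
    open ≤-Reasoning
    r : ∀ a b → a * b + a * b ≡ 2 * a * b
    r = solve-∀

-- Sign matrices without large monochromatic rectangles

allVec : ∀ {A : Set} → List A → ∀ n → List (Vec A n)
allVec xs zero = [] ∷ []
allVec xs (suc n) = List.cartesianProductWith _∷_ xs (allVec xs n)

allVec-unique : ∀ {A : Set} {xs : List A} → Unique xs → ∀ n → Unique (allVec xs n)
allVec-unique u zero = [] ∷ []
allVec-unique u (suc n) = Uniqueₚ.cartesianProductWith⁺ _∷_ (λ { refl → refl , refl }) u (allVec-unique u n)

length-cartesianProductWith : ∀ {A B C : Set} (f : A → B → C) xs ys → length (List.cartesianProductWith f xs ys) ≡ length xs * length ys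
length-cartesianProductWith f [] ys = refl
length-cartesianProductWith f (x ∷ xs) ys = trans (Listₚ.length-++ (map (f x) ys)) (cong₂ _+_ (Listₚ.length-map (f x) ys) (length-cartesianProductWith f xs ys))

allVec-length : ∀ {A : Set} (xs : List A) n → length (allVec xs n) ≡ length xs ^ n
allVec-length xs zero = refl
allVec-length xs (suc n) = trans (length-cartesianProductWith _∷_ xs (allVec xs n)) (cong (length xs *_) (allVec-length xs n))

∈-allVec : ∀ {A : Set} {xs : List A} {n} (v : Vec A n) → (∀ i → lookup v i ∈ xs) → v ∈ allVec xs n
∈-allVec [] h = here refl
∈-allVec (a ∷ v) h = ∈-cartesianProductWith⁺ _∷_ (h zero) (∈-allVec v (h ∘ suc))

bools : List Bool
bools = false ∷ true ∷ []

bools-unique : Unique bools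
bools-unique = ((λ ()) ∷ []) ∷ [] ∷ []

card-Bool : Card≤ {A = Bool} (λ _ → ⊤) 2
card-Bool = card-⊆ {Q = λ b → b ≡ true ⊎ b ≡ false} (λ { true _ → return (inj₁ refl) ; false _ → return (inj₂ refl) })
  (card-⊎ {M = 1} {N = 1} (card-1 λ { _ _ refl refl → refl }) (card-1 λ { _ _ refl refl → refl }))

prodF-if : ∀ {n} y (b : Fin n → Bool) → prodF (λ i → if b i then y else 1) ≡ y ^ # b
prodF-if {zero} y b = refl
prodF-if {suc n} y b with b zero
... | true = cong (y *_) (prodF-if y (b ∘ suc))
... | false = trans (+-identityʳ _) (prodF-if y (b ∘ suc))

Member : ∀ {n} → List (Fin n) → Fin n → Bool
Member l i = does (_∈?_ Fin._≟_ i l)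

member-true : ∀ {n} (l : List (Fin n)) {i} → i ∈ l → Member l i ≡ true
member-true l {i} m = dec-true (_∈?_ Fin._≟_ i l) m

member-∈ : ∀ {n} (l : List (Fin n)) {i} → Member l i ≡ true → i ∈ l
member-∈ l {i} e with _∈?_ Fin._≟_ i l
... | yes m = m

length-≤-member : ∀ {n} {l : List (Fin n)} → Unique l → length l ≤ # Member l
length-≤-member {l = l} u = length-≤-# u (All.tabulate (member-true l))

NoMono : ℕ → ∀ {d} → Vec (Vec Bool d) d → Set
NoMono μ Mx = ∀ b I J → Unique I → Unique J → μ ≤ length I → μ ≤ length J →
  ¬ ¬ ∃ λ a → ∃ λ c → a ∈ I × c ∈ J × lookup (lookup Mx a) c ≡ b

-- Erdős's counting bound: a fixed `μ × μ` rectangle is monochromatic in a `2 ^ - (μ * μ)`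
-- proportion of the matrices for each sign, and there are at most `(1 + d) ^ μ` choices for its
-- rows and for its columns.
ramsey : ∀ d μ → 2 * ((1 + d) ^ μ * (1 + d) ^ μ) < 2 ^ (μ * μ) → ¬ ¬ Σ (Vec (Vec Bool d) d) (NoMono μ)
ramsey d μ small none = <⇒≱ small (*-cancelʳ-≤ _ _ ((2 ^ d) ^ d) ⦃ m^n≢0 (2 ^ d) d ⦃ m^n≢0 2 d ⦄ ⦄ (begin
    2 ^ (μ * μ) * (2 ^ d) ^ d                  ≡⟨ *-comm (2 ^ (μ * μ)) _ ⟩
    (2 ^ d) ^ d * 2 ^ (μ * μ)                  ≡⟨ cong (_* 2 ^ (μ * μ)) (sym len) ⟩
    length all * 2 ^ (μ * μ)                   ≤⟨ *-monoˡ-≤ (2 ^ (μ * μ)) (card-all all (allVec-unique (allVec-unique bools-unique d) d) (All.universal (λ _ → tt) all)) ⟩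
    2 * (L * (L * X)) * 2 ^ (μ * μ)            ≡⟨ r L X (2 ^ (μ * μ)) ⟩
    2 * (L * L) * (X * 2 ^ (μ * μ))            ≤⟨ *-monoʳ-≤ (2 * (L * L)) X-bound ⟩
    2 * (L * L) * (2 ^ d) ^ d ∎))
  where
  open ≤-Reasoning
  all = allVec (allVec bools d) d
  len : length all ≡ (2 ^ d) ^ d
  len = trans (allVec-length (allVec bools d) d) (cong (_^ d) (allVec-length bools d))
  L = (1 + d) ^ μ
  instance
    nz : NonZero (2 ^ (μ * μ))
    nz = m^n≢0 2 (μ * μ)
  X = (2 ^ d) ^ d / 2 ^ (μ * μ)
  X-bound : X * 2 ^ (μ * μ) ≤ (2 ^ d) ^ d
  X-bound = m/n*n≤m ((2 ^ d) ^ d) (2 ^ (μ * μ))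
  r : ∀ L X Y → 2 * (L * (L * X)) * Y ≡ 2 * (L * L) * (X * Y)
  r = solve-∀
  Mono : Bool → List (Fin d) → List (Fin d) → Vec (Vec Bool d) d → Set
  Mono b I J Mx = ∀ a c → a ∈ I → c ∈ J → lookup (lookup Mx a) c ≡ b
  Set′ : List (Fin d) → Set
  Set′ I = length I ≤ μ × All (λ _ → ⊤) I
  card-mono-rect : ∀ b I J → Unique I → Unique J → length I ≡ μ → length J ≡ μ → Card≤ (Mono b I J) X
  card-mono-rect b I J uI uJ lI lJ = card-mono (≤X X₁)
    (card-⊆ (λ Mx mo → return λ a → row Mx mo a) (card-Π {Q = λ a v → Member I a ≡ true → ∀ c → Member J c ≡ true → lookup v c ≡ b} {g = g} card-row))
    where
    h : Fin d → ℕ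
    h c = if Member J c then 1 else 2
    g : Fin d → ℕ
    g a = if Member I a then prodF h else 2 ^ d
    row : ∀ Mx → Mono b I J Mx → ∀ a → Member I a ≡ true → ∀ c → Member J c ≡ true → lookup (lookup Mx a) c ≡ b
    row Mx mo a ea c ec = mo a c (member-∈ I ea) (member-∈ J ec)
    card-entry : ∀ c → Card≤ (λ x → Member J c ≡ true → x ≡ b) (h c)
    card-entry c with Member J c
    ... | true = card-1 λ x y p q → trans (p refl) (sym (q refl))
    ... | false = card-⊆ (λ _ _ → return tt) card-Bool
    card-row : ∀ a → Card≤ (λ v → Member I a ≡ true → ∀ c → Member J c ≡ true → lookup v c ≡ b) (g a)
    card-row a with Member I a
    ... | true = card-⊆ (λ v p → return (p refl)) (card-Π card-entry)
    ... | false = card-⊆ (λ _ _ → return tt) (card-All card-Bool)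
    h-bound : prodF h * 2 ^ μ ≤ 2 ^ d
    h-bound = begin
      prodF h * 2 ^ μ ≤⟨ *-monoʳ-≤ (prodF h) (^-monoʳ-≤ 2 (≤-trans (≤-reflexive (sym lJ)) (length-≤-member uJ))) ⟩
      prodF h * 2 ^ # Member J ≡⟨ cong (prodF h *_) (sym (prodF-if 2 (Member J))) ⟩
      prodF h * prodF (λ c → if Member J c then 2 else 1) ≡⟨ sym (prodF-* h _) ⟩
      prodF (λ c → h c * (if Member J c then 2 else 1)) ≤⟨ prodF-mono (λ c → pt (Member J c)) ⟩
      prodF {d} (λ _ → 2) ≡⟨ prodF-const d 2 ⟩
      2 ^ d ∎
      where
      pt : ∀ b → (if b then 1 else 2) * (if b then 2 else 1) ≤ 2
      pt true = ≤-refl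
      pt false = ≤-refl
    X₁ : prodF g * 2 ^ (μ * μ) ≤ (2 ^ d) ^ d
    X₁ = begin
      prodF g * 2 ^ (μ * μ) ≡⟨ cong (prodF g *_) (sym (^-*-assoc 2 μ μ)) ⟩
      prodF g * (2 ^ μ) ^ μ ≤⟨ *-monoʳ-≤ (prodF g) (^-monoʳ-≤ (2 ^ μ) ⦃ m^n≢0 2 μ ⦄ (≤-trans (≤-reflexive (sym lI)) (length-≤-member uI))) ⟩
      prodF g * (2 ^ μ) ^ # Member I ≡⟨ cong (prodF g *_) (sym (prodF-if (2 ^ μ) (Member I))) ⟩
      prodF g * prodF (λ a → if Member I a then 2 ^ μ else 1) ≡⟨ sym (prodF-* g _) ⟩
      prodF (λ a → g a * (if Member I a then 2 ^ μ else 1)) ≤⟨ prodF-mono (λ a → pt (Member I a)) ⟩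
      prodF {d} (λ _ → 2 ^ d) ≡⟨ prodF-const d (2 ^ d) ⟩
      (2 ^ d) ^ d ∎
      where
      pt : ∀ b → (if b then prodF h else 2 ^ d) * (if b then 2 ^ μ else 1) ≤ 2 ^ d
      pt true = h-bound
      pt false = ≤-reflexive (*-identityʳ _)
    ≤X : ∀ {Y} → Y * 2 ^ (μ * μ) ≤ (2 ^ d) ^ d → Y ≤ X
    ≤X {Y} le = subst (_≤ X) (m*n/n≡m Y (2 ^ (μ * μ))) (/-monoˡ-≤ (2 ^ (μ * μ)) le)
  lists : Card≤ Set′ L
  lists = card-List μ (card-fin {d})
  Bad : Bool → List (Fin d) → List (Fin d) → Vec (Vec Bool d) d → Set
  Bad b I J Mx = Unique I × Unique J × length I ≡ μ × length J ≡ μ × Mono b I J Mx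
  card-all : Card≤ {A = Vec (Vec Bool d) d} (λ _ → ⊤) (2 * (L * (L * X)))
  card-all = card-bind {R = λ b Mx → ∃ λ I → ∃ λ J → Bad b I J Mx} card-Bool
    (λ b _ → card-bind {R = λ I Mx → ∃ λ J → Bad b I J Mx} lists
      (λ I _ → card-bind {R = λ J Mx → Bad b I J Mx} lists
        (λ J _ → card-rep λ { _ (uI , uJ , lI , lJ , _) → card-⊆ (λ _ bad → return (proj₂ (proj₂ (proj₂ (proj₂ bad))))) (card-mono-rect b I J uI uJ lI lJ) })
        (λ { Mx (J , bad@(_ , _ , _ , lJ , _)) → return (J , (≤-reflexive lJ , All.universal (λ _ → tt) J) , bad) }))
      (λ { Mx (I , J , bad@(_ , _ , lI , _ , _)) → return (I , (≤-reflexive lI , All.universal (λ _ → tt) I) , J , bad) }))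
    (λ Mx _ k → none (Mx , λ b I J uI uJ lI lJ no → k (not b , tt , take μ I , take μ J ,
      Uniqueₚ.take⁺ μ uI , Uniqueₚ.take⁺ μ uJ , trans (Listₚ.length-take μ I) (m≤n⇒m⊓n≡m lI) , trans (Listₚ.length-take μ J) (m≤n⇒m⊓n≡m lJ) ,
      λ a c a∈ c∈ → ≢⇒not (λ e → no (a , c , ∈-take⁻ μ I a∈ , ∈-take⁻ μ J c∈ , e)))))
    where
    ≢⇒not : ∀ {x b : Bool} → ¬ x ≡ b → x ≡ not b
    ≢⇒not {true} {true} n = ⊥-elim (n refl)
    ≢⇒not {true} {false} n = refl
    ≢⇒not {false} {true} n = refl
    ≢⇒not {false} {false} n = ⊥-elim (n refl)

-- Blocks

InPart : ∀ {n s} → Vec (Fin n) s → Fin n → Set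
InPart S v = ∃ λ a → lookup S a ≡ v

infix 9 _⟪_⟫_
_⟪_⟫_ : ∀ {A : Set} {s r} → Vec (Vec A s) r → Fin r → Fin s → A
S ⟪ i ⟫ a = lookup (lookup S i) a

Distinct : ∀ {n s r} → Vec (Vec (Fin n) s) r → Set
Distinct S = ∀ i a j b → S ⟪ i ⟫ a ≡ S ⟪ j ⟫ b → i ≡ j × a ≡ b

record Block {n} (G : Graph n) (μ : ℕ) {r} (D : Pat r) {s} (S : Vec (Vec (Fin n) s) r) : Set where
  field
    distinct : Distinct S
    disp : ∀ i j → has true (kind D i j) ≡ true → Disp G μ (InPart (lookup S i)) (InPart (lookup S j))

rowOf : ∀ {n r s} → Graph n → Vec (Vec (Fin n) s) r → Fin n → Vec (Vec State s) r
rowOf G S v = Vec.map (Vec.map (st G v)) S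

lookup-rowOf : ∀ {n r s} (G : Graph n) (S : Vec (Vec (Fin n) s) r) v i a → rowOf G S v ⟪ i ⟫ a ≡ st G v (S ⟪ i ⟫ a)
lookup-rowOf G S v i a rewrite Vecₚ.lookup-map i (Vec.map (st G v)) S = Vecₚ.lookup-map a (st G v) (lookup S i)

Outside : ∀ {n r s} → Vec (Vec (Fin n) s) r → Fin n → Set
Outside S v = ∀ i a → S ⟪ i ⟫ a ≢ v

-- More than `d` outside vertices have this row. This allows `d` distinct vertices with prescribed
-- popular rows, even if the rows coincide, and leaves at most `d` vertices for every unpopular row.
Popular : ∀ {n r s} → Graph n → Vec (Vec (Fin n) s) r → ℕ → Vec (Vec State s) r → Set
Popular G S d ρ = ¬ Card≤ (λ v → Outside S v × rowOf G S v ≡ ρ) d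

card-∈ : ∀ {A : Set} (l : List A) → Card≤ (_∈ l) (length l)
card-∈ [] = card-∅ λ _ ()
card-∈ (x ∷ l) = card-⊆ (λ { y (here e) → return (inj₁ e) ; y (there m) → return (inj₂ m) }) (card-⊎ {M = 1} (card-1 λ { _ _ refl refl → refl }) (card-∈ l))

representatives : ∀ {A : Set} m d (P : Fin m → A → Set) (avoid : List A) → length avoid + m ≤ suc d →
  (∀ a → ¬ Card≤ (P a) d) → ¬ ¬ Σ (Vec A m) λ T → (∀ a → P a (lookup T a)) × (∀ a b → lookup T a ≡ lookup T b → a ≡ b) × (∀ a → lookup T a ∉ avoid)
representatives zero d P avoid le many′ = return ([] , (λ ()) , (λ ()) , λ ())
representatives (suc m) d P avoid le many′ = fresh >>= λ { (x , p , x∉) →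
  representatives m d (P ∘ suc) (x ∷ avoid) (≤-trans (≤-reflexive (sym (+-suc (length avoid) m))) le) (many′ ∘ suc) >>= λ { (T , pT , inj , av) →
  return (x ∷ T , (λ { zero → p ; (suc a) → pT a }) ,
    (λ { zero zero _ → refl ; zero (suc b) e → ⊥-elim (av b (here (sym e))) ; (suc a) zero e → ⊥-elim (av a (here e)) ; (suc a) (suc b) e → cong suc (inj a b e) }) ,
    λ { zero → x∉ ; (suc a) m → av a (there m) }) } }
  where
  fresh : ¬ ¬ ∃ λ x → P zero x × x ∉ avoid
  fresh k = many′ zero (card-mono (s≤s⁻¹ (≤-trans (≤-trans (s≤s (m≤m+n (length avoid) m)) (≤-reflexive (sym (+-suc (length avoid) m)))) le))
    (card-⊆ (λ x p no → k (x , p , no)) (card-∈ avoid)))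

indices : ∀ {n s} (S : Vec (Fin n) s) X → All (InPart S) X → Unique X → Σ (List (Fin s)) λ I → Unique I × length I ≡ length X × (∀ {a} → a ∈ I → lookup S a ∈ X)
indices S [] [] [] = [] , [] , refl , λ ()
indices S (x ∷ X) ((a , refl) ∷ p) (x∉ ∷ u) with indices S X p u
... | I , uI , len , sub = a ∷ I , All.tabulate (λ b∈ e → All.lookup x∉ (sub b∈) (cong (lookup S) e)) ∷ uI , cong suc len ,
  λ { (here refl) → here refl ; (there m) → there (sub m) }

module Extension {n : ℕ} (G : Graph n) (both : Bool) {s d r μ : ℕ} (d≤s : d ≤ s) (1≤μ : 1 ≤ μ) (D : Pat r) (S : Vec (Vec (Fin n) s) r)
  (blk : Block G μ D S) (Mx : Vec (Vec Bool d) d) (noMono : NoMono μ Mx) where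
  open MultiSauer both s d d≤s
  open Block blk

  -- The new part has one vertex for each row of the sign matrix `Mx`, chosen so that this row is
  -- matched on `lookup Bs j` in every double part `j`. Since `Mx` has no large monochromatic
  -- rectangle, both directions occur between any large subsets. The old parts shrink to the sets in
  -- `Bs`, of the size of the new one.
  extend : ∀ w Bs → Realises (Popular G S d) w Bs → ¬ ¬ Σ (Vec (Vec (Fin n) d) (suc r)) (Block G μ (w , D))
  extend w Bs re = ¬¬-Fin (λ a → realises-use (Popular G S d) w Bs re (λ _ → lookup Mx a)) >>= λ ρs →
      representatives d d (λ a v → Outside S v × rowOf G S v ≡ proj₁ (ρs a)) [] (n≤1+n d) (λ a → proj₁ (proj₂ (ρs a))) >>= λ { (T , pT , injT , _) →
      return (T ∷ parts , record { distinct = dist T (proj₁ ∘ pT) injT ; disp = dsp T λ a j → subst (Meets (lookup w j) (lookup Bs j) (lookup Mx a) ∘ (λ ρ → lookup ρ j)) (sym (proj₂ (pT a))) (proj₂ (proj₂ (ρs a)) j) }) }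
    where
    part : Fin r → Vec (Fin n) d
    part i = Vec.map (lookup (lookup S i)) (lookup Bs i)
    parts = Vec.tabulate part
    at : ∀ i a → parts ⟪ i ⟫ a ≡ S ⟪ i ⟫ (lookup (lookup Bs i) a)
    at i a rewrite Vecₚ.lookup∘tabulate part i = Vecₚ.lookup-map a (lookup (lookup S i)) (lookup Bs i)
    dist : ∀ T → (∀ a → Outside S (lookup T a)) → (∀ a b → lookup T a ≡ lookup T b → a ≡ b) → Distinct (T ∷ parts)
    dist T pT injT zero a zero b e = refl , injT a b e
    dist T pT injT zero a (suc j) b e = ⊥-elim (pT a j _ (sym (trans e (at j b))))
    dist T pT injT (suc i) a zero b e = ⊥-elim (pT b i _ (trans (sym (at i a)) e))
    dist T pT injT (suc i) a (suc j) b e with distinct i _ j _ (trans (sym (at i a)) (trans e (at j b)))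
    ... | refl , e′ = refl , realises-inj (Popular G S d) w Bs re i a b e′
    module _ (T : Vec (Fin n) d) (mt : ∀ a j → Meets (lookup w j) (lookup Bs j) (lookup Mx a) (lookup (rowOf G S (lookup T a)) j)) where
      inPart : ∀ j v → InPart (lookup parts j) v → InPart (lookup S j) v
      inPart j v (a , e) = _ , trans (sym (at j a)) e
      arc : ∀ ε j → has ε (lookup w j) ≡ true → ∀ X Y → Unique X → Unique Y → All (InPart T) X → All (InPart (lookup parts j)) Y →
        μ ≤ length X → μ ≤ length Y → ¬ ¬ ∃ λ v → ∃ λ y → v ∈ X × y ∈ Y × sees ε (st G v y) ≡ true
      arc ε j hε X Y uX uY pX pY lX lY with indices T X pX uX | indices (lookup parts j) Y pY uY
      ... | I , uI , lI , subI | J , uJ , lJ , subJ = go (lookup w j) refl hε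
        where
        see : ∀ a c ε → sees ε (rowOf G S (lookup T a) ⟪ j ⟫ lookup (lookup Bs j) c) ≡ true → sees ε (st G (lookup T a) (parts ⟪ j ⟫ c)) ≡ true
        see a c ε e = trans (cong (sees ε) (trans (cong (st G (lookup T a)) (at j c)) (sym (lookup-rowOf G S (lookup T a) j _)))) e
        nonempty : ∀ {A : Set} (l : List A) → 1 ≤ length l → ∃ (_∈ l)
        nonempty (x ∷ l) _ = x , here refl
        go : ∀ κ → lookup w j ≡ κ → has ε κ ≡ true → ¬ ¬ ∃ λ v → ∃ λ y → v ∈ X × y ∈ Y × sees ε (st G v y) ≡ true
        go non eq ()
        go dbl eq _ = noMono ε I J uI uJ (subst (μ ≤_) (sym lI) lX) (subst (μ ≤_) (sym lJ) lY) >>= λ { (a , c , a∈ , c∈ , e) →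
          return (_ , _ , subI a∈ , subJ c∈ , see a c ε (subst (λ b → sees b _ ≡ true) e (meets-dbl a c))) }
          where
          meets-dbl : ∀ a c → sees (lookup (lookup Mx a) c) (rowOf G S (lookup T a) ⟪ j ⟫ lookup (lookup Bs j) c) ≡ true
          meets-dbl a with mt a j
          ... | m rewrite eq = m
        go (sg b) eq h = let a , a∈ = nonempty I (subst (1 ≤_) (sym lI) (≤-trans 1≤μ lX)) ; c , c∈ = nonempty J (subst (1 ≤_) (sym lJ) (≤-trans 1≤μ lY)) in
          return (_ , _ , subI a∈ , subJ c∈ , see a c ε (subst (λ b → sees b _ ≡ true) (sgn ε b h) (meets-sg a c)))
          where
          sgn : ∀ ε b → has ε (sg b) ≡ true → b ≡ ε
          sgn true true _ = refl
          sgn false false _ = refl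
          meets-sg : ∀ a c → sees b (rowOf G S (lookup T a) ⟪ j ⟫ lookup (lookup Bs j) c) ≡ true
          meets-sg a c with mt a j
          ... | m rewrite eq = subst (λ b → sees b _ ≡ true) (Vecₚ.lookup-replicate c b) (m c)
      has-flip : ∀ κ → has true (flip κ) ≡ has false κ
      has-flip non = refl
      has-flip dbl = refl
      has-flip (sg b) = refl
      dsp : ∀ i j → has true (kind (w , D) i j) ≡ true → Disp G μ (InPart (lookup (T ∷ parts) i)) (InPart (lookup (T ∷ parts) j))
      dsp zero zero ()
      dsp zero (suc j) h X Y uX uY pX pY lX lY = arc true j h X Y uX uY pX pY lX lY
      dsp (suc i) zero h X Y uX uY pX pY lX lY = arc false i (trans (sym (has-flip (lookup w i))) h) Y X uY uX pY pX lY lX >>= λ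
        { (v , y , v∈ , y∈ , e) → return (y , v , y∈ , v∈ , e) }
      dsp (suc i) (suc j) h X Y uX uY pX pY lX lY = disp i j h X Y uX uY (All.map (λ {v} → inPart i v) pX) (All.map (λ {v} → inPart j v) pY) lX lY

-- Enumerating T_{k+1}-free and k-partite graphs

graphs : ∀ n → List (Graph n)
graphs n = allVec (allVec bools n) n

∈-bools : ∀ b → b ∈ bools
∈-bools false = here refl
∈-bools true = there (here refl)

∈-graphs : ∀ {n} (G : Graph n) → G ∈ graphs n
∈-graphs G = ∈-allVec G λ i → ∈-allVec (lookup G i) λ j → ∈-bools _

graphs-unique : ∀ n → Unique (graphs n)
graphs-unique n = allVec-unique (allVec-unique bools-unique n) n

anyVec? : ∀ {m n} {P : Vec (Fin m) n → Set} → (∀ v → Dec (P v)) → Dec (∃ P)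
anyVec? {m} {n} P? = map′ (λ a → let v , _ , p = find a in v , p) (λ (v , p) → lose (∈-allVec v λ i → ∈-allFin _) p) (any? P? (allVec (List.allFin m) n))

isClass? : ∀ both {n} (G : Graph n) → Dec (IsClass both G)
isClass? both G = Finₚ.all? (λ i → adj G i i ≟ᵇ false) ×-dec Finₚ.all? (λ i → Finₚ.all? λ j → ok both (st G i j) ≟ᵇ true)

containsTT? : ∀ k {n} (G : Graph n) → Dec (ContainsTT k G)
containsTT? k {n} G = map′
  (λ (v , inj , e) → lookup v , (λ {x} {y} → inj x y) , e)
  (λ (f , inj , e) → Vec.tabulate f ,
     (λ x y eq → inj (trans (sym (Vecₚ.lookup∘tabulate f x)) (trans eq (Vecₚ.lookup∘tabulate f y)))) ,
     (λ i j lt → subst₂ (λ a b → adj G a b ≡ true) (sym (Vecₚ.lookup∘tabulate f i)) (sym (Vecₚ.lookup∘tabulate f j)) (e i j lt)))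
  (anyVec? λ (v : Vec (Fin n) (suc k)) →
    Finₚ.all? (λ x → Finₚ.all? λ y → (lookup v x Fin.≟ lookup v y) →-dec (x Fin.≟ y)) ×-dec
    Finₚ.all? (λ i → Finₚ.all? λ j → (i Fin.<? j) →-dec (adj G (lookup v i) (lookup v j) ≟ᵇ true)))

partite? : ∀ k {n} (G : Graph n) → Dec (Partite k G)
partite? k {n} G = map′
  (λ (v , e) → lookup v , e)
  (λ (c , e) → Vec.tabulate c , λ i j a eq → e i j a (trans (sym (Vecₚ.lookup∘tabulate c i)) (trans eq (Vecₚ.lookup∘tabulate c j))))
  (anyVec? λ (v : Vec (Fin k) n) → Finₚ.all? λ i → Finₚ.all? λ j → (adj G i j ≟ᵇ true) →-dec ¬? (lookup v i Fin.≟ lookup v j))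

free? : ∀ both k {n} (G : Graph n) → Dec (Free both k G)
free? both k G = isClass? both G ×-dec ¬? (containsTT? k G)

FreePartite : Bool → ℕ → ∀ {n} → Graph n → Set
FreePartite both k G = Free both k G × Partite k G

freePartite? : ∀ both k {n} (G : Graph n) → Dec (FreePartite both k G)
freePartite? both k G = free? both k G ×-dec partite? k G

numFree numPartite : Bool → ℕ → ℕ → ℕ
numFree both k n = length (filter (free? both k) (graphs n))
numPartite both k n = length (filter (freePartite? both k) (graphs n))

card-filter : ∀ {A : Set} {P : A → Set} (P? : ∀ x → Dec (P x)) l → (∀ x → x ∈ l) → Card≤ P (length (filter P? l))
card-filter P? l all = card-⊆ (λ x p → return (∈-filter⁺ P? (all x) p)) (card-∈ (filter P? l))

card-free : ∀ both k n → Card≤ (Free both k {n}) (numFree both k n)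
card-free both k n = card-filter (free? both k) (graphs n) ∈-graphs

card-partite : ∀ both k n → Card≤ (FreePartite both k {n}) (numPartite both k n)
card-partite both k n = card-filter (freePartite? both k) (graphs n) ∈-graphs

partite⇒free : ∀ k {n} (G : Graph n) → Partite k G → TTFree k G
partite⇒free k G (c , proper) (f , inj , e) with Finₚ.pigeonhole (n<1+n k) (c ∘ f)
... | i , j , lt , eq = proper (f i) (f j) (e i j lt) eq

-- Growth of the number of k-partite graphs

states : Bool → List State
states true = (false , false) ∷ (true , false) ∷ (false , true) ∷ (true , true) ∷ []
states false = (false , false) ∷ (true , false) ∷ (false , true) ∷ []

states-unique : ∀ both → Unique (states both)
states-unique true = ((λ ()) ∷ (λ ()) ∷ (λ ()) ∷ []) ∷ ((λ ()) ∷ (λ ()) ∷ []) ∷ ((λ ()) ∷ []) ∷ [] ∷ []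
states-unique false = ((λ ()) ∷ (λ ()) ∷ []) ∷ ((λ ()) ∷ []) ∷ [] ∷ []

states-ok : ∀ both → All (Ok both) (states both)
states-ok true = refl ∷ refl ∷ refl ∷ refl ∷ []
states-ok false = refl ∷ refl ∷ refl ∷ []

states-length : ∀ both → length (states both) ≡ arity both
states-length true = refl
states-length false = refl

rows : ∀ both {n} → (Fin n → Bool) → List (Vec State n)
rows both {zero} b = [] ∷ []
rows both {suc n} b = if b zero then map ((false , false) ∷_) (rows both (b ∘ suc)) else List.cartesianProductWith _∷_ (states both) (rows both (b ∘ suc))

rows-length : ∀ both {n} (b : Fin n → Bool) → length (rows both b) ≡ arity both ^ # (not ∘ b)
rows-length both {zero} b = refl
rows-length both {suc n} b with b zero
... | true = trans (Listₚ.length-map _ (rows both (b ∘ suc))) (rows-length both (b ∘ suc))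
... | false = trans (length-cartesianProductWith _∷_ (states both) (rows both (b ∘ suc))) (cong₂ _*_ (states-length both) (rows-length both (b ∘ suc)))

rows-unique : ∀ both {n} (b : Fin n → Bool) → Unique (rows both b)
rows-unique both {zero} b = [] ∷ []
rows-unique both {suc n} b with b zero
... | true = Uniqueₚ.map⁺ (λ { refl → refl }) (rows-unique both (b ∘ suc))
... | false = Uniqueₚ.cartesianProductWith⁺ _∷_ (λ { refl → refl , refl }) (states-unique both) (rows-unique both (b ∘ suc))

rows-All : ∀ both {n} (b : Fin n → Bool) → All (λ ρ → ∀ y → Ok both (lookup ρ y) × (b y ≡ true → lookup ρ y ≡ (false , false))) (rows both b)
rows-All both {zero} b = (λ ()) ∷ []
rows-All both {suc n} b with b zero in e
... | true = Allₚ.map⁺ (All.map (λ h → λ { zero → ok₀ both , (λ _ → refl) ; (suc y) → h y }) (rows-All both (b ∘ suc)))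
  where
  ok₀ : ∀ both → Ok both (false , false)
  ok₀ true = refl
  ok₀ false = refl
... | false = All.tabulate λ {ρ} m → let s , ρ′ , s∈ , ρ′∈ , eq = ∈-cartesianProductWith⁻ _∷_ (states both) (rows both (b ∘ suc)) m in
    subst (λ ρ → ∀ y → Ok both (lookup ρ y) × (b y ≡ true → lookup ρ y ≡ (false , false))) (sym eq)
      λ { zero → All.lookup (states-ok both) s∈ , (λ e′ → case trans (sym e) e′ of λ ()) ; (suc y) → All.lookup (rows-All both (b ∘ suc)) ρ′∈ y }

addVertex : ∀ {n} → Graph n → Vec State n → Graph (suc n)
addVertex G ρ = (false ∷ Vec.map proj₁ ρ) ∷ Vec.zipWith Vec._∷_ (Vec.map proj₂ ρ) G

zipWith-∷-injective : ∀ {A : Set} {n m} {a b : Vec A n} {G H : Vec (Vec A m) n} → Vec.zipWith Vec._∷_ a G ≡ Vec.zipWith Vec._∷_ b H → a ≡ b × G ≡ H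
zipWith-∷-injective {a = []} {[]} {[]} {[]} e = refl , refl
zipWith-∷-injective {a = x ∷ a} {y ∷ b} {g ∷ G} {h ∷ H} e =
  let ih = zipWith-∷-injective {a = a} {b} {G} {H} (cong Vec.tail e)
  in cong₂ _∷_ (cong (Vec.head ∘ Vec.head) e) (proj₁ ih) , cong₂ _∷_ (cong (Vec.tail ∘ Vec.head) e) (proj₂ ih)

unzip-≡ : ∀ {n} {ρ ρ′ : Vec State n} → Vec.map proj₁ ρ ≡ Vec.map proj₁ ρ′ → Vec.map proj₂ ρ ≡ Vec.map proj₂ ρ′ → ρ ≡ ρ′
unzip-≡ {ρ = []} {[]} _ _ = refl
unzip-≡ {ρ = (a , b) ∷ ρ} {(c , d) ∷ ρ′} e₁ e₂ =
  cong₂ _∷_ (cong₂ _,_ (cong Vec.head e₁) (cong Vec.head e₂)) (unzip-≡ (cong Vec.tail e₁) (cong Vec.tail e₂))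

addVertex-injective : ∀ {n} {G H : Graph n} {ρ σ} → addVertex G ρ ≡ addVertex H σ → G ≡ H × ρ ≡ σ
addVertex-injective {G = G} {H} {ρ} {σ} e =
  let e₂ = zipWith-∷-injective {a = Vec.map proj₂ ρ} {Vec.map proj₂ σ} {G} {H} (cong Vec.tail e)
  in proj₂ e₂ , unzip-≡ (cong (Vec.tail ∘ Vec.head) e) (proj₁ e₂)

adj-0s : ∀ {n} (G : Graph n) ρ y → adj (addVertex G ρ) zero (suc y) ≡ proj₁ (lookup ρ y)
adj-0s G ρ y = Vecₚ.lookup-map y proj₁ ρ

adj-s : ∀ {n} (G : Graph n) ρ x → lookup (addVertex G ρ) (suc x) ≡ proj₂ (lookup ρ x) ∷ lookup G x
adj-s G ρ x = trans (Vecₚ.lookup-zipWith Vec._∷_ x (Vec.map proj₂ ρ) G) (cong (_∷ lookup G x) (Vecₚ.lookup-map x proj₂ ρ))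

adj-s0 : ∀ {n} (G : Graph n) ρ x → adj (addVertex G ρ) (suc x) zero ≡ proj₂ (lookup ρ x)
adj-s0 G ρ x = cong (λ r → lookup r zero) (adj-s G ρ x)

adj-ss : ∀ {n} (G : Graph n) ρ x y → adj (addVertex G ρ) (suc x) (suc y) ≡ adj G x y
adj-ss G ρ x y = cong (λ r → lookup r (suc y)) (adj-s G ρ x)

concatMap-unique : ∀ {A B : Set} (ys : A → List B) (xs : List A) → Unique xs → (∀ a → Unique (ys a)) → (∀ {a a′ y} → y ∈ ys a → y ∈ ys a′ → a ≡ a′) →
  Unique (List.concatMap ys xs)
concatMap-unique ys [] u uy dec = []
concatMap-unique ys (x ∷ xs) (x∉ ∷ u) uy dec = Uniqueₚ.++⁺ (uy x) (concatMap-unique ys xs u uy dec)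
  λ { (m , m′) → let a , a∈ , y∈ = find (∈-concatMap⁻ ys {xs = xs} m′) in All.lookup x∉ a∈ (dec m y∈) }

concatMap-length : ∀ {A B : Set} (ys : A → List B) E (xs : List A) → All (λ a → E ≤ length (ys a)) xs → length xs * E ≤ length (List.concatMap ys xs)
concatMap-length ys E [] [] = z≤n
concatMap-length ys E (x ∷ xs) (le ∷ les) = ≤-trans (+-mono-≤ le (concatMap-length ys E xs les)) (≤-reflexive (sym (Listₚ.length-++ (ys x))))

classOf : ∀ {n k} → (Fin n → Fin k) → Fin k → Fin n → Bool
classOf c i y = does (c y Fin.≟ i)

sum-classes : ∀ {n k} (c : Fin n → Fin k) → sumF (λ i → # classOf c i) ≡ n
sum-classes {n} {k} c = trans (sumF-swap (λ i y → 𝟙 (classOf c i y))) (trans (sumF-cong one) (trans (sumF-const n 1) (*-identityʳ n)))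
  where
  one : ∀ y → sumF (λ i → 𝟙 (classOf c i y)) ≡ 1
  one y = trans (sumF-except (λ i → 𝟙 (classOf c i y)) (λ _ → 0) (c y) off refl) (cong₂ _+_ on (trans (sumF-const k 0) (*-zeroʳ k)))
    where
    off : ∀ i → i ≢ c y → 𝟙 (classOf c i y) ≡ 0
    off i ne with c y Fin.≟ i
    ... | yes e = ⊥-elim (ne (sym e))
    ... | no _ = refl
    on : 𝟙 (classOf c (c y) y) ≡ 1
    on = cong 𝟙 (dec-true (c y Fin.≟ c y) refl)

smallClass : ∀ {n k′} (c : Fin n → Fin (suc k′)) → ∃ λ i → suc k′ * # classOf c i ≤ n
smallClass {n} {k′} c with Finₚ.any? (λ i → suc k′ * # classOf c i ≤? n)
... | yes p = p
... | no np = ⊥-elim (<-irrefl refl (begin-strict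
    suc k′ * n                                    <⟨ m<m+n (suc k′ * n) {suc k′} (s≤s z≤n) ⟩
    suc k′ * n + suc k′                           ≡⟨ trans (+-comm (suc k′ * n) (suc k′)) (sym (*-suc (suc k′) n)) ⟩
    suc k′ * suc n                                ≡⟨ sym (sumF-const (suc k′) (suc n)) ⟩
    sumF {suc k′} (λ _ → suc n)                   ≤⟨ sumF-mono (λ i → ≰⇒> λ le → np (i , le)) ⟩
    sumF (λ i → suc k′ * # classOf c i)           ≡⟨ sumF-* (suc k′) (λ i → # classOf c i) ⟩
    suc k′ * sumF (λ i → # classOf c i)           ≡⟨ cong (suc k′ *_) (sum-classes c) ⟩
    suc k′ * n ∎))
  where open ≤-Reasoning

module Counts (both : Bool) (k′ : ℕ) where
  k q : ℕ
  k = suc k′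
  q = arity both

  instance
    q≢0 : NonZero q
    q≢0 = arity≢0 both

  f p : ℕ → ℕ
  f = numFree both k
  p = numPartite both k

  -- The new vertex joins a smallest class of the one colouring that `partite?` returns. Deleting it
  -- recovers `G`, so different graphs have disjoint lists of extensions however many colourings
  -- they admit.
  extensions : ∀ {n} → Graph n → List (Graph (suc n))
  extensions {n} G with partite? k G
  ... | yes (c , _) = map (addVertex G) (rows both (classOf c (proj₁ (smallClass c))))
  ... | no _ = []

  ∈-extensions : ∀ {n} (G : Graph n) {H} → H ∈ extensions G → ∃ λ ρ → H ≡ addVertex G ρ
  ∈-extensions G m with partite? k G
  ... | yes (c , _) = let ρ , _ , e = ∈-map⁻ (addVertex G) m in ρ , e
  ∈-extensions G () | no _

  extensions-unique : ∀ {n} (G : Graph n) → Unique (extensions G)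
  extensions-unique G with partite? k G
  ... | yes (c , _) = Uniqueₚ.map⁺ (λ e → proj₂ (addVertex-injective {G = G} e)) (rows-unique both _)
  ... | no _ = []

  extensions-All : ∀ {n} (G : Graph n) → FreePartite both k G → All (FreePartite both k) (extensions G)
  extensions-All {n} G (((loopless , okG) , _) , _) with partite? k G
  ... | no _ = []
  ... | yes (c , proper) = Allₚ.map⁺ (All.map (λ {ρ} h → ((loops ρ , oks ρ h) , partite⇒free k (addVertex G ρ) (prt ρ h)) , prt ρ h) (rows-All both (classOf c i)))
    where
    i = proj₁ (smallClass c)
    Good : Vec State n → Set
    Good ρ = ∀ y → Ok both (lookup ρ y) × (classOf c i y ≡ true → lookup ρ y ≡ (false , false))
    loops : ∀ ρ v → adj (addVertex G ρ) v v ≡ false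
    loops ρ zero = refl
    loops ρ (suc v) = trans (adj-ss G ρ v v) (loopless v)
    ok-swap : ∀ a b → Ok both (a , b) → Ok both (b , a)
    ok-swap a b = sw both a b
      where
      sw : ∀ both a b → Ok both (a , b) → Ok both (b , a)
      sw true a b _ = refl
      sw false false false _ = refl
      sw false false true _ = refl
      sw false true false _ = refl
    okff : ∀ both → Ok both (false , false)
    okff true = refl
    okff false = refl
    oks : ∀ ρ → Good ρ → ∀ x y → Ok both (st (addVertex G ρ) x y)
    oks ρ h zero zero = okff both
    oks ρ h zero (suc y) rewrite adj-0s G ρ y | adj-s0 G ρ y = proj₁ (h y)
    oks ρ h (suc x) zero rewrite adj-0s G ρ x | adj-s0 G ρ x = ok-swap (proj₁ (lookup ρ x)) (proj₂ (lookup ρ x)) (proj₁ (h x))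
    oks ρ h (suc x) (suc y) rewrite adj-ss G ρ x y | adj-ss G ρ y x = okG x y
    c′ : Fin (suc n) → Fin k
    c′ zero = i
    c′ (suc y) = c y
    prt : ∀ ρ → Good ρ → Partite k (addVertex G ρ)
    prt ρ h = c′ , pr
      where
      pr : ∀ x y → adj (addVertex G ρ) x y ≡ true → c′ x ≢ c′ y
      pr zero zero ()
      pr zero (suc y) a e = case trans (sym a) (trans (adj-0s G ρ y) (cong proj₁ (proj₂ (h y) (dec-true (c y Fin.≟ i) (sym e))))) of λ ()
      pr (suc x) zero a e = case trans (sym a) (trans (adj-s0 G ρ x) (cong proj₂ (proj₂ (h x) (dec-true (c x Fin.≟ i) e)))) of λ ()
      pr (suc x) (suc y) a e = proper x y (trans (sym (adj-ss G ρ x y)) a) e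

  extensions-length : ∀ {n} (G : Graph n) → FreePartite both k G → q ^ (n ∸ n / k) ≤ length (extensions G)
  extensions-length {n} G (_ , pG) with partite? k G
  ... | no np = ⊥-elim (np pG)
  ... | yes (c , _) = ≤-trans (^-monoʳ-≤ q le) (≤-reflexive (sym (trans (Listₚ.length-map (addVertex G) (rows both b)) (rows-length both b))))
    where
    i = proj₁ (smallClass c)
    b = classOf c i
    small : # b ≤ n / k
    small = subst (_≤ n / k) (m*n/n≡m (# b) k) (/-monoˡ-≤ k (≤-trans (≤-reflexive (*-comm (# b) k)) (proj₂ (smallClass c))))
    le : n ∸ n / k ≤ # (not ∘ b)
    le = ≤-trans (∸-monoʳ-≤ n small) (≤-reflexive (trans (cong (_∸ # b) (sym (#-not b))) (m+n∸n≡m _ (# b))))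

  growth₁ : ∀ n → p n * q ^ (n ∸ n / k) ≤ p (suc n)
  growth₁ n = ≤-trans (concatMap-length extensions (q ^ (n ∸ n / k)) xs (All.map (λ {G} → extensions-length G) all))
      (card-partite both k (suc n) (List.concatMap extensions xs)
        (concatMap-unique extensions xs (Uniqueₚ.filter⁺ _ (graphs-unique n)) extensions-unique same)
        (Allₚ.concat⁺ (Allₚ.map⁺ (All.map (λ {G} → extensions-All G) all))))
    where
    xs = filter (freePartite? both k) (graphs n)
    all : All (FreePartite both k) xs
    all = Allₚ.all-filter (freePartite? both k) (graphs n)
    same : ∀ {G G′ : Graph n} {H} → H ∈ extensions G → H ∈ extensions G′ → G ≡ G′
    same {G} {G′} m m′ with ∈-extensions G m | ∈-extensions G′ m′
    ... | ρ , refl | ρ′ , e = proj₁ (addVertex-injective e)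

  -- The growth factor is `q ^ ((1 - 1/k) * n)`; the `k`-th power makes the exponent an integer and
  -- removes the rounding in `n / k`.
  growth : ∀ n → p n ^ k * q ^ (k′ * n) ≤ p (suc n) ^ k
  growth n = begin
    p n ^ k * q ^ (k′ * n)              ≤⟨ *-monoʳ-≤ (p n ^ k) (^-monoʳ-≤ q expo) ⟩
    p n ^ k * q ^ ((n ∸ n / k) * k)     ≡⟨ cong (p n ^ k *_) (sym (^-*-assoc q (n ∸ n / k) k)) ⟩
    p n ^ k * (q ^ (n ∸ n / k)) ^ k     ≡⟨ sym (^-distribʳ k (p n) _) ⟩
    (p n * q ^ (n ∸ n / k)) ^ k         ≤⟨ ^-monoˡ-≤ k (growth₁ n) ⟩
    p (suc n) ^ k ∎
    where
    open ≤-Reasoning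
    expo : k′ * n ≤ (n ∸ n / k) * k
    expo = ≤-trans (≤-reflexive (trans (sym (m+n∸m≡n n (k′ * n))) (cong (_∸ n) (*-comm k n)))) (≤-trans (∸-monoʳ-≤ (n * k) (m/n*n≤m n k)) (≤-reflexive (sym (*-distribʳ-∸ k n (n / k)))))

  growths : ∀ m j → p m ^ k * q ^ (k′ * (j * m)) ≤ p (j + m) ^ k
  growths m zero = ≤-reflexive (trans (cong (λ z → p m ^ k * q ^ z) (*-zeroʳ k′)) (*-identityʳ _))
  growths m (suc j) = begin
    p m ^ k * q ^ (k′ * (m + j * m))                ≡⟨ cong (λ z → p m ^ k * q ^ z) (trans (cong (k′ *_) (+-comm m (j * m))) (*-distribˡ-+ k′ (j * m) m)) ⟩
    p m ^ k * q ^ (k′ * (j * m) + k′ * m)           ≡⟨ cong (p m ^ k *_) (^-distribˡ-+-* q (k′ * (j * m)) (k′ * m)) ⟩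
    p m ^ k * (q ^ (k′ * (j * m)) * q ^ (k′ * m))   ≡⟨ sym (*-assoc (p m ^ k) _ _) ⟩
    p m ^ k * q ^ (k′ * (j * m)) * q ^ (k′ * m)     ≤⟨ *-mono-≤ (growths m j) (^-monoʳ-≤ q (*-monoʳ-≤ k′ (m≤n+m m j))) ⟩
    p (j + m) ^ k * q ^ (k′ * (j + m))              ≤⟨ growth (j + m) ⟩
    p (suc j + m) ^ k ∎
    where open ≤-Reasoning

  p-pos : ∀ n → 1 ≤ p n
  p-pos zero = card-partite both k 0 ([] ∷ []) ([] ∷ []) (((((λ ()) , λ ()) , partite⇒free k [] pt) , pt) ∷ [])
    where
    pt : Partite k {0} []
    pt = (λ ()) , λ ()
  p-pos (suc n) = ≤-trans (p-pos n) (≤-trans (m≤m*n (p n) (q ^ (n ∸ n / k)) ⦃ m^n≢0 q (n ∸ n / k) ⦄) (growth₁ n))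

  -- Deleting j vertices loses at least the factor by which the number of k-partite graphs grows.
  finish : ∀ m j M X e .⦃ _ : NonZero e ⦄ → (M * X) ^ (k * e) ≤ q ^ (k′ * (j * m) * e) → M * (p m * X) ≤ p (j + m)
  finish m j M X e le = ^-cancelˡ-≤ k (begin
    (M * (p m * X)) ^ k             ≡⟨ cong (_^ k) (r M (p m) X) ⟩
    (p m * (M * X)) ^ k             ≡⟨ ^-distribʳ k (p m) (M * X) ⟩
    p m ^ k * (M * X) ^ k           ≤⟨ *-monoʳ-≤ (p m ^ k) (^-cancelˡ-≤ e (subst₂ _≤_ (sym (^-*-assoc (M * X) k e)) (sym (^-*-assoc q (k′ * (j * m)) e)) le)) ⟩
    p m ^ k * q ^ (k′ * (j * m))    ≤⟨ growths m j ⟩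
    p (j + m) ^ k ∎)
    where
    open ≤-Reasoning
    r : ∀ M p X → M * (p * X) ≡ p * (M * X)
    r = solve-∀

-- Deleting a set of vertices

sub : ∀ {n} → Graph n → (vs : List (Fin n)) → Graph (length vs)
sub G vs = Vec.tabulate λ i → Vec.tabulate λ j → adj G (List.lookup vs i) (List.lookup vs j)

adj-sub : ∀ {n} (G : Graph n) vs i j → adj (sub G vs) i j ≡ adj G (List.lookup vs i) (List.lookup vs j)
adj-sub G vs i j = trans (cong (λ r → lookup r j) (Vecₚ.lookup∘tabulate _ i)) (Vecₚ.lookup∘tabulate _ j)

lookup-unique : ∀ {A : Set} {xs : List A} → Unique xs → ∀ i j → List.lookup xs i ≡ List.lookup xs j → i ≡ j
lookup-unique u i j e with Finₚ.<-cmp i j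
... | tri< lt _ _ = ⊥-elim (AllPairs-lookup u i j lt e)
... | tri≈ _ eq _ = eq
... | tri> _ _ gt = ⊥-elim (AllPairs-lookup u j i gt (sym e))

free-sub : ∀ both k {n} (G : Graph n) {vs} → Unique vs → Free both k G → Free both k (sub G vs)
free-sub both k G {vs} u ((loopless , oks) , tt-free) =
  ((λ i → trans (adj-sub G vs i i) (loopless _)) , λ i j → subst₂ (λ a b → Ok both (a , b)) (sym (adj-sub G vs i j)) (sym (adj-sub G vs j i)) (oks _ _)) ,
  λ (g , inj , e) → tt-free (List.lookup vs ∘ g , (λ {x} {y} eq → inj (lookup-unique u (g x) (g y) eq)) , λ i j lt → trans (sym (adj-sub G vs (g i) (g j))) (e i j lt))

graph-ext : ∀ {n} {G H : Graph n} → (∀ x y → adj G x y ≡ adj H x y) → G ≡ H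
graph-ext {G = G} {H} h = vec-ext λ x → vec-ext λ y → h x y
  where
  vec-ext : ∀ {A : Set} {n} {v w : Vec A n} → (∀ i → lookup v i ≡ lookup w i) → v ≡ w
  vec-ext {v = []} {[]} h = refl
  vec-ext {v = a ∷ v} {b ∷ w} h = cong₂ _∷_ (h zero) (vec-ext (h ∘ suc))

Agree : ∀ {n} → List (Fin n) → Graph n → Graph n → Set
Agree S G H = ∀ x y → x ∉ S → y ∉ S → adj G x y ≡ adj H x y

agree-det : ∀ {n} (S : List (Fin n)) {G H} → Agree S G H → (∀ v x → x ∈ S → st G v x ≡ st H v x) → G ≡ H
agree-det S {G} {H} ag h = graph-ext eq
  where
  eq : ∀ x y → adj G x y ≡ adj H x y
  eq x y with _∈?_ Fin._≟_ x S | _∈?_ Fin._≟_ y S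
  ... | _ | yes y∈ = cong proj₁ (h x y y∈)
  ... | yes x∈ | no _ = cong proj₂ (h y x x∈)
  ... | no x∉ | no y∉ = ag x y x∉ y∉

module Skeleton (both : Bool) (k : ℕ) {n : ℕ} (S : List (Fin n)) (uS : Unique S) where
  out? : ∀ v → Dec (v ∉ S)
  out? v = ¬? (_∈?_ Fin._≟_ v S)

  rest : List (Fin n)
  rest = filter out? (List.allFin n)

  length-rest : length rest + length S ≡ n
  length-rest = trans (cong (length rest +_) (sym inside)) (trans (+-comm (length rest) _)
      (trans (length-partition (λ v → _∈?_ Fin._≟_ v S) (List.allFin n)) (Listₚ.length-tabulate id)))
    where
    ins = filter (λ v → _∈?_ Fin._≟_ v S) (List.allFin n)
    inside : length ins ≡ length S
    inside = ≤-antisym (card-∈ S ins (Uniqueₚ.filter⁺ _ (Uniqueₚ.allFin⁺ n)) (Allₚ.all-filter _ (List.allFin n)))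
      (card-∈ ins S uS (All.tabulate λ {v} v∈ → ∈-filter⁺ (λ v → _∈?_ Fin._≟_ v S) (∈-allFin v) v∈))

  -- The graph outside `S` is again free, hence one of `numFree both k m` graphs. For a fixed one,
  -- any member of the class serves as reference, and what remains is to count the ways in which `S`
  -- is attached.
  skeleton : ∀ {m X} (P : Graph n → Set) → length S + m ≡ n → (∀ G → P G → Free both k G) →
    (∀ G₀ → P G₀ → Card≤ (λ G → P G × Agree S G G₀) X) → Card≤ P (numFree both k m * X)
  skeleton {m} {X} P len free bound = subst (λ z → Card≤ P (numFree both k z * X)) eq
      (card-fiber (λ G → sub G rest) (card-free both k (length rest))
        (λ G pG → free-sub both k G (Uniqueₚ.filter⁺ out? (Uniqueₚ.allFin⁺ n)) (free G pG))
        (λ G₀ p₀ → card-⊆ (λ G (pG , e) → return (pG , agree G G₀ e)) (bound G₀ p₀)))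
    where
    eq : length rest ≡ m
    eq = +-cancelʳ-≡ (length S) _ _ (trans length-rest (trans (sym len) (+-comm (length S) m)))
    agree : ∀ G G₀ → sub G rest ≡ sub G₀ rest → Agree S G G₀
    agree G G₀ e x y x∉ y∉ with idx x x∉ | idx y y∉
      where
      idx : ∀ v → v ∉ S → ∃ λ i → List.lookup rest i ≡ v
      idx v v∉ = let m = ∈-filter⁺ out? (∈-allFin v) v∉ in index m , sym (lookup-index m)
    ... | i , refl | j , refl = trans (sym (adj-sub G rest i j)) (trans (cong (λ H → adj H i j) e) (adj-sub G₀ rest i j))

card-× : ∀ {A B : Set} {P : A → Set} {Q : B → Set} {M N} → Card≤ P M → Card≤ Q N → Card≤ (λ (x : A × B) → P (proj₁ x) × Q (proj₂ x)) (M * N)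
card-× {Q = Q} c d = card-bind {R = λ a x → proj₁ x ≡ a × Q (proj₂ x)} c
  (λ a _ → card-inj {Q = Q} proj₂ (λ { _ _ (refl , _) (refl , _) refl → refl }) (λ _ → proj₂) d)
  (λ x (p , q) → return (proj₁ x , p , refl , q))

-- The observations `h b` are revealed one at a time; the final bound `N` concerns objects on which
-- all of them agree.
card-iter : ∀ {X A H : Set} {P : X → Set} {Ok : H → A → Set} {α N} (h : H → X → A) (hs : List H) → (∀ b → b ∈ hs → Card≤ (Ok b) α) →
  (∀ x → P x → ∀ b → b ∈ hs → Ok b (h b x)) → (∀ x₀ → P x₀ → Card≤ (λ x → P x × ∀ b → b ∈ hs → h b x ≡ h b x₀) N) → Card≤ P (α ^ length hs * N)
card-iter {N = N} h [] c okP last = card-rep λ x₀ p₀ → card-mono (≤-reflexive (sym (+-identityʳ N))) (card-⊆ (λ x p → return (p , λ b ())) (last x₀ p₀))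
card-iter {P = P} {α = α} {N} h (b ∷ hs) c okP last = card-mono (≤-reflexive (sym (*-assoc α (α ^ length hs) N)))
  (card-fiber (h b) (c b (here refl)) (λ x p → okP x p b (here refl))
    (λ x₀ p₀ → card-iter {P = λ x → P x × h b x ≡ h b x₀} h hs (λ b′ m → c b′ (there m)) (λ x p b′ m → okP x (proj₁ p) b′ (there m))
      (λ x₁ (p₁ , e₁) → card-⊆ (λ x ((p , e) , es) → return (p , λ { b′ (here refl) → trans e (sym e₁) ; b′ (there m) → es b′ m })) (last x₁ p₁))))

vertexAt : ∀ {n s r} → Vec (Vec (Fin n) s) r → Fin r × Fin s → Fin n
vertexAt S (i , a) = S ⟪ i ⟫ a

vertices : ∀ {n s r} → Vec (Vec (Fin n) s) r → List (Fin n)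
vertices {s = s} {r} S = List.tabulate (vertexAt S ∘ Fin.remQuot {r} s)

vertices-length : ∀ {n s r} (S : Vec (Vec (Fin n) s) r) → length (vertices S) ≡ r * s
vertices-length {s = s} {r} S = Listₚ.length-tabulate (vertexAt S ∘ Fin.remQuot {r} s)

∈-vertices : ∀ {n s r} (S : Vec (Vec (Fin n) s) r) i a → S ⟪ i ⟫ a ∈ vertices S
∈-vertices {s = s} {r} S i a = subst (_∈ vertices S) (cong (vertexAt S) (Finₚ.remQuot-combine {r} {s} i a))
  (∈-tabulate⁺ {f = vertexAt S ∘ Fin.remQuot {r} s} (Fin.combine i a))

vertices-∈ : ∀ {n s r} (S : Vec (Vec (Fin n) s) r) {v} → v ∈ vertices S → ∃ λ i → ∃ λ a → v ≡ S ⟪ i ⟫ a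
vertices-∈ {s = s} {r} S m = let e , eq = ∈-tabulate⁻ {f = vertexAt S ∘ Fin.remQuot {r} s} m in
  proj₁ (Fin.remQuot {r} s e) , proj₂ (Fin.remQuot {r} s e) , eq

vertices-unique : ∀ {n s r} (S : Vec (Vec (Fin n) s) r) → Distinct S → Unique (vertices S)
vertices-unique {s = s} {r} S dist = Uniqueₚ.tabulate⁺ λ {x} {y} e →
  let x′ = Fin.remQuot {r} s x
      y′ = Fin.remQuot {r} s y
      e₁ , e₂ = dist (proj₁ x′) (proj₂ x′) (proj₁ y′) (proj₂ y′) e
  in trans (sym (Finₚ.combine-remQuot {r} s x)) (trans (cong₂ Fin.combine e₁ e₂) (Finₚ.combine-remQuot {r} s y))

∉-outside : ∀ {n s r} (S : Vec (Vec (Fin n) s) r) {v} → v ∉ vertices S → Outside S v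
∉-outside S v∉ i a e = v∉ (subst (_∈ vertices S) e (∈-vertices S i a))

_≟ᵣ_ : ∀ {s r} → DecidableEquality (Vec (Vec State s) r)
_≟ᵣ_ = Vecₚ.≡-dec (Vecₚ.≡-dec (Productₚ.≡-dec _≟ᵇ_ _≟ᵇ_))

OkRow : Bool → ∀ {s r} → Vec (Vec State s) r → Set
OkRow both ρ = ∀ i a → Ok both (ρ ⟪ i ⟫ a)

card-OkRow : ∀ both s r → Card≤ (OkRow both {s} {r}) ((arity both ^ s) ^ r)
card-OkRow both s r = card-Vec r (card-Vec s (card-Ok both))

rowOf-ok : ∀ both {k n s r} (G : Graph n) → Free both k G → (S : Vec (Vec (Fin n) s) r) → ∀ v → OkRow both (rowOf G S v)
rowOf-ok both G ((_ , oks) , _) S v i a = subst (Ok both) (sym (lookup-rowOf G S v i a)) (oks v (S ⟪ i ⟫ a))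

rowOf-det : ∀ {n s r} (S : Vec (Vec (Fin n) s) r) {G H} → Agree (vertices S) G H → (∀ v → rowOf G S v ≡ rowOf H S v) → G ≡ H
rowOf-det S {G} {H} ag eq = agree-det (vertices S) ag λ v x x∈ → let i , a , e = vertices-∈ S x∈ in
  subst (λ x → st G v x ≡ st H v x) (sym e) (trans (sym (lookup-rowOf G S v i a)) (trans (cong (λ ρ → ρ ⟪ i ⟫ a) (eq v)) (lookup-rowOf H S v i a)))

patCount : ℕ → ℕ
patCount zero = 1
patCount (suc r) = 4 ^ r * patCount r

card-Pat : ∀ r → Card≤ {A = Pat r} (λ _ → ⊤) (patCount r)
card-Pat zero = card-1 λ _ _ _ _ → refl
card-Pat (suc r) = card-⊆ (λ _ _ → return (tt , tt)) (card-× (card-All card-Kind) (card-Pat r))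

HasBlock : ∀ {n} → ℕ → ℕ → ℕ → ℕ → Graph n → Set
HasBlock {n} k′ μ r s G = ∃ λ (D : Pat r) → HeavyPat k′ D × Σ (Vec (Vec (Fin n) s) r) (Block G μ D)

-- Graphs whose largest heavy block has r parts

module Stopped (both : Bool) (k′ : ℕ) {s d r μ : ℕ} (d≤s : d ≤ s) (1≤μ : 1 ≤ μ)
  (Mx : Vec (Vec Bool d) d) (noMono : NoMono μ Mx)
  (M g : ℕ) (light : ∀ (w : Vec Kind r) → ¬ Heavy k′ w → MultiSauer.costOf both s d d≤s w ≤ M)
  (g-bound : MultiSauer.K both s d d≤s ^ r * M ≤ g) where
  open MultiSauer both s d d≤s using (multi-sauer; Realises; Row)

  k = suc k′
  Rw = (arity both ^ s) ^ r

  Stop : ∀ {n} → Graph n → Set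
  Stop G = Free both k G × HasBlock k′ μ r s G × ¬ HasBlock k′ μ (suc r) d G

  -- The block itself has `r * s` vertices, and each of the at most `Rw` unpopular rows belongs to
  -- at most `d` vertices outside it. The number does not grow with `n`.
  exceptions : ℕ
  exceptions = r * s + Rw * d

  rowsCount : ℕ → ℕ
  rowsCount n = countFew {n} (λ _ → g) Rw (λ _ → true) exceptions

  module _ {n : ℕ} (D : Pat r) (S : Vec (Vec (Fin n) s) r) where

    At : Graph n → Set
    At G = Free both k G × HeavyPat k′ D × Block G μ D S × ¬ HasBlock k′ μ (suc r) d G

    -- A realised pattern that is heavy would extend the block by a part, which the class forbids.
    -- So every realised pattern is light and costs at most `M`.
    card-popular : ∀ G → At G → Card≤ (Popular G S d) g
    card-popular G (free , heavy , blk , stop) = card-mono g-bound (multi-sauer r (Popular G S d) M pop-ok bound)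
      where
      pop-ok : ∀ ρ → Popular G S d ρ → OkRow both ρ
      pop-ok ρ pop i a = bool-stable (many pop >>= λ { (v ∷ _ , _ , ((_ , refl) ∷ _) , _) → return (rowOf-ok both G free S v i a) })
      bound : ∀ w Bs → Realises (Popular G S d) w Bs → MultiSauer.costOf both s d d≤s w ≤ M
      bound w Bs re = light w λ hw → Extension.extend G both d≤s 1≤μ D S blk Mx noMono w Bs re
        λ { (S′ , blk′) → stop ((w , D) , (hw , heavy) , S′ , blk′) }

    -- The list of popular rows is guessed in advance. This costs a factor independent of `n`, after
    -- which almost every vertex has only `g` rows to choose from.
    Listed : Graph n → Set
    Listed G = ∃ λ l → (length l ≤ g × All (OkRow both) l) × Few (λ _ ρ → ρ ∈ l) (OkRow both) (λ _ → true) exceptions (Vec.tabulate (rowOf G S))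

    listed : ∀ G → At G → ¬ ¬ Listed G
    listed G at@(free , _ , blk , _) = enumerate g (card-popular G at) >>= λ { (l , le , pops , cov) →
      return (l , (le , All.map (λ {ρ} → pop-ok ρ) pops) ,
        few-intro (λ _ → sp l) (Vec.tabulate (rowOf G S)) exceptions
          (λ v e → sp-false l _ e)
          (λ v _ → refl , subst (OkRow both) (sym (Vecₚ.lookup∘tabulate (rowOf G S) v)) (rowOf-ok both G free S v))
          (#-≤ (card-⊆ (λ v e → uncovered l cov v (sp-true l _ (trans (cong (sp l) (sym (Vecₚ.lookup∘tabulate (rowOf G S) v))) e)))
            (card-⊎ (card-mono (≤-reflexive (vertices-length S)) (card-∈ (vertices S)))
              (card-bind {R = λ ρ v → ¬ Popular G S d ρ × Outside S v × rowOf G S v ≡ ρ} (card-OkRow both s r)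
                (λ ρ _ → card-rep λ { _ (np , _) → card-⊆ (λ v p → return (proj₂ p)) (card-stable np) })
                (λ v (out , np) → return (rowOf G S v , rowOf-ok both G free S v , np , out , refl))))))) }
      where
      pop-ok : ∀ ρ → Popular G S d ρ → OkRow both ρ
      pop-ok ρ pop i a = bool-stable (many pop >>= λ { (v ∷ _ , _ , ((_ , refl) ∷ _) , _) → return (rowOf-ok both G free S v i a) })
      sp : List (Row r) → Row r → Bool
      sp l ρ = not (does (_∈?_ _≟ᵣ_ ρ l))
      sp-false : ∀ l ρ → sp l ρ ≡ false → ρ ∈ l
      sp-false l ρ e with _∈?_ _≟ᵣ_ ρ l
      ... | yes m = m
      sp-true : ∀ l ρ → sp l ρ ≡ true → ρ ∉ l
      sp-true l ρ e with _∈?_ _≟ᵣ_ ρ l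
      ... | no n = n
      uncovered : ∀ l → (∀ ρ → Popular G S d ρ → ¬ ¬ (ρ ∈ l)) → ∀ v → rowOf G S v ∉ l →
        ¬ ¬ (v ∈ vertices S ⊎ (Outside S v × ¬ Popular G S d (rowOf G S v)))
      uncovered l cov v ∉l with _∈?_ Fin._≟_ v (vertices S)
      ... | yes m = return (inj₁ m)
      ... | no v∉ = return (inj₂ (∉-outside S v∉ , λ pop → cov _ pop ∉l))

    card-At : ∀ {m} → r * s + m ≡ n → Card≤ At (numFree both k m * ((1 + Rw) ^ g * rowsCount n))
    card-At {m} len = card-rep λ { G₀ (_ , _ , blk , _) →
      Skeleton.skeleton both k (vertices S) (vertices-unique S (Block.distinct blk)) At (trans (cong (_+ m) (vertices-length S)) len) (λ G → proj₁)
        (λ G₁ _ → card-bind {R = λ l G → (Agree (vertices S) G G₁) × Few (λ _ ρ → ρ ∈ l) (OkRow both) (λ _ → true) exceptions (Vec.tabulate (rowOf G S))}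
          (card-List g (card-OkRow both s r))
          (λ l (le , _) → card-inj {Q = Few (λ _ ρ → ρ ∈ l) (OkRow both) (λ _ → true) exceptions} (λ G → Vec.tabulate (rowOf G S))
            (λ G H (ag , _) (ah , _) e → rowOf-det S (λ x y x∉ y∉ → trans (ag x y x∉ y∉) (sym (ah x y x∉ y∉)))
              (λ v → trans (sym (Vecₚ.lookup∘tabulate (rowOf G S) v)) (trans (cong (λ R → lookup R v) e) (Vecₚ.lookup∘tabulate (rowOf H S) v))))
            (λ G → proj₂)
            (card-few (λ _ → true) exceptions (λ _ → card-mono le (card-∈ l)) (card-OkRow both s r)))
          (λ G (at , ag) → listed G at >>= λ { (l , p , fw) → return (l , p , ag , fw) })) }

  stopCount : ℕ → ℕ → ℕ
  stopCount n m = patCount r * ((n ^ s) ^ r * (numFree both k m * ((1 + Rw) ^ g * rowsCount n)))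

  card-Stop : ∀ n m → r * s + m ≡ n → Card≤ (Stop {n}) (stopCount n m)
  card-Stop n m len = card-bind {R = λ D G → ∃ λ S → At D S G} (card-Pat r)
    (λ D _ → card-bind {R = λ S G → At D S G} (card-All (card-All (card-fin {n}))) (λ S _ → card-At D S len)
      (λ G (S , at) → return (S , tt , at)))
    (λ G (free , (D , heavy , S , blk) , stop) → return (D , tt , S , free , heavy , blk , stop))

-- Greedy matchings

ends : ∀ {A : Set} → List (A × A) → List A
ends [] = []
ends ((u , v) ∷ m) = u ∷ v ∷ ends m

length-ends : ∀ {A : Set} (m : List (A × A)) → length (ends m) ≡ 2 * length m
length-ends [] = refl
length-ends (_ ∷ m) = trans (cong (2 +_) (length-ends m)) (sym (*-suc 2 (length m)))

∈-ends : ∀ {A : Set} {m : List (A × A)} {u v} → (u , v) ∈ m → u ∈ ends m × v ∈ ends m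
∈-ends (here refl) = here refl , there (here refl)
∈-ends (there e) = let a , b = ∈-ends e in there (there a) , there (there b)

matching : ∀ {n} (R : Fin n → Fin n → Bool) → (∀ v → R v v ≡ false) → Σ (List (Fin n × Fin n)) λ m →
  Unique (ends m) × All (λ (u , v) → R u v ≡ true) m × (∀ u v → R u v ≡ true → u ∈ ends m ⊎ v ∈ ends m)
matching {n} R irr = let m , um , rm , cov = go (List.cartesianProduct (List.allFin n) (List.allFin n)) in
    m , um , rm , λ u v e → cov u v (∈-cartesianProduct⁺ (∈-allFin u) (∈-allFin v)) e
  where
  go : ∀ ps → Σ (List (Fin n × Fin n)) λ m →
    Unique (ends m) × All (λ (u , v) → R u v ≡ true) m × (∀ u v → (u , v) ∈ ps → R u v ≡ true → u ∈ ends m ⊎ v ∈ ends m)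
  go [] = [] , [] , [] , λ u v ()
  go ((u , v) ∷ ps) with go ps
  ... | m , um , rm , cov with R u v in e | _∈?_ Fin._≟_ u (ends m) | _∈?_ Fin._≟_ v (ends m)
  ...   | false | _ | _ = m , um , rm , λ { _ _ (here refl) e′ → case trans (sym e) e′ of λ () ; x y (there p) e′ → cov x y p e′ }
  ...   | true | yes u∈ | _ = m , um , rm , λ { _ _ (here refl) _ → inj₁ u∈ ; x y (there p) e′ → cov x y p e′ }
  ...   | true | no _ | yes v∈ = m , um , rm , λ { _ _ (here refl) _ → inj₂ v∈ ; x y (there p) e′ → cov x y p e′ }
  ...   | true | no u∉ | no v∉ = (u , v) ∷ m ,
            ((λ { refl → case trans (sym e) (irr u) of λ () }) ∷ All.tabulate (λ x∈ eq → u∉ (subst (_∈ ends m) (sym eq) x∈))) ∷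
            All.tabulate (λ x∈ eq → v∉ (subst (_∈ ends m) (sym eq) x∈)) ∷ um ,
            e ∷ rm ,
            λ { _ _ (here refl) _ → inj₁ (here refl) ; x y (there p) e′ → [ (λ a → inj₁ (there (there a))) , (λ b → inj₂ (there (there b))) ]′ (cov x y p e′) }

-- Nearly k-partite graphs

NearBy : ∀ {n k} → Graph n → Vec (Fin k) n → Vec Bool n → Set
NearBy G c W = ∀ x y → Arc G x y → lookup c x ≡ lookup c y → lookup W x ≡ true ⊎ lookup W y ≡ true

Near : ∀ k → ℕ → ∀ {n} → Graph n → Set
Near k w {n} G = Σ (Vec (Fin k) n) λ c → Σ (Vec Bool n) λ W → # (lookup W) ≤ w × NearBy G c W

DKBlock : ∀ {n s k} → Graph n → ℕ → Vec (Vec (Fin n) s) k → Set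
DKBlock G μ S = Distinct S × ∀ i j → i ≢ j → Disp G μ (InPart (lookup S i)) (InPart (lookup S j))

-- Compares a product having two exceptional factors with a constant one. The factors `C` put back
-- at `i` and `j` take the place of a division.
onlyAt₂-bound : ∀ {k} (g : Fin k → ℕ) i j A B C → i ≢ j → g i ≤ A → g j ≤ B → (∀ l → l ≢ i → l ≢ j → g l ≤ C) → prodF g * (C * C) ≤ C ^ k * (A * B)
onlyAt₂-bound {k} g i j A B C i≢j gi gj gl = begin
  prodF g * (C * C)                                              ≡⟨ cong (prodF g *_) (sym (cong₂ _*_ (prodF-onlyAt i C) (prodF-onlyAt j C))) ⟩
  prodF g * (prodF (onlyAt i C) * prodF (onlyAt j C))            ≡⟨ cong (prodF g *_) (sym (prodF-* (onlyAt i C) (onlyAt j C))) ⟩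
  prodF g * prodF (λ l → onlyAt i C l * onlyAt j C l)            ≡⟨ sym (prodF-* g (λ l → onlyAt i C l * onlyAt j C l)) ⟩
  prodF (λ l → g l * (onlyAt i C l * onlyAt j C l))              ≤⟨ prodF-mono pt ⟩
  prodF (λ l → C * (onlyAt i A l * onlyAt j B l))                ≡⟨ prodF-* (λ _ → C) (λ l → onlyAt i A l * onlyAt j B l) ⟩
  prodF {k} (λ _ → C) * prodF (λ l → onlyAt i A l * onlyAt j B l) ≡⟨ cong₂ _*_ (prodF-const k C) (trans (prodF-* (onlyAt i A) (onlyAt j B)) (cong₂ _*_ (prodF-onlyAt i A) (prodF-onlyAt j B))) ⟩
  C ^ k * (A * B) ∎
  where
  open ≤-Reasoning
  pt : ∀ l → g l * (onlyAt i C l * onlyAt j C l) ≤ C * (onlyAt i A l * onlyAt j B l)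
  pt l with i Fin.≟ l | j Fin.≟ l
  ... | yes refl | yes refl = ⊥-elim (i≢j refl)
  ... | yes refl | no ne rewrite onlyAt-same i C | onlyAt-same i A | onlyAt-other {i = j} C ne | onlyAt-other {i = j} B ne | *-identityʳ C | *-identityʳ A = ≤-trans (*-monoˡ-≤ C gi) (≤-reflexive (*-comm A C))
  ... | no ne | yes refl rewrite onlyAt-same j C | onlyAt-same j B | onlyAt-other {i = i} C ne | onlyAt-other {i = i} A ne | +-identityʳ C | +-identityʳ B = ≤-trans (*-monoˡ-≤ C gj) (≤-reflexive (*-comm B C))
  ... | no ne | no ne′ rewrite onlyAt-other {i = i} C ne | onlyAt-other {i = i} A ne | onlyAt-other {i = j} C ne′ | onlyAt-other {i = j} B ne′ = *-monoˡ-≤ 1 (gl l (ne ∘ sym) (ne′ ∘ sym))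

onlyAt-bound : ∀ {k} (g : Fin k → ℕ) i A C → g i ≤ A → (∀ l → l ≢ i → g l ≤ C) → prodF g * C ≤ C ^ k * A
onlyAt-bound {k} g i A C gi gl = begin
  prodF g * C                                   ≡⟨ cong (prodF g *_) (sym (prodF-onlyAt i C)) ⟩
  prodF g * prodF (onlyAt i C)                  ≡⟨ sym (prodF-* g (onlyAt i C)) ⟩
  prodF (λ l → g l * onlyAt i C l)              ≤⟨ prodF-mono pt ⟩
  prodF (λ l → C * onlyAt i A l)                ≡⟨ prodF-* (λ _ → C) (onlyAt i A) ⟩
  prodF {k} (λ _ → C) * prodF (onlyAt i A)      ≡⟨ cong₂ _*_ (prodF-const k C) (prodF-onlyAt i A) ⟩
  C ^ k * A ∎
  where
  open ≤-Reasoning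
  pt : ∀ l → g l * onlyAt i C l ≤ C * onlyAt i A l
  pt l with i Fin.≟ l
  ... | yes refl rewrite onlyAt-same i C | onlyAt-same i A = ≤-trans (*-monoˡ-≤ C gi) (≤-reflexive (*-comm A C))
  ... | no ne rewrite onlyAt-other {i = i} C ne | onlyAt-other {i = i} A ne = *-monoˡ-≤ 1 (gl l (ne ∘ sym))

bothOut : State × State → Bool
bothOut (x , y) = sees true x ∧ sees true y

card-notBothOut : ∀ both → Card≤ (λ p → (Ok both (proj₁ p) × Ok both (proj₂ p)) × bothOut p ≡ false) (arity both * arity both ∸ 1)
card-notBothOut both = card-⊆ (λ { p (okp , e) → return (okp , λ { refl → case e of λ () }) })
  (card-remove ((true , false) , (true , false)) (o both , o both) (subst (Card≤ _) (sym (m+[n∸m]≡n {1} (s≤ both))) (card-× (card-Ok both) (card-Ok both))))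
  where
  o : ∀ both → Ok both (true , false)
  o true = refl
  o false = refl
  s≤ : ∀ both → 1 ≤ arity both * arity both
  s≤ true = s≤s z≤n
  s≤ false = s≤s z≤n

module NotNear (both : Bool) (k″ s μ w : ℕ) .⦃ _ : NonZero μ ⦄ where
  k′ k q : ℕ
  k′ = suc k″
  k = suc k′
  q = arity both

  instance
    q≢0 : NonZero q
    q≢0 = arity≢0 both
    2μ≢0 : NonZero (2 * μ)
    2μ≢0 = m*n≢0 2 μ

  θ : ℕ
  θ = suc k * (2 * μ) * (2 * μ) ^ suc k

  Row : Set
  Row = Vec (Vec State s) k

  ColourOk : Fin k → Row → Set
  ColourOk i ρ = OkRow both ρ × # (sees true ∘ lookup (lookup ρ i)) < θ × # (sees false ∘ lookup (lookup ρ i)) < θ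

  common : Row → Row → Fin k → Fin s → Bool
  common ρ ρ′ j a = bothOut (ρ ⟪ j ⟫ a , ρ′ ⟪ j ⟫ a)

  PairOk : Fin k → Row × Row → Set
  PairOk i (ρ , ρ′) = ColourOk i ρ × ColourOk i ρ′ × ¬ ¬ ∃ λ j → j ≢ i × # common ρ ρ′ j < θ

  -- `Q` counts all rows towards one part, `fu` the sparse ones, `nb` the pairs of rows with few
  -- common out-neighbours. A single vertex has at most `α` rows, a matched pair at most `β`, and up
  -- to lower-order factors `β` is `α * α` times `(1 - 1/q²) ^ s`.
  Q fu nb α β : ℕ
  Q = q ^ s
  fu = (1 + 4 * s) ^ (2 * θ)
  nb = (q * q ∸ 1) ^ s * (1 + q * q * s) ^ θ
  α = Q ^ k′ * fu
  β = k * ((Q * Q) ^ k″ * (fu * fu * nb))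

  Q≢0 : NonZero Q
  Q≢0 = m^n≢0 q s

  sparse-colour : ∀ i ρ → ColourOk i ρ → Sparse (2 * θ) (lookup ρ i)
  sparse-colour i ρ (_ , a , b) = sparse-intro (lookup ρ i) (2 * θ)
    (≤-trans (#-nonzero (lookup ρ i)) (≤-trans (+-mono-≤ (<⇒≤ a) (<⇒≤ b)) (≤-reflexive (cong (θ +_) (sym (+-identityʳ θ))))))

  card-colour : ∀ i → Card≤ (ColourOk i) α
  card-colour i = card-mono (*-cancelʳ-≤ _ _ Q ⦃ Q≢0 ⦄ (≤-trans (onlyAt-bound g i fu Q gi gl) (≤-reflexive (r Q (Q ^ k′) fu))))
    (card-⊆ (λ ρ c → return (λ l → (λ a → proj₁ c l a) , λ { refl → sparse-colour i ρ c })) (card-Π {Q = λ l x → (∀ a → Ok both (lookup x a)) × (i ≡ l → Sparse (2 * θ) x)} {g = g} each))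
    where
    r : ∀ a b c → a * b * c ≡ b * c * a
    r = solve-∀
    g : Fin k → ℕ
    g l = if does (i Fin.≟ l) then fu else Q
    gi : g i ≤ fu
    gi with i Fin.≟ i
    ... | yes _ = ≤-refl
    ... | no n = ⊥-elim (n refl)
    gl : ∀ l → l ≢ i → g l ≤ Q
    gl l ne with i Fin.≟ l
    ... | yes e = ⊥-elim (ne (sym e))
    ... | no _ = ≤-refl
    each : ∀ l → Card≤ (λ x → (∀ a → Ok both (lookup x a)) × (i ≡ l → Sparse (2 * θ) x)) (g l)
    each l with i Fin.≟ l
    ... | yes e = card-⊆ (λ x p → return (proj₂ p e)) (card-Sparse (2 * θ))
    ... | no _ = card-⊆ (λ x p → return (proj₁ p)) (card-Vec s (card-Ok both))

  CommonFew : Vec State s × Vec State s → Set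
  CommonFew (x , y) = (∀ a → Ok both (lookup x a)) × (∀ a → Ok both (lookup y a)) × # (λ a → bothOut (lookup x a , lookup y a)) < θ

  card-common : Card≤ CommonFew nb
  card-common = card-mono (≤-trans (countFew-poly {s} (λ _ → q * q ∸ 1) (q * q) (λ _ → true) θ (λ _ → pos both)) (≤-reflexive (cong (_* (1 + q * q * s) ^ θ) (prodF-const s (q * q ∸ 1)))))
    (card-inj {Q = Few (λ _ p → (Ok both (proj₁ p) × Ok both (proj₂ p)) × bothOut p ≡ false) (λ p → Ok both (proj₁ p) × Ok both (proj₂ p)) (λ _ → true) θ} (λ (x , y) → Vec.zip x y)
      (λ { (x , y) (x′ , y′) _ _ e → zip-inj x y x′ y′ e })
      (λ { (x , y) (ox , oy , lt) → few-intro (λ _ → bothOut) (Vec.zip x y) θ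
          (λ a e → oks x y ox oy a , e) (λ a _ → refl , oks x y ox oy a)
          (≤-trans (≤-reflexive (sumF-cong λ a → cong (𝟙 ∘ bothOut) (Vecₚ.lookup-zip a x y))) (<⇒≤ lt)) })
      (card-few (λ _ → true) θ (λ _ → card-notBothOut both) (card-× (card-Ok both) (card-Ok both))))
    where
    pos : ∀ both → 1 ≤ arity both * arity both ∸ 1
    pos true = s≤s z≤n
    pos false = s≤s z≤n
    oks : ∀ x y → (∀ a → Ok both (lookup x a)) → (∀ a → Ok both (lookup y a)) → ∀ a → Ok both (proj₁ (lookup (Vec.zip x y) a)) × Ok both (proj₂ (lookup (Vec.zip x y) a))
    oks x y ox oy a = subst (λ p → Ok both (proj₁ p) × Ok both (proj₂ p)) (sym (Vecₚ.lookup-zip a x y)) (ox a , oy a)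
    zip-inj : ∀ {s} (x y x′ y′ : Vec State s) → Vec.zip x y ≡ Vec.zip x′ y′ → (x , y) ≡ (x′ , y′)
    zip-inj x y x′ y′ e = cong₂ _,_ (trans (sym (Vecₚ.map-proj₁-zip x y)) (trans (cong (Vec.map proj₁) e) (Vecₚ.map-proj₁-zip x′ y′)))
                                    (trans (sym (Vecₚ.map-proj₂-zip x y)) (trans (cong (Vec.map proj₂) e) (Vecₚ.map-proj₂-zip x′ y′)))

  card-pair : ∀ i → Card≤ (PairOk i) β
  card-pair i = card-bind {R = λ j p → j ≢ i × ColourOk i (proj₁ p) × ColourOk i (proj₂ p) × # common (proj₁ p) (proj₂ p) j < θ} (card-fin {k})
      (λ j _ → card-rep λ { _ (j≢i , _) → fixed j j≢i })
      (λ { _ (a , b , ex) → ex >>= λ { (j , ne , lt) → return (j , tt , ne , a , b , lt) } })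
    where
    module _ (j : Fin k) (j≢i : j ≢ i) where
      Fix : Row × Row → Set
      Fix p = j ≢ i × ColourOk i (proj₁ p) × ColourOk i (proj₂ p) × # common (proj₁ p) (proj₂ p) j < θ
      At : Fin k → Vec State s × Vec State s → Set
      At l p = ((∀ a → Ok both (lookup (proj₁ p) a)) × (∀ a → Ok both (lookup (proj₂ p) a))) ×
        (i ≡ l → Sparse (2 * θ) (proj₁ p) × Sparse (2 * θ) (proj₂ p)) × (j ≡ l → CommonFew p)
      g : Fin k → ℕ
      g l = if does (i Fin.≟ l) then fu * fu else (if does (j Fin.≟ l) then nb else Q * Q)
      each : ∀ l → Card≤ (At l) (g l)
      each l with i Fin.≟ l | j Fin.≟ l
      ... | yes e | _ = card-⊆ (λ p c → return (proj₁ (proj₂ c) e)) (card-× (card-Sparse (2 * θ)) (card-Sparse (2 * θ)))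
      ... | no _ | yes e = card-⊆ (λ p c → return (proj₂ (proj₂ c) e)) card-common
      ... | no _ | no _ = card-⊆ (λ p c → return (proj₁ c)) (card-× (card-Vec s (card-Ok both)) (card-Vec s (card-Ok both)))
      gi : g i ≤ fu * fu
      gi with i Fin.≟ i
      ... | yes _ = ≤-refl
      ... | no n = ⊥-elim (n refl)
      gj : g j ≤ nb
      gj with i Fin.≟ j | j Fin.≟ j
      ... | yes e | _ = ⊥-elim (j≢i (sym e))
      ... | no _ | yes _ = ≤-refl
      ... | no _ | no n = ⊥-elim (n refl)
      gl : ∀ l → l ≢ i → l ≢ j → g l ≤ Q * Q
      gl l ne ne′ with i Fin.≟ l | j Fin.≟ l
      ... | yes e | _ = ⊥-elim (ne (sym e))
      ... | no _ | yes e = ⊥-elim (ne′ (sym e))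
      ... | no _ | no _ = ≤-refl
      r : ∀ C X Y → C * (C * X) * Y ≡ X * Y * (C * C)
      r = solve-∀
      fixed : Card≤ Fix ((Q * Q) ^ k″ * (fu * fu * nb))
      fixed = card-mono (*-cancelʳ-≤ _ _ (Q * Q * (Q * Q)) ⦃ m*n≢0 (Q * Q) (Q * Q) ⦃ m*n≢0 Q Q ⦃ Q≢0 ⦄ ⦃ Q≢0 ⦄ ⦄ ⦃ m*n≢0 Q Q ⦃ Q≢0 ⦄ ⦃ Q≢0 ⦄ ⦄ ⦄
            (≤-trans (onlyAt₂-bound g i j (fu * fu) nb (Q * Q) (j≢i ∘ sym) gi gj gl) (≤-reflexive (r (Q * Q) ((Q * Q) ^ k″) (fu * fu * nb)))))
        (card-inj {Q = λ v → ∀ l → At l (lookup v l)} (λ (ρ , ρ′) → Vec.zip ρ ρ′)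
          (λ { (x , y) (x′ , y′) _ _ e → cong₂ _,_ (trans (sym (Vecₚ.map-proj₁-zip x y)) (trans (cong (Vec.map proj₁) e) (Vecₚ.map-proj₁-zip x′ y′)))
                                    (trans (sym (Vecₚ.map-proj₂-zip x y)) (trans (cong (Vec.map proj₂) e) (Vecₚ.map-proj₂-zip x′ y′))) })
          (λ { (ρ , ρ′) (_ , c , c′ , lt) l → subst (At l) (sym (Vecₚ.lookup-zip l ρ ρ′))
               ((proj₁ c l , proj₁ c′ l) , (λ { refl → sparse-colour i ρ c , sparse-colour i ρ′ c′ }) , λ { refl → proj₁ c l , proj₁ c′ l , lt }) })
          (card-Π each))

  module _ {n : ℕ} (S : Vec (Vec (Fin n) s) k) where

    module _ (G : Graph n) (free : Free both k G) (blk : DKBlock G μ S) where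
      open Parts {both} {k′} G free (λ i → InPart (lookup S i)) (2 * μ) (2 * μ)
        (λ i j ne → disp⇒rich G μ _ _ (proj₂ blk i j ne)) using (Fits; few-in-some-part; few-common-outs)

      seen : (Fin k → Fin s → Bool) → Fin k → List (Fin n)
      seen b i = map (lookup (lookup S i)) (proj₁ (positions (b i)))

      seen-fits : ∀ b → Fits (seen b)
      seen-fits b i = let xs , u , _ , _ = positions (b i) in
        Uniqueₚ.map⁺ (λ {x} {y} e → proj₂ (proj₁ blk i x i y e)) u , Allₚ.map⁺ (All.universal (λ a → a , refl) xs)

      seen-length : ∀ b i → length (seen b i) ≡ # b i
      seen-length b i = let xs , _ , _ , e = positions (b i) in trans (Listₚ.length-map _ xs) e

      seen-All : ∀ b i {P : Fin n → Set} → (∀ a → b i a ≡ true → P (S ⟪ i ⟫ a)) → All P (seen b i)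
      seen-All b i h = let xs , _ , al , _ = positions (b i) in Allₚ.map⁺ (All.map (λ {a} → h a) al)

      coloured : ∀ v → ¬ ¬ ∃ λ i → ColourOk i (rowOf G S v)
      coloured v = few-in-some-part v (seen (b true)) (seen (b false)) (seen-fits (b true)) (seen-fits (b false))
          (λ i → seen-All (b true) i λ a e → trans (cong (sees true) (sym (lookup-rowOf G S v i a))) e)
          (λ i → seen-All (b false) i λ a e → trans (cong (sees false) (sym (lookup-rowOf G S v i a))) e)
          >>= λ { (i , lt , lt′) → return (i , rowOf-ok both G free S v , subst (_< θ) (seen-length (b true) i) lt , subst (_< θ) (seen-length (b false) i) lt′) }
        where
        b : Bool → Fin k → Fin s → Bool
        b ε i a = sees ε (rowOf G S v ⟪ i ⟫ a)

      paired : ∀ u v → Arc G u v → ∀ i → ¬ ¬ ∃ λ j → j ≢ i × # common (rowOf G S u) (rowOf G S v) j < θ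
      paired u v uv i = few-common-outs u v uv i (seen b) (seen-fits b)
          (λ j → seen-All b j λ a e → let e₁ , e₂ = split _ _ e in
            trans (cong (sees true) (sym (lookup-rowOf G S u j a))) e₁ , trans (cong (sees true) (sym (lookup-rowOf G S v j a))) e₂)
          >>= λ { (j , ne , lt) → return (j , ne , subst (_< θ) (seen-length b j) lt) }
        where
        b = common (rowOf G S u) (rowOf G S v)
        split : ∀ x y → x ∧ y ≡ true → x ≡ true × y ≡ true
        split true true _ = refl , refl

    At : Graph n → Set
    At G = Free both k G × DKBlock G μ S × ¬ Near k w G

    Coloured : Vec (Fin k) n → Graph n → Set
    Coloured c G = ∀ v → ColourOk (lookup c v) (rowOf G S v)

    module _ (distS : Distinct S) (G₀ : Graph n) (free₀ : Free both k G₀) (c : Vec (Fin k) n) where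
      Sl = vertices S

      -- The pairs inside colour classes, away from the parts. They are read off `G₀` and `c` alone,
      -- so the same matching `mt` serves every graph that agrees with `G₀` outside the parts, and
      -- it does not have to be guessed.
      R : Fin n → Fin n → Bool
      R u v = (adj G₀ u v ∨ adj G₀ v u) ∧ (does (lookup c u Fin.≟ lookup c v) ∧ (not (Member Sl u) ∧ not (Member Sl v)))

      R-irr : ∀ v → R v v ≡ false
      R-irr v rewrite proj₁ (proj₁ free₀) v = refl

      R-elim : ∀ u v → R u v ≡ true → (Arc G₀ u v ⊎ Arc G₀ v u) × lookup c u ≡ lookup c v × u ∉ Sl × v ∉ Sl
      R-elim u v e with adj G₀ u v | adj G₀ v u | lookup c u Fin.≟ lookup c v | Member Sl u in eu | Member Sl v in ev
      ... | true | _ | yes eq | false | false = inj₁ refl , eq , (λ m → case trans (sym eu) (member-true Sl m) of λ ()) , (λ m → case trans (sym ev) (member-true Sl m) of λ ())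
      ... | false | true | yes eq | false | false = inj₂ refl , eq , (λ m → case trans (sym eu) (member-true Sl m) of λ ()) , (λ m → case trans (sym ev) (member-true Sl m) of λ ())
      R-elim u v () | true | _ | yes eq | true | _
      R-elim u v () | true | _ | yes eq | false | true
      R-elim u v () | true | _ | no _ | _ | _
      R-elim u v () | false | true | yes _ | true | _
      R-elim u v () | false | true | yes _ | false | true
      R-elim u v () | false | true | no _ | _ | _
      R-elim u v () | false | false | _ | _ | _

      R-intro : ∀ u v → Arc G₀ u v → lookup c u ≡ lookup c v → u ∉ Sl → v ∉ Sl → R u v ≡ true
      R-intro u v a e u∉ v∉ rewrite a | dec-true (lookup c u Fin.≟ lookup c v) e | dec-false (_∈?_ Fin._≟_ u Sl) u∉ | dec-false (_∈?_ Fin._≟_ v Sl) v∉ = refl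

      mt = proj₁ (matching R R-irr)
      mt-unique = proj₁ (proj₂ (matching R R-irr))
      mt-R = proj₁ (proj₂ (proj₂ (matching R R-irr)))
      mt-cover = proj₂ (proj₂ (proj₂ (matching R R-irr)))

      used = ends mt ++ Sl

      ends-∉ : ∀ (m : List (Fin n × Fin n)) → All (λ (u , v) → R u v ≡ true) m → All (_∉ Sl) (ends m)
      ends-∉ [] [] = []
      ends-∉ ((u , v) ∷ m) (e ∷ es) = let _ , _ , u∉ , v∉ = R-elim u v e in u∉ ∷ v∉ ∷ ends-∉ m es

      used-unique : Unique used
      used-unique = Uniqueₚ.++⁺ mt-unique (vertices-unique S distS) λ { (a , b) → All.lookup (ends-∉ mt mt-R) a b }

      used-length : length used ≡ 2 * length mt + k * s
      used-length = trans (Listₚ.length-++ (ends mt)) (cong₂ _+_ (length-ends mt) (vertices-length S))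

      module Sk = Skeleton both k used used-unique

      near : ∀ G → Agree Sl G G₀ → 2 * length mt + k * s ≤ w → Near k w G
      near G ag le = c , W , ≤-trans (#-≤ (card-⊆ (λ v e → return (member-∈ used (trans (sym (Vecₚ.lookup∘tabulate (Member used) v)) e))) (card-∈ used))) (≤-trans (≤-reflexive used-length) le) , nb′
        where
        W = Vec.tabulate (Member used)
        inW : ∀ v → v ∈ used → lookup W v ≡ true
        inW v m = trans (Vecₚ.lookup∘tabulate (Member used) v) (member-true used m)
        nb′ : NearBy G c W
        nb′ x y a e with _∈?_ Fin._≟_ x Sl | _∈?_ Fin._≟_ y Sl
        ... | yes x∈ | _ = inj₁ (inW x (∈-++⁺ʳ (ends mt) x∈))
        ... | no _ | yes y∈ = inj₂ (inW y (∈-++⁺ʳ (ends mt) y∈))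
        ... | no x∉ | no y∉ = [ (λ m → inj₁ (inW x (∈-++⁺ˡ m))) , (λ m → inj₂ (inW y (∈-++⁺ˡ m))) ]′ (mt-cover x y (R-intro x y (trans (sym (ag x y x∉ y∉)) a) e x∉ y∉))

      Here : Graph n → Set
      Here G = At G × Agree Sl G G₀ × Coloured c G

      bound : ∀ X → (w < 2 * length mt + k * s → 2 * length mt + k * s ≤ n → β ^ length mt * (((Q ^ k) ^ (k * s)) * (α ^ (n ∸ (2 * length mt + k * s)))) ≤ X) → Card≤ Here X
      bound X h with 2 * length mt + k * s ≤? w
      ... | yes le = card-∅ λ { G ((_ , _ , far) , ag , _) → far (near G ag le) }
      ... | no nle = card-mono (≤-trans (≤-reflexive (cong (β ^ length mt *_) (cong₂ _*_ (cong ((Q ^ k) ^_) (vertices-length S)) (trans (*-identityʳ _) (cong (α ^_) rest-len))))) (h (≰⇒> nle) used≤))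
            -- Rows are revealed for the matched pairs, for the vertices of the parts, and for all
            -- other vertices; the three groups cover every vertex.
            (card-iter {Ok = λ (u , v) p → PairOk (lookup c u) p} (λ (u , v) G → rowOf G S u , rowOf G S v) mt
              (λ (u , v) _ → card-pair (lookup c u))
              (λ { G (at , ag , col) (u , v) m → stable-pair G at ag col u v m })
              (λ G₁ _ → card-iter {Ok = λ _ → OkRow both} (λ v G → rowOf G S v) Sl (λ v _ → card-OkRow both s k)
                (λ { G ((at , _) , _) v _ → rowOf-ok both G (proj₁ at) S v })
                (λ G₂ _ → card-iter {Ok = λ v → ColourOk (lookup c v)} (λ v G → rowOf G S v) Sk.rest (λ v _ → card-colour (lookup c v))
                  (λ { G (((_ , _ , col) , _) , _) v _ → col v })
                  (λ G₃ _ → card-1 λ { G H (((( _ , ag , _) , e₁) , e₂) , e₃) ((((_ , ah , _) , f₁) , f₂) , f₃) →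
                     rowOf-det S (λ x y x∉ y∉ → trans (ag x y x∉ y∉) (sym (ah x y x∉ y∉)))
                       (λ v → all G H G₁ G₂ G₃ v (λ u v m → trans (e₁ (u , v) m) (sym (f₁ (u , v) m))) (λ m → trans (e₂ v m) (sym (f₂ v m))) (λ m → trans (e₃ v m) (sym (f₃ v m)))) }))))
        where
        rest-len : length Sk.rest ≡ n ∸ (2 * length mt + k * s)
        rest-len = trans (sym (m+n∸n≡m (length Sk.rest) (2 * length mt + k * s))) (cong (_∸ (2 * length mt + k * s)) (trans (cong (length Sk.rest +_) (sym used-length)) Sk.length-rest))
        used≤ : 2 * length mt + k * s ≤ n
        used≤ = ≤-trans (m≤n+m _ (length Sk.rest)) (≤-reflexive (trans (cong (length Sk.rest +_) (sym used-length)) Sk.length-rest))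
        stable-pair : ∀ G → At G → Agree Sl G G₀ → Coloured c G → ∀ u v → (u , v) ∈ mt → PairOk (lookup c u) (rowOf G S u , rowOf G S v)
        stable-pair G (free , blk , _) ag col u v m with R-elim u v (All.lookup mt-R m)
        ... | arc , e , u∉ , v∉ = col u , subst (λ i → ColourOk i (rowOf G S v)) (sym e) (col v) , dir arc
          where
          dir : Arc G₀ u v ⊎ Arc G₀ v u → ¬ ¬ ∃ λ j → j ≢ lookup c u × # common (rowOf G S u) (rowOf G S v) j < θ
          dir (inj₁ a) = paired G free blk u v (trans (ag u v u∉ v∉) a) (lookup c u)
          dir (inj₂ a) = paired G free blk v u (trans (ag v u v∉ u∉) a) (lookup c u) >>= λ { (j , ne , lt) →
            return (j , ne , subst (_< θ) (sumF-cong λ x → cong 𝟙 (∧-comm (sees true (rowOf G S v ⟪ j ⟫ x)) _)) lt) }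
        pairRows : ∀ (G H : Graph n) (m : List (Fin n × Fin n)) → (∀ u v → (u , v) ∈ m → (rowOf G S u , rowOf G S v) ≡ (rowOf H S u , rowOf H S v)) → ∀ {v} → v ∈ ends m → rowOf G S v ≡ rowOf H S v
        pairRows G H ((x , y) ∷ m) h (here refl) = cong proj₁ (h x y (here refl))
        pairRows G H ((x , y) ∷ m) h (there (here refl)) = cong proj₂ (h x y (here refl))
        pairRows G H ((x , y) ∷ m) h (there (there v∈)) = pairRows G H m (λ u v p → h u v (there p)) v∈
        all : ∀ (G H G₁ G₂ G₃ : Graph n) v → (∀ u v → (u , v) ∈ mt → (rowOf G S u , rowOf G S v) ≡ (rowOf H S u , rowOf H S v)) →
          (v ∈ Sl → rowOf G S v ≡ rowOf H S v) → (v ∈ Sk.rest → rowOf G S v ≡ rowOf H S v) → rowOf G S v ≡ rowOf H S v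
        all G H G₁ G₂ G₃ v h₁ h₂ h₃ with _∈?_ Fin._≟_ v used
        ... | no v∉ = h₃ (∈-filter⁺ Sk.out? (∈-allFin v) v∉)
        ... | yes v∈ = [ pairRows G H mt h₁ , h₂ ]′ (∈-++⁻ (ends mt) v∈)

    card-At : ∀ {m} X → k * s + m ≡ n →
      (∀ a → w < 2 * a + k * s → 2 * a + k * s ≤ n → β ^ a * (((Q ^ k) ^ (k * s)) * (α ^ (n ∸ (2 * a + k * s)))) ≤ X) →
      Card≤ At (numFree both k m * (k ^ n * X))
    card-At {m} X len h = card-rep λ { G₀ (free₀ , (distS , _) , _) →
      Skeleton.skeleton both k (vertices S) (vertices-unique S distS) At (trans (cong (_+ m) (vertices-length S)) len) (λ G → proj₁)
        (λ G₁ at₁ → card-bind {R = λ c G → At G × Agree (vertices S) G G₁ × Coloured c G} (card-All (card-fin {k}))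
          (λ c _ → bound distS G₁ (proj₁ at₁) c X (h (length (mt distS G₁ (proj₁ at₁) c))))
          (λ { G (at@(free , blk , _) , ag) → ¬¬-choice (coloured G free blk) >>= λ { (c , col) → return (c , tt , at , ag , col) } })) }

  Bad : ∀ {n} → Graph n → Set
  Bad {n} G = Free both k G × Σ (Vec (Vec (Fin n) s) k) (DKBlock G μ) × ¬ Near k w G

  card-Bad : ∀ n m X → k * s + m ≡ n →
    (∀ a → w < 2 * a + k * s → 2 * a + k * s ≤ n → β ^ a * (((Q ^ k) ^ (k * s)) * (α ^ (n ∸ (2 * a + k * s)))) ≤ X) →
    Card≤ (Bad {n}) ((n ^ s) ^ k * (numFree both k m * (k ^ n * X)))
  card-Bad n m X len h = card-bind {R = λ S G → At S G} (card-All (card-All (card-fin {n}))) (λ S _ → card-At S X len h)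
    (λ { G (free , (S , blk) , far) → return (S , tt , free , blk , far) })

-- Balanced and rich colourings

distinct₁ : ∀ {n J} (S : Vec (Fin n) J) → Inj S → Distinct (S ∷ [])
distinct₁ S inj zero a zero b e = refl , inj a b e

toVec : ∀ {A : Set} J (xs : List A) → Unique xs → J ≤ length xs → Σ (Vec A J) λ v → (∀ a b → lookup v a ≡ lookup v b → a ≡ b) × (∀ a → lookup v a ∈ xs)
toVec zero xs u le = [] , (λ ()) , λ ()
toVec (suc J) (x ∷ xs) (x∉ ∷ u) (s≤s le) with toVec J xs u le
... | v , inj , sub = x ∷ v ,
  (λ { zero zero _ → refl ; zero (suc b) e → ⊥-elim (All.lookup x∉ (sub b) e) ; (suc a) zero e → ⊥-elim (All.lookup x∉ (sub a) (sym e)) ; (suc a) (suc b) e → cong suc (inj a b e) }) ,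
  λ { zero → here refl ; (suc a) → there (sub a) }

∧-true : ∀ {x y} → x ∧ y ≡ true → x ≡ true × y ≡ true
∧-true {true} {true} _ = refl , refl

not-true : ∀ {x} → not x ≡ true → x ≡ false
not-true {false} _ = refl

classOf-≡ : ∀ {n k} (c : Fin n → Fin k) i y → classOf c i y ≡ true → c y ≡ i
classOf-≡ c i y e with c y Fin.≟ i
... | yes eq = eq

core : ∀ {n k} → Vec (Fin k) n → Vec Bool n → Fin k → Fin n → Bool
core c W i y = classOf (lookup c) i y ∧ not (lookup W y)

core-elim : ∀ {n k} (c : Vec (Fin k) n) W i y → core c W i y ≡ true → lookup c y ≡ i × lookup W y ≡ false
core-elim c W i y e = let a , b = ∧-true e in classOf-≡ (lookup c) i y a , not-true b

core-large : ∀ {n k} (c : Vec (Fin k) n) W i → # classOf (lookup c) i ≤ # core c W i + # (lookup W)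
core-large c W i = ≤-trans (sumF-mono λ y → pt (classOf (lookup c) i y) (lookup W y)) (≤-reflexive (sumF-+ (𝟙 ∘ core c W i) (𝟙 ∘ lookup W)))
  where
  pt : ∀ a b → 𝟙 a ≤ 𝟙 (a ∧ not b) + 𝟙 b
  pt false b = z≤n
  pt true false = s≤s z≤n
  pt true true = s≤s z≤n

core-empty : ∀ {k n} {G : Graph n} {c : Vec (Fin k) n} {W i} → NearBy G c W → ∀ {x y} → core c W i x ≡ true → core c W i y ≡ true → st G x y ≡ (false , false)
core-empty {G = G} {c} {W} {i} near {x} {y} ex ey = cong₂ _,_ (noArc x y ex ey) (noArc y x ey ex)
  where
  noArc : ∀ x y → core c W i x ≡ true → core c W i y ≡ true → adj G x y ≡ false
  noArc x y ex ey with core-elim c W i x ex | core-elim c W i y ey | adj G x y in e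
  ... | cx , wx | cy , wy | false = refl
  ... | cx , wx | cy , wy | true with near x y e (trans cx (sym cy))
  ...   | inj₁ w = case trans (sym w) wx of λ ()
  ...   | inj₂ w = case trans (sym w) wy of λ ()

-- The core of a class spans no arc. So `J` core vertices of an oversized class attach only to the
-- vertices outside that core, and their number falls short of `(1 - 1/k) * n` by about `b / k`.
module Unbalanced (both : Bool) (k′ w b J : ℕ) where
  k q : ℕ
  k = suc k′
  q = arity both

  Big : ∀ {n} → Graph n → Set
  Big {n} G = Free both k G × Σ (Vec (Fin k) n) λ c → Σ (Vec Bool n) λ W → # (lookup W) ≤ w × NearBy G c W × ∃ λ i → n + b ≤ k * # classOf (lookup c) i

  card-Big : ∀ n m Z → 1 * J + m ≡ n → k * (J + w) ≤ n → (∀ z → k * z + b ≤ k′ * n + k * w → z ≤ Z) →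
    Card≤ (Big {n}) (k ^ n * (2 ^ n * (k * (n ^ J * (numFree both k m * ((q ^ J) ^ 1) ^ Z)))))
  card-Big n m Z len large zZ =
    card-bind {R = λ c G → ∃ λ W → ∃ λ i → ∃ λ S → At c W i S G} (card-All (card-fin {k})) (λ c _ →
      card-bind {R = λ W G → ∃ λ i → ∃ λ S → At c W i S G} (card-All card-Bool) (λ W _ →
        card-bind {R = λ i G → ∃ λ S → At c W i S G} (card-fin {k}) (λ i _ →
          card-bind {R = λ S G → At c W i S G} (card-All (card-fin {n})) (λ S _ → card-rep λ { _ (_ , _ , st) → card-At c W i S st })
            (λ { G (S , at) → return (S , tt , at) }))
          (λ { G (i , r) → return (i , tt , r) }))
        (λ { G (W , r) → return (W , tt , r) }))
      (λ { G (free , c , W , wW , near , i , big) → let S , inj , co = choose J (core c W i) (enough c W i wW big) in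
           return (c , tt , W , i , S , free , near , (inj , co , wW , big)) })
    where
    Static : Vec (Fin k) n → Vec Bool n → Fin k → Vec (Fin n) J → Set
    Static c W i S = Inj S × (∀ a → core c W i (lookup S a) ≡ true) × # (lookup W) ≤ w × n + b ≤ k * # classOf (lookup c) i
    At : Vec (Fin k) n → Vec Bool n → Fin k → Vec (Fin n) J → Graph n → Set
    At c W i S G = Free both k G × NearBy G c W × Static c W i S
    open ≤-Reasoning
    kcore : ∀ c W i → # (lookup W) ≤ w → n + b ≤ k * # classOf (lookup c) i → n + b ≤ k * # core c W i + k * w
    kcore c W i wW big = begin
      n + b ≤⟨ big ⟩
      k * # classOf (lookup c) i ≤⟨ *-monoʳ-≤ k (≤-trans (core-large c W i) (+-monoʳ-≤ (# core c W i) wW)) ⟩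
      k * (# core c W i + w) ≡⟨ *-distribˡ-+ k (# core c W i) w ⟩
      k * # core c W i + k * w ∎
    enough : ∀ c W i → # (lookup W) ≤ w → n + b ≤ k * # classOf (lookup c) i → J ≤ # core c W i
    enough c W i wW big = *-cancelˡ-≤ k (+-cancelʳ-≤ (k * w) (k * J) (k * # core c W i) (begin
      k * J + k * w ≡⟨ sym (*-distribˡ-+ k J w) ⟩
      k * (J + w) ≤⟨ large ⟩
      n ≤⟨ m≤m+n n b ⟩
      n + b ≤⟨ kcore c W i wW big ⟩
      k * # core c W i + k * w ∎))
    card-At : ∀ c W i S → Static c W i S → Card≤ (At c W i S) (numFree both k m * ((q ^ J) ^ 1) ^ Z)
    card-At c W i S (inj , co , wW , big) = Skeleton.skeleton both k (vertices (S ∷ [])) (vertices-unique (S ∷ []) (distinct₁ S inj)) (At c W i S)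
        (trans (cong (_+ m) (vertices-length (S ∷ []))) len) (λ G → proj₁)
        (λ G₁ _ → card-mono (≤-trans (≤-reflexive (prodF-if ((q ^ J) ^ 1) (not ∘ core c W i))) (^-monoʳ-≤ ((q ^ J) ^ 1) ⦃ m^n≢0 (q ^ J) 1 ⦃ m^n≢0 q J ⦃ arity≢0 both ⦄ ⦄ ⦄ (zZ (# (not ∘ core c W i)) zbound)))
          (card-inj {Q = λ v → ∀ y → Good y (lookup v y)} (λ G → Vec.tabulate (rowOf G (S ∷ [])))
            (λ { G H (_ , ag) (_ , ah) e → rowOf-det (S ∷ []) (λ x y x∉ y∉ → trans (ag x y x∉ y∉) (sym (ah x y x∉ y∉)))
              (λ v → trans (sym (Vecₚ.lookup∘tabulate (rowOf G (S ∷ [])) v)) (trans (cong (λ R → lookup R v) e) (Vecₚ.lookup∘tabulate (rowOf H (S ∷ [])) v))) })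
            (λ { G ((free , near , _) , _) y → subst (Good y) (sym (Vecₚ.lookup∘tabulate (rowOf G (S ∷ [])) y))
                 (rowOf-ok both G free (S ∷ []) y , λ { ey zero a → trans (lookup-rowOf G (S ∷ []) y zero a) (core-empty {G = G} {c} {W} {i} near ey (co a)) }) })
            (card-Π card-good)))
      where
      Good : Fin n → Vec (Vec State J) 1 → Set
      Good y ρ = OkRow both ρ × (core c W i y ≡ true → ∀ j a → ρ ⟪ j ⟫ a ≡ (false , false))
      ext₂ : ∀ {ρ σ : Vec (Vec State J) 1} → (∀ j a → ρ ⟪ j ⟫ a ≡ (false , false)) → (∀ j a → σ ⟪ j ⟫ a ≡ (false , false)) → ρ ≡ σ
      ext₂ {x ∷ []} {y ∷ []} hx hy = cong (_∷ []) (ext x y (hx zero) (hy zero))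
        where
        ext : ∀ {J} (x y : Vec State J) → (∀ a → lookup x a ≡ (false , false)) → (∀ a → lookup y a ≡ (false , false)) → x ≡ y
        ext [] [] _ _ = refl
        ext (a ∷ x) (b ∷ y) hx hy = cong₂ _∷_ (trans (hx zero) (sym (hy zero))) (ext x y (hx ∘ suc) (hy ∘ suc))
      card-good : ∀ y → Card≤ (Good y) (if not (core c W i y) then (q ^ J) ^ 1 else 1)
      card-good y with core c W i y
      ... | true = card-1 λ ρ σ p p′ → ext₂ (proj₂ p refl) (proj₂ p′ refl)
      ... | false = card-⊆ (λ ρ p → return (proj₁ p)) (card-OkRow both J 1)
      zbound : k * # (not ∘ core c W i) + b ≤ k′ * n + k * w
      zbound = +-cancelˡ-≤ (n + k * # core c W i) _ _ (begin
        n + k * z₁ + (k * z + b) ≡⟨ e₁ n k z₁ z b ⟩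
        k * (z + z₁) + (n + b) ≤⟨ +-mono-≤ (≤-reflexive (cong (k *_) (#-not (core c W i)))) (kcore c W i wW big) ⟩
        k * n + (k * z₁ + k * w) ≡⟨ e₂ n k′ z₁ w ⟩
        n + k * z₁ + (k′ * n + k * w) ∎)
        where
        z = # (not ∘ core c W i)
        z₁ = # core c W i
        e₁ : ∀ n k z₁ z b → n + k * z₁ + (k * z + b) ≡ k * (z + z₁) + (n + b)
        e₁ = solve-∀
        e₂ : ∀ n k′ z₁ w → (1 + k′) * n + ((1 + k′) * z₁ + (1 + k′) * w) ≡ n + (1 + k′) * z₁ + (k′ * n + (1 + k′) * w)
        e₂ = solve-∀

2^11≤q^7 : ∀ both → 2 ^ 11 ≤ arity both ^ 7
2^11≤q^7 true = m≤m+n 2048 14336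
2^11≤q^7 false = m≤m+n 2048 139

Balanced : ∀ {n k} → ℕ → Vec (Fin k) n → Set
Balanced {n} {k} b c = ∀ i → n ≤ k * # classOf (lookup c) i + (k ∸ 1) * b

ColourRich : ∀ {n k} → Graph n → ℕ → ℕ → Vec (Fin k) n → Set
ColourRich G t C c = ∀ i j → i ≢ j → Rich G t C (λ v → lookup c v ≡ i) (λ v → lookup c v ≡ j)

module NotRich (both : Bool) (k′ w b J t C : ℕ) .⦃ _ : NonZero C ⦄
  (few-bound : ∀ {n} (g : Fin n → ℕ) (bb : Fin n → Bool) (j : ℕ) → (∀ i → 1 ≤ g i) → C * j ≤ # bb → countFew g 4 bb j ^ 2 ≤ 2 ^ # bb * prodF g ^ 2) where
  k q : ℕ
  k = suc k′
  q = arity both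

  instance
    q≢0 : NonZero q
    q≢0 = arity≢0 both

  Poor : ∀ {n} → Graph n → Set
  Poor {n} G = Free both k G × Σ (Vec (Fin k) n) λ c → Σ (Vec Bool n) λ W → # (lookup W) ≤ w × NearBy G c W × Balanced b c × ¬ ColourRich G t C c

  module _ {n : ℕ} where
    Static : Vec (Fin k) n → Vec Bool n → Fin k → Vec Bool n → Vec (Fin n) J → Set
    Static c W i Y S = Inj S × (∀ a → core c W i (lookup S a) ≡ true) × # (lookup W) ≤ w × Balanced b c ×
      t ≤ # (lookup Y) × (∀ v → lookup Y v ≡ true → lookup c v ≢ i)

    At : Vec (Fin k) n → Vec Bool n → Fin k → Vec Bool n → Vec (Fin n) J → Graph n → Set
    At c W i Y S G = Free both k G × NearBy G c W × (∀ a → C * # (λ v → lookup Y v ∧ adj G (lookup S a) v) ≤ # (lookup Y)) × Static c W i Y S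

    module _ (c : Vec (Fin k) n) (W : Vec Bool n) (i : Fin k) (Y : Vec Bool n) (S : Vec (Fin n) J) (static : Static c W i Y S) where
      y₀ j₀ z₁ : ℕ
      y₀ = # (lookup Y)
      j₀ = y₀ / C
      z₁ = # core c W i

      Good : Fin n → State → Set
      Good v s = Ok both s × (core c W i v ≡ true → s ≡ (false , false)) × (lookup Y v ≡ true → sees true s ≡ false)

      -- A vertex of `S` has no arc into the core of its class, and apart from exceptions no arc
      -- towards `Y`, which leaves two states there.
      g : Fin n → ℕ
      g v = if core c W i v then 1 else (if lookup Y v then 2 else q)

      card-good : ∀ v → Card≤ (Good v) (g v)
      card-good v with core c W i v | lookup Y v
      ... | true | _ = card-1 λ x y p p′ → trans (proj₁ (proj₂ p) refl) (sym (proj₁ (proj₂ p′) refl))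
      ... | false | false = card-⊆ (λ x p → return (proj₁ p)) (card-Ok both)
      ... | false | true = card-⊆ {Q = λ s → s ≡ (false , false) ⊎ s ≡ (false , true)}
              (λ { (false , false) p → return (inj₁ refl) ; (false , true) p → return (inj₂ refl) ; (true , _) p → case proj₂ (proj₂ p) refl of λ () })
              (card-⊎ {M = 1} {N = 1} (card-1 λ { _ _ refl refl → refl }) (card-1 λ { _ _ refl refl → refl }))

      X : ℕ
      X = countFew g 4 (lookup Y) j₀

      g-pos : ∀ v → 1 ≤ g v
      g-pos v with core c W i v | lookup Y v
      ... | true | _ = ≤-refl
      ... | false | true = s≤s z≤n
      ... | false | false = >-nonZero⁻¹ q

      column : Fin J → Graph n → Vec State n
      column a G = Vec.tabulate (st G (lookup S a))

      column-few : ∀ G → At c W i Y S G → ∀ a → Few Good (Ok true) (lookup Y) j₀ (column a G)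
      column-few G (free , near , few , inj , co , _) a = few-intro (λ v s → lookup Y v ∧ sees true s) (column a G) j₀
          (λ v e → subst (Good v) (sym (at v)) (proj₂ (proj₁ free) (lookup S a) v , (λ cv → core-empty {G = G} {c} {W} {i} near (co a) cv) , λ yv → outs-false v yv (trans (cong (λ s → lookup Y v ∧ sees true s) (sym (at v))) e)))
          (λ v e → proj₁ (∧-true e) , refl)
          (subst (_≤ j₀) (sumF-cong λ v → cong (λ s → 𝟙 (lookup Y v ∧ sees true s)) (sym (at v))) cnt)
        where
        at : ∀ v → lookup (column a G) v ≡ st G (lookup S a) v
        at v = Vecₚ.lookup∘tabulate (st G (lookup S a)) v
        outs-false : ∀ v → lookup Y v ≡ true → lookup Y v ∧ adj G (lookup S a) v ≡ false → adj G (lookup S a) v ≡ false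
        outs-false v yv e rewrite yv = e
        cnt : # (λ v → lookup Y v ∧ adj G (lookup S a) v) ≤ j₀
        cnt = subst (_≤ j₀) (m*n/n≡m _ C) (/-monoˡ-≤ C (≤-trans (≤-reflexive (*-comm _ C)) (few a)))

      open ≤-Reasoning

      Πg-bound : prodF g * (q ^ z₁ * q ^ y₀) ≤ 2 ^ y₀ * q ^ n
      Πg-bound = begin
        prodF g * (q ^ z₁ * q ^ y₀) ≡⟨ cong (prodF g *_) (cong₂ _*_ (sym (prodF-if q (core c W i))) (sym (prodF-if q (lookup Y)))) ⟩
        prodF g * (prodF a₁ * prodF a₂) ≡⟨ cong (prodF g *_) (sym (prodF-* a₁ a₂)) ⟩
        prodF g * prodF (λ v → a₁ v * a₂ v) ≡⟨ sym (prodF-* g (λ v → a₁ v * a₂ v)) ⟩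
        prodF (λ v → g v * (a₁ v * a₂ v)) ≤⟨ prodF-mono pt ⟩
        prodF (λ v → a₃ v * q) ≡⟨ trans (prodF-* a₃ (λ _ → q)) (cong₂ _*_ (prodF-if 2 (lookup Y)) (prodF-const n q)) ⟩
        2 ^ y₀ * q ^ n ∎
        where
        a₁ a₂ a₃ : Fin n → ℕ
        a₁ v = if core c W i v then q else 1
        a₂ v = if lookup Y v then q else 1
        a₃ v = if lookup Y v then 2 else 1
        pt : ∀ v → g v * (a₁ v * a₂ v) ≤ a₃ v * q
        pt v with core c W i v in ec | lookup Y v in ey
        ... | true | true = ⊥-elim (proj₂ (proj₂ (proj₂ (proj₂ (proj₂ static)))) v ey (proj₁ (core-elim c W i v ec)))
        ... | true | false = ≤-reflexive (cong (_+ 0) (*-identityʳ q))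
        ... | false | true = ≤-reflexive (cong (2 *_) (+-identityʳ q))
        ... | false | false = ≤-reflexive (trans (*-identityʳ q) (sym (+-identityʳ q)))

      X²-bound : X ^ 2 ≤ 2 ^ y₀ * prodF g ^ 2
      X²-bound = few-bound g (lookup Y) j₀ g-pos (≤-trans (≤-reflexive (*-comm C j₀)) (m/n*n≤m y₀ C))

      -- On `Y` there are 2 instead of `q` states, while the exceptions cost at most `2 ^ (y₀ / 2)`.
      -- As `2 ^ 33 ≤ q ^ 21`, the factor `2 ^ (3/2)` per vertex of `Y` is at most `q ^ (21/22)`, so
      -- a saving of `q ^ (y₀ / 22)` remains.
      X²²-bound : X ^ 22 * q ^ (22 * z₁ + y₀) ≤ q ^ (22 * n)
      X²²-bound = *-cancelʳ-≤ _ _ (q ^ (21 * y₀)) ⦃ m^n≢0 q (21 * y₀) ⦄ (begin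
        X ^ 22 * q ^ (22 * z₁ + y₀) * q ^ (21 * y₀) ≡⟨ trans (*-assoc (X ^ 22) _ _) (cong (X ^ 22 *_) (sym (^-distribˡ-+-* q (22 * z₁ + y₀) (21 * y₀)))) ⟩
        X ^ 22 * q ^ (22 * z₁ + y₀ + 21 * y₀) ≡⟨ cong₂ (λ u v → u * q ^ v) (sym (^-*-assoc X 2 11)) (e₁ z₁ y₀) ⟩
        (X ^ 2) ^ 11 * q ^ ((z₁ + y₀) * 22) ≡⟨ cong ((X ^ 2) ^ 11 *_) (trans (sym (^-*-assoc q (z₁ + y₀) 22)) (cong (_^ 22) (^-distribˡ-+-* q z₁ y₀))) ⟩
        (X ^ 2) ^ 11 * (q ^ z₁ * q ^ y₀) ^ 22 ≤⟨ *-monoˡ-≤ ((q ^ z₁ * q ^ y₀) ^ 22) (^-monoˡ-≤ 11 X²-bound) ⟩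
        (2 ^ y₀ * prodF g ^ 2) ^ 11 * (q ^ z₁ * q ^ y₀) ^ 22 ≡⟨ cong (_* (q ^ z₁ * q ^ y₀) ^ 22) (trans (^-distribʳ 11 (2 ^ y₀) (prodF g ^ 2)) (cong ((2 ^ y₀) ^ 11 *_) (^-*-assoc (prodF g) 2 11))) ⟩
        (2 ^ y₀) ^ 11 * prodF g ^ 22 * (q ^ z₁ * q ^ y₀) ^ 22 ≡⟨ trans (*-assoc ((2 ^ y₀) ^ 11) _ _) (cong ((2 ^ y₀) ^ 11 *_) (sym (^-distribʳ 22 (prodF g) (q ^ z₁ * q ^ y₀)))) ⟩
        (2 ^ y₀) ^ 11 * (prodF g * (q ^ z₁ * q ^ y₀)) ^ 22 ≤⟨ *-monoʳ-≤ ((2 ^ y₀) ^ 11) (^-monoˡ-≤ 22 Πg-bound) ⟩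
        (2 ^ y₀) ^ 11 * (2 ^ y₀ * q ^ n) ^ 22 ≡⟨ cong ((2 ^ y₀) ^ 11 *_) (^-distribʳ 22 (2 ^ y₀) (q ^ n)) ⟩
        (2 ^ y₀) ^ 11 * ((2 ^ y₀) ^ 22 * (q ^ n) ^ 22) ≡⟨ sym (*-assoc ((2 ^ y₀) ^ 11) _ _) ⟩
        (2 ^ y₀) ^ 11 * (2 ^ y₀) ^ 22 * (q ^ n) ^ 22 ≡⟨ cong₂ _*_ (trans (sym (^-distribˡ-+-* (2 ^ y₀) 11 22)) (^-^-comm 2 y₀ 33)) (^-*-assoc q n 22) ⟩
        (2 ^ 33) ^ y₀ * q ^ (n * 22) ≤⟨ *-monoˡ-≤ (q ^ (n * 22)) (^-monoˡ-≤ y₀ (≤-trans (≤-reflexive (sym (^-*-assoc 2 11 3))) (≤-trans (^-monoˡ-≤ 3 (2^11≤q^7 both)) (≤-reflexive (^-*-assoc q 7 3))))) ⟩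
        (q ^ 21) ^ y₀ * q ^ (n * 22) ≡⟨ cong₂ _*_ (^-*-assoc q 21 y₀) (cong (q ^_) (*-comm n 22)) ⟩
        q ^ (21 * y₀) * q ^ (22 * n) ≡⟨ *-comm (q ^ (21 * y₀)) _ ⟩
        q ^ (22 * n) * q ^ (21 * y₀) ∎)
        where
        e₁ : ∀ z y → 22 * z + y + 21 * y ≡ (z + y) * 22
        e₁ = solve-∀

      z₁-large : n ≤ k * z₁ + (k * w + k′ * b)
      z₁-large = begin
        n ≤⟨ proj₁ (proj₂ (proj₂ (proj₂ static))) i ⟩
        k * # classOf (lookup c) i + k′ * b ≤⟨ +-monoˡ-≤ (k′ * b) (*-monoʳ-≤ k (≤-trans (core-large c W i) (+-monoʳ-≤ z₁ (proj₁ (proj₂ (proj₂ static)))))) ⟩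
        k * (z₁ + w) + k′ * b ≡⟨ e k z₁ w (k′ * b) ⟩
        k * z₁ + (k * w + k′ * b) ∎
        where
        e : ∀ k z w x → k * (z + w) + x ≡ k * z + (k * w + x)
        e = solve-∀

      X-bound : X ^ (22 * k) * q ^ (k * t) ≤ q ^ (22 * (k′ * n + (k * w + k′ * b)))
      X-bound = *-cancelʳ-≤ _ _ (q ^ (22 * n)) ⦃ m^n≢0 q (22 * n) ⦄ (begin
        X ^ (22 * k) * q ^ (k * t) * q ^ (22 * n) ≡⟨ trans (*-assoc (X ^ (22 * k)) _ _) (cong (X ^ (22 * k) *_) (sym (^-distribˡ-+-* q (k * t) (22 * n)))) ⟩
        X ^ (22 * k) * q ^ (k * t + 22 * n) ≤⟨ *-monoʳ-≤ (X ^ (22 * k)) (^-monoʳ-≤ q expo) ⟩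
        X ^ (22 * k) * q ^ ((22 * z₁ + y₀) * k + 22 * (k * w + k′ * b)) ≡⟨ cong₂ _*_ (sym (^-*-assoc X 22 k)) (trans (^-distribˡ-+-* q ((22 * z₁ + y₀) * k) _) (cong (_* q ^ (22 * (k * w + k′ * b))) (sym (^-*-assoc q (22 * z₁ + y₀) k)))) ⟩
        (X ^ 22) ^ k * ((q ^ (22 * z₁ + y₀)) ^ k * q ^ (22 * (k * w + k′ * b))) ≡⟨ trans (sym (*-assoc ((X ^ 22) ^ k) _ _)) (cong (_* q ^ (22 * (k * w + k′ * b))) (sym (^-distribʳ k (X ^ 22) (q ^ (22 * z₁ + y₀))))) ⟩
        (X ^ 22 * q ^ (22 * z₁ + y₀)) ^ k * q ^ (22 * (k * w + k′ * b)) ≤⟨ *-monoˡ-≤ (q ^ (22 * (k * w + k′ * b))) (^-monoˡ-≤ k X²²-bound) ⟩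
        (q ^ (22 * n)) ^ k * q ^ (22 * (k * w + k′ * b)) ≡⟨ trans (cong (_* q ^ (22 * (k * w + k′ * b))) (^-*-assoc q (22 * n) k)) (sym (^-distribˡ-+-* q (22 * n * k) _)) ⟩
        q ^ (22 * n * k + 22 * (k * w + k′ * b)) ≡⟨ cong (q ^_) (e₂ n k′ (k * w + k′ * b)) ⟩
        q ^ (22 * (k′ * n + (k * w + k′ * b)) + 22 * n) ≡⟨ ^-distribˡ-+-* q (22 * (k′ * n + (k * w + k′ * b))) (22 * n) ⟩
        q ^ (22 * (k′ * n + (k * w + k′ * b))) * q ^ (22 * n) ∎)
        where
        e₂ : ∀ n k′ x → 22 * n * (1 + k′) + 22 * x ≡ 22 * (k′ * n + x) + 22 * n
        e₂ = solve-∀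
        e₃ : ∀ k y z x → k * y + 22 * (k * z + x) ≡ (22 * z + y) * k + 22 * x
        e₃ = solve-∀
        expo : k * t + 22 * n ≤ (22 * z₁ + y₀) * k + 22 * (k * w + k′ * b)
        expo = ≤-trans (+-mono-≤ (*-monoʳ-≤ k (proj₁ (proj₂ (proj₂ (proj₂ (proj₂ static)))))) (*-monoʳ-≤ 22 z₁-large)) (≤-reflexive (e₃ k y₀ z₁ (k * w + k′ * b)))

      card-At : ∀ {m B} → 1 * J + m ≡ n → (∀ X → X ^ (22 * k) * q ^ (k * t) ≤ q ^ (22 * (k′ * n + (k * w + k′ * b))) → X ≤ B) →
        Card≤ (At c W i Y S) (numFree both k m * B ^ J)
      card-At {m} {B} len root = Skeleton.skeleton both k (vertices (S ∷ [])) (vertices-unique (S ∷ []) (distinct₁ S (proj₁ static))) (At c W i Y S)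
        (trans (cong (_+ m) (vertices-length (S ∷ []))) len) (λ G → proj₁)
        (λ G₁ _ → card-mono (≤-reflexive (trans (*-identityʳ _) (cong (B ^_) (Listₚ.length-tabulate {n = J} id))))
          (card-iter {Ok = λ _ → Few Good (Ok true) (lookup Y) j₀} column (List.allFin J)
            (λ a _ → card-mono (root X X-bound) (card-few (lookup Y) j₀ card-good (card-Ok true)))
            (λ G (at , _) a _ → column-few G at a)
            (λ G₂ _ → card-1 λ { G H ((_ , ag) , e) ((_ , ah) , f) → agree-det (vertices (S ∷ [])) (λ x y x∉ y∉ → trans (ag x y x∉ y∉) (sym (ah x y x∉ y∉)))
              (λ v x x∈ → same G H (λ a → trans (e a (∈-allFin a)) (sym (f a (∈-allFin a)))) v x x∈) })))
        where
        same : ∀ G H → (∀ a → column a G ≡ column a H) → ∀ v x → x ∈ vertices (S ∷ []) → st G v x ≡ st H v x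
        same G H eq v x x∈ with vertices-∈ (S ∷ []) x∈
        ... | zero , a , refl = cong (λ s → proj₂ s , proj₁ s) (trans (sym (Vecₚ.lookup∘tabulate (st G (lookup S a)) v))
                (trans (cong (λ r → lookup r v) (eq a)) (Vecₚ.lookup∘tabulate (st H (lookup S a)) v)))

  card-Poor : ∀ n m B → 1 * J + m ≡ n → J + w ≤ t → (∀ X → X ^ (22 * k) * q ^ (k * t) ≤ q ^ (22 * (k′ * n + (k * w + k′ * b))) → X ≤ B) →
    Card≤ (Poor {n}) (k ^ n * (2 ^ n * (k * (2 ^ n * (n ^ J * (numFree both k m * B ^ J))))))
  card-Poor n m B len large root =
    card-bind {R = λ c G → ∃ λ W → ∃ λ i → ∃ λ Y → ∃ λ S → At c W i Y S G} (card-All (card-fin {k})) (λ c _ →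
      card-bind {R = λ W G → ∃ λ i → ∃ λ Y → ∃ λ S → At c W i Y S G} (card-All card-Bool) (λ W _ →
        card-bind {R = λ i G → ∃ λ Y → ∃ λ S → At c W i Y S G} (card-fin {k}) (λ i _ →
          card-bind {R = λ Y G → ∃ λ S → At c W i Y S G} (card-All card-Bool) (λ Y _ →
            card-bind {R = λ S G → At c W i Y S G} (card-All (card-fin {n})) (λ S _ → card-rep λ { _ (_ , _ , _ , st) → card-At c W i Y S st len root })
              (λ { G (S , at) → return (S , tt , at) }))
            (λ { G (Y , r) → return (Y , tt , r) }))
          (λ { G (i , r) → return (i , tt , r) }))
        (λ { G (W , r) → return (W , tt , r) }))
      (λ { G (free , c , W , wW , near , bal , poor) k₀ → poor λ i j i≢j X Y uX uY pX pY tX tY none →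
           k₀ (c , tt , W , i , witness G free c W wW near bal i j i≢j X Y uX uY pX pY tX tY none) })
    where
    witness : ∀ G → Free both k G → ∀ c W → # (lookup W) ≤ w → NearBy G c W → Balanced b c → ∀ i j → i ≢ j → ∀ X Y → Unique X → Unique Y →
      All (λ v → lookup c v ≡ i) X → All (λ v → lookup c v ≡ j) Y → t ≤ length X → t ≤ length Y →
      ¬ (∃ λ x → x ∈ X × length Y ≤ C * length (outs G x Y)) → ∃ λ Yv → ∃ λ S → At c W i Yv S G
    witness G free c W wW near bal i j i≢j X Y uX uY pX pY tX tY none = Yv , S , free , near , few , inj , co , wW , bal , tY′ , (λ v yv e → i≢j (trans (sym e) (All.lookup pY (inY v yv))))
      where
      Yv = Vec.tabulate (Member Y)
      inY : ∀ v → lookup Yv v ≡ true → v ∈ Y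
      inY v e = member-∈ Y (trans (sym (Vecₚ.lookup∘tabulate (Member Y) v)) e)
      Y≤ : length Y ≤ # (lookup Yv)
      Y≤ = length-≤-# uY (All.tabulate λ {v} v∈ → trans (Vecₚ.lookup∘tabulate (Member Y) v) (member-true Y v∈))
      tY′ : t ≤ # (lookup Yv)
      tY′ = ≤-trans tY Y≤
      inW? : ∀ v → Dec (lookup W v ≡ true)
      inW? v = lookup W v ≟ᵇ true
      X′ = filter (¬? ∘ inW?) X
      lenX′ : J ≤ length X′
      lenX′ = +-cancelˡ-≤ w _ _ (≤-trans (≤-trans (≤-reflexive (+-comm w J)) large) (≤-trans tX (≤-trans (≤-reflexive (sym (length-partition inW? X)))
        (+-monoˡ-≤ (length X′) (≤-trans (length-≤-# (Uniqueₚ.filter⁺ inW? uX) (Allₚ.all-filter inW? X)) wW)))))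
      SV = toVec J X′ (Uniqueₚ.filter⁺ (¬? ∘ inW?) uX) lenX′
      S = proj₁ SV
      inj = proj₁ (proj₂ SV)
      inX : ∀ a → lookup S a ∈ X × ¬ lookup W (lookup S a) ≡ true
      inX a = ∈-filter⁻ (¬? ∘ inW?) {xs = X} (proj₂ (proj₂ SV) a)
      co : ∀ a → core c W i (lookup S a) ≡ true
      co a rewrite dec-true (lookup c (lookup S a) Fin.≟ i) (All.lookup pX (proj₁ (inX a))) with lookup W (lookup S a) in e
      ... | false = refl
      ... | true = ⊥-elim (proj₂ (inX a) e)
      few : ∀ a → C * # (λ v → lookup Yv v ∧ adj G (lookup S a) v) ≤ # (lookup Yv)
      few a = ≤-trans (*-monoʳ-≤ C (#-≤ (card-⊆ (λ v e → let e₁ , e₂ = ∧-true e in return (∈-filter⁺ (λ y → adj G (lookup S a) y ≟ᵇ true) (inY v e₁) e₂)) (card-∈ (outs G (lookup S a) Y)))))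
        (≤-trans (≮⇒≥ λ lt → none (lookup S a , proj₁ (inX a) , <⇒≤ lt)) Y≤)

-- Good colourings of graphs that are not k-partite

-- Forbidding a common out-neighbour excludes one of the `q²` pairs of states and thereby saves a
-- factor `q ^ (1/24)`.
[q²-1]^24≤q^47 : ∀ both → (arity both * arity both ∸ 1) ^ 24 ≤ arity both ^ 47
[q²-1]^24≤q^47 true = ≤ᵇ⇒≤ (15 ^ 24) (4 ^ 47) tt
[q²-1]^24≤q^47 false = ≤ᵇ⇒≤ (8 ^ 24) (3 ^ 47) tt

#-true : ∀ n → # (λ (_ : Fin n) → true) ≡ n
#-true n = trans (sumF-const n 1) (*-identityʳ n)

Good : ∀ k → ℕ → ℕ → ℕ → ℕ → ∀ {n} → Graph n → Set
Good k w b t C {n} G = Σ (Vec (Fin k) n) λ c → Σ (Vec Bool n) λ W → # (lookup W) ≤ w × NearBy G c W × Balanced b c × ColourRich G t C c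

module GoodNotPartite (both : Bool) (k″ w b t C e D₁ D₂ : ℕ) .⦃ _ : NonZero t ⦄ .⦃ _ : NonZero C ⦄
  (few₁ : ∀ {n} (g : Fin n → ℕ) (bb : Fin n → Bool) (j : ℕ) → (∀ i → 1 ≤ g i) → D₁ * j ≤ # bb → countFew g (suc (suc k″)) bb j ^ e ≤ 2 ^ # bb * prodF g ^ e)
  (few₂ : ∀ {n} (g : Fin n → ℕ) (bb : Fin n → Bool) (j : ℕ) → (∀ i → 1 ≤ g i) → D₂ * j ≤ # bb → countFew g (arity both * arity both) bb j ^ e ≤ 2 ^ # bb * prodF g ^ e) where

  k′ k q θ : ℕ
  k′ = suc k″
  k = suc k′
  q = arity both
  θ = suc k * t * C ^ suc k

  instance
    q≢0 : NonZero q
    q≢0 = arity≢0 both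

  Bad : ∀ {n} → Graph n → Set
  Bad G = Free both k G × ¬ Partite k G × Good k w b t C G

  -- Where two colourings may disagree up to a map of colours: on the `w` exceptional vertices of
  -- the reference, on the two deleted vertices, and on at most `t` vertices for each pair of
  -- colours that do not correspond.
  jc : ℕ
  jc = w + (2 + k * (k * t))

  coloursCount : ℕ → ℕ
  coloursCount n = countFew {n} (λ _ → 1) k (λ _ → true) jc

  coloursCount-bound : ∀ n → D₁ * jc ≤ n → coloursCount n ^ e ≤ 2 ^ n
  coloursCount-bound n le = ≤-trans (few₁ {n} (λ _ → 1) (λ _ → true) jc (λ _ → ≤-refl) (≤-trans le (≤-reflexive (sym (#-true n)))))
    (≤-reflexive (trans (cong₂ (λ x y → 2 ^ x * y) (#-true n) (trans (cong (_^ e) (trans (prodF-const n 1) (^-zeroˡ n))) (^-zeroˡ e))) (*-identityʳ _)))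

  module _ {n : ℕ} where

    FewAt : Graph n → Vec (Fin k) n → Fin n → Fin k → Set
    FewAt G c u i = ∀ ε → # (λ y → classOf (lookup c) i y ∧ sees ε (st G u y)) ≤ θ

    FewCommon : Graph n → Vec (Fin k) n → Fin n → Fin n → Fin k → Set
    FewCommon G c u v j = # (λ y → classOf (lookup c) j y ∧ bothOut (st G u y , st G v y)) ≤ θ

    GoodBy : Graph n → Vec (Fin k) n → Vec Bool n → Set
    GoodBy G c W = # (lookup W) ≤ w × NearBy G c W × Balanced b c × ColourRich G t C c

    At : Fin n → Fin n → Fin k → Fin k → Graph n → Set
    At u v i j G = Free both k G × u ≢ v × i ≢ j × Σ (Vec (Fin k) n) λ c → Σ (Vec Bool n) λ W → GoodBy G c W × FewAt G c u i × FewAt G c v i × FewCommon G c u v j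

    module _ (G : Graph n) (free : Free both k G) (c : Vec (Fin k) n) (rich : ColourRich G t C c) where
      open Parts {both} {k′} G free (λ i v → lookup c v ≡ i) t C rich using (Fits; few-in-some-part; few-common-outs)

      sel : (Fin n → Bool) → Fin k → List (Fin n)
      sel p i = proj₁ (positions (λ y → classOf (lookup c) i y ∧ p y))

      sel-All : ∀ p i → All (λ y → lookup c y ≡ i × p y ≡ true) (sel p i)
      sel-All p i = let _ , _ , al , _ = positions (λ y → classOf (lookup c) i y ∧ p y) in
        All.map (λ {y} e → let e₁ , e₂ = ∧-true e in classOf-≡ (lookup c) i y e₁ , e₂) al

      sel-fits : ∀ p → Fits (sel p)
      sel-fits p i = proj₁ (proj₂ (positions (λ y → classOf (lookup c) i y ∧ p y))) , All.map proj₁ (sel-All p i)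

      sel-length : ∀ p i → length (sel p i) ≡ # (λ y → classOf (lookup c) i y ∧ p y)
      sel-length p i = proj₂ (proj₂ (proj₂ (positions (λ y → classOf (lookup c) i y ∧ p y))))

      fewAt : ∀ u → ¬ ¬ ∃ (FewAt G c u)
      fewAt u = few-in-some-part u (sel (λ y → adj G u y)) (sel (λ y → adj G y u)) (sel-fits _) (sel-fits _)
          (λ i → All.map proj₂ (sel-All (λ y → adj G u y) i)) (λ i → All.map proj₂ (sel-All (λ y → adj G y u) i))
        >>= λ { (i , lt , lt′) → return (i , λ { true → subst (_≤ θ) (sel-length (λ y → adj G u y) i) (<⇒≤ lt) ; false → subst (_≤ θ) (sel-length (λ y → adj G y u) i) (<⇒≤ lt′) }) }

      fewCommon : ∀ u v → Arc G u v → ∀ i → ¬ ¬ ∃ λ j → j ≢ i × FewCommon G c u v j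
      fewCommon u v uv i = few-common-outs u v uv i (sel pr) (sel-fits pr) (λ j → All.map (λ (_ , e) → ∧-true e) (sel-All pr j))
        >>= λ { (j , ne , lt) → return (j , ne , subst (_≤ θ) (sel-length pr j) (<⇒≤ lt)) }
        where
        pr : Fin n → Bool
        pr y = bothOut (st G u y , st G v y)

    -- Every vertex is recoloured by a class of `c` in which it has few neighbours. The graph is not
    -- k-partite, so even the new colouring `c′` has an arc inside a class; the neighbourhoods of
    -- its ends are still measured in the classes of `c`.
    innerArc : ∀ G → Bad G → ¬ ¬ ∃ λ u → ∃ λ v → ∃ λ i → ∃ λ j → At u v i j G
    innerArc G (free , np , c , W , good@(_ , _ , _ , rich)) = ¬¬-choice (fewAt G free c rich) >>= λ { (c′ , few) →
        arc c′ >>= λ { (u , v , a , eq) → fewCommon G free c rich u v a (lookup c′ u) >>= λ { (j , ne , fc) →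
        return (u , v , lookup c′ u , j , free , (λ { refl → case trans (sym a) (proj₁ (proj₁ free) u) of λ () }) , (ne ∘ sym) , c , W , good , few u , subst (FewAt G c v) (sym eq) (few v) , fc) } } }
      where
      arc : ∀ c′ → ¬ ¬ ∃ λ u → ∃ λ v → Arc G u v × lookup c′ u ≡ lookup c′ v
      arc c′ no′ = np (lookup c′ , λ x y a e → no′ (x , y , a , e))

    module _ (u v : Fin n) (i j : Fin k) (i≢j : i ≢ j) where
      S : List (Fin n)
      S = u ∷ v ∷ []

      -- No colour class of c₁ meets two classes of c in large sets: richness would put an arc between them.
      close : ∀ G G₁ c W c₁ W₁ → Agree S G G₁ → GoodBy G c W → GoodBy G₁ c₁ W₁ →
        ¬ ¬ Σ (Vec (Fin k) k) λ σ → Few (λ y x → x ≡ lookup σ (lookup c₁ y)) (λ _ → ⊤) (λ _ → true) jc c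
      close G G₁ c W c₁ W₁ ag (_ , _ , _ , rich) (w₁ , near₁ , _) = ¬¬-choice pick′ >>= λ { (σ , h) →
          return (σ , few-intro (λ y x → not (does (x Fin.≟ lookup σ (lookup c₁ y)))) c jc
            (λ y → same) (λ _ _ → refl , tt)
            (#-≤ (card-⊆ (λ y ey → cover σ y (differ ey)) (card-⊎ (card-mono w₁ (card-# (lookup W₁))) (card-⊎ (card-∈ S)
              (card-bind {R = λ a y → ∃ λ x → x ≢ lookup σ a × Cell a x y} (card-fin {k})
                (λ a _ → card-bind {R = λ x y → x ≢ lookup σ a × Cell a x y} (card-fin {k}) (λ x _ → card-rep λ { _ (ne , _) → card-⊆ (λ y r → return (proj₂ r)) (h a x ne) }) (λ y (x , r) → return (x , tt , r)))
                (λ y r → return (lookup c₁ y , tt , r)))))))) }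
        where
        Cell : Fin k → Fin k → Fin n → Set
        Cell a x y = lookup c₁ y ≡ a × lookup c y ≡ x × lookup W₁ y ≡ false × y ∉ S
        same : ∀ {x z : Fin k} → not (does (x Fin.≟ z)) ≡ false → x ≡ z
        same {x} {z} e with x Fin.≟ z
        ... | yes eq = eq
        differ : ∀ {x z : Fin k} → not (does (x Fin.≟ z)) ≡ true → x ≢ z
        differ {x} {z} e with x Fin.≟ z
        ... | no ne = ne
        cover : ∀ σ y → lookup c y ≢ lookup σ (lookup c₁ y) → ¬ ¬ (lookup W₁ y ≡ true ⊎ y ∈ S ⊎ ∃ λ x → x ≢ lookup σ (lookup c₁ y) × Cell (lookup c₁ y) x y)
        cover σ y ne with lookup W₁ y | _∈?_ Fin._≟_ y S
        ... | true | _ = return (inj₁ refl)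
        ... | false | yes m = return (inj₂ (inj₁ m))
        ... | false | no y∉ = return (inj₂ (inj₂ (lookup c y , ne , refl , refl , refl , y∉)))
        pick′ : ∀ a → ¬ ¬ ∃ λ z → ∀ x → x ≢ z → Card≤ (Cell a x) t
        pick′ a = lem {∃ λ z → ¬ Card≤ (Cell a z) t} >>= λ
          -- If class `a` meets no class of `c` in more than `t` vertices, any colour will do as its
          -- image.
          { (no none) → return (zero , λ x _ → card-stable λ nc → none (x , nc))
          ; (yes (z , large)) → return (z , λ x x≢z → card-stable λ large′ → clash z x (x≢z ∘ sym) large large′) }
          where
          clash : ∀ z x → z ≢ x → ¬ Card≤ (Cell a z) t → ¬ Card≤ (Cell a x) t → ⊥
          clash z x z≢x l l′ = many l λ { (X , uX , pX , lX) → many l′ λ { (Y , uY , pY , lY) →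
            rich z x z≢x X Y uX uY (All.map (λ p → proj₁ (proj₂ p)) pX) (All.map (λ p → proj₁ (proj₂ p)) pY)
              (≤-trans (n≤1+n t) (≤-reflexive (sym lX))) (≤-trans (n≤1+n t) (≤-reflexive (sym lY)))
              λ { (p , p∈ , le) → arcs X Y pX pY p p∈ (subst (_≤ C * length (outs G p Y)) lY le) } } }
            where
            arcs : ∀ X Y → All (Cell a z) X → All (Cell a x) Y → ∀ p → p ∈ X → suc t ≤ C * length (outs G p Y) → ⊥
            arcs X Y pX pY p p∈ le with outs G p Y in eo
            ... | [] = case ≤-trans le (≤-reflexive (*-zeroʳ C)) of λ ()
            ... | y ∷ _ with ∈-filter⁻ (λ y → adj G p y ≟ᵇ true) {xs = Y} (subst (y ∈_) (sym eo) (here refl))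
            ...   | y∈ , py with All.lookup pX p∈ | All.lookup pY y∈
            ...     | cp , _ , wp , p∉ | cy , _ , wy , y∉ with near₁ p y (trans (sym (ag p y p∉ y∉)) py) (trans cp (sym cy))
            ...       | inj₁ eW = case trans (sym eW) wp of λ ()
            ...       | inj₂ eW = case trans (sym eW) wy of λ ()

      module _ (c : Vec (Fin k) n) where
        cls : Fin k → Fin n → Bool
        cls = classOf (lookup c)

        PairGood : Fin n → State × State → Set
        PairGood y p = (Ok both (proj₁ p) × Ok both (proj₂ p)) × (cls i y ≡ true → p ≡ ((false , false) , (false , false))) × (cls j y ≡ true → bothOut p ≡ false)

        g : Fin n → ℕ
        g y = if cls i y then 1 else (if cls j y then q * q ∸ 1 else q * q)

        qq-1 : 1 ≤ q * q ∸ 1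
        qq-1 = pos both
          where
          pos : ∀ both → 1 ≤ arity both * arity both ∸ 1
          pos true = s≤s z≤n
          pos false = s≤s z≤n

        g-pos : ∀ y → 1 ≤ g y
        g-pos y with cls i y | cls j y
        ... | true | _ = ≤-refl
        ... | false | true = qq-1
        ... | false | false = ≤-trans qq-1 (m∸n≤m (q * q) 1)

        card-g : ∀ y → Card≤ (PairGood y) (g y)
        card-g y with cls i y | cls j y
        ... | true | _ = card-1 λ x z p p′ → trans (proj₁ (proj₂ p) refl) (sym (proj₁ (proj₂ p′) refl))
        ... | false | true = card-⊆ (λ x p → return (proj₁ p , proj₂ (proj₂ p) refl)) (card-notBothOut both)
        ... | false | false = card-⊆ (λ x p → return (proj₁ p)) (card-× (card-Ok both) (card-Ok both))

        sp : Fin n → State × State → Bool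
        sp y (s , s′) = (cls i y ∧ (nonzero s ∨ nonzero s′)) ∨ (cls j y ∧ bothOut (s , s′))

        pairs : Graph n → Vec (State × State) n
        pairs G = Vec.tabulate λ y → st G u y , st G v y

        -- Out- and in-neighbours of `u` and of `v` in class `i`, and common out-neighbours in class
        -- `j`: five sets of size at most `θ`.
        jr : ℕ
        jr = 5 * θ

        pairs-few : ∀ G → Free both k G → FewAt G c u i → FewAt G c v i → FewCommon G c u v j →
          Few PairGood (λ p → Ok both (proj₁ p) × Ok both (proj₂ p)) (λ _ → true) jr (pairs G)
        pairs-few G free fu fv fc = few-intro sp (pairs G) jr
            (λ y e → subst (PairGood y) (sym (at y)) (oks y , zeros y (trans (cong (sp y) (sym (at y))) e)))
            (λ y _ → refl , subst (λ p → Ok both (proj₁ p) × Ok both (proj₂ p)) (sym (at y)) (oks y))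
            (subst (_≤ jr) (sumF-cong λ y → cong (𝟙 ∘ sp y) (sym (at y))) count)
          where
          at : ∀ y → lookup (pairs G) y ≡ (st G u y , st G v y)
          at y = Vecₚ.lookup∘tabulate _ y
          oks : ∀ y → Ok both (st G u y) × Ok both (st G v y)
          oks y = proj₂ (proj₁ free) u y , proj₂ (proj₁ free) v y
          zeros : ∀ y → sp y (st G u y , st G v y) ≡ false → (cls i y ≡ true → (st G u y , st G v y) ≡ ((false , false) , (false , false))) × (cls j y ≡ true → bothOut (st G u y , st G v y) ≡ false)
          zeros y e with cls i y | cls j y
          ... | true | true = (λ _ → z₀ (st G u y) (st G v y) (∨-f₁ e)) , λ _ → ∨-f₂ {nonzero (st G u y) ∨ nonzero (st G v y)} e
            where
            ∨-f₁ : ∀ {x z} → x ∨ z ≡ false → x ≡ false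
            ∨-f₁ {false} _ = refl
            ∨-f₂ : ∀ {x z} → x ∨ z ≡ false → z ≡ false
            ∨-f₂ {false} e = e
            z₀ : ∀ s s′ → nonzero s ∨ nonzero s′ ≡ false → (s , s′) ≡ ((false , false) , (false , false))
            z₀ (false , false) (false , false) _ = refl
          ... | true | false = (λ _ → z₀ (st G u y) (st G v y) (∨-f₁ e)) , λ ()
            where
            ∨-f₁ : ∀ {x z} → x ∨ z ≡ false → x ≡ false
            ∨-f₁ {false} _ = refl
            z₀ : ∀ s s′ → nonzero s ∨ nonzero s′ ≡ false → (s , s′) ≡ ((false , false) , (false , false))
            z₀ (false , false) (false , false) _ = refl
          ... | false | true = (λ ()) , λ _ → e
          ... | false | false = (λ ()) , λ ()
          cnt : Fin n → Fin n → Bool → ℕ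
          cnt x y ε = 𝟙 (cls i y ∧ sees ε (st G x y))
          pt : ∀ y → 𝟙 (sp y (st G u y , st G v y)) ≤ (cnt u y true + cnt u y false) + ((cnt v y true + cnt v y false) + 𝟙 (cls j y ∧ bothOut (st G u y , st G v y)))
          pt y with cls i y | cls j y ∧ bothOut (st G u y , st G v y)
          ... | false | true = ≤-refl
          ... | false | false = z≤n
          ... | true | x = lemma (adj G u y) (adj G y u) (adj G v y) (adj G y v) x
            where
            lemma : ∀ a b c d x → 𝟙 (((a ∨ b) ∨ (c ∨ d)) ∨ x) ≤ (𝟙 a + 𝟙 b) + ((𝟙 c + 𝟙 d) + 𝟙 x)
            lemma true b c d x = s≤s z≤n
            lemma false true c d x = s≤s z≤n
            lemma false false true d x = s≤s z≤n
            lemma false false false true x = s≤s z≤n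
            lemma false false false false x = ≤-refl
          count : # (λ y → sp y (st G u y , st G v y)) ≤ jr
          count = begin
            # (λ y → sp y (st G u y , st G v y)) ≤⟨ sumF-mono pt ⟩
            sumF (λ y → (cnt u y true + cnt u y false) + ((cnt v y true + cnt v y false) + r y)) ≡⟨ trans (sumF-+ (λ y → cnt u y true + cnt u y false) (λ y → (cnt v y true + cnt v y false) + r y))
                (cong₂ _+_ (sumF-+ (λ y → cnt u y true) (λ y → cnt u y false)) (trans (sumF-+ (λ y → cnt v y true + cnt v y false) r) (cong (_+ sumF r) (sumF-+ (λ y → cnt v y true) (λ y → cnt v y false))))) ⟩
            (sumF (λ y → cnt u y true) + sumF (λ y → cnt u y false)) + ((sumF (λ y → cnt v y true) + sumF (λ y → cnt v y false)) + sumF r)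
              ≤⟨ +-mono-≤ (+-mono-≤ (fu true) (fu false)) (+-mono-≤ (+-mono-≤ (fv true) (fv false)) fc) ⟩
            (θ + θ) + ((θ + θ) + θ) ≡⟨ five θ ⟩
            jr ∎
            where
            open ≤-Reasoning
            r : Fin n → ℕ
            r y = 𝟙 (cls j y ∧ bothOut (st G u y , st G v y))
            five : ∀ x → (x + x) + ((x + x) + x) ≡ 5 * x
            five = solve-∀

        X : ℕ
        X = countFew g (q * q) (λ _ → true) jr

        Xe-bound : D₂ * jr ≤ n → X ^ e ≤ 2 ^ n * prodF g ^ e
        Xe-bound le = subst (λ z → X ^ e ≤ 2 ^ z * prodF g ^ e) (#-true n) (few₂ g (λ _ → true) jr g-pos (≤-trans le (≤-reflexive (sym (#-true n)))))

        open ≤-Reasoning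

        Πg-bound : prodF g ^ 24 * q ^ (48 * # cls i + # cls j) ≤ q ^ (48 * n)
        Πg-bound = begin
          prodF g ^ 24 * q ^ (48 * # cls i + # cls j) ≡⟨ cong₂ _*_ (prodF-^ 24 g) (trans (^-distribˡ-+-* q (48 * # cls i) (# cls j)) (cong₂ _*_ (trans (sym (^-*-assoc q 48 (# cls i))) (sym (prodF-if (q ^ 48) (cls i)))) (sym (prodF-if q (cls j))))) ⟩
          prodF (λ y → g y ^ 24) * (prodF a₁ * prodF a₂) ≡⟨ cong (prodF (λ y → g y ^ 24) *_) (sym (prodF-* a₁ a₂)) ⟩
          prodF (λ y → g y ^ 24) * prodF (λ y → a₁ y * a₂ y) ≡⟨ sym (prodF-* (λ y → g y ^ 24) (λ y → a₁ y * a₂ y)) ⟩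
          prodF (λ y → g y ^ 24 * (a₁ y * a₂ y)) ≤⟨ prodF-mono pt ⟩
          prodF {n} (λ _ → q ^ 48) ≡⟨ trans (prodF-const n (q ^ 48)) (^-*-assoc q 48 n) ⟩
          q ^ (48 * n) ∎
          where
          a₁ a₂ : Fin n → ℕ
          a₁ y = if cls i y then q ^ 48 else 1
          a₂ y = if cls j y then q else 1
          pt : ∀ y → g y ^ 24 * (a₁ y * a₂ y) ≤ q ^ 48
          pt y with cls i y in ei | cls j y in ej
          ... | true | true = ⊥-elim (i≢j (trans (sym (classOf-≡ (lookup c) i y ei)) (classOf-≡ (lookup c) j y ej)))
          ... | true | false = ≤-reflexive (trans (cong₂ _*_ (^-zeroˡ 24) (*-identityʳ (q ^ 48))) (*-identityˡ (q ^ 48)))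
          ... | false | true = ≤-trans (*-mono-≤ ([q²-1]^24≤q^47 both) (≤-reflexive (*-identityˡ q))) (≤-reflexive (*-comm (q ^ 47) q))
          ... | false | false = ≤-reflexive (trans (*-identityʳ _) (trans (^-distribʳ 24 q q) (sym (^-distribˡ-+-* q 24 24))))

        -- In a balanced colouring the 48 parts are what two vertices of a k-partite graph lose on
        -- their own class as well. The 49th comes from class `j` and is the gain, a factor
        -- `q ^ (n / (24 * k))` up to the errors from `b` and the entropy.
        X-bound : Balanced b c → D₂ * jr ≤ n → X ^ (e * (24 * k)) * q ^ (49 * n * e) ≤ 2 ^ (n * (24 * k)) * q ^ ((48 * n * k + 49 * (k′ * b)) * e)
        X-bound bal le = begin
          X ^ (e * (24 * k)) * q ^ (49 * n * e) ≡⟨ cong (_* q ^ (49 * n * e)) (sym (^-*-assoc X e (24 * k))) ⟩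
          (X ^ e) ^ (24 * k) * q ^ (49 * n * e) ≤⟨ *-monoˡ-≤ (q ^ (49 * n * e)) (^-monoˡ-≤ (24 * k) (Xe-bound le)) ⟩
          (2 ^ n * prodF g ^ e) ^ (24 * k) * q ^ (49 * n * e) ≡⟨ cong (_* q ^ (49 * n * e)) (trans (^-distribʳ (24 * k) (2 ^ n) (prodF g ^ e)) (cong₂ _*_ (^-*-assoc 2 n (24 * k)) (^-^-comm (prodF g) e (24 * k)))) ⟩
          2 ^ (n * (24 * k)) * (prodF g ^ (24 * k)) ^ e * q ^ (49 * n * e) ≡⟨ trans (*-assoc (2 ^ (n * (24 * k))) _ _) (cong (λ z → 2 ^ (n * (24 * k)) * ((prodF g ^ (24 * k)) ^ e * z)) (sym (^-*-assoc q (49 * n) e))) ⟩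
          2 ^ (n * (24 * k)) * ((prodF g ^ (24 * k)) ^ e * (q ^ (49 * n)) ^ e) ≡⟨ cong (2 ^ (n * (24 * k)) *_) (sym (^-distribʳ e (prodF g ^ (24 * k)) (q ^ (49 * n)))) ⟩
          2 ^ (n * (24 * k)) * (prodF g ^ (24 * k) * q ^ (49 * n)) ^ e ≤⟨ *-monoʳ-≤ (2 ^ (n * (24 * k))) (^-monoˡ-≤ e inner) ⟩
          2 ^ (n * (24 * k)) * (q ^ (48 * n * k + 49 * (k′ * b))) ^ e ≡⟨ cong (2 ^ (n * (24 * k)) *_) (^-*-assoc q (48 * n * k + 49 * (k′ * b)) e) ⟩
          2 ^ (n * (24 * k)) * q ^ ((48 * n * k + 49 * (k′ * b)) * e) ∎
          where
          e₁ : ∀ k x y z → 48 * (k * x + z) + (k * y + z) ≡ (48 * x + y) * k + 49 * z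
          e₁ = solve-∀
          e₂ : ∀ n → 49 * n ≡ 48 * n + n
          e₂ = solve-∀
          inner : prodF g ^ (24 * k) * q ^ (49 * n) ≤ q ^ (48 * n * k + 49 * (k′ * b))
          inner = begin
            prodF g ^ (24 * k) * q ^ (49 * n) ≤⟨ *-monoʳ-≤ (prodF g ^ (24 * k)) (^-monoʳ-≤ q (≤-trans (≤-reflexive (e₂ n)) (≤-trans (+-mono-≤ (*-monoʳ-≤ 48 (bal i)) (bal j)) (≤-reflexive (e₁ k (# cls i) (# cls j) (k′ * b)))))) ⟩
            prodF g ^ (24 * k) * q ^ ((48 * # cls i + # cls j) * k + 49 * (k′ * b)) ≡⟨ cong₂ _*_ (sym (^-*-assoc (prodF g) 24 k)) (trans (^-distribˡ-+-* q ((48 * # cls i + # cls j) * k) _) (cong (_* q ^ (49 * (k′ * b))) (sym (^-*-assoc q (48 * # cls i + # cls j) k)))) ⟩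
            (prodF g ^ 24) ^ k * ((q ^ (48 * # cls i + # cls j)) ^ k * q ^ (49 * (k′ * b))) ≡⟨ trans (sym (*-assoc ((prodF g ^ 24) ^ k) _ _)) (cong (_* q ^ (49 * (k′ * b))) (sym (^-distribʳ k (prodF g ^ 24) (q ^ (48 * # cls i + # cls j))))) ⟩
            (prodF g ^ 24 * q ^ (48 * # cls i + # cls j)) ^ k * q ^ (49 * (k′ * b)) ≤⟨ *-monoˡ-≤ (q ^ (49 * (k′ * b))) (^-monoˡ-≤ k Πg-bound) ⟩
            (q ^ (48 * n)) ^ k * q ^ (49 * (k′ * b)) ≡⟨ trans (cong (_* q ^ (49 * (k′ * b))) (^-*-assoc q (48 * n) k)) (sym (^-distribˡ-+-* q (48 * n * k) _)) ⟩
            q ^ (48 * n * k + 49 * (k′ * b)) ∎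

      -- Guessing the colouring outright would cost `k ^ n`, more than two vertices can save. It is
      -- instead chosen close to the colouring `c₁` of a reference graph with the same skeleton, up
      -- to a map `σ` of the colours.
      card-At : ∀ {m B} → u ≢ v → 2 + m ≡ n → D₂ * (5 * θ) ≤ n →
        (∀ X → X ^ (e * (24 * k)) * q ^ (49 * n * e) ≤ 2 ^ (n * (24 * k)) * q ^ ((48 * n * k + 49 * (k′ * b)) * e) → X ≤ B) →
        Card≤ (At u v i j) (numFree both k m * (k ^ k * (coloursCount n * B)))
      card-At {m} {B} u≢v len le root = Skeleton.skeleton both k S ((u≢v ∷ []) ∷ [] ∷ []) (At u v i j) len (λ G → proj₁)
        (λ { G₁ (_ , _ , _ , c₁ , W₁ , good₁ , _) →
          card-bind {R = λ σ G → ∃ λ c → Near₂ G₁ c₁ σ c G} (card-All (card-fin {k}))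
            (λ σ _ → card-bind {Q = Few (λ y x → x ≡ lookup σ (lookup c₁ y)) (λ _ → ⊤) (λ _ → true) jc} {R = λ c G → Near₂ G₁ c₁ σ c G}
              (card-few (λ _ → true) jc (λ _ → card-1 λ { _ _ refl refl → refl }) (card-fin {k}))
              (λ c _ → card-rep λ { _ (_ , _ , bal , _) →
                card-mono (root (X c) (X-bound c bal le))
                  (card-inj {Q = Few (PairGood c) (λ p → Ok both (proj₁ p) × Ok both (proj₂ p)) (λ _ → true) (jr c)} (pairs c)
                    (λ { G H (_ , ag , _) (_ , ah , _) eq → agree-det S (λ x y x∉ y∉ → trans (ag x y x∉ y∉) (sym (ah x y x∉ y∉))) (λ y x x∈ → pairs-det c G H eq y x x∈) })
                    (λ { G (free , _ , _ , _ , fu , fv , fc) → pairs-few c G free fu fv fc })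
                    (card-few (λ _ → true) (jr c) (card-g c) (card-× (card-Ok both) (card-Ok both)))) })
              (λ { G (c , r@(_ , _ , _ , fw , _)) → return (c , fw , r) }))
            (λ { G ((free , _ , _ , c , W , good@(_ , _ , bal , _) , fu , fv , fc) , ag) → close G G₁ c W c₁ W₁ ag good good₁ >>= λ { (σ , fw) →
                 return (σ , tt , c , free , ag , bal , fw , fu , fv , fc) } }) })
        where
        Near₂ : Graph n → Vec (Fin k) n → Vec (Fin k) k → Vec (Fin k) n → Graph n → Set
        Near₂ G₁ c₁ σ c G = Free both k G × Agree S G G₁ × Balanced b c × Few (λ y x → x ≡ lookup σ (lookup c₁ y)) (λ _ → ⊤) (λ _ → true) jc c ×
          FewAt G c u i × FewAt G c v i × FewCommon G c u v j
        swap : State → State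
        swap (a , b) = b , a
        pairs-det : ∀ c G H → pairs c G ≡ pairs c H → ∀ y x → x ∈ S → st G y x ≡ st H y x
        pairs-det c G H eq y x x∈ = go x∈
          where
          at : (st G u y , st G v y) ≡ (st H u y , st H v y)
          at = trans (sym (Vecₚ.lookup∘tabulate (λ y → st G u y , st G v y) y)) (trans (cong (λ r → lookup r y) eq) (Vecₚ.lookup∘tabulate (λ y → st H u y , st H v y) y))
          go : x ∈ S → st G y x ≡ st H y x
          go (here refl) = cong (swap ∘ proj₁) at
          go (there (here refl)) = cong (swap ∘ proj₂) at

  card-Bad : ∀ n m B → 2 + m ≡ n → D₂ * (5 * θ) ≤ n →
    (∀ X → X ^ (e * (24 * k)) * q ^ (49 * n * e) ≤ 2 ^ (n * (24 * k)) * q ^ ((48 * n * k + 49 * (k′ * b)) * e) → X ≤ B) →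
    Card≤ (Bad {n}) (n * (n * (k * (k * (numFree both k m * (k ^ k * (coloursCount n * B)))))))
  card-Bad n m B len le root =
    card-bind {R = λ u G → ∃ λ v → ∃ λ i → ∃ λ j → At u v i j G} (card-fin {n}) (λ u _ →
      card-bind {R = λ v G → ∃ λ i → ∃ λ j → At u v i j G} (card-fin {n}) (λ v _ →
        card-bind {R = λ i G → ∃ λ j → At u v i j G} (card-fin {k}) (λ i _ →
          card-bind {R = λ j G → At u v i j G} (card-fin {k}) (λ j _ → card-rep λ { _ (_ , u≢v , i≢j , _) → card-At u v i j i≢j u≢v len le root })
            (λ { G (j , at) → return (j , tt , at) }))
          (λ { G (i , r) → return (i , tt , r) }))
        (λ { G (v , r) → return (v , tt , r) }))
      (λ G bad → innerArc G bad >>= λ { (u , r) → return (u , tt , r) })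

-- Statements that hold for all large n

Ev : (ℕ → Set) → Set
Ev P = ∃ λ n₀ → ∀ n → n₀ ≤ n → P n

ev-∧ : ∀ {P Q : ℕ → Set} → Ev P → Ev Q → Ev (λ n → P n × Q n)
ev-∧ (a , p) (b , q) = a ⊔ b , λ n le → p n (m⊔n≤o⇒m≤o a b le) , q n (m⊔n≤o⇒n≤o a b le)

ev-map : ∀ {P Q : ℕ → Set} → (∀ n → P n → Q n) → Ev P → Ev Q
ev-map f (a , p) = a , λ n le → f n (p n le)

ev-≥ : ∀ a → Ev (a ≤_)
ev-≥ a = a , λ n le → le

-- At `t₀` the left side is at most `(c + 2) ^ 3`, and `c + 2 ≤ 2 ^ (c + 1)`. Each further step adds
-- `c`, at most what is already there, while the right side doubles.
linear≤exp : ∀ c → Ev (λ t → c * (t + 1) ≤ 2 ^ t)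
linear≤exp c = t₀ , λ t le → subst (λ t → c * (t + 1) ≤ 2 ^ t) (m+[n∸m]≡n le) (go (t ∸ t₀))
  where
  open ≤-Reasoning
  t₀ = (c + 1) * 3
  e₁ : ∀ c → (c + 2) * ((c + 2) * ((c + 2) * 1)) ≡ c * ((c + 1) * 3 + 0 + 1) + (c * c * c + 3 * (c * c) + 8 * c + 8)
  e₁ = solve-∀
  e₂ : ∀ c t d → c * (t + (1 + d) + 1) ≡ c * (t + d + 1) + c
  e₂ = solve-∀
  go : ∀ d → c * (t₀ + d + 1) ≤ 2 ^ (t₀ + d)
  go zero = begin
    c * (t₀ + 0 + 1)    ≤⟨ m≤m+n _ _ ⟩
    c * (t₀ + 0 + 1) + (c * c * c + 3 * (c * c) + 8 * c + 8) ≡⟨ sym (e₁ c) ⟩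
    (c + 2) ^ 3         ≤⟨ ^-monoˡ-≤ 3 (≤-trans (≤-reflexive (+-suc c 1)) (n<2^n (c + 1))) ⟩
    (2 ^ (c + 1)) ^ 3   ≡⟨ trans (^-*-assoc 2 (c + 1) 3) (cong (2 ^_) (sym (+-identityʳ t₀))) ⟩
    2 ^ (t₀ + 0) ∎
  go (suc d) = begin
    c * (t₀ + suc d + 1)        ≡⟨ e₂ c t₀ d ⟩
    c * (t₀ + d + 1) + c        ≤⟨ +-mono-≤ (go d) (≤-trans (m≤m*n c (t₀ + d + 1) ⦃ ≢-nonZero (λ e → case trans (sym (+-comm (t₀ + d) 1)) e of λ ()) ⦄) (go d)) ⟩
    2 ^ (t₀ + d) + 2 ^ (t₀ + d) ≡⟨ cong (2 ^ (t₀ + d) +_) (sym (+-identityʳ _)) ⟩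
    2 ^ suc (t₀ + d)            ≡⟨ cong (2 ^_) (sym (+-suc t₀ d)) ⟩
    2 ^ (t₀ + suc d) ∎

n<d[n/d+1] : ∀ n d .⦃ _ : NonZero d ⦄ → n ≤ d * (n / d + 1)
n<d[n/d+1] n d = begin
  n                       ≡⟨ m≡m%n+[m/n]*n n d ⟩
  n % d + (n / d) * d     ≤⟨ +-monoˡ-≤ ((n / d) * d) (<⇒≤ (m%n<n n d)) ⟩
  d + (n / d) * d         ≡⟨ r d (n / d) ⟩
  d * (n / d + 1) ∎
  where
  open ≤-Reasoning
  r : ∀ d t → d + t * d ≡ d * (t + 1)
  r = solve-∀

/-large : ∀ a n d .⦃ _ : NonZero d ⦄ → a * d ≤ n → a ≤ n / d
/-large a n d le = subst (_≤ n / d) (m*n/n≡m a d) (/-monoˡ-≤ d le)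

-- For `n ≥ a` the left side is at most `n ^ suc c`, and `n ≤ 2 ^ (n / suc c)` holds for large `n`
-- by the linear case.
poly≤exp : ∀ a c → Ev (λ n → a * n ^ c ≤ 2 ^ n)
poly≤exp a c with linear≤exp (suc c)
... | t₀ , lin = a ⊔ t₀ * suc c , λ n le → begin
    a * n ^ c                        ≤⟨ *-monoˡ-≤ (n ^ c) (m⊔n≤o⇒m≤o a (t₀ * suc c) le) ⟩
    n ^ suc c                        ≤⟨ ^-monoˡ-≤ (suc c) (n<d[n/d+1] n (suc c)) ⟩
    (suc c * (n / suc c + 1)) ^ suc c ≤⟨ ^-monoˡ-≤ (suc c) (lin (n / suc c) (/-large t₀ n (suc c) (m⊔n≤o⇒n≤o a (t₀ * suc c) le))) ⟩
    (2 ^ (n / suc c)) ^ suc c        ≡⟨ ^-*-assoc 2 (n / suc c) (suc c) ⟩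
    2 ^ (n / suc c * suc c)          ≤⟨ ^-monoʳ-≤ 2 (m/n*n≤m n (suc c)) ⟩
    2 ^ n ∎
  where open ≤-Reasoning

half-/ : ∀ n d .⦃ _ : NonZero d ⦄ → d ≤ n → n ≤ 2 * d * (n / d)
half-/ n d le = begin
  n                     ≤⟨ n<d[n/d+1] n d ⟩
  d * (n / d + 1)       ≤⟨ *-monoʳ-≤ d (+-monoʳ-≤ (n / d) (/-large 1 n d (≤-trans (≤-reflexive (*-identityˡ d)) le))) ⟩
  d * (n / d + n / d)   ≡⟨ r d (n / d) ⟩
  2 * d * (n / d) ∎
  where
  open ≤-Reasoning
  r : ∀ d t → d * (t + t) ≡ 2 * d * t
  r = solve-∀

-- Exponents of q and negligible classes

module Powers (both : Bool) where
  q : ℕ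
  q = arity both

  instance
    q≢0 : NonZero q
    q≢0 = arity≢0 both

  2≤q : ∀ both → 2 ≤ arity both
  2≤q true = s≤s (s≤s z≤n)
  2≤q false = s≤s (s≤s z≤n)

  2^≤q^ : ∀ a → 2 ^ a ≤ q ^ a
  2^≤q^ a = ^-monoˡ-≤ a (2≤q both)

  n≤q^n : ∀ n → n ≤ q ^ n
  n≤q^n n = ≤-trans (n≤2^n n) (2^≤q^ n)

  mulq : ∀ {X Y} a b → X ≤ q ^ a → Y ≤ q ^ b → X * Y ≤ q ^ (a + b)
  mulq a b x y = ≤-trans (*-mono-≤ x y) (≤-reflexive (sym (^-distribˡ-+-* q a b)))

  powq : ∀ {X} a e → X ≤ q ^ a → X ^ e ≤ q ^ (a * e)
  powq a e x = ≤-trans (^-monoˡ-≤ e x) (≤-reflexive (^-*-assoc q a e))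

  -- The fractional exponent is rounded up. By `root-exp` this costs only a factor `q ^ e` after
  -- raising back to the power `e`, against exponents that are linear in `n`.
  root : ∀ X e Y .⦃ _ : NonZero e ⦄ → X ^ e ≤ q ^ Y → X ≤ q ^ (Y / e + 1)
  root X e Y le = ^-cancelˡ-≤ e (≤-trans le (≤-trans (^-monoʳ-≤ q (≤-trans (n<d[n/d+1] Y e) (≤-reflexive (*-comm e _)))) (≤-reflexive (sym (^-*-assoc q (Y / e + 1) e)))))

  root-exp : ∀ e Y .⦃ _ : NonZero e ⦄ → (Y / e + 1) * e ≤ Y + e
  root-exp e Y = ≤-trans (≤-reflexive (trans (*-distribʳ-+ e (Y / e) 1) (cong ((Y / e) * e +_) (*-identityˡ e)))) (+-monoˡ-≤ e (m/n*n≤m Y e))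

  cancelq : ∀ X Z Y → Z ≤ Y → X * q ^ Z ≤ q ^ Y → X ≤ q ^ (Y ∸ Z)
  cancelq X Z Y Z≤Y le = *-cancelʳ-≤ _ _ (q ^ Z) ⦃ m^n≢0 q Z ⦄ (≤-trans le (≤-reflexive (trans (cong (q ^_) (sym (m∸n+n≡m Z≤Y))) (^-distribˡ-+-* q (Y ∸ Z) Z))))

module Negligibility (both : Bool) (k″ : ℕ) where
  k′ : ℕ
  k′ = suc k″

  open Counts both k′ public
  open Powers both hiding (q; q≢0) public

  -- If the bound f ≤ C p holds below n, then the class is small compared to C p n.
  Negl : (∀ n → Graph n → Set) → Set
  Negl Bad = ∀ M → Ev λ n → ∀ C → (∀ m → m < n → f m ≤ C * p m) → ∃ λ B → Card≤ (Bad n) B × M * B ≤ C * p n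

  negl-intro : ∀ {Bad : ∀ n → Graph n → Set} →
    (∀ M → Ev λ n → ∃ λ m → ∃ λ X → m < n × Card≤ (Bad n) (f m * X) × M * (p m * X) ≤ p n) → Negl Bad
  negl-intro h M = ev-map (λ { n (m , X , m<n , c , le) C ih → f m * X , c , (begin
      M * (f m * X)         ≤⟨ *-monoʳ-≤ M (*-monoˡ-≤ X (ih m m<n)) ⟩
      M * (C * p m * X)     ≡⟨ r M C (p m) X ⟩
      C * (M * (p m * X))   ≤⟨ *-monoʳ-≤ C le ⟩
      C * p n ∎) }) (h M)
    where
    open ≤-Reasoning
    r : ∀ M C p X → M * (C * p * X) ≡ C * (M * (p * X))
    r = solve-∀

  negl-⊎ : ∀ {P Q : ∀ n → Graph n → Set} → Negl P → Negl Q → Negl (λ n G → P n G ⊎ Q n G)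
  negl-⊎ hP hQ M = ev-map (λ { n (a , b) C ih → let B₁ , c₁ , l₁ = a C ih ; B₂ , c₂ , l₂ = b C ih in
      B₁ + B₂ , card-⊎ c₁ c₂ , *-cancelˡ-≤ 2 (≤-trans (≤-reflexive (r M B₁ B₂)) (≤-trans (+-mono-≤ l₁ l₂) (≤-reflexive (cong (C * p n +_) (sym (+-identityʳ _)))))) })
      (ev-∧ (hP (2 * M)) (hQ (2 * M)))
    where
    r : ∀ M a b → 2 * (M * (a + b)) ≡ 2 * M * a + 2 * M * b
    r = solve-∀

  negl-∃ : ∀ r {P : Fin r → ∀ n → Graph n → Set} → (∀ i → Negl (P i)) → Negl (λ n G → ∃ λ i → P i n G)
  negl-∃ zero h M = 0 , λ n _ C _ → 0 , card-∅ (λ { _ () }) , ≤-trans (≤-reflexive (*-zeroʳ M)) z≤n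
  negl-∃ (suc r) {P} h M = ev-map (λ { n x C ih → let B , c , l = x C ih in
      B , card-⊆ (λ { G (zero , b) → return (inj₁ b) ; G (suc i , b) → return (inj₂ (i , b)) }) c , l }) (negl-⊎ (h zero) (negl-∃ r (h ∘ suc)) M)

  -- Choosing `c`, `W` and the deleted vertices costs at most `q ^ ((2 + k) * n)`; the oversized
  -- class saves about `q ^ (J * b / k)`. Hypothesis `large` compares the two after raising to the
  -- power `k`.
  unbalanced-numeric : ∀ n m M J w b Z → J + m ≡ n → M * k * n ^ J ≤ 2 ^ n → k * (2 + k) * n + J * (k * w) + k′ * (J * J) ≤ J * b →
    k * Z + b ≤ k′ * n + k * w → (M * (k ^ n * (2 ^ n * (k * (n ^ J * ((q ^ J) ^ 1) ^ Z))))) ^ (k * 1) ≤ q ^ (k′ * (J * m) * 1)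
  unbalanced-numeric n m M J w b Z len poly large zZ = begin
    (M * (k ^ n * (2 ^ n * (k * (n ^ J * ((q ^ J) ^ 1) ^ Z))))) ^ (k * 1) ≡⟨ cong (_^ (k * 1)) (r₁ M (k ^ n) (2 ^ n) k (n ^ J) (((q ^ J) ^ 1) ^ Z)) ⟩
    (M * k * n ^ J * (k ^ n * (2 ^ n * ((q ^ J) ^ 1) ^ Z))) ^ (k * 1) ≤⟨ powq (n + (k * n + (n + J * 1 * Z))) (k * 1) (mulq n (k * n + (n + J * 1 * Z)) (≤-trans poly (2^≤q^ n)) (mulq (k * n) (n + J * 1 * Z) (powq k n (n≤q^n k)) (mulq n (J * 1 * Z) (2^≤q^ n) (powq (J * 1) Z (powq J 1 ≤-refl))))) ⟩
    q ^ ((n + (k * n + (n + J * 1 * Z))) * (k * 1)) ≤⟨ ^-monoʳ-≤ q (+-cancelʳ-≤ (J * b) _ _ expo) ⟩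
    q ^ (k′ * (J * m) * 1) ∎
    where
    open ≤-Reasoning
    r₁ : ∀ M a b k c d → M * (a * (b * (k * (c * d)))) ≡ M * k * c * (a * (b * d))
    r₁ = solve-∀
    r₂ : ∀ n k J Z b → (n + (k * n + (n + J * 1 * Z))) * (k * 1) + J * b ≡ k * (2 + k) * n + J * (k * Z + b)
    r₂ = solve-∀
    r₃ : ∀ k m J k′ w → k * (2 + k) * (J + m) + J * (k′ * (J + m) + k * w) ≡ k′ * (J * m) * 1 + (k * (2 + k) * (J + m) + J * (k * w) + k′ * (J * J))
    r₃ = solve-∀
    expo : (n + (k * n + (n + J * 1 * Z))) * (k * 1) + J * b ≤ k′ * (J * m) * 1 + J * b
    expo = begin
      (n + (k * n + (n + J * 1 * Z))) * (k * 1) + J * b ≡⟨ r₂ n k J Z b ⟩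
      k * (2 + k) * n + J * (k * Z + b) ≤⟨ +-monoʳ-≤ (k * (2 + k) * n) (*-monoʳ-≤ J zZ) ⟩
      k * (2 + k) * n + J * (k′ * n + k * w) ≡⟨ cong (λ n → k * (2 + k) * n + J * (k′ * n + k * w)) (sym len) ⟩
      k * (2 + k) * (J + m) + J * (k′ * (J + m) + k * w) ≡⟨ r₃ k m J k′ w ⟩
      k′ * (J * m) * 1 + (k * (2 + k) * (J + m) + J * (k * w) + k′ * (J * J)) ≡⟨ cong (λ n → k′ * (J * m) * 1 + (k * (2 + k) * n + J * (k * w) + k′ * (J * J))) len ⟩
      k′ * (J * m) * 1 + (k * (2 + k) * n + J * (k * w) + k′ * (J * J)) ≤⟨ +-monoʳ-≤ (k′ * (J * m) * 1) large ⟩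
      k′ * (J * m) * 1 + J * b ∎

  -- The choices of `c`, `W`, `Y` and the deleted vertices cost at most `q ^ ((3 + k) * n)`, against
  -- a saving of about `q ^ (t / 22)` for each of the `J` vertices.
  poor-numeric : ∀ n m M J w b t → J + m ≡ n → M * k * n ^ J ≤ 2 ^ n → k * t ≤ 22 * (k′ * n + (k * w + k′ * b)) →
    22 * (k * (3 + k)) * n + J * (22 * (k * w + k′ * b)) + (22 * k * J + 22 * k′ * (J * J)) ≤ J * (k * t) →
    let Y = 22 * (k′ * n + (k * w + k′ * b)) ∸ k * t; B = q ^ (Y / (22 * k) + 1) in
    (M * (k ^ n * (2 ^ n * (k * (2 ^ n * (n ^ J * B ^ J)))))) ^ (k * 22) ≤ q ^ (k′ * (J * m) * 22)
  poor-numeric n m M J w b t len poly t≤ large = begin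
    (M * (k ^ n * (2 ^ n * (k * (2 ^ n * (n ^ J * B ^ J)))))) ^ (k * 22) ≡⟨ cong (_^ (k * 22)) (r₁ M (k ^ n) (2 ^ n) k (n ^ J) (B ^ J)) ⟩
    (M * k * n ^ J * (k ^ n * (2 ^ n * 2 ^ n)) * B ^ J) ^ (k * 22) ≡⟨ ^-distribʳ (k * 22) (M * k * n ^ J * (k ^ n * (2 ^ n * 2 ^ n))) (B ^ J) ⟩
    (M * k * n ^ J * (k ^ n * (2 ^ n * 2 ^ n))) ^ (k * 22) * (B ^ J) ^ (k * 22) ≤⟨ mulq ((n + (k * n + (n + n))) * (k * 22)) (J * (Y + 22 * k)) (powq (n + (k * n + (n + n))) (k * 22) (mulq n (k * n + (n + n)) (≤-trans poly (2^≤q^ n)) (mulq (k * n) (n + n) (powq k n (n≤q^n k)) (mulq n n (2^≤q^ n) (2^≤q^ n))))) BJ ⟩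
    q ^ ((n + (k * n + (n + n))) * (k * 22) + J * (Y + 22 * k)) ≤⟨ ^-monoʳ-≤ q (+-cancelʳ-≤ (J * (k * t)) _ _ expo) ⟩
    q ^ (k′ * (J * m) * 22) ∎
    where
    open ≤-Reasoning
    Y₀ Y B : ℕ
    Y₀ = 22 * (k′ * n + (k * w + k′ * b))
    Y = Y₀ ∸ k * t
    B = q ^ (Y / (22 * k) + 1)
    r₁ : ∀ M a b k c d → M * (a * (b * (k * (b * (c * d))))) ≡ M * k * c * (a * (b * b)) * d
    r₁ = solve-∀
    r₄ : ∀ x J k → x * J * (k * 22) ≡ J * (x * (22 * k))
    r₄ = solve-∀
    BJ : (B ^ J) ^ (k * 22) ≤ q ^ (J * (Y + 22 * k))
    BJ = ≤-trans (powq ((Y / (22 * k) + 1) * J) (k * 22) (powq (Y / (22 * k) + 1) J ≤-refl)) (^-monoʳ-≤ q (≤-trans (≤-reflexive (r₄ (Y / (22 * k) + 1) J k)) (*-monoʳ-≤ J (root-exp (22 * k) Y))))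
    r₂ : ∀ n k J Y T → (n + (k * n + (n + n))) * (k * 22) + J * (Y + 22 * k) + J * T ≡ 22 * (k * (3 + k)) * n + J * (Y + T) + 22 * k * J
    r₂ = solve-∀
    r₃ : ∀ P J k′ m x y → P + J * (22 * (k′ * (J + m) + x)) + y ≡ k′ * (J * m) * 22 + (P + J * (22 * x) + (y + 22 * k′ * (J * J)))
    r₃ = solve-∀
    expo : (n + (k * n + (n + n))) * (k * 22) + J * (Y + 22 * k) + J * (k * t) ≤ k′ * (J * m) * 22 + J * (k * t)
    expo = begin
      (n + (k * n + (n + n))) * (k * 22) + J * (Y + 22 * k) + J * (k * t) ≡⟨ r₂ n k J Y (k * t) ⟩
      22 * (k * (3 + k)) * n + J * (Y + k * t) + 22 * k * J ≡⟨ cong (λ z → 22 * (k * (3 + k)) * n + J * z + 22 * k * J) (m∸n+n≡m t≤) ⟩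
      22 * (k * (3 + k)) * n + J * Y₀ + 22 * k * J ≡⟨ cong (λ z → 22 * (k * (3 + k)) * n + J * (22 * (k′ * z + (k * w + k′ * b))) + 22 * k * J) (sym len) ⟩
      22 * (k * (3 + k)) * n + J * (22 * (k′ * (J + m) + (k * w + k′ * b))) + 22 * k * J ≡⟨ r₃ (22 * (k * (3 + k)) * n) J k′ m (k * w + k′ * b) (22 * k * J) ⟩
      k′ * (J * m) * 22 + (22 * (k * (3 + k)) * n + J * (22 * (k * w + k′ * b)) + (22 * k * J + 22 * k′ * (J * J))) ≤⟨ +-monoʳ-≤ (k′ * (J * m) * 22) large ⟩
      k′ * (J * m) * 22 + J * (k * t) ∎

  -- The exponent e = 288 k makes the entropy losses smaller than the gain of one factor q^(n / 24 k).
  e₄ : ℕ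
  e₄ = 288 * k

  good-numeric : ∀ n m M b cc → 2 + m ≡ n → (M * (k * (k * k ^ k)) * n ^ 2) ^ e₄ ≤ 2 ^ n → cc ^ e₄ ≤ 2 ^ n →
    196 * (k′ * b) ≤ n → 48 * k + 192 * k′ ≤ n →
    let Y = n * (24 * k) + (48 * n * k + 49 * (k′ * b)) * e₄ ∸ 49 * n * e₄; B = q ^ (Y / (e₄ * (24 * k)) + 1) in
    (M * (n * (n * (k * (k * (k ^ k * (cc * B))))))) ^ (k * (24 * e₄)) ≤ q ^ (k′ * (2 * m) * (24 * e₄))
  good-numeric n m M b cc len poly ccb bb nb = begin
    (M * (n * (n * (k * (k * (k ^ k * (cc * B))))))) ^ (k * (24 * e₄)) ≡⟨ cong₂ _^_ (r₁ M n k (k ^ k) cc B) (r₂ k e₄) ⟩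
    (M * (k * (k * k ^ k)) * n ^ 2 * cc * B) ^ (e₄ * (24 * k)) ≡⟨ trans (^-distribʳ (e₄ * (24 * k)) (P * cc) B) (cong (_* B ^ (e₄ * (24 * k))) (trans (sym (^-*-assoc (P * cc) e₄ (24 * k))) (cong (_^ (24 * k)) (^-distribʳ e₄ P cc)))) ⟩
    (P ^ e₄ * cc ^ e₄) ^ (24 * k) * B ^ (e₄ * (24 * k)) ≤⟨ mulq ((n + n) * (24 * k)) (Y + e₄ * (24 * k)) (powq (n + n) (24 * k) (mulq n n (≤-trans poly (2^≤q^ n)) (≤-trans ccb (2^≤q^ n)))) (≤-trans (powq (Y / (e₄ * (24 * k)) + 1) (e₄ * (24 * k)) ≤-refl) (^-monoʳ-≤ q (root-exp (e₄ * (24 * k)) Y))) ⟩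
    q ^ ((n + n) * (24 * k) + (Y + e₄ * (24 * k))) ≤⟨ ^-monoʳ-≤ q (+-cancelʳ-≤ (49 * n * e₄) _ _ expo) ⟩
    q ^ (k′ * (2 * m) * (24 * e₄)) ∎
    where
    open ≤-Reasoning
    Y₀ Y B P : ℕ
    Y₀ = n * (24 * k) + (48 * n * k + 49 * (k′ * b)) * e₄
    Y = Y₀ ∸ 49 * n * e₄
    B = q ^ (Y / (e₄ * (24 * k)) + 1)
    P = M * (k * (k * k ^ k)) * n ^ 2
    r₁ : ∀ M n k K c B → M * (n * (n * (k * (k * (K * (c * B)))))) ≡ M * (k * (k * K)) * (n * (n * 1)) * c * B
    r₁ = solve-∀
    r₂ : ∀ k e → k * (24 * e) ≡ e * (24 * k)
    r₂ = solve-∀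
    Y₀-large : 49 * n * e₄ ≤ Y₀
    Y₀-large = ≤-trans (*-monoˡ-≤ e₄ (≤-trans (subst (49 * n ≤_) (sym (r n k″)) (m≤m+n _ _)) (m≤m+n (48 * n * k) (49 * (k′ * b))))) (m≤n+m _ (n * (24 * k)))
      where
      r : ∀ n j → 48 * n * (2 + j) ≡ 49 * n + (47 * n + 48 * n * j)
      r = solve-∀
    r₃ : ∀ n k e Y Z → (n + n) * (24 * k) + (Y + e * (24 * k)) + Z ≡ (n + n) * (24 * k) + (Y + Z) + e * (24 * k)
    r₃ = solve-∀
    r₄ : ∀ n k e x y → (n + n) * (24 * k) + (n * (24 * k) + (48 * n * k + 49 * x) * e) + e * (24 * k) + 96 * y * e ≡ 72 * k * n + 49 * x * e + (24 * k + 96 * y) * e + 48 * n * k * e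
    r₄ = solve-∀
    r₅ : ∀ m k′ e → (2 + m) * e + 48 * (2 + m) * (1 + k′) * e ≡ k′ * (2 * m) * (24 * e) + 49 * (2 + m) * e + 96 * k′ * e
    r₅ = solve-∀
    r₆ : ∀ k n e x y → 4 * (72 * k * n + 49 * x * e + (24 * k + 96 * y) * e) ≡ 288 * k * n + 196 * x * e + 2 * (48 * k + 192 * y) * e
    r₆ = solve-∀
    r₇ : ∀ e n → e * n + n * e + 2 * n * e ≡ 4 * (n * e)
    r₇ = solve-∀
    small : 72 * k * n + 49 * (k′ * b) * e₄ + (24 * k + 96 * k′) * e₄ ≤ n * e₄
    small = *-cancelˡ-≤ 4 (begin
      4 * (72 * k * n + 49 * (k′ * b) * e₄ + (24 * k + 96 * k′) * e₄) ≡⟨ r₆ k n e₄ (k′ * b) k′ ⟩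
      e₄ * n + 196 * (k′ * b) * e₄ + 2 * (48 * k + 192 * k′) * e₄ ≤⟨ +-mono-≤ (+-monoʳ-≤ (e₄ * n) (*-monoˡ-≤ e₄ bb)) (*-monoˡ-≤ e₄ (*-monoʳ-≤ 2 nb)) ⟩
      e₄ * n + n * e₄ + 2 * n * e₄ ≡⟨ r₇ e₄ n ⟩
      4 * (n * e₄) ∎)
    expo : (n + n) * (24 * k) + (Y + e₄ * (24 * k)) + 49 * n * e₄ ≤ k′ * (2 * m) * (24 * e₄) + 49 * n * e₄
    expo = +-cancelʳ-≤ (96 * k′ * e₄) _ _ (begin
      (n + n) * (24 * k) + (Y + e₄ * (24 * k)) + 49 * n * e₄ + 96 * k′ * e₄ ≡⟨ cong (_+ 96 * k′ * e₄) (r₃ n k e₄ Y (49 * n * e₄)) ⟩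
      (n + n) * (24 * k) + (Y + 49 * n * e₄) + e₄ * (24 * k) + 96 * k′ * e₄ ≡⟨ cong (λ z → (n + n) * (24 * k) + z + e₄ * (24 * k) + 96 * k′ * e₄) (m∸n+n≡m Y₀-large) ⟩
      (n + n) * (24 * k) + Y₀ + e₄ * (24 * k) + 96 * k′ * e₄ ≡⟨ r₄ n k e₄ (k′ * b) k′ ⟩
      72 * k * n + 49 * (k′ * b) * e₄ + (24 * k + 96 * k′) * e₄ + 48 * n * k * e₄ ≤⟨ +-monoˡ-≤ (48 * n * k * e₄) small ⟩
      n * e₄ + 48 * n * k * e₄ ≡⟨ cong (λ n → n * e₄ + 48 * n * k * e₄) (sym len) ⟩
      (2 + m) * e₄ + 48 * (2 + m) * k * e₄ ≡⟨ r₅ m k′ e₄ ⟩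
      k′ * (2 * m) * (24 * e₄) + 49 * (2 + m) * e₄ + 96 * k′ * e₄ ≡⟨ cong (λ n → k′ * (2 * m) * (24 * e₄) + 49 * n * e₄ + 96 * k′ * e₄) len ⟩
      k′ * (2 * m) * (24 * e₄) + 49 * n * e₄ + 96 * k′ * e₄ ∎)

abstract
  FewBound : ℕ → ℕ → ℕ → Set
  FewBound e h D = ∀ {n} (g : Fin n → ℕ) (bb : Fin n → Bool) j → (∀ i → 1 ≤ g i) → D * j ≤ # bb → countFew g h bb j ^ e ≤ 2 ^ # bb * prodF g ^ e

  few-use : ∀ {e h D} → FewBound e h D → ∀ {n} (g : Fin n → ℕ) (bb : Fin n → Bool) j → (∀ i → 1 ≤ g i) → D * j ≤ # bb → countFew g h bb j ^ e ≤ 2 ^ # bb * prodF g ^ e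
  few-use fb = fb

  fewConst : ∀ e h .⦃ _ : NonZero e ⦄ .⦃ _ : NonZero h ⦄ → ∃ λ D → NonZero D × FewBound e h D
  fewConst e h = let D , bound = countFew-bound e h in suc D , _ , λ g bb j pos le → bound g bb j pos (≤-trans (*-monoˡ-≤ j (n≤1+n D)) le)

-- Half of `J * b` pays for the guesses `P * n`, which a large `J` makes possible since `b` is
-- linear in `n`; the two errors take a quarter each.
unbalanced-large : ∀ P n J x k′ b D → n ≤ 2 * D * b → 4 * x ≤ b → 4 * (k′ * J) ≤ b → 4 * P * D ≤ J → P * n + J * x + k′ * (J * J) ≤ J * b
unbalanced-large P n J x k′ b D nD xb Jb DJ = *-cancelˡ-≤ 4 (begin
  4 * (P * n + J * x + k′ * (J * J))                ≡⟨ r₁ P n J x k′ ⟩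
  4 * P * n + J * (4 * x) + J * (4 * (k′ * J))      ≤⟨ +-mono-≤ (+-mono-≤ (*-monoʳ-≤ (4 * P) nD) (*-monoʳ-≤ J xb)) (*-monoʳ-≤ J Jb) ⟩
  4 * P * (2 * D * b) + J * b + J * b               ≡⟨ r₂ P D b (J * b) ⟩
  2 * (4 * P * D * b) + 2 * (J * b)                 ≤⟨ +-monoˡ-≤ (2 * (J * b)) (*-monoʳ-≤ 2 (*-monoˡ-≤ b DJ)) ⟩
  2 * (J * b) + 2 * (J * b)                         ≡⟨ r₃ (J * b) ⟩
  4 * (J * b) ∎)
  where
  open ≤-Reasoning
  r₁ : ∀ P n J x k′ → 4 * (P * n + J * x + k′ * (J * J)) ≡ 4 * P * n + J * (4 * x) + J * (4 * (k′ * J))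
  r₁ = solve-∀
  r₂ : ∀ P D b y → 4 * P * (2 * D * b) + y + y ≡ 2 * (4 * P * D * b) + 2 * y
  r₂ = solve-∀
  r₃ : ∀ y → 2 * y + 2 * y ≡ 4 * y
  r₃ = solve-∀

poor-large : ∀ k k′ x n J w b t D → k′ ≤ k → n ≤ 2 * D * t → 88 * w ≤ t → 88 * b ≤ t → 88 * (1 + J) ≤ t → 176 * x * D ≤ J →
  22 * (k * x) * n + J * (22 * (k * w + k′ * b)) + (22 * k * J + 22 * k′ * (J * J)) ≤ J * (k * t)
poor-large k k′ x n J w b t D k≤ nD wt bt Jt DJ = *-cancelˡ-≤ 4 (begin
  4 * (22 * (k * x) * n + J * (22 * (k * w + k′ * b)) + (22 * k * J + 22 * k′ * (J * J))) ≡⟨ r₁ k x n J w k′ b ⟩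
  88 * (k * x) * n + J * (k * (88 * w) + k′ * (88 * b)) + J * (88 * k + k′ * (88 * J))
    ≤⟨ +-mono-≤ (+-mono-≤ (*-monoʳ-≤ (88 * (k * x)) nD) (*-monoʳ-≤ J (+-mono-≤ (*-monoʳ-≤ k wt) (*-mono-≤ k≤ bt)))) (*-monoʳ-≤ J (+-monoʳ-≤ (88 * k) (*-monoˡ-≤ (88 * J) k≤))) ⟩
  88 * (k * x) * (2 * D * t) + J * (k * t + k * t) + J * (88 * k + k * (88 * J)) ≡⟨ r₂ k x D t J ⟩
  176 * x * D * (k * t) + J * (k * t + k * t) + J * (k * (88 * (1 + J))) ≤⟨ +-mono-≤ (+-monoˡ-≤ (J * (k * t + k * t)) (*-monoˡ-≤ (k * t) DJ)) (*-monoʳ-≤ J (*-monoʳ-≤ k Jt)) ⟩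
  J * (k * t) + J * (k * t + k * t) + J * (k * t) ≡⟨ r₃ J (k * t) ⟩
  4 * (J * (k * t)) ∎)
  where
  open ≤-Reasoning
  r₁ : ∀ k x n J w k′ b → 4 * (22 * (k * x) * n + J * (22 * (k * w + k′ * b)) + (22 * k * J + 22 * k′ * (J * J))) ≡ 88 * (k * x) * n + J * (k * (88 * w) + k′ * (88 * b)) + J * (88 * k + k′ * (88 * J))
  r₁ = solve-∀
  r₂ : ∀ k x D t J → 88 * (k * x) * (2 * D * t) + J * (k * t + k * t) + J * (88 * k + k * (88 * J)) ≡ 176 * x * D * (k * t) + J * (k * t + k * t) + J * (k * (88 * (1 + J)))
  r₂ = solve-∀
  r₃ : ∀ J y → J * y + J * (y + y) + J * y ≡ 4 * (J * y)
  r₃ = solve-∀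

-- With `t`, `b`, `w` equal to `n` over `Dt`, `Db`, `Dw`, each is a small fraction of the one
-- before. `Dt` makes the entropy bounds applicable, `Db` and `Dw` keep imbalance and exceptional
-- vertices below the savings. `Ja` and `Jb` are the numbers of deleted vertices; they depend on
-- `Db` and `Dt`, so that savings proportional to `b` and `t` outweigh the guesses.
record Constants (k k′ c₁ D₁ D₂ : ℕ) : Set where
  field
    Dt Db Dw Ja Jb : ℕ
    Dt≢0 : NonZero Dt
    Db≢0 : NonZero Db
    Dw≢0 : NonZero Dw
    Ja≢0 : NonZero Ja
    Jb≢0 : NonZero Jb
    Dt₁ : D₁ * (2 + k * k) ≤ Dt
    Dt₂ : D₂ * (5 * c₁) ≤ Dt
    Db₁ : 88 * Dt ≤ Db
    Db₂ : 196 * k′ ≤ Db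
    Dw₁ : 4 * k * Db ≤ Dw
    Ja₁ : 4 * (k * (2 + k)) * Db ≤ Ja
    Jb₁ : 176 * (3 + k) * Dt ≤ Jb

abstract
  constants : ∀ k k′ c₁ D₁ D₂ → Constants k k′ c₁ D₁ D₂
  constants k k′ c₁ D₁ D₂ = record
    { Dt≢0 = _ ; Db≢0 = _ ; Dw≢0 = _ ; Ja≢0 = _ ; Jb≢0 = _
    ; Dt = suc x ; Db = suc y ; Dw = suc (4 * k * suc y) ; Ja = suc (4 * (k * (2 + k)) * suc y) ; Jb = suc (176 * (3 + k) * suc x)
    ; Dt₁ = ≤-trans (m≤n+m _ (D₂ * (5 * c₁))) (n≤1+n x) ; Dt₂ = ≤-trans (m≤m+n _ _) (n≤1+n x)
    ; Db₁ = ≤-trans (m≤m+n _ _) (n≤1+n y) ; Db₂ = ≤-trans (m≤n+m _ (88 * suc x)) (n≤1+n y)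
    ; Dw₁ = n≤1+n _ ; Ja₁ = n≤1+n _ ; Jb₁ = n≤1+n _ }
    where
    x y : ℕ
    x = D₂ * (5 * c₁) + D₁ * (2 + k * k)
    y = 88 * suc x + 196 * k′

module ColouredClasses (both : Bool) (k″ : ℕ) where
  open Negligibility both k″ public

  C D₁ D₂ : ℕ
  C = proj₁ (fewConst 2 4)
  D₁ = proj₁ (fewConst e₄ k)
  D₂ = proj₁ (fewConst e₄ (q * q) ⦃ _ ⦄ ⦃ m*n≢0 q q ⦄)

  instance
    C≢0 : NonZero C
    C≢0 = proj₁ (proj₂ (fewConst 2 4))

  c₁ : ℕ
  c₁ = suc k * C ^ suc k

  open Constants (constants k k′ c₁ D₁ D₂) public

  instance
    _ = Dt≢0
    _ = Db≢0
    _ = Dw≢0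
    _ = Ja≢0
    _ = Jb≢0

  t b w : ℕ → ℕ
  t n = n / Dt
  b n = n / Db
  w n = n / Dw

  b-t : ∀ n → 88 * b n ≤ t n
  b-t n = /-large (88 * b n) n Dt (≤-trans (≤-trans (≤-reflexive (r (b n) Dt)) (*-monoʳ-≤ (b n) Db₁)) (m/n*n≤m n Db))
    where
    r : ∀ b D → 88 * b * D ≡ b * (88 * D)
    r = solve-∀

  b-n : ∀ n → 196 * (k′ * b n) ≤ n
  b-n n = ≤-trans (≤-trans (≤-reflexive (r k′ (b n))) (*-monoʳ-≤ (b n) Db₂)) (m/n*n≤m n Db)
    where
    r : ∀ k b → 196 * (k * b) ≡ b * (196 * k)
    r = solve-∀

  w-b : ∀ n → 4 * (k * w n) ≤ b n
  w-b n = /-large (4 * (k * w n)) n Db (≤-trans (≤-trans (≤-reflexive (r k (w n) Db)) (*-monoʳ-≤ (w n) Dw₁)) (m/n*n≤m n Dw))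
    where
    r : ∀ k w D → 4 * (k * w) * D ≡ w * (4 * k * D)
    r = solve-∀

  w≤b : ∀ n → w n ≤ b n
  w≤b n = ≤-trans (≤-trans (m≤n*m (w n) k) (m≤n*m (k * w n) 4)) (w-b n)

  w-t : ∀ n → 88 * w n ≤ t n
  w-t n = ≤-trans (*-monoʳ-≤ 88 (w≤b n)) (b-t n)

  rearrange₄ : ∀ F a b c d R → a * (b * (c * (d * (F * R)))) ≡ F * (a * (b * (c * (d * R))))
  rearrange₄ = solve-∀

  minus : ∀ J n → J ≤ n → J + (n ∸ J) ≡ n
  minus J n = m+[n∸m]≡n

  BigBad : ∀ n → Graph n → Set
  BigBad n = Unbalanced.Big both k′ (w n) (b n) Ja

  negl-unbalanced : Negl BigBad
  negl-unbalanced = negl-intro {BigBad} λ M → ev-map (step M) (ev-∧ (poly≤exp (M * k) Ja) (ev-∧ (ev-≥ Db) (ev-∧ (ev-≥ (2 * (k * Ja))) (ev-∧ (ev-≥ (4 * (k′ * Ja) * Db)) (ev-≥ 1)))))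
    where
    open ≤-Reasoning
    step : ∀ M n → M * k * n ^ Ja ≤ 2 ^ n × Db ≤ n × 2 * (k * Ja) ≤ n × 4 * (k′ * Ja) * Db ≤ n × 1 ≤ n → ∃ λ m → ∃ λ X → m < n × Card≤ (BigBad n) (f m * X) × M * (p m * X) ≤ p n
    step M n (poly , Db≤ , kJ≤ , kJ′≤ , pos) = n ∸ Ja , X , ∸-monoʳ-< {o = 0} (>-nonZero⁻¹ Ja) Ja≤n ,
        card-mono (≤-reflexive (rearrange₄ (f (n ∸ Ja)) (k ^ n) (2 ^ n) k (n ^ Ja) (((q ^ Ja) ^ 1) ^ Z)))
          (Unbalanced.card-Big both k′ (w n) (b n) Ja n (n ∸ Ja) Z (trans (cong (_+ (n ∸ Ja)) (+-identityʳ Ja)) (minus Ja n Ja≤n)) kJw zZ) ,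
        subst (λ z → M * (p (n ∸ Ja) * X) ≤ p z) (minus Ja n Ja≤n)
          (finish (n ∸ Ja) Ja M X 1 (unbalanced-numeric n (n ∸ Ja) M Ja (w n) (b n) Z (minus Ja n Ja≤n) poly large kZ))
      where
      Y Z X : ℕ
      Y = k′ * n + k * w n ∸ b n
      Z = Y / k
      X = k ^ n * (2 ^ n * (k * (n ^ Ja * ((q ^ Ja) ^ 1) ^ Z)))
      Ja≤n : Ja ≤ n
      Ja≤n = ≤-trans (≤-trans (m≤n*m Ja k) (m≤n*m (k * Ja) 2)) kJ≤
      b≤n : b n ≤ n
      b≤n = m/n≤m n Db
      b≤ : b n ≤ k′ * n + k * w n
      b≤ = ≤-trans b≤n (≤-trans (m≤n*m n k′) (m≤m+n (k′ * n) _))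
      zZ : ∀ z → k * z + b n ≤ k′ * n + k * w n → z ≤ Z
      zZ z le = /-large z Y k (≤-trans (≤-reflexive (trans (*-comm z k) (sym (m+n∸n≡m (k * z) (b n))))) (∸-monoˡ-≤ (b n) le))
      kZ : k * Z + b n ≤ k′ * n + k * w n
      kZ = ≤-trans (+-monoˡ-≤ (b n) (≤-trans (≤-reflexive (*-comm k Z)) (m/n*n≤m Y k))) (≤-reflexive (m∸n+n≡m b≤))
      kJw : k * (Ja + w n) ≤ n
      kJw = *-cancelˡ-≤ 2 (begin
        2 * (k * (Ja + w n)) ≡⟨ r k Ja (w n) ⟩
        2 * (k * Ja) + 2 * (k * w n) ≤⟨ +-mono-≤ kJ≤ (≤-trans (*-monoˡ-≤ (k * w n) (s≤s (s≤s (z≤n {2})))) (≤-trans (w-b n) b≤n)) ⟩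
        n + n ≡⟨ cong (n +_) (sym (+-identityʳ n)) ⟩
        2 * n ∎)
        where
        r : ∀ k J w → 2 * (k * (J + w)) ≡ 2 * (k * J) + 2 * (k * w)
        r = solve-∀
      large : k * (2 + k) * n + Ja * (k * w n) + k′ * (Ja * Ja) ≤ Ja * b n
      large = unbalanced-large (k * (2 + k)) n Ja (k * w n) k′ (b n) Db (half-/ n Db Db≤) (w-b n) (/-large (4 * (k′ * Ja)) n Db kJ′≤) Ja₁

  module PoorAt (n : ℕ) = NotRich both k′ (w n) (b n) Jb (t n) C (few-use (proj₂ (proj₂ (fewConst 2 4))))

  rearrange₅ : ∀ F a b c d e R → a * (b * (c * (d * (e * (F * R))))) ≡ F * (a * (b * (c * (d * (e * R)))))
  rearrange₅ = solve-∀

  PoorBad : ∀ n → Graph n → Set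
  PoorBad n = PoorAt.Poor n

  negl-poor : Negl PoorBad
  negl-poor = negl-intro {PoorBad} λ M → ev-map (step M) (ev-∧ (poly≤exp (M * k) Jb) (ev-∧ (ev-≥ Dt) (ev-∧ (ev-≥ Jb) (ev-≥ (88 * (1 + Jb) * Dt)))))
    where
    open ≤-Reasoning
    step : ∀ M n → M * k * n ^ Jb ≤ 2 ^ n × Dt ≤ n × Jb ≤ n × 88 * (1 + Jb) * Dt ≤ n → ∃ λ m → ∃ λ X → m < n × Card≤ (PoorBad n) (f m * X) × M * (p m * X) ≤ p n
    step M n (poly , Dt≤ , Jb≤n , tJ) = n ∸ Jb , X , ∸-monoʳ-< {o = 0} (>-nonZero⁻¹ Jb) Jb≤n ,
        card-mono (≤-reflexive (rearrange₅ (f (n ∸ Jb)) (k ^ n) (2 ^ n) k (2 ^ n) (n ^ Jb) (B ^ Jb)))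
          (PoorAt.card-Poor n n (n ∸ Jb) B (trans (cong (_+ (n ∸ Jb)) (+-identityʳ Jb)) (minus Jb n Jb≤n)) Jw
            (λ X le → root X (22 * k) Y (cancelq (X ^ (22 * k)) (k * t n) Y₀ kt le))) ,
        subst (λ z → M * (p (n ∸ Jb) * X) ≤ p z) (minus Jb n Jb≤n)
          (finish (n ∸ Jb) Jb M X 22 (poor-numeric n (n ∸ Jb) M Jb (w n) (b n) (t n) (minus Jb n Jb≤n) poly kt large))
      where
      Y₀ Y B X : ℕ
      Y₀ = 22 * (k′ * n + (k * w n + k′ * b n))
      Y = Y₀ ∸ k * t n
      B = q ^ (Y / (22 * k) + 1)
      X = k ^ n * (2 ^ n * (k * (2 ^ n * (n ^ Jb * B ^ Jb))))
      t≥ : 88 * (1 + Jb) ≤ t n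
      t≥ = /-large (88 * (1 + Jb)) n Dt tJ
      Jw : Jb + w n ≤ t n
      Jw = *-cancelˡ-≤ 2 (begin
        2 * (Jb + w n) ≡⟨ *-distribˡ-+ 2 Jb (w n) ⟩
        2 * Jb + 2 * w n ≤⟨ +-mono-≤ (≤-trans (≤-trans (*-monoʳ-≤ 2 (n≤1+n Jb)) (*-monoˡ-≤ (1 + Jb) (s≤s (s≤s (z≤n {86}))))) t≥) (≤-trans (*-monoˡ-≤ (w n) (s≤s (s≤s (z≤n {86})))) (w-t n)) ⟩
        t n + t n ≡⟨ cong (t n +_) (sym (+-identityʳ (t n))) ⟩
        2 * t n ∎)
      kt : k * t n ≤ Y₀
      kt = begin
        k * t n ≤⟨ *-mono-≤ (subst (k ≤_) (sym (r k″)) (m≤m+n k _)) (m/n≤m n Dt) ⟩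
        22 * k′ * n ≡⟨ *-assoc 22 k′ n ⟩
        22 * (k′ * n) ≤⟨ *-monoʳ-≤ 22 (m≤m+n (k′ * n) _) ⟩
        Y₀ ∎
        where
        r : ∀ j → 22 * (1 + j) ≡ 2 + j + (20 + 21 * j)
        r = solve-∀
      large : 22 * (k * (3 + k)) * n + Jb * (22 * (k * w n + k′ * b n)) + (22 * k * Jb + 22 * k′ * (Jb * Jb)) ≤ Jb * (k * t n)
      large = poor-large k k′ (3 + k) n Jb (w n) (b n) (t n) Dt (n≤1+n k′) (half-/ n Dt Dt≤) (w-t n) (b-t n) t≥ Jb₁

  t-pos : ∀ n → Dt ≤ n → NonZero (t n)
  t-pos n le = >-nonZero (/-large 1 n Dt (≤-trans (≤-reflexive (*-identityˡ Dt)) le))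

  GoodBad : ∀ n → Graph n → Set
  GoodBad n G = Free both k G × ¬ Partite k G × Good k (w n) (b n) (t n) C G

  negl-good : Negl GoodBad
  negl-good = negl-intro {GoodBad} λ M → ev-map (step M) (ev-∧ (poly≤exp ((M * (k * (k * k ^ k))) ^ e₄) (2 * e₄)) (ev-∧ (ev-≥ (2 * Dt)) (ev-∧ (ev-≥ (48 * k + 192 * k′)) (ev-≥ 2))))
    where
    open ≤-Reasoning
    step : ∀ M n → (M * (k * (k * k ^ k))) ^ e₄ * n ^ (2 * e₄) ≤ 2 ^ n × 2 * Dt ≤ n × 48 * k + 192 * k′ ≤ n × 2 ≤ n →
      ∃ λ m → ∃ λ X → m < n × Card≤ (GoodBad n) (f m * X) × M * (p m * X) ≤ p n
    step M n (poly , Dt≤ , k≤ , 2≤n) = n ∸ 2 , X , ∸-monoʳ-< {o = 0} (s≤s z≤n) 2≤n ,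
        card-mono (≤-reflexive (rearrange₄ (f (n ∸ 2)) n n k k (k ^ k * (G.coloursCount n * B))))
          (G.card-Bad n (n ∸ 2) B (minus 2 n 2≤n) D₂≤ (λ X le → root X (e₄ * (24 * k)) Y (cancelq (X ^ (e₄ * (24 * k))) (49 * n * e₄) Y₀ Y₀-large
            (≤-trans le (mulq (n * (24 * k)) ((48 * n * k + 49 * (k′ * b n)) * e₄) (2^≤q^ (n * (24 * k))) ≤-refl))))) ,
        subst (λ z → M * (p (n ∸ 2) * X) ≤ p z) (minus 2 n 2≤n)
          (finish (n ∸ 2) 2 M X (24 * e₄) (good-numeric n (n ∸ 2) M (b n) (G.coloursCount n) (minus 2 n 2≤n) poly′ (G.coloursCount-bound n D₁≤) (b-n n) k≤))
      where
      Dt≤n : Dt ≤ n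
      Dt≤n = ≤-trans (m≤n*m Dt 2) Dt≤
      module G = GoodNotPartite both k″ (w n) (b n) (t n) C e₄ D₁ D₂ ⦃ t-pos n Dt≤n ⦄
        (few-use (proj₂ (proj₂ (fewConst e₄ k)))) (few-use (proj₂ (proj₂ (fewConst e₄ (q * q) ⦃ _ ⦄ ⦃ m*n≢0 q q ⦄))))
      Y₀ Y B X : ℕ
      Y₀ = n * (24 * k) + (48 * n * k + 49 * (k′ * b n)) * e₄
      Y = Y₀ ∸ 49 * n * e₄
      B = q ^ (Y / (e₄ * (24 * k)) + 1)
      X = n * (n * (k * (k * (k ^ k * (G.coloursCount n * B)))))
      Y₀-large : 49 * n * e₄ ≤ Y₀
      Y₀-large = ≤-trans (*-monoˡ-≤ e₄ (≤-trans (subst (49 * n ≤_) (sym (r n k″)) (m≤m+n _ _)) (m≤m+n (48 * n * k) (49 * (k′ * b n))))) (m≤n+m _ (n * (24 * k)))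
        where
        r : ∀ n j → 48 * n * (2 + j) ≡ 49 * n + (47 * n + 48 * n * j)
        r = solve-∀
      poly′ : (M * (k * (k * k ^ k)) * n ^ 2) ^ e₄ ≤ 2 ^ n
      poly′ = ≤-trans (≤-reflexive (trans (^-distribʳ e₄ (M * (k * (k * k ^ k))) (n ^ 2)) (cong ((M * (k * (k * k ^ k))) ^ e₄ *_) (^-*-assoc n 2 e₄)))) poly
      tDt : t n * Dt ≤ n
      tDt = m/n*n≤m n Dt
      D₂≤ : D₂ * (5 * G.θ) ≤ n
      D₂≤ = begin
        D₂ * (5 * (suc k * t n * C ^ suc k)) ≡⟨ r D₂ (suc k) (t n) (C ^ suc k) ⟩
        t n * (D₂ * (5 * c₁)) ≤⟨ *-monoʳ-≤ (t n) Dt₂ ⟩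
        t n * Dt ≤⟨ tDt ⟩
        n ∎
        where
        r : ∀ D k t c → D * (5 * (k * t * c)) ≡ t * (D * (5 * (k * c)))
        r = solve-∀
      2≤t : 2 ≤ t n
      2≤t = /-large 2 n Dt Dt≤
      D₁≤ : D₁ * G.jc ≤ n
      D₁≤ = begin
        D₁ * (w n + (2 + k * (k * t n))) ≤⟨ *-monoʳ-≤ D₁ (+-mono-≤ (≤-trans (m≤n*m (w n) 88) (w-t n)) (+-monoˡ-≤ (k * (k * t n)) 2≤t)) ⟩
        D₁ * (t n + (t n + k * (k * t n))) ≡⟨ r D₁ (t n) k ⟩
        t n * (D₁ * (2 + k * k)) ≤⟨ *-monoʳ-≤ (t n) Dt₁ ⟩
        t n * Dt ≤⟨ tDt ⟩
        n ∎
        where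
        r : ∀ D t k → D * (t + (t + k * (k * t))) ≡ t * (D * (2 + k * k))
        r = solve-∀

  near-cover : ∀ n G → Free both k G → ¬ Partite k G → Near k (w n) G →
    ¬ ¬ (BigBad n G ⊎ PoorBad n G ⊎ GoodBad n G)
  near-cover n G free np (c , W , wW , near) = lem {∃ λ i → n + b n ≤ k * # classOf (lookup c) i} >>= λ
    { (yes big) → return (inj₁ (free , c , W , wW , near , big))
    ; (no nb) → lem {ColourRich G (t n) C c} >>= λ
      { (yes rich) → return (inj₂ (inj₂ (free , np , c , W , wW , near , balanced nb , rich)))
      ; (no poor) → return (inj₂ (inj₁ (free , c , W , wW , near , balanced nb , poor))) } }
    where
    x : Fin k → ℕ
    x i = k * # classOf (lookup c) i
    B = n + b n
    -- The numbers `B - x i` are nonnegative and add up to `k * b n`, so none of them exceeds this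
    -- sum.
    balanced : ¬ (∃ λ i → n + b n ≤ x i) → Balanced (b n) c
    balanced nb i = +-cancelʳ-≤ (b n) n _ (begin
      n + b n ≡⟨ sym (m+[n∸m]≡n (x≤ i)) ⟩
      x i + (B ∸ x i) ≤⟨ +-monoʳ-≤ (x i) (≤-trans (term≤sumF (λ i → B ∸ x i) i) (≤-reflexive sum)) ⟩
      x i + k * b n ≡⟨ r (x i) k′ (b n) ⟩
      x i + k′ * b n + b n ∎)
      where
      open ≤-Reasoning
      r : ∀ x k b → x + (1 + k) * b ≡ x + k * b + b
      r = solve-∀
      r′ : ∀ k n b → k * n + k * b ≡ k * (n + b)
      r′ = solve-∀
      x≤ : ∀ i → x i ≤ B
      x≤ i = ≰⇒≥ λ le → nb (i , le)
      sum : sumF (λ i → B ∸ x i) ≡ k * b n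
      sum = +-cancelˡ-≡ (k * n) _ _ (begin-equality
        k * n + sumF (λ i → B ∸ x i) ≡⟨ cong (_+ sumF (λ i → B ∸ x i)) (sym (trans (sumF-* k (λ i → # classOf (lookup c) i)) (cong (k *_) (sum-classes (lookup c))))) ⟩
        sumF x + sumF (λ i → B ∸ x i) ≡⟨ sym (sumF-+ x (λ i → B ∸ x i)) ⟩
        sumF (λ i → x i + (B ∸ x i)) ≡⟨ sumF-cong (λ i → m+[n∸m]≡n (x≤ i)) ⟩
        sumF {k} (λ _ → B) ≡⟨ sumF-const k B ⟩
        k * B ≡⟨ sym (r′ k n (b n)) ⟩
        k * n + k * b n ∎)

-- Part sizes: adding a part replaces the size by its square root

module Sizes (y N : ℕ) where
  lev sz : ℕ → ℕ
  lev r = y * 2 ^ (N ∸ r)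
  sz r = 2 ^ lev r

  -- One scale serves all stages, so it is linear in the logarithm of the largest size. It exceeds
  -- `2 * (lev r + 1)` for every `r`, which the counting bound for sign matrices requires.
  μ : ℕ
  μ = 2 * (y * 2 ^ N) + 3

  lev-suc : ∀ r → r < N → lev r ≡ lev (suc r) + lev (suc r)
  lev-suc r lt = trans (cong (λ z → y * 2 ^ z) (sym (suc-pred′))) (e y (2 ^ (N ∸ suc r)))
    where
    suc-pred′ : suc (N ∸ suc r) ≡ N ∸ r
    suc-pred′ = sym (+-∸-assoc 1 lt)
    e : ∀ y x → y * (2 * x) ≡ y * x + y * x
    e = solve-∀

  sz-suc : ∀ r → r < N → sz r ≡ sz (suc r) * sz (suc r)
  sz-suc r lt = trans (cong (2 ^_) (lev-suc r lt)) (^-distribˡ-+-* 2 (lev (suc r)) (lev (suc r)))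

  y≤lev : ∀ r → y ≤ lev r
  y≤lev r = m≤m*n y (2 ^ (N ∸ r)) ⦃ m^n≢0 2 (N ∸ r) ⦄

  lev≤ : ∀ r → lev r ≤ y * 2 ^ N
  lev≤ r = *-monoʳ-≤ y (^-monoʳ-≤ 2 (m∸n≤m N r))

  sz≢0 : ∀ r → NonZero (sz r)
  sz≢0 r = m^n≢0 2 (lev r)

  1+2^ : ∀ l → 1 + 2 ^ l ≤ 2 ^ (l + 1)
  1+2^ l = ≤-trans (+-monoˡ-≤ (2 ^ l) (>-nonZero⁻¹ (2 ^ l) ⦃ m^n≢0 2 l ⦄)) (≤-reflexive (trans (cong (2 ^ l +_) (sym (+-identityʳ _))) (cong (2 ^_) (+-comm 1 l))))

  ramsey-size : ∀ r → 2 * ((1 + sz r) ^ μ * (1 + sz r) ^ μ) < 2 ^ (μ * μ)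
  ramsey-size r = begin-strict
    2 * ((1 + sz r) ^ μ * (1 + sz r) ^ μ) ≤⟨ *-monoʳ-≤ 2 (*-mono-≤ pw pw) ⟩
    2 * (2 ^ (l * μ) * 2 ^ (l * μ)) ≡⟨ cong (2 *_) (sym (^-distribˡ-+-* 2 (l * μ) (l * μ))) ⟩
    2 ^ (1 + (l * μ + l * μ)) <⟨ ^-monoʳ-< 2 (s≤s (s≤s z≤n)) lt ⟩
    2 ^ (μ * μ) ∎
    where
    open ≤-Reasoning
    l = lev r + 1
    pw : (1 + sz r) ^ μ ≤ 2 ^ (l * μ)
    pw = ≤-trans (^-monoˡ-≤ μ (1+2^ (lev r))) (≤-reflexive (^-*-assoc 2 l μ))
    e₁ : ∀ x m → (x + 1) * m + (x + 1) * m ≡ (2 * x + 2) * m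
    e₁ = solve-∀
    e₂ : ∀ x m → (2 * x + 3) * m ≡ m + (2 * x + 2) * m
    e₂ = solve-∀
    lt : 1 + (l * μ + l * μ) < μ * μ
    lt = begin-strict
      1 + (l * μ + l * μ) ≡⟨ cong suc (e₁ (lev r) μ) ⟩
      1 + (2 * lev r + 2) * μ ≤⟨ +-monoʳ-≤ 1 (*-monoˡ-≤ μ (+-monoˡ-≤ 2 (*-monoʳ-≤ 2 (lev≤ r)))) ⟩
      1 + (2 * (y * 2 ^ N) + 2) * μ <⟨ +-monoˡ-< ((2 * (y * 2 ^ N) + 2) * μ) (≤-trans (s≤s (s≤s z≤n)) (m≤n+m 3 (2 * (y * 2 ^ N)))) ⟩
      μ + (2 * (y * 2 ^ N) + 2) * μ ≡⟨ sym (e₂ (y * 2 ^ N) μ) ⟩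
      μ * μ ∎

-- Estimates for stopped blocks and for large matchings

module EarlyNumerics (both : Bool) (k″ : ℕ) where
  open Negligibility both k″

  -- A light pattern leaves the exponent `E` short of `(1 - 1/k) * r * s` by about
  -- `r * s / (44 * k²)`. This has to cover the Sauer-Shelah error `κ * r` and the guesses, which is
  -- the hypothesis that `s` is large compared with `44 * k² * κ`.
  stop-numeric : ∀ n m M r s κ E P g R → r * s + m ≡ n → 1 ≤ r → M * P * n ^ (s * r) ≤ 2 ^ n → R ≤ 2 ^ n * g ^ n → g ≤ q ^ (κ * r + E) →
    44 * (k * k) * E + s * r ≤ s * (r * (44 * (k * k′))) + 44 * (k * k) → 44 * (k * k) * (3 + κ) + 1 ≤ s → 44 * (k * k′) * (r * s * (r * s)) ≤ n →
    (M * (P * ((n ^ s) ^ r * R))) ^ (k * (44 * k)) ≤ q ^ (k′ * (r * s * m) * (44 * k))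
  stop-numeric n m M r s κ E P g R len 1≤r poly Rb gb Eb sb nb = begin
    (M * (P * ((n ^ s) ^ r * R))) ^ (k * (44 * k)) ≡⟨ cong (_^ (k * (44 * k))) (trans (r₁ M P ((n ^ s) ^ r) R) (cong (λ z → M * P * z * R) (^-*-assoc n s r))) ⟩
    (M * P * n ^ (s * r) * R) ^ (k * (44 * k)) ≤⟨ powq (n + (n + (κ * r + E) * n)) (k * (44 * k)) (mulq n (n + (κ * r + E) * n) (≤-trans poly (2^≤q^ n)) (≤-trans Rb (mulq n ((κ * r + E) * n) (2^≤q^ n) (powq (κ * r + E) n gb)))) ⟩
    q ^ ((n + (n + (κ * r + E) * n)) * (k * (44 * k))) ≤⟨ ^-monoʳ-≤ q (+-cancelʳ-≤ (s * r * n) _ _ expo) ⟩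
    q ^ (k′ * (r * s * m) * (44 * k)) ∎
    where
    open ≤-Reasoning
    r₁ : ∀ M P x R → M * (P * (x * R)) ≡ M * P * x * R
    r₁ = solve-∀
    r₂ : ∀ n κ r E k s → (n + (n + (κ * r + E) * n)) * (k * (44 * k)) + s * r * n ≡ 44 * (k * k) * (2 + κ * r) * n + (44 * (k * k) * E + s * r) * n
    r₂ = solve-∀
    r₃ : ∀ kk κr n s r K → 44 * kk * (2 + κr) * n + (s * (r * K) + 44 * kk) * n ≡ 44 * kk * (3 + κr) * n + s * r * K * n
    r₃ = solve-∀
    r₄ : ∀ s r k k′ m → s * r * (44 * (k * k′)) * (r * s + m) ≡ k′ * (r * s * m) * (44 * k) + 44 * (k * k′) * (r * s * (r * s))
    r₄ = solve-∀
    r₅ : ∀ kk κ r n → (44 * kk * (3 + κ) + 1) * r * n ≡ 44 * kk * (3 * r + κ * r) * n + r * n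
    r₅ = solve-∀
    r₆ : ∀ a b c → a + (b + c) ≡ b + (a + c)
    r₆ = solve-∀
    main : 44 * (k * k) * (3 + κ * r) * n + 44 * (k * k′) * (r * s * (r * s)) ≤ s * r * n
    main = begin
      44 * (k * k) * (3 + κ * r) * n + 44 * (k * k′) * (r * s * (r * s))
        ≤⟨ +-mono-≤ (*-monoˡ-≤ n (*-monoʳ-≤ (44 * (k * k)) (+-monoˡ-≤ (κ * r) (m≤m*n 3 r ⦃ >-nonZero 1≤r ⦄)))) (≤-trans nb (m≤n*m n r ⦃ >-nonZero 1≤r ⦄)) ⟩
      44 * (k * k) * (3 * r + κ * r) * n + r * n ≡⟨ sym (r₅ (k * k) κ r n) ⟩
      (44 * (k * k) * (3 + κ) + 1) * r * n ≤⟨ *-monoˡ-≤ n (*-monoˡ-≤ r sb) ⟩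
      s * r * n ∎
    expo : (n + (n + (κ * r + E) * n)) * (k * (44 * k)) + s * r * n ≤ k′ * (r * s * m) * (44 * k) + s * r * n
    expo = begin
      (n + (n + (κ * r + E) * n)) * (k * (44 * k)) + s * r * n ≡⟨ r₂ n κ r E k s ⟩
      44 * (k * k) * (2 + κ * r) * n + (44 * (k * k) * E + s * r) * n ≤⟨ +-monoʳ-≤ (44 * (k * k) * (2 + κ * r) * n) (*-monoˡ-≤ n Eb) ⟩
      44 * (k * k) * (2 + κ * r) * n + (s * (r * (44 * (k * k′))) + 44 * (k * k)) * n ≡⟨ r₃ (k * k) (κ * r) n s r (44 * (k * k′)) ⟩
      44 * (k * k) * (3 + κ * r) * n + s * r * (44 * (k * k′)) * n ≡⟨ cong (44 * (k * k) * (3 + κ * r) * n +_) (trans (cong (s * r * (44 * (k * k′)) *_) (sym len)) (r₄ s r k k′ m)) ⟩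
      44 * (k * k) * (3 + κ * r) * n + (k′ * (r * s * m) * (44 * k) + 44 * (k * k′) * (r * s * (r * s))) ≡⟨ r₆ (44 * (k * k) * (3 + κ * r) * n) (k′ * (r * s * m) * (44 * k)) _ ⟩
      k′ * (r * s * m) * (44 * k) + (44 * (k * k) * (3 + κ * r) * n + 44 * (k * k′) * (r * s * (r * s))) ≤⟨ +-monoʳ-≤ (k′ * (r * s * m) * (44 * k)) main ⟩
      k′ * (r * s * m) * (44 * k) + s * r * n ∎

  -- In 24-th powers two unrelated vertices account for `48 * s * k′` in the exponent, apart from
  -- `φ`. A matched pair has `48 * s * k″ + 47 * s`, so each of the `a` pairs saves `s`.
  pairs-numeric : ∀ n s φ a u A α β Q → 2 * a + k * s + u ≡ n → A ≤ a → Q ≡ q ^ s → α ≤ q ^ (s * k′ + φ) → β ^ 24 ≤ q ^ (24 * φ + 48 * (s * k″) + 47 * s) →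
    let Y₀ = 24 * φ * n + 24 * (s * k′) * n + 24 * (s * k * (k * s)) in
    β ^ a * ((Q ^ k) ^ (k * s) * α ^ u) ≤ q ^ ((Y₀ ∸ A * s) / 24 + 1)
  pairs-numeric n s φ a u A α β Q len A≤a refl αb βb = root _ 24 (Y₀ ∸ A * s) (begin
    (β ^ a * ((Q ^ k) ^ (k * s) * α ^ u)) ^ 24 ≡⟨ trans (^-distribʳ 24 (β ^ a) _) (cong₂ _*_ (^-^-comm β a 24) (^-distribʳ 24 ((Q ^ k) ^ (k * s)) (α ^ u))) ⟩
    (β ^ 24) ^ a * (((Q ^ k) ^ (k * s)) ^ 24 * (α ^ u) ^ 24) ≤⟨ mulq (E₁ * a) (s * k * (k * s) * 24 + (s * k′ + φ) * u * 24) (powq E₁ a βb)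
        (mulq (s * k * (k * s) * 24) ((s * k′ + φ) * u * 24) (powq (s * k * (k * s)) 24 (powq (s * k) (k * s) (powq s k ≤-refl))) (powq ((s * k′ + φ) * u) 24 (powq (s * k′ + φ) u αb))) ⟩
    q ^ (E₁ * a + (s * k * (k * s) * 24 + (s * k′ + φ) * u * 24)) ≤⟨ ^-monoʳ-≤ q (≤-trans (≤-reflexive (sym (m+n∸n≡m _ (A * s)))) (∸-monoˡ-≤ (A * s) expo)) ⟩
    q ^ (Y₀ ∸ A * s) ∎)
    where
    open ≤-Reasoning
    E₁ Y₀ : ℕ
    E₁ = 24 * φ + 48 * (s * k″) + 47 * s
    Y₀ = 24 * φ * n + 24 * (s * k′) * n + 24 * (s * k * (k * s))
    r₁ : ∀ φ s j a Z u → (24 * φ + 48 * (s * j) + 47 * s) * a + (Z * 24 + (s * (1 + j) + φ) * u * 24) + a * s ≡ 24 * φ * (a + u) + 24 * (s * (1 + j)) * (2 * a + u) + 24 * Z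
    r₁ = solve-∀
    expo : E₁ * a + (s * k * (k * s) * 24 + (s * k′ + φ) * u * 24) + A * s ≤ Y₀
    expo = begin
      E₁ * a + (s * k * (k * s) * 24 + (s * k′ + φ) * u * 24) + A * s ≤⟨ +-monoʳ-≤ (E₁ * a + (s * k * (k * s) * 24 + (s * k′ + φ) * u * 24)) (*-monoˡ-≤ s A≤a) ⟩
      E₁ * a + (s * k * (k * s) * 24 + (s * k′ + φ) * u * 24) + a * s ≡⟨ r₁ φ s k″ a (s * k * (k * s)) u ⟩
      24 * φ * (a + u) + 24 * (s * k′) * (2 * a + u) + 24 * (s * k * (k * s)) ≤⟨ +-monoˡ-≤ (24 * (s * k * (k * s))) (+-mono-≤ (*-monoʳ-≤ (24 * φ) (≤-trans (+-monoˡ-≤ u (m≤n*m a 2)) le)) (*-monoʳ-≤ (24 * (s * k′)) le)) ⟩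
      Y₀ ∎
      where
      le : 2 * a + u ≤ n
      le = ≤-trans (+-monoˡ-≤ u (m≤m+n (2 * a) (k * s))) (≤-reflexive len)

  -- The saving `A * s`, with `A` linear in `n`, outweighs the colouring and the overhead `φ` of
  -- each vertex once `s` exceeds a constant multiple of `2 + k + φ`; 384 is 24 times the 16
  -- relating `n` to `A`.
  near-numeric : ∀ n m M s φ A D → k * s + m ≡ n → M * n ^ (s * k) ≤ 2 ^ n → n ≤ 16 * D * A → A ≤ n → 384 * D * (2 + k + φ) ≤ s → s * k * (k * s) + 1 + s * k′ * (k * s) ≤ n →
    let Y₀ = 24 * φ * n + 24 * (s * k′) * n + 24 * (s * k * (k * s)) in
    (M * ((n ^ s) ^ k * (k ^ n * q ^ ((Y₀ ∸ A * s) / 24 + 1)))) ^ (k * 24) ≤ q ^ (k′ * (k * s * m) * 24)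
  near-numeric n m M s φ A D len poly nA A≤n sD nb = begin
    (M * ((n ^ s) ^ k * (k ^ n * X))) ^ (k * 24) ≡⟨ cong (_^ (k * 24)) (trans (r₁ M ((n ^ s) ^ k) (k ^ n) X) (cong (λ z → M * z * k ^ n * X) (^-*-assoc n s k))) ⟩
    (M * n ^ (s * k) * k ^ n * X) ^ (k * 24) ≡⟨ ^-distribʳ (k * 24) (M * n ^ (s * k) * k ^ n) X ⟩
    (M * n ^ (s * k) * k ^ n) ^ (k * 24) * X ^ (k * 24) ≤⟨ mulq ((n + k * n) * (k * 24)) ((Y + 24) * k) (powq (n + k * n) (k * 24) (mulq n (k * n) (≤-trans poly (2^≤q^ n)) (powq k n (n≤q^n k)))) Xb ⟩
    q ^ ((n + k * n) * (k * 24) + (Y + 24) * k) ≤⟨ ^-monoʳ-≤ q (+-cancelʳ-≤ (A * s * k) _ _ expo) ⟩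
    q ^ (k′ * (k * s * m) * 24) ∎
    where
    open ≤-Reasoning
    Y₀ Y X : ℕ
    Y₀ = 24 * φ * n + 24 * (s * k′) * n + 24 * (s * k * (k * s))
    Y = Y₀ ∸ A * s
    X = q ^ (Y / 24 + 1)
    r₁ : ∀ M a b X → M * (a * (b * X)) ≡ M * a * b * X
    r₁ = solve-∀
    r₂ : ∀ x k → x * (k * 24) ≡ x * 24 * k
    r₂ = solve-∀
    Xb : X ^ (k * 24) ≤ q ^ ((Y + 24) * k)
    Xb = ≤-trans (powq (Y / 24 + 1) (k * 24) ≤-refl) (^-monoʳ-≤ q (≤-trans (≤-reflexive (r₂ (Y / 24 + 1) k)) (*-monoˡ-≤ k (root-exp 24 Y))))
    AY : A * s ≤ Y₀
    AY = begin
      A * s ≤⟨ *-monoˡ-≤ s A≤n ⟩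
      n * s ≤⟨ m≤n*m (n * s) (24 * k′) ⟩
      24 * k′ * (n * s) ≡⟨ r k′ n s ⟩
      24 * (s * k′) * n ≤⟨ m≤n+m _ (24 * φ * n) ⟩
      24 * φ * n + 24 * (s * k′) * n ≤⟨ m≤m+n _ _ ⟩
      Y₀ ∎
      where
      r : ∀ k n s → 24 * k * (n * s) ≡ 24 * (s * k) * n
      r = solve-∀
    r₃ : ∀ n k Y Z → (n + k * n) * (k * 24) + (Y + 24) * k + Z * k ≡ (24 * (1 + k) * n + (Y + Z) + 24) * k
    r₃ = solve-∀
    r₄ : ∀ k φ n s k′ m → (24 * (1 + k) * n + (24 * φ * n + 24 * (s * k′) * (k * s + m) + 24 * (s * k * (k * s))) + 24) * k ≡
      k′ * (k * s * m) * 24 + (24 * (1 + k + φ) * n + 24 * (s * k * (k * s) + 1 + s * k′ * (k * s))) * k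
    r₄ = solve-∀
    r₅ : ∀ x n → 24 * x * n + 24 * n ≡ 24 * (1 + x) * n
    r₅ = solve-∀
    r₆ : ∀ x D A → 24 * x * (16 * D * A) ≡ A * (384 * D * x)
    r₆ = solve-∀
    main : 24 * (1 + k + φ) * n + 24 * (s * k * (k * s) + 1 + s * k′ * (k * s)) ≤ A * s
    main = begin
      24 * (1 + k + φ) * n + 24 * (s * k * (k * s) + 1 + s * k′ * (k * s)) ≤⟨ +-monoʳ-≤ (24 * (1 + k + φ) * n) (*-monoʳ-≤ 24 nb) ⟩
      24 * (1 + k + φ) * n + 24 * n ≡⟨ r₅ (1 + k + φ) n ⟩
      24 * (2 + k + φ) * n ≤⟨ *-monoʳ-≤ (24 * (2 + k + φ)) nA ⟩
      24 * (2 + k + φ) * (16 * D * A) ≡⟨ r₆ (2 + k + φ) D A ⟩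
      A * (384 * D * (2 + k + φ)) ≤⟨ *-monoʳ-≤ A sD ⟩
      A * s ∎
    expo : (n + k * n) * (k * 24) + (Y + 24) * k + A * s * k ≤ k′ * (k * s * m) * 24 + A * s * k
    expo = begin
      (n + k * n) * (k * 24) + (Y + 24) * k + A * s * k ≡⟨ r₃ n k Y (A * s) ⟩
      (24 * (1 + k) * n + (Y + A * s) + 24) * k ≡⟨ cong (λ z → (24 * (1 + k) * n + z + 24) * k) (m∸n+n≡m AY) ⟩
      (24 * (1 + k) * n + Y₀ + 24) * k ≡⟨ cong (λ z → (24 * (1 + k) * n + (24 * φ * n + 24 * (s * k′) * z + 24 * (s * k * (k * s))) + 24) * k) (sym len) ⟩
      (24 * (1 + k) * n + (24 * φ * n + 24 * (s * k′) * (k * s + m) + 24 * (s * k * (k * s))) + 24) * k ≡⟨ r₄ k φ n s k′ m ⟩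
      k′ * (k * s * m) * 24 + (24 * (1 + k + φ) * n + 24 * (s * k * (k * s) + 1 + s * k′ * (k * s))) * k ≤⟨ +-monoʳ-≤ (k′ * (k * s * m) * 24) (*-monoˡ-≤ k main) ⟩
      k′ * (k * s * m) * 24 + A * s * k ∎

abstract
  patternSize : ℕ → ℕ
  patternSize k″ = 44 * (suc (suc k″) * suc k″)

  patternSize-pos : ∀ k″ → 1 ≤ patternSize k″
  patternSize-pos k″ = s≤s z≤n

  pattern-clique : ∀ k″ → (D : Pat (patternSize k″)) → HeavyPat (suc k″) D →
    (∀ L → AllPairs (λ u v → has true (kind D u v) ≡ true) L → length L ≤ suc (suc k″)) →
    (∀ L → AllPairs (λ u v → kind D u v ≡ dbl) L → length L ≤ suc k″) → ⊥
  pattern-clique = heavy-clique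

costOf-weight : ∀ both s d d≤s {r} (w : Vec Kind r) → MultiSauer.costOf both s d d≤s w ^ 11 ≤ arity both ^ (s * weightOf w)
costOf-weight both s d d≤s [] = ≤-reflexive (sym (cong (arity both ^_) (*-zeroʳ s)))
costOf-weight both s d d≤s (κ ∷ w) = begin
  (cost κ * costOf w) ^ 11 ≡⟨ ^-distribʳ 11 (cost κ) (costOf w) ⟩
  cost κ ^ 11 * costOf w ^ 11 ≤⟨ *-mono-≤ (one κ) (costOf-weight both s d d≤s w) ⟩
  q ^ (s * weight κ) * q ^ (s * weightOf w) ≡⟨ sym (^-distribˡ-+-* q (s * weight κ) (s * weightOf w)) ⟩
  q ^ (s * weight κ + s * weightOf w) ≡⟨ cong (q ^_) (sym (*-distribˡ-+ s (weight κ) (weightOf w))) ⟩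
  q ^ (s * weightOf (κ ∷ w)) ∎
  where
  open ≤-Reasoning
  open MultiSauer both s d d≤s
  one : ∀ κ → cost κ ^ 11 ≤ q ^ (s * weight κ)
  one non = ≤-reflexive (sym (cong (q ^_) (*-zeroʳ s)))
  one dbl = ≤-reflexive (^-*-assoc q s 11)
  one (sg _) = begin
    (2 ^ s) ^ 11 ≡⟨ trans (^-*-assoc 2 s 11) (trans (cong (2 ^_) (*-comm s 11)) (sym (^-*-assoc 2 11 s))) ⟩
    (2 ^ 11) ^ s ≤⟨ ^-monoˡ-≤ s (2^11≤q^7 both) ⟩
    (q ^ 7) ^ s ≡⟨ trans (^-*-assoc q 7 s) (cong (q ^_) (*-comm 7 s)) ⟩
    q ^ (s * 7) ∎

module Main (both : Bool) (k″ : ℕ) where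
  open ColouredClasses both k″
  open EarlyNumerics both k″ using (stop-numeric; pairs-numeric; near-numeric)

  N : ℕ
  N = patternSize k″

  θOf : ℕ → ℕ
  θOf μ = suc k * (2 * μ) * (2 * μ) ^ suc k

  -- With `l` the binary logarithm of the part size, this bounds the exponent of all lower-order
  -- factors of `β`: the `k` choices of a colour, `fu` twice, and the polynomial factor of `nb`.
  φOf : ℕ → ℕ → ℕ
  φOf l μ = k + (l + 3) * (2 * θOf μ) + (l + 3) * (2 * θOf μ) + (l + 5) * θOf μ

  μOf : ℕ → ℕ
  μOf y = 2 * (y * 2 ^ N) + 3

  -- With `d = 2 ^ l` and `s = d * d` the Sauer-Shelah error has an exponent of order `d * l` for
  -- each part. Dividing the requirement of `stop-numeric` by `d` leaves this inequality, which
  -- explains why sizes are squared from one stage to the next.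
  chain-scale : Ev (λ l → 44 * (k * k) * (6 * l + 14) + 1 ≤ 2 ^ l)
  chain-scale = ev-map (λ { l (le , pos) → ≤-trans (bound l pos) le }) (ev-∧ (poly≤exp (44 * (k * k) * 20 + 1) 1) (ev-≥ 1))
    where
    r : ∀ X l → X * (6 * (1 + l) + 14) + 1 + (X * 14 * l + l) ≡ (X * 20 + 1) * ((1 + l) * 1)
    r = solve-∀
    bound : ∀ l → 1 ≤ l → 44 * (k * k) * (6 * l + 14) + 1 ≤ (44 * (k * k) * 20 + 1) * l ^ 1
    bound (suc l) _ = ≤-trans (m≤m+n _ _) (≤-reflexive (r (44 * (k * k)) l))

  -- The scale `μ` is linear in `y`, so the overhead is a polynomial in `y` of degree `3 + k`, while
  -- the last part size is `2 ^ y`. The tower factor `2 ^ N` only enters the coefficient.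
  near-scale : Ev (λ y → 384 * Dw * (2 + k + φOf y (μOf y)) ≤ 2 ^ y)
  near-scale = ev-map (λ { y (le , pos) → ≤-trans (bound y pos) le }) (ev-∧ (poly≤exp (384 * Dw * (2 + k + k + 22 * (suc k * (c₂ * c₂ ^ suc k)))) (3 + k)) (ev-≥ 1))
    where
    c₂ : ℕ
    c₂ = 4 * 2 ^ N + 6
    open ≤-Reasoning
    e₁ : ∀ y X → 2 * (2 * (y * X) + 3) ≡ y * (4 * X) + 6
    e₁ = solve-∀
    e₂ : ∀ y X → y * X + y * 6 ≡ (X + 6) * y
    e₂ = solve-∀
    e₃ : ∀ y x → k + (y + 3) * (2 * x) + (y + 3) * (2 * x) + (y + 5) * x ≡ k + (5 * y + 17) * x
    e₃ y x = e k y x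
      where
      e : ∀ k y x → k + (y + 3) * (2 * x) + (y + 3) * (2 * x) + (y + 5) * x ≡ k + (5 * y + 17) * x
      e = solve-∀
    e₄′ : ∀ y s c C Y → (5 * y + 17 * y) * (s * (c * y) * (C * Y)) ≡ 22 * (s * (c * C)) * (y * (y * Y))
    e₄′ = solve-∀
    bound : ∀ y → 1 ≤ y → 384 * Dw * (2 + k + φOf y (μOf y)) ≤ 384 * Dw * (2 + k + k + 22 * (suc k * (c₂ * c₂ ^ suc k))) * y ^ (3 + k)
    bound y pos = ≤-trans (*-monoʳ-≤ (384 * Dw) inner) (≤-reflexive (sym (*-assoc (384 * Dw) _ (y ^ (3 + k)))))
      where
      y≢0 : NonZero y
      y≢0 = >-nonZero pos
      2μ≤ : 2 * μOf y ≤ c₂ * y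
      2μ≤ = ≤-trans (≤-reflexive (e₁ y (2 ^ N))) (≤-trans (+-monoʳ-≤ (y * (4 * 2 ^ N)) (m≤n*m 6 y ⦃ y≢0 ⦄)) (≤-reflexive (e₂ y (4 * 2 ^ N))))
      θ≤ : θOf (μOf y) ≤ suc k * (c₂ * y) * (c₂ ^ suc k * y ^ suc k)
      θ≤ = *-mono-≤ (*-monoʳ-≤ (suc k) 2μ≤) (≤-trans (^-monoˡ-≤ (suc k) 2μ≤) (≤-reflexive (^-distribʳ (suc k) c₂ y)))
      inner : 2 + k + φOf y (μOf y) ≤ (2 + k + k + 22 * (suc k * (c₂ * c₂ ^ suc k))) * y ^ (3 + k)
      inner = begin
        2 + k + φOf y (μOf y) ≡⟨ trans (cong (2 + k +_) (e₃ y (θOf (μOf y)))) (sym (+-assoc (2 + k) k _)) ⟩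
        2 + k + k + (5 * y + 17) * θOf (μOf y) ≤⟨ +-mono-≤ (m≤m*n (2 + k + k) (y ^ (3 + k)) ⦃ m^n≢0 y (3 + k) ⦃ y≢0 ⦄ ⦄) (*-mono-≤ (+-monoʳ-≤ (5 * y) (m≤m*n 17 y ⦃ y≢0 ⦄)) θ≤) ⟩
        (2 + k + k) * y ^ (3 + k) + (5 * y + 17 * y) * (suc k * (c₂ * y) * (c₂ ^ suc k * y ^ suc k)) ≡⟨ cong ((2 + k + k) * y ^ (3 + k) +_) (e₄′ y (suc k) c₂ (c₂ ^ suc k) (y ^ suc k)) ⟩
        (2 + k + k) * y ^ (3 + k) + 22 * (suc k * (c₂ * c₂ ^ suc k)) * y ^ (3 + k) ≡⟨ sym (*-distribʳ-+ (y ^ (3 + k)) (2 + k + k) _) ⟩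
        (2 + k + k + 22 * (suc k * (c₂ * c₂ ^ suc k))) * y ^ (3 + k) ∎

  abstract
    scale : ∃ λ y → (∀ l → y ≤ l → 44 * (k * k) * (6 * l + 14) + 1 ≤ 2 ^ l) × 384 * Dw * (2 + k + φOf y (μOf y)) ≤ 2 ^ y
    scale = let a , p = chain-scale ; b , r = near-scale in a ⊔ b , (λ l le → p l (m⊔n≤o⇒m≤o a b le)) , r (a ⊔ b) (m≤n⊔m a b)

  y : ℕ
  y = proj₁ scale

  open Sizes y N

  instance
    μ≢0 : NonZero μ
    μ≢0 = >-nonZero (≤-trans (s≤s z≤n) (m≤n+m 3 (2 * (y * 2 ^ N))))

  StopBad : ℕ → ∀ n → Graph n → Set
  StopBad r n G = Free both k G × HasBlock k′ μ r (sz r) G × ¬ HasBlock k′ μ (suc r) (sz (suc r)) G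

  negl-stop : ∀ r → 1 ≤ r → r < N → Negl (StopBad r)
  negl-stop r 1≤r r<N = negl-intro {StopBad r} λ M → ev-map (step M)
      (ev-∧ (poly≤exp (M * P) (s * r)) (ev-∧ (ev-≥ (r * s)) (ev-∧ (ev-≥ (44 * (k * k′) * (r * s * (r * s)))) (ev-≥ (Df * (r * s + Rw * d))))))
    where
    open ≤-Reasoning
    s d l κ : ℕ
    s = sz r
    d = sz (suc r)
    l = lev (suc r)
    κ = 2 + 3 * d * (2 * l + 3)
    s≡dd : s ≡ d * d
    s≡dd = sz-suc r r<N
    d≤s : d ≤ s
    d≤s = subst (d ≤_) (sym s≡dd) (m≤m*n d d ⦃ sz≢0 (suc r) ⦄)
    open MultiSauer both s d d≤s using (costOf; K; fud)
    Y₁ E₁ M₁ g Rw P Df : ℕ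
    Y₁ = s * (r * (44 * (k * k′)) ∸ r)
    E₁ = Y₁ / (44 * (k * k)) + 1
    M₁ = q ^ E₁
    g = K ^ r * M₁
    Rw = (q ^ s) ^ r
    P = patCount r * (1 + Rw) ^ g
    Rw≢0 : NonZero Rw
    Rw≢0 = m^n≢0 (q ^ s) r ⦃ m^n≢0 q s ⦄
    Df = proj₁ (fewConst 1 Rw ⦃ _ ⦄ ⦃ Rw≢0 ⦄)
    -- Failure of `Heavy` bounds `4k²` times the weight by `44kk′r - r`, and `44k²` is the common
    -- multiple of 11 and `4k²` that turns this into a bound for the cost.
    light : ∀ (w : Vec Kind r) → ¬ Heavy k′ w → costOf w ≤ M₁
    light w nh = root (costOf w) (44 * (k * k)) Y₁ (begin
      costOf w ^ (44 * (k * k)) ≡⟨ trans (cong (costOf w ^_) (r₁ (k * k))) (sym (^-*-assoc (costOf w) 11 (4 * (k * k)))) ⟩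
      (costOf w ^ 11) ^ (4 * (k * k)) ≤⟨ powq (s * weightOf w) (4 * (k * k)) (costOf-weight both s d d≤s w) ⟩
      q ^ (s * weightOf w * (4 * (k * k))) ≤⟨ ^-monoʳ-≤ q (≤-trans (≤-reflexive (trans (*-assoc s (weightOf w) _) (cong (s *_) (*-comm (weightOf w) _)))) (*-monoʳ-≤ s le)) ⟩
      q ^ Y₁ ∎)
      where
      r₁ : ∀ x → 44 * x ≡ 11 * (4 * x)
      r₁ = solve-∀
      le : 4 * (k * k) * weightOf w ≤ r * (44 * (k * k′)) ∸ r
      le = ≤-trans (≤-reflexive (sym (m+n∸n≡m (4 * (k * k) * weightOf w) r))) (∸-monoˡ-≤ r (<⇒≤ (≰⇒> nh)))
    K-bound : K ≤ q ^ κ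
    K-bound = ≤-trans (begin
      4 * (s ^ d * (1 + 4 * s) ^ (2 * d)) ≤⟨ *-monoʳ-≤ 4 (*-mono-≤ (^-monoˡ-≤ d (≤-trans (m≤n*m s 4) (≤-trans (n≤1+n _) big))) (^-monoˡ-≤ (2 * d) big)) ⟩
      4 * ((2 ^ (2 * l + 3)) ^ d * (2 ^ (2 * l + 3)) ^ (2 * d)) ≡⟨ cong (4 *_) (trans (sym (^-distribˡ-+-* (2 ^ (2 * l + 3)) d (2 * d))) (^-*-assoc 2 (2 * l + 3) (d + 2 * d))) ⟩
      2 ^ 2 * 2 ^ ((2 * l + 3) * (d + 2 * d)) ≡⟨ sym (^-distribˡ-+-* 2 2 ((2 * l + 3) * (d + 2 * d))) ⟩
      2 ^ (2 + (2 * l + 3) * (d + 2 * d)) ≡⟨ cong (λ z → 2 ^ (2 + z)) (r₁ (2 * l + 3) d) ⟩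
      2 ^ κ ∎) (2^≤q^ κ)
      where
      r₁ : ∀ x d → x * (d + 2 * d) ≡ 3 * d * x
      r₁ = solve-∀
      r₂ : ∀ l → 2 + (l + l) + 1 ≡ 2 * l + 3
      r₂ = solve-∀
      big : 1 + 4 * s ≤ 2 ^ (2 * l + 3)
      big = begin
        1 + 4 * s ≡⟨ cong (λ z → 1 + 4 * 2 ^ z) (lev-suc r r<N) ⟩
        1 + 2 ^ 2 * 2 ^ (l + l) ≡⟨ cong suc (sym (^-distribˡ-+-* 2 2 (l + l))) ⟩
        1 + 2 ^ (2 + (l + l)) ≤⟨ 1+2^ (2 + (l + l)) ⟩
        2 ^ (2 + (l + l) + 1) ≡⟨ cong (2 ^_) (r₂ l) ⟩
        2 ^ (2 * l + 3) ∎
    g-bound : g ≤ q ^ (κ * r + E₁)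
    g-bound = mulq (κ * r) E₁ (powq κ r K-bound) ≤-refl
    K≢0 : NonZero K
    K≢0 = m*n≢0 4 (s ^ d * fud) ⦃ _ ⦄ ⦃ m*n≢0 (s ^ d) fud ⦃ m^n≢0 s d ⦃ sz≢0 r ⦄ ⦄ ⦃ m^n≢0 (1 + 4 * s) (2 * d) ⦄ ⦄
    g≥1 : 1 ≤ g
    g≥1 = >-nonZero⁻¹ g ⦃ m*n≢0 (K ^ r) M₁ ⦃ m^n≢0 K r ⦃ K≢0 ⦄ ⦄ ⦃ m^n≢0 q E₁ ⦄ ⦄
    E-bound : 44 * (k * k) * E₁ + s * r ≤ s * (r * (44 * (k * k′))) + 44 * (k * k)
    E-bound = begin
      44 * (k * k) * E₁ + s * r ≤⟨ +-monoˡ-≤ (s * r) (≤-trans (≤-reflexive (*-comm (44 * (k * k)) E₁)) (root-exp (44 * (k * k)) Y₁)) ⟩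
      Y₁ + 44 * (k * k) + s * r ≡⟨ r₁ Y₁ (44 * (k * k)) (s * r) ⟩
      Y₁ + s * r + 44 * (k * k) ≡⟨ cong (_+ 44 * (k * k)) (trans (sym (*-distribˡ-+ s (r * (44 * (k * k′)) ∸ r) r)) (cong (s *_) (m∸n+n≡m (m≤m*n r (44 * (k * k′)))))) ⟩
      s * (r * (44 * (k * k′))) + 44 * (k * k) ∎
      where
      r₁ : ∀ a b c → a + b + c ≡ a + c + b
      r₁ = solve-∀
    s-bound : 44 * (k * k) * (3 + κ) + 1 ≤ s
    s-bound = begin
      44 * (k * k) * (5 + 3 * d * (2 * l + 3)) + 1 ≤⟨ +-mono-≤ (*-monoʳ-≤ (44 * (k * k)) (+-monoˡ-≤ (3 * d * (2 * l + 3)) (m≤m*n 5 d ⦃ sz≢0 (suc r) ⦄))) (>-nonZero⁻¹ d ⦃ sz≢0 (suc r) ⦄) ⟩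
      44 * (k * k) * (5 * d + 3 * d * (2 * l + 3)) + d ≡⟨ r₁ (44 * (k * k)) d l ⟩
      d * (44 * (k * k) * (6 * l + 14) + 1) ≤⟨ *-monoʳ-≤ d (proj₁ (proj₂ scale) l (y≤lev (suc r))) ⟩
      d * d ≡⟨ sym s≡dd ⟩
      s ∎
      where
      r₁ : ∀ X d l → X * (5 * d + 3 * d * (2 * l + 3)) + d ≡ d * (X * (6 * l + 14) + 1)
      r₁ = solve-∀
    rearrange : ∀ F a x c R → a * (x * (F * (c * R))) ≡ F * (a * c * (x * R))
    rearrange = solve-∀
    step : ∀ M n → M * P * n ^ (s * r) ≤ 2 ^ n × r * s ≤ n × 44 * (k * k′) * (r * s * (r * s)) ≤ n × Df * (r * s + Rw * d) ≤ n →
      ∃ λ m → ∃ λ X → m < n × Card≤ (StopBad r n) (f m * X) × M * (p m * X) ≤ p n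
    step M n (poly , rs≤ , sq≤ , ex≤) = n ∸ r * s , P * ((n ^ s) ^ r * R) , ∸-monoʳ-< {o = 0} (>-nonZero⁻¹ (r * s) ⦃ m*n≢0 r s ⦃ >-nonZero 1≤r ⦄ ⦃ sz≢0 r ⦄ ⦄) rs≤ ,
        card-mono (≤-reflexive (rearrange (f (n ∸ r * s)) (patCount r) ((n ^ s) ^ r) ((1 + Rw) ^ g) R))
          (card-stable (ramsey d μ (ramsey-size (suc r)) >>= λ { (Mx , noMono) →
            return (Stopped.card-Stop both k′ d≤s (>-nonZero⁻¹ μ) Mx noMono M₁ g light ≤-refl n (n ∸ r * s) (minus (r * s) n rs≤)) })) ,
        subst (λ z → M * (p (n ∸ r * s) * (P * ((n ^ s) ^ r * R))) ≤ p z) (minus (r * s) n rs≤)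
          (finish (n ∸ r * s) (r * s) M (P * ((n ^ s) ^ r * R)) (44 * k)
            (stop-numeric n (n ∸ r * s) M r s κ E₁ P g R (minus (r * s) n rs≤) 1≤r poly R-bound g-bound E-bound s-bound sq≤))
      where
      R : ℕ
      R = countFew {n} (λ _ → g) Rw (λ _ → true) (r * s + Rw * d)
      R-bound : R ≤ 2 ^ n * g ^ n
      R-bound = subst₂ _≤_ (*-identityʳ R) (cong₂ (λ a b → 2 ^ a * b) (#-true n) (trans (*-identityʳ _) (prodF-const n g)))
        (few-use (proj₂ (proj₂ (fewConst 1 Rw ⦃ _ ⦄ ⦃ Rw≢0 ⦄))) {n} (λ _ → g) (λ _ → true) (r * s + Rw * d) (λ _ → g≥1) (≤-trans ex≤ (≤-reflexive (sym (#-true n)))))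

  s : ℕ
  s = sz N

  FarBad : ∀ n → Graph n → Set
  FarBad n G = Free both k G × Σ (Vec (Vec (Fin n) s) k) (DKBlock G μ) × ¬ Near k (w n) G

  levN : lev N ≡ y
  levN = trans (cong (λ z → y * 2 ^ z) (n∸n≡0 N)) (*-identityʳ y)

  θ φ : ℕ
  θ = θOf μ
  φ = φOf y μ

  s≡ : s ≡ 2 ^ y
  s≡ = cong (2 ^_) levN

  scale-s : 384 * Dw * (2 + k + φ) ≤ s
  scale-s = ≤-trans (proj₂ (proj₂ scale)) (≤-reflexive (sym s≡))

  θ≤s : θ ≤ s
  θ≤s = begin
    θ ≤⟨ m≤n*m θ (y + 5) ⦃ ≢-nonZero (λ e → case trans (sym (+-comm y 5)) e of λ ()) ⦄ ⟩
    (y + 5) * θ ≤⟨ m≤n+m _ _ ⟩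
    φ ≤⟨ m≤n+m φ (2 + k) ⟩
    2 + k + φ ≤⟨ m≤n*m (2 + k + φ) (384 * Dw) ⦃ m*n≢0 384 Dw ⦃ _ ⦄ ⦃ Dw≢0 ⦄ ⦄ ⟩
    384 * Dw * (2 + k + φ) ≤⟨ scale-s ⟩
    s ∎
    where open ≤-Reasoning

  negl-far : Negl FarBad
  negl-far = negl-intro {FarBad} λ M → ev-map (step M)
      (ev-∧ (poly≤exp M (s * k)) (ev-∧ (ev-≥ Dw) (ev-∧ (ev-≥ ((2 * (k * s) + 2) * Dw)) (ev-∧ (ev-≥ (k * s)) (ev-≥ (s * k * (k * s) + 1 + s * k′ * (k * s)))))))
    where
    open ≤-Reasoning
    module Z (w : ℕ) = NotNear both k″ s μ w
    open Z 0 using (fu; nb; α; β; Q)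
    l+3 : 1 + 4 * s ≤ 2 ^ (y + 3)
    l+3 = ≤-trans (≤-reflexive (cong (λ z → 1 + 4 * z) s≡)) (≤-trans (≤-reflexive (cong suc (sym (^-distribˡ-+-* 2 2 y)))) (≤-trans (1+2^ (2 + y)) (≤-reflexive (cong (2 ^_) (e y)))))
      where
      e : ∀ y → 2 + y + 1 ≡ y + 3
      e = solve-∀
    l+5 : 1 + q * q * s ≤ 2 ^ (y + 5)
    l+5 = ≤-trans (+-monoʳ-≤ 1 (*-mono-≤ (sixteen both) (≤-reflexive s≡))) (≤-trans (≤-reflexive (cong suc (sym (^-distribˡ-+-* 2 4 y)))) (≤-trans (1+2^ (4 + y)) (≤-reflexive (cong (2 ^_) (e y)))))
      where
      sixteen : ∀ both → arity both * arity both ≤ 16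
      sixteen true = ≤-refl
      sixteen false = m≤m+n 9 7
      e : ∀ y → 4 + y + 1 ≡ y + 5
      e = solve-∀
    fu≤ : fu ≤ q ^ ((y + 3) * (2 * θ))
    fu≤ = powq (y + 3) (2 * θ) (≤-trans l+3 (2^≤q^ (y + 3)))
    α≤ : α ≤ q ^ (s * k′ + φ)
    α≤ = mulq (s * k′) φ (powq s k′ ≤-refl) (≤-trans fu≤ (^-monoʳ-≤ q (≤-trans (m≤n+m _ k) (≤-trans (m≤m+n _ _) (m≤m+n _ _)))))
    β≤ : β ^ 24 ≤ q ^ (24 * φ + 48 * (s * k″) + 47 * s)
    β≤ = begin
      β ^ 24 ≡⟨ cong (_^ 24) (r₁ k ((Q * Q) ^ k″) (fu * fu) ((q * q ∸ 1) ^ s) ((1 + q * q * s) ^ θ)) ⟩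
      (k * (fu * fu * (1 + q * q * s) ^ θ) * (Q * Q) ^ k″ * (q * q ∸ 1) ^ s) ^ 24 ≡⟨ ^-distribʳ 24 (k * (fu * fu * (1 + q * q * s) ^ θ) * (Q * Q) ^ k″) ((q * q ∸ 1) ^ s) ⟩
      (k * (fu * fu * (1 + q * q * s) ^ θ) * (Q * Q) ^ k″) ^ 24 * ((q * q ∸ 1) ^ s) ^ 24
        ≤⟨ mulq ((φ + (s + s) * k″) * 24) (47 * s) (powq (φ + (s + s) * k″) 24 (mulq φ ((s + s) * k″) small (powq (s + s) k″ (mulq s s ≤-refl ≤-refl)))) gain ⟩
      q ^ ((φ + (s + s) * k″) * 24 + 47 * s) ≡⟨ cong (q ^_) (r₂ φ s k″) ⟩
      q ^ (24 * φ + 48 * (s * k″) + 47 * s) ∎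
      where
      r₁ : ∀ k a b c d → k * (a * (b * (c * d))) ≡ k * (b * d) * a * c
      r₁ = solve-∀
      r₂ : ∀ φ s j → (φ + (s + s) * j) * 24 + 47 * s ≡ 24 * φ + 48 * (s * j) + 47 * s
      r₂ = solve-∀
      gain : ((q * q ∸ 1) ^ s) ^ 24 ≤ q ^ (47 * s)
      gain = ≤-trans (≤-reflexive (trans (^-*-assoc (q * q ∸ 1) s 24) (trans (cong ((q * q ∸ 1) ^_) (*-comm s 24)) (sym (^-*-assoc (q * q ∸ 1) 24 s)))))
        (powq 47 s ([q²-1]^24≤q^47 both))
      r₃ : ∀ k a b → k + (a + a + b) ≡ k + a + a + b
      r₃ = solve-∀
      small : k * (fu * fu * (1 + q * q * s) ^ θ) ≤ q ^ φ
      small = ≤-trans (mulq k ((y + 3) * (2 * θ) + (y + 3) * (2 * θ) + (y + 5) * θ) (n≤q^n k) (mulq ((y + 3) * (2 * θ) + (y + 3) * (2 * θ)) ((y + 5) * θ) (mulq ((y + 3) * (2 * θ)) ((y + 3) * (2 * θ)) fu≤ fu≤) (powq (y + 5) θ (≤-trans l+5 (2^≤q^ (y + 5))))))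
        (≤-reflexive (cong (q ^_) (r₃ k ((y + 3) * (2 * θ)) ((y + 5) * θ))))
    rearrange : ∀ F a b X → a * (F * (b * X)) ≡ F * (a * (b * X))
    rearrange = solve-∀
    step : ∀ M n → M * n ^ (s * k) ≤ 2 ^ n × Dw ≤ n × (2 * (k * s) + 2) * Dw ≤ n × k * s ≤ n × s * k * (k * s) + 1 + s * k′ * (k * s) ≤ n →
      ∃ λ m → ∃ λ X → m < n × Card≤ (FarBad n) (f m * X) × M * (p m * X) ≤ p n
    step M n (poly , Dw≤ , w-large , ks≤ , sq≤) = n ∸ k * s , X , ∸-monoʳ-< {o = 0} (>-nonZero⁻¹ (k * s) ⦃ m*n≢0 k s ⦃ _ ⦄ ⦃ sz≢0 N ⦄ ⦄) ks≤ ,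
        card-mono (≤-reflexive (rearrange (f (n ∸ k * s)) ((n ^ s) ^ k) (k ^ n) X₂))
          (Z.card-Bad (w n) n (n ∸ k * s) X₂ (minus (k * s) n ks≤)
            (λ a lt le → pairs-numeric n s φ a (n ∸ (2 * a + k * s)) A α β Q (m+[n∸m]≡n le) (A≤ a lt) refl α≤ β≤)) ,
        subst (λ z → M * (p (n ∸ k * s) * X) ≤ p z) (minus (k * s) n ks≤)
          (finish (n ∸ k * s) (k * s) M X 24 (near-numeric n (n ∸ k * s) M s φ A Dw (minus (k * s) n ks≤) poly nA A≤n scale-s sq≤))
      where
      -- `A` is a lower bound for the number of matching edges when `2 * a + k * s` exceeds `w n`.
      -- It stays linear in `n` because `w n` is at least twice `k * s` once `n` is large.
      v A Y₀ X₂ X : ℕ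
      v = w n ∸ k * s
      A = v / 2
      Y₀ = 24 * φ * n + 24 * (s * k′) * n + 24 * (s * k * (k * s))
      X₂ = q ^ ((Y₀ ∸ A * s) / 24 + 1)
      X = (n ^ s) ^ k * (k ^ n * X₂)
      A≤n : A ≤ n
      A≤n = ≤-trans (m/n≤m v 2) (≤-trans (m∸n≤m (w n) (k * s)) (m/n≤m n Dw ⦃ Dw≢0 ⦄))
      A≤ : ∀ a → w n < 2 * a + k * s → A ≤ a
      A≤ a lt = ≤-trans (/-monoˡ-≤ 2 (≤-trans (∸-monoˡ-≤ (k * s) (<⇒≤ lt)) (≤-reflexive (trans (m+n∸n≡m (2 * a) (k * s)) (*-comm 2 a))))) (≤-reflexive (m*n/n≡m a 2))
      wl : 2 * (k * s) + 2 ≤ w n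
      wl = /-large (2 * (k * s) + 2) n Dw ⦃ Dw≢0 ⦄ w-large
      e₁ : ∀ x → 2 * x + 2 ≡ x + 2 + x
      e₁ = solve-∀
      vl : k * s + 2 ≤ v
      vl = ≤-trans (≤-reflexive (sym (m+n∸n≡m (k * s + 2) (k * s)))) (∸-monoˡ-≤ (k * s) (≤-trans (≤-reflexive (sym (e₁ (k * s)))) wl))
      e₂ : ∀ D A → 2 * D * (2 * (2 * 2 * A)) ≡ 16 * D * A
      e₂ = solve-∀
      nA : n ≤ 16 * Dw * A
      nA = begin
        n ≤⟨ half-/ n Dw ⦃ Dw≢0 ⦄ Dw≤ ⟩
        2 * Dw * w n ≤⟨ *-monoʳ-≤ (2 * Dw) wv ⟩
        2 * Dw * (2 * v) ≤⟨ *-monoʳ-≤ (2 * Dw) (*-monoʳ-≤ 2 (half-/ v 2 (≤-trans (m≤n+m 2 (k * s)) vl))) ⟩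
        2 * Dw * (2 * (2 * 2 * A)) ≡⟨ e₂ Dw A ⟩
        16 * Dw * A ∎
        where
        wv : w n ≤ 2 * v
        wv = ≤-trans (≤-reflexive (sym (m∸n+n≡m (≤-trans (≤-trans (m≤n*m (k * s) 2) (m≤m+n _ 2)) wl)))) (+-monoʳ-≤ v (≤-trans (≤-trans (m≤m+n (k * s) 2) vl) (≤-reflexive (sym (+-identityʳ v)))))

-- Induction on n and conclusion

bounded-ratio : ∀ (f p : ℕ → ℕ) n₀ → (∀ n → 1 ≤ p n) →
  (∀ C n → n₀ ≤ n → (∀ m → m < n → f m ≤ C * p m) → 2 * f n ≤ 2 * p n + C * p n) → ∃ λ C → 1 ≤ C × ∀ n → f n ≤ C * p n
bounded-ratio f p n₀ pos next = C , s≤s z≤n , <-rec (λ n → f n ≤ C * p n) step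
  where
  open ≤-Reasoning
  total : ℕ → ℕ
  total zero = 0
  total (suc n) = f n + total n
  -- `C` is chosen after `n₀`: the sum covers all smaller `n`, where `p n ≥ 1` suffices, and the
  -- summand 2 lets the induction step close with `2 * p n + C * p n ≤ 2 * (C * p n)`.
  C : ℕ
  C = 2 + total n₀
  f≤total : ∀ m n → n < m → f n ≤ total m
  f≤total (suc m) n lt with m≤n⇒m<n∨m≡n (s≤s⁻¹ lt)
  ... | inj₁ n<m = ≤-trans (f≤total m n n<m) (m≤n+m (total m) (f m))
  ... | inj₂ refl = m≤m+n (f n) (total n)
  step : ∀ n → (∀ {m} → m < n → f m ≤ C * p m) → f n ≤ C * p n
  step n ih with n <? n₀
  ... | yes lt = ≤-trans (≤-trans (f≤total n₀ n lt) (m≤n+m (total n₀) 2)) (m≤m*n C (p n) ⦃ >-nonZero (pos n) ⦄)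
  ... | no nlt = *-cancelˡ-≤ 2 (begin
    2 * f n               ≤⟨ next C n (≮⇒≥ nlt) (λ m lt → ih lt) ⟩
    2 * p n + C * p n     ≤⟨ +-monoˡ-≤ (C * p n) (*-monoˡ-≤ (p n) (m≤m+n 2 (total n₀))) ⟩
    C * p n + C * p n     ≡⟨ cong (C * p n +_) (sym (+-identityʳ _)) ⟩
    2 * (C * p n) ∎)

excess-bound : ∀ m C f p B → 1 ≤ C → f ≤ p + B → p ≤ f → m * C * B ≤ C * p → m * (f ∸ p) ≤ f
excess-bound m C f p B pos f≤ p≤f small =
  ≤-trans (*-monoʳ-≤ m (≤-trans (∸-monoˡ-≤ p f≤) (≤-reflexive (m+n∸m≡n p B))))
    (≤-trans (*-cancelˡ-≤ C ⦃ >-nonZero pos ⦄ (≤-trans (≤-reflexive (r C m B)) small)) p≤f)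
  where
  r : ∀ C m B → C * (m * B) ≡ m * C * B
  r = solve-∀

module Conclusion (both : Bool) (k″ : ℕ) where
  open ColouredClasses both k″
  open Main both k″
  open Sizes y N

  firstBlock : ∀ {n} (G : Graph n) → sz 1 ≤ n → HasBlock k′ μ 1 (sz 1) G
  firstBlock {n} G le = ([] , tt) , (z≤n , tt) , S , record { distinct = distinct₁ _ inj ; disp = λ { zero zero () } }
    where
    S : Vec (Vec (Fin n) (sz 1)) 1
    S = Vec.tabulate (λ a → Fin.inject≤ a le) ∷ []
    inj : Inj (Vec.tabulate (λ a → Fin.inject≤ a le))
    inj a b e = Finₚ.inject≤-injective le le a b
      (trans (sym (Vecₚ.lookup∘tabulate (λ i → Fin.inject≤ i le) a)) (trans e (Vecₚ.lookup∘tabulate (λ i → Fin.inject≤ i le) b)))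

  SomeStop : ∀ n → Graph n → Set
  SomeStop n G = ∃ λ (i : Fin (N ∸ 1)) → StopBad (suc (Fin.toℕ i)) n G

  -- Any `sz 1` vertices form a block with one part. Raising the number of parts one at a time, the
  -- graph either gets stuck at some `r < N` or reaches `N` parts.
  climb : ∀ {n} (G : Graph n) → Free both k G → sz 1 ≤ n → ¬ ¬ (SomeStop n G ⊎ HasBlock k′ μ N (sz N) G)
  climb {n} G free le = subst (λ z → ¬ ¬ (SomeStop n G ⊎ HasBlock k′ μ z (sz z) G)) suc-pred″ (go (N ∸ 1) ≤-refl)
    where
    suc-pred″ : suc (N ∸ 1) ≡ N
    suc-pred″ = m+[n∸m]≡n (patternSize-pos k″)
    go : ∀ r → r ≤ N ∸ 1 → ¬ ¬ (SomeStop n G ⊎ HasBlock k′ μ (suc r) (sz (suc r)) G)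
    go zero _ = return (inj₂ (firstBlock G le))
    go (suc r) r< = go r (<⇒≤ r<) >>= λ
      { (inj₁ stop) → return (inj₁ stop)
      ; (inj₂ blk) → lem {HasBlock k′ μ (suc (suc r)) (sz (suc (suc r))) G} >>= λ
        { (yes blk′) → return (inj₂ blk′)
        ; (no nb) → return (inj₁ (Fin.fromℕ< r< , subst (λ z → StopBad (suc z) n G) (sym (Finₚ.toℕ-fromℕ< r<)) (free , blk , nb))) } }

  -- By Turán's bound a heavy block with N parts contains k parts that are pairwise joined in both directions.
  clique : ∀ {n} (G : Graph n) → Free both k G → HasBlock k′ μ N (sz N) G → ¬ ¬ Σ (Vec (Vec (Fin n) s) k) (DKBlock G μ)
  clique {n} G free (D , heavy , S , blk) none = pattern-clique k″ D heavy noTT (λ L ap → ≮⇒≥ λ lt → none (found L ap lt))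
    where
    open Block blk
    Pt : Fin N → Fin n → Set
    Pt i = InPart (lookup S i)
    instance
      2μ≢0 : NonZero (2 * μ)
      2μ≢0 = m*n≢0 2 μ
    open Embedding G Pt (2 * μ) (2 * μ)
    -- A longer chain in the pattern is cut to `k + 1` parts, so that the part size `s ≥ θ` meets
    -- the embedding threshold; the embedded chain would be a forbidden tournament in `G`.
    noTT : ∀ L → AllPairs (λ u v → has true (kind D u v) ≡ true) L → length L ≤ k
    noTT L ap = ≮⇒≥ λ lt → let len = trans (Listₚ.length-take (suc k) L) (m≤n⇒m⊓n≡m lt) in
      embed (take (suc k) L) (AllPairs.map (λ {i} {j} h → disp⇒rich G μ (Pt i) (Pt j) (disp i j h)) (AllPairsₚ.take⁺ (suc k) ap)) A
        (All.tabulate λ {i} _ → fits i len)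
        λ { (xs , pw , ch) → <-irrefl refl (≤-trans (≤-reflexive (trans (sym len) (Pw.Pointwise-length pw))) (noChain both G free ch)) }
      where
      A : Fin N → List (Fin n)
      A i = List.tabulate (lookup (lookup S i))
      fits : ∀ i → length (take (suc k) L) ≡ suc k → Unique (A i) × All (Pt i) (A i) × threshold (length (take (suc k) L)) ≤ length (A i)
      fits i len = Uniqueₚ.tabulate⁺ (λ {a} {b} e → proj₂ (distinct i a i b e)) , Allₚ.tabulate⁺ (λ a → a , refl) ,
        ≤-trans (≤-reflexive (cong threshold len)) (≤-trans θ≤s (≤-reflexive (sym (Listₚ.length-tabulate (lookup (lookup S i))))))
    found : ∀ L → AllPairs (λ u v → kind D u v ≡ dbl) L → k′ < length L → Σ (Vec (Vec (Fin n) s) k) (DKBlock G μ)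
    found L ap lt = S′ , dist , λ a b ne → subst₂ (λ X Y → Disp G μ (InPart X) (InPart Y)) (sym (at a)) (sym (at b)) (disp (idx a) (idx b) (cong (has true) (joined a b ne)))
      where
      pos : Fin k → Fin (length L)
      pos a = Fin.inject≤ a lt
      idx : Fin k → Fin N
      idx a = List.lookup L (pos a)
      joined : ∀ a b → a ≢ b → kind D (idx a) (idx b) ≡ dbl
      joined a b ne with Finₚ.<-cmp (pos a) (pos b)
      ... | tri< l _ _ = AllPairs-lookup ap (pos a) (pos b) l
      ... | tri≈ _ e _ = ⊥-elim (ne (Finₚ.inject≤-injective lt lt a b e))
      ... | tri> _ _ g = trans (kind-flip D (idx b) (idx a)) (cong flip (AllPairs-lookup ap (pos b) (pos a) g))
      S′ : Vec (Vec (Fin n) s) k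
      S′ = Vec.tabulate (lookup S ∘ idx)
      at : ∀ a → lookup S′ a ≡ lookup S (idx a)
      at a = Vecₚ.lookup∘tabulate (lookup S ∘ idx) a
      dist : Distinct S′
      dist a x b z e with distinct (idx a) x (idx b) z (trans (sym (cong (λ p → lookup p x) (at a))) (trans e (cong (λ p → lookup p z) (at b)))) | a Fin.≟ b
      ... | _ , x≡z | yes a≡b = a≡b , x≡z
      ... | eq , _ | no ne = case trans (sym (joined a b ne)) (trans (cong (kind D (idx a)) (sym eq)) (kind-irrefl D (idx a))) of λ ()

  Bad : ∀ n → Graph n → Set
  Bad n G = SomeStop n G ⊎ FarBad n G ⊎ BigBad n G ⊎ PoorBad n G ⊎ GoodBad n G

  abstract
    negl-bad : Negl Bad
    negl-bad = negl-⊎ {SomeStop} (negl-∃ (N ∸ 1) {λ i → StopBad (suc (Fin.toℕ i))} (λ i → negl-stop (suc (Fin.toℕ i)) (s≤s z≤n) (below i)))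
        (negl-⊎ {FarBad} negl-far (negl-⊎ {BigBad} negl-unbalanced (negl-⊎ {PoorBad} {GoodBad} negl-poor negl-good)))
      where
      below : ∀ (i : Fin (N ∸ 1)) → suc (Fin.toℕ i) < N
      below i = ≤-trans (s≤s (Finₚ.toℕ<n i)) (≤-reflexive (m+[n∸m]≡n (patternSize-pos k″)))

  cover : ∀ n (G : Graph n) → sz 1 ≤ n → Free both k G → ¬ Partite k G → ¬ ¬ Bad n G
  cover n G le free np = climb G free le >>= λ
    { (inj₁ stop) → return (inj₁ stop)
    ; (inj₂ blk) → clique G free blk >>= λ dk → lem {Near k (w n) G} >>= λ
      { (no far) → return (inj₂ (inj₁ (free , dk , far)))
      ; (yes near) → near-cover n G free np near >>= λ b → return (inj₂ (inj₂ b)) } }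

  free-≤ : ∀ n B → sz 1 ≤ n → Card≤ (Bad n) B → f n ≤ p n + B
  free-≤ n B le c = card-⊆ {Q = λ G → FreePartite both k G ⊎ Bad n G}
      (λ G free → lem {Partite k G} >>= λ { (yes pt) → return (inj₁ (free , pt)) ; (no np) → cover n G le free np >>= λ b → return (inj₂ b) })
      (card-⊎ (card-partite both k n) c) (filter (free? both k) (graphs n)) (Uniqueₚ.filter⁺ (free? both k) (graphs-unique n)) (Allₚ.all-filter (free? both k) (graphs n))

  abstract
    comparable : ∃ λ C → 1 ≤ C × ∀ n → f n ≤ C * p n
    comparable = bounded-ratio f p (proj₁ (negl-bad 2) ⊔ sz 1) p-pos λ C n le ih →
      let B , c , small = proj₂ (negl-bad 2) n (m⊔n≤o⇒m≤o (proj₁ (negl-bad 2)) (sz 1) le) C ih in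
      ≤-trans (*-monoʳ-≤ 2 (free-≤ n B (m⊔n≤o⇒n≤o (proj₁ (negl-bad 2)) (sz 1) le) c))
        (≤-trans (≤-reflexive (*-distribˡ-+ 2 (p n) B)) (+-monoʳ-≤ (2 * p n) small))

    p≤f : ∀ n → p n ≤ f n
    p≤f n = card-free both k n (filter (freePartite? both k) (graphs n)) (Uniqueₚ.filter⁺ (freePartite? both k) (graphs-unique n)) (All.map proj₁ (Allₚ.all-filter (freePartite? both k) (graphs n)))

    -- Negligibility bounds the exceptional graphs by a multiple of `C₀ * p n`, so it is applied
    -- with `m * C₀` in order that `C₀` cancels.
    almostAll : ∀ m → ∃ λ n₀ → ∀ n → n₀ ≤ n → m * (f n ∸ p n) ≤ f n
    almostAll m = proj₁ (negl-bad (m * C₀)) ⊔ sz 1 , λ n le →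
        let B , c , small = proj₂ (negl-bad (m * C₀)) n (m⊔n≤o⇒m≤o (proj₁ (negl-bad (m * C₀))) (sz 1) le) C₀ (λ j _ → proj₂ (proj₂ comparable) j) in
        excess-bound m C₀ (f n) (p n) B (proj₁ (proj₂ comparable)) (free-≤ n B (m⊔n≤o⇒n≤o (proj₁ (negl-bad (m * C₀))) (sz 1) le) c) (p≤f n) small
      where
      C₀ : ℕ
      C₀ = proj₁ comparable

module ClassCounts (both : Bool) (k : ℕ) (Class : ∀ {n} → Graph n → Set)
  (to : ∀ {n} (G : Graph n) → IsClass both G → Class G) (from : ∀ {n} (G : Graph n) → Class G → IsClass both G) where

  count-free : ∀ n → HasCount {n} (λ G → Class G × TTFree k G) (numFree both k n)
  count-free n = filter (free? both k) (graphs n) , Uniqueₚ.filter⁺ (free? both k) (graphs-unique n) ,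
      (λ G → mk⇔ (λ G∈ → forth G (proj₂ (∈-filter⁻ (free? both k) {xs = graphs n} G∈))) (λ c → ∈-filter⁺ (free? both k) (∈-graphs G) (back G c))) , refl
    where
    forth : ∀ (G : Graph n) → Free both k G → Class G × TTFree k G
    forth G (cl , fr) = to G cl , fr
    back : ∀ (G : Graph n) → Class G × TTFree k G → Free both k G
    back G (cl , fr) = from G cl , fr

  count-partite : ∀ n → HasCount {n} (λ G → (Class G × TTFree k G) × Partite k G) (numPartite both k n)
  count-partite n = filter (freePartite? both k) (graphs n) , Uniqueₚ.filter⁺ (freePartite? both k) (graphs-unique n) ,
      (λ G → mk⇔ (λ G∈ → forth G (proj₂ (∈-filter⁻ (freePartite? both k) {xs = graphs n} G∈))) (λ c → ∈-filter⁺ (freePartite? both k) (∈-graphs G) (back G c))) , refl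
    where
    forth : ∀ (G : Graph n) → FreePartite both k G → (Class G × TTFree k G) × Partite k G
    forth G ((cl , fr) , pt) = (to G cl , fr) , pt
    back : ∀ (G : Graph n) → (Class G × TTFree k G) × Partite k G → FreePartite both k G
    back G ((cl , fr) , pt) = (from G cl , fr) , pt

  almostAllPartite : (∀ m → ∃ λ n₀ → ∀ n → n₀ ≤ n → m * (numFree both k n ∸ numPartite both k n) ≤ numFree both k n) → AlmostAllPartite k Class
  almostAllPartite h m _ = proj₁ (h m) , λ n le → numFree both k n , numPartite both k n , count-free n , count-partite n , proj₂ (h m) n le

theorem1p2 : (k : ℕ) → k ≥ 2 →
    AlmostAllPartite k IsOriented × AlmostAllPartite k IsDigraph
theorem1p2 (suc (suc k″)) (s≤s (s≤s z≤n)) =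
    ClassCounts.almostAllPartite false (suc (suc k″)) IsOriented
      (λ G (loopless , oks) → loopless , λ i j e → oriented (adj G i j) (adj G j i) (oks i j) e)
      (λ G (loopless , anti) → loopless , λ i j → antisym (adj G i j) (adj G j i) (anti i j))
      (Conclusion.almostAll false k″) ,
    ClassCounts.almostAllPartite true (suc (suc k″)) IsDigraph (λ G → proj₁) (λ G loopless → loopless , λ i j → refl)
      (Conclusion.almostAll true k″)
  where
  oriented : ∀ a b → Ok false (a , b) → a ≡ true → b ≡ false
  oriented true false _ _ = refl
  antisym : ∀ a b → (a ≡ true → b ≡ false) → Ok false (a , b)
  antisym false b _ = refl
  antisym true b h rewrite h refl = refl
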